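{- Let $q=2^r$ ($r\ge1$), and let all notation be as in the context. For $\epsilon\in\{+,-\}$ and $i\in\{1,2,3,4\}$ write $A=A_i^{\epsilon}(n,q)$, $B=B_i^{\epsilon}(n,q)$, $N=N_i^{\epsilon}(n,q):=|DC_i^{\epsilon}(n,q)|$, and let $\{C_{i,j}^{\epsilon}(n,q)\}_{j=0}^{N}$ be the weight distribution of the binary code $C(DC_i^{\epsilon}(n,q))$. Identify the sign $\epsilon$ with the number $\epsilon 1\in\{1,-1\}$. Then $N=A\,B$, and moreover: (a) Suppose one of the following holds: $i=1$, $\epsilon=+$, $n\ge2$ even, $q$ arbitrary; or $i=3$, $\epsilon=+$, and either $n\ge4$ even ($q$ arbitrary) or $n=2$ and $q\ge8$; or $i=1$, $\epsilon=-$, $n\ge1$ odd, $q$ arbitrary; or $i=3$, $\epsilon=-$, $n\ge3$ odd, $q$ arbitrary. Then for every $h=1,2,\ldots$, $$(-\epsilon)^h MK^h=-\sum_{l=0}^{h-1}(-\epsilon)^l\binom{h}{l}B^{h-l}MK^l+qA^{ -h}\sum_{j=0}^{\min\{N,h\}}(-1)^jC_{i,j}^{\epsilon}(n,q)\sum_{t=j}^{h}t!\,S(h,t)\,2^{h-t}\binom{N-j}{N-t},$$ and $$C_{i,j}^{\epsilon}(n,q)=\sum\binom{q^{ -1}A(B+\epsilon 1)}{\nu_0}\prod_{\beta\in\mathbb{F}_q^*,\ tr(\beta^{ -1})=0}\binom{q^{ -1}A(B+\epsilon(q+1))}{\nu_\beta}\prod_{\beta\in\mathbb{F}_q^*,\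 tr(\beta^{ -1})=1}\binom{q^{ -1}A(B+\epsilon(-q+1))}{\nu_\beta},$$ the sum being over all families of nonnegative integers $\{\nu_\beta\}_{\beta\in\mathbb{F}_q}$ with $\sum_{\beta\in\mathbb{F}_q}\nu_\beta=j$ and $\sum_{\beta\in\mathbb{F}_q}\nu_\beta\beta=0$ (in $\mathbb{F}_q$). (b) Let $i=2$, and suppose either $\epsilon=+$, $n\ge2$ even and $q\ge4$, or $\epsilon=-$, $n\ge3$ odd and $q\ge4$. Then for every $h=1,2,\ldots$, writing $\Sigma_h=qA^{ -h}\sum_{j=0}^{\min\{N,h\}}(-1)^jC_{2,j}^{\epsilon}(n,q)\sum_{t=j}^{h}t!\,S(h,t)\,2^{h-t}\binom{N-j}{N-t}$, $$\epsilon^h MK_2^h=-\sum_{l=0}^{h-1}\epsilon^l\binom hl(B+\epsilon q)^{h-l}MK_2^l+\Sigma_h,\qquad \epsilon^h MK^{2h}=-\sum_{l=0}^{h-1}\epsilon^l\binom hl B^{h-l}MK^{2l}+\Sigma_h,$$ and $$C_{2,j}^{\epsilon}(n,q)=\sum\binom{q^{ -1}A(B+\epsilon(q+1-q^2))}{\nu_0}\prod_{\substack{\tau\in\mathbb{Z},\ |\tau|<2\sqrt q\\ \tau\equiv-1\ (\mathrm{mod}\ 4)}}\ \prod_{\beta\in\mathbb{F}_q^*:\ K(\lambda;\beta^{ -1})=\tau}\binom{q^{ -1}A(B+\epsilon(q+1-q\tau))}{\nu_\beta},$$ the sum being over all families of nonnegative integers $\{\nu_\beta\}_{\beta\in\mathbb{F}_q}$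 with $\sum_\beta\nu_\beta=j$ and $\sum_\beta\nu_\beta\beta=0$. (c) Let $i=4$, and suppose either $\epsilon=+$, $n\ge4$ even and $q\ge4$, or $\epsilon=-$, $n\ge3$ odd and $q\ge4$. Then for every $h=1,2,\ldots$, with $\Sigma_h=qA^{ -h}\sum_{j=0}^{\min\{N,h\}}(-1)^jC_{4,j}^{\epsilon}(n,q)\sum_{t=j}^{h}t!\,S(h,t)\,2^{h-t}\binom{N-j}{N-t}$, $$\epsilon^h MK_2^h=-\sum_{l=0}^{h-1}\epsilon^l\binom hl(B+\epsilon q^2)^{h-l}MK_2^l+\Sigma_h,\qquad \epsilon^h MK^{2h}=-\sum_{l=0}^{h-1}\epsilon^l\binom hl (B+\epsilon(q^2-q))^{h-l}MK^{2l}+\Sigma_h,$$ and $$C_{4,j}^{\epsilon}(n,q)=\sum\binom{q^{ -1}A(B+\epsilon(q^2+1-q^3))}{\nu_0}\prod_{\substack{\tau\in\mathbb{Z},\ |\tau|<2\sqrt q\\ \tau\equiv-1\ (\mathrm{mod}\ 4)}}\ \prod_{\beta\in\mathbb{F}_q^*:\ K(\lambda;\beta^{ -1})=\tau}\binom{q^{ -1}A(B+\epsilon(q^2+1-q\tau))}{\nu_\beta},$$ the sum being over all families of nonnegative integers $\{\nu_\beta\}_{\beta\in\mathbb{F}_q}$ with $\sum_\beta\nu_\beta=j$ and $\sum_\beta\nu_\beta\beta=0$.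
   Context: Let $q=2^r$, $\mathbb{F}_q$ the field with $q$ elements, $tr(x)=x+x^2+\cdots+x^{2^{r-1}}$ the trace $\mathbb{F}_q\to\mathbb{F}_2$, $\lambda(x)=(-1)^{tr(x)}$. For $a\in\mathbb{F}_q^*$: $K(\lambda;a)=\sum_{\alpha\in\mathbb{F}_q^*}\lambda(\alpha+a\alpha^{ -1})$ and $K_2(\lambda;a)=\sum_{\alpha_1,\alpha_2\in\mathbb{F}_q^*}\lambda(\alpha_1+\alpha_2+a\alpha_1^{ -1}\alpha_2^{ -1})$. Power moments: $MK^h=\sum_{a\in\mathbb{F}_q^*}K(\lambda;a)^h$, $MK_2^h=\sum_{a\in\mathbb{F}_q^*}K_2(\lambda;a)^h$ (both equal $q-1$ for $h=0$). $S(h,t)=\frac1{t!}\sum_{j=0}^t(-1)^{t-j}\binom tj j^h$ (Stirling numbers of the second kind); $\binom ba=0$ if $a>b$ or $a<0$. $\mathrm{Tr}$ is matrix trace, ${}^tX$ transpose; a square matrix is alternating if it is symmetric with zero diagonal. Gaussian binomial $\left[\substack{m\\ s}\right]_q=\prod_{j=0}^{s-1}(q^{m-j}-1)/(q^{s-j}-1)$; empty products are 1. Fix $\kappa\in\mathbb{F}_q$ with $z^2+z+\kappa$ irreducible over $\mathbb{F}_q$. For $n\ge1$, $\theta^-(x)=\sum_{i=1}^{n-1}x_ix_{n-1+i}+x_{2n-1}^2+x_{2n-1}x_{2n}+\kappa x_{2n}^2$ on $\mathbb{F}_q^{2n\times1}$, and $O^-(2n,q)=\{g\in GL(2n,q):\theta^-(gx)=\theta^-(x)\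 \forall x\}$. Let $\delta=\begin{pmatrix}1&1\\0&\kappa\end{pmatrix}$, $\eta=\begin{pmatrix}0&1\\1&0\end{pmatrix}$, $SO^-(2,q)=\{\begin{pmatrix}d_1&\kappa d_2\\ d_2&d_1+d_2\end{pmatrix}: d_1^2+d_1d_2+\kappa d_2^2=1\}$. $Q^-(2n,q)$ is the subgroup of $O^-(2n,q)$ of all products (blocks of sizes $n-1,n-1,2$) $\begin{pmatrix}A&0&0\\0&{}^tA^{ -1}&0\\0&0&i\end{pmatrix}\begin{pmatrix}1_{n-1}&B&{}^th\,{}^ti\,\eta\, i\\0&1_{n-1}&0\\0&h&1_2\end{pmatrix}$ with $A\in GL(n-1,q)$, $i\in SO^-(2,q)$, $B\in\mathbb{F}_q^{(n-1)\times(n-1)}$, $h\in\mathbb{F}_q^{2\times(n-1)}$, ${}^tB+{}^th\delta h$ alternating. Let $\rho=\mathrm{diag}\big(1_{2n-2},\begin{pmatrix}1&1\\0&1\end{pmatrix}\big)$. For $0\le s\le n-1$, $\sigma_s$ is the permutation matrix interchanging standard basis vectors $e^j$ and $e^{n-1+j}$ for $1\le j\le s$ and fixing the others. Write $Q=Q^-(2n,q)$ and $XgY=\{xgy\}$. Double cosets: $DC_1^+(n,q)=Q\sigma_{n-1}Q$, $DC_2^+(n,q)=Q\sigma_{n-2}Q$, $DC_3^+(n,q)=\rho Q\sigma_{n-2}Q$ (for $n=2,4,6,\dots$); $DC_4^+(n,q)=\rho Q\sigma_{n-3}Q$ ($n=4,6,\dots$); $DC_1^-(n,q)=Q\sigma_{n-1}Q$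 ($n=1,3,5,\dots$); $DC_2^-(n,q)=Q\sigma_{n-2}Q$, $DC_3^-(n,q)=\rho Q\sigma_{n-2}Q$, $DC_4^-(n,q)=\rho Q\sigma_{n-3}Q$ ($n=3,5,\dots$). Constants: $A_1^+=q^{(5n^2-2n-4)/4}(q^{n-1}-1)\prod_{j=1}^{(n-2)/2}(q^{2j-1}-1)$; $B_1^+=(q+1)q^{n^2/4}\prod_{j=1}^{(n-2)/2}(q^{2j}-1)$; $A_2^+=q^{(5n^2-2n-8)/4}\left[\substack{n-1\\1}\right]_q\prod_{j=1}^{(n-2)/2}(q^{2j-1}-1)$; $B_2^+=(q+1)q^{(n-2)^2/4}(q^{n-1}-1)\prod_{j=1}^{(n-2)/2}(q^{2j}-1)$; $A_3^+=(q+1)q^{(5n^2-2n-8)/4}\left[\substack{n-1\\1}\right]_q\prod_{j=1}^{(n-2)/2}(q^{2j-1}-1)$; $B_3^+=q^{(n-2)^2/4}(q^{n-1}-1)\prod_{j=1}^{(n-2)/2}(q^{2j}-1)$; $A_4^+=(q+1)q^{(5n^2-6n-4)/4}\left[\substack{n-1\\2}\right]_q\prod_{j=1}^{(n-2)/2}(q^{2j-1}-1)$; $B_4^+=q^{(n-2)^2/4}(q^{n-1}-1)\prod_{j=1}^{(n-2)/2}(q^{2j}-1)$; $A_1^-=q^{5(n^2-1)/4}\prod_{j=1}^{(n-1)/2}(q^{2j-1}-1)$; $B_1^-=(q+1)q^{(n-1)^2/4}\prod_{j=1}^{(n-1)/2}(q^{2j}-1)$; $A_2^-=q^{(5n^2-4n-5)/4}\left[\substack{n-1\\1}\right]_q\prod_{j=1}^{(n-1)/2}(q^{2j-1}-1)$;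 $B_2^-=(q+1)q^{(n-1)^2/4}\prod_{j=1}^{(n-1)/2}(q^{2j}-1)$; $A_3^-=(q+1)q^{(5n^2-4n-5)/4}\left[\substack{n-1\\1}\right]_q\prod_{j=1}^{(n-1)/2}(q^{2j-1}-1)$; $B_3^-=q^{(n-1)^2/4}\prod_{j=1}^{(n-1)/2}(q^{2j}-1)$; $A_4^-=(q+1)q^{(5n^2-4n-9)/4}\left[\substack{n-1\\2}\right]_q\prod_{j=1}^{(n-3)/2}(q^{2j-1}-1)$; $B_4^-=q^{(n-3)^2/4}(q^{n-2}-1)(q^{n-1}-1)\prod_{j=1}^{(n-3)/2}(q^{2j}-1)$ (all arguments $(n,q)$). Codes: for $D=DC_i^\epsilon(n,q)$ with $N=|D|$, fix an ordering $g_1,\dots,g_N$ of $D$ and set $C(D)=\{u\in\mathbb{F}_2^N:\sum_{k=1}^N u_k\mathrm{Tr}(g_k)=0\text{ in }\mathbb{F}_q\}$; its weight distribution $C_{i,j}^\epsilon(n,q)$ is the number of codewords of Hamming weight $j$. -}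

module Defs where

open import Data.Bool using (Bool; true; false; if_then_else_; _∧_; _∨_; not; T)
open import Data.Nat as Nat using (ℕ; zero; suc; _!)
open import Data.Nat.Combinatorics using (_C_)
open import Data.Integer as Int using (ℤ; +_; -[1+_]; 0ℤ; 1ℤ; -1ℤ)
open import Data.Rational as Rat using (ℚ)
open import Data.Fin using (Fin; toℕ; splitAt; _↑ˡ_; _↑ʳ_)
open import Data.List using (List; []; _∷_; _++_; map; foldr; length; filterᵇ; concatMap; upTo; allFin; cartesianProduct)
open import Data.Bool.ListAction using (all; any)
open import Data.Product using (_×_; _,_; proj₁; proj₂; ∃-syntax)
open import Data.Sum using (_⊎_; inj₁; inj₂)
open import Relation.Binary.PropositionalEquality using (_≡_; _≢_)
open import Relation.Binary.Definitions using (DecidableEquality)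
open import Relation.Nullary.Decidable using (⌊_⌋)
open import Relation.Nullary using (¬_)
open import Algebra.Structures using (IsCommutativeRing)
open import Data.List.Membership.Propositional using (_∈_)
open import Data.List.Relation.Unary.Unique.Propositional using (Unique)

sumℤ : List ℤ → ℤ
sumℤ = foldr Int._+_ 0ℤ

prodℕ : List ℕ → ℕ
prodℕ = foldr Nat._*_ 1

sumℕ : List ℕ → ℕ
sumℕ = foldr Nat._+_ 0

-- ℕ-division, with the (never used) convention x / 0 = 0
divℕ : ℕ → ℕ → ℕ
divℕ x zero = 0
divℕ x (suc k) = x Nat./ suc k

-- ℤ-division by a natural number (exact in all uses), x / 0 = 0
divℤ : ℤ → ℕ → ℤ
divℤ x zero = 0ℤ
divℤ x (suc k) = x Int./ (+ suc k)

-- rational number x / d (d ≠ 0 in all uses), x / 0 = 0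
divℚ : ℤ → ℕ → ℚ
divℚ x zero = Rat.0ℚ
divℚ x (suc k) = x Rat./ suc k

toℚ : ℤ → ℚ
toℚ x = x Rat./ 1

prodFrom1 : ℕ → (ℕ → ℕ) → ℕ
prodFrom1 zero f = 1
prodFrom1 (suc k) f = prodFrom1 k f Nat.* f (suc k)

sumRangeℤ : ℕ → ℕ → (ℕ → ℤ) → ℤ
sumRangeℤ a b f = sumℤ (map (λ k → f (a Nat.+ k)) (upTo (suc b Nat.∸ a)))

binℤ : ℤ → ℤ → ℤ
binℤ (+ b) (+ a) = + (b C a)
binℤ (+ b) -[1+ a ] = 0ℤ
binℤ -[1+ b ] a = 0ℤ

binT : ℤ → ℕ → ℕ
binT (+ b) a = b C a
binT -[1+ b ] a = 0

stirling2 : ℕ → ℕ → ℤ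
stirling2 h t = divℤ (sumRangeℤ 0 t (λ j → (-1ℤ Int.^ (t Nat.∸ j)) Int.* (+ (t C j)) Int.* (+ (j Nat.^ h)))) (t !)

gauss : ℕ → ℕ → ℕ → ℕ
gauss q m s = divℕ (prodFrom1 s (λ j → q Nat.^ (m Nat.∸ (j Nat.∸ 1)) Nat.∸ 1))
                   (prodFrom1 s (λ j → q Nat.^ (s Nat.∸ (j Nat.∸ 1)) Nat.∸ 1))

allFns : {A : Set} → (n : ℕ) → List A → List (Fin n → A)
allFns zero xs = (λ ()) ∷ []
allFns (suc n) xs =
  concatMap (λ a → map (λ f → λ { Fin.zero → a ; (Fin.suc k) → f k }) (allFns n xs)) xs
  where import Data.Fin as Fin

-- all sub-sequences of a list (one for each vector u ∈ F_2^N)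
subseqs : {A : Set} → List A → List (List A)
subseqs [] = [] ∷ []
subseqs (x ∷ xs) = subseqs xs ++ map (x ∷_) (subseqs xs)

count : {A : Set} → (A → Bool) → List A → ℕ
count p xs = length (filterᵇ p xs)

assignments : {A : Set} → List A → ℕ → List (List (A × ℕ))
assignments [] j = [] ∷ []
assignments (x ∷ xs) j =
  concatMap (λ v → map ((x , v) ∷_) (assignments xs j)) (upTo (suc j))

_==ℕ_ : ℕ → ℕ → Bool
a ==ℕ b = ⌊ a Nat.≟ b ⌋

_==ℤ_ : ℤ → ℤ → Bool
a ==ℤ b = ⌊ a Int.≟ b ⌋

record FiniteField : Set₁ where
  infixl 6 _+_
  infixl 7 _*_
  field
    Carrier : Set
    _≟_ : DecidableEquality Carrier
    _+_ _*_ : Carrier → Carrier → Carrier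
    -_ : Carrier → Carrier
    0# 1# : Carrier
    isCommutativeRing : IsCommutativeRing _≡_ _+_ _*_ -_ 0# 1#
    _⁻¹ : Carrier → Carrier
    0≢1 : 0# ≢ 1#
    ⁻¹-inverse : ∀ x → x ≢ 0# → x * (x ⁻¹) ≡ 1#
    elements : List Carrier
    elements-complete : ∀ x → x ∈ elements
    elements-unique : Unique elements

  size : ℕ
  size = length elements

-- z^2 + z + κ is irreducible over F: it has no factorisation (z + a)(z + b)
Irreducible : (F : FiniteField) → FiniteField.Carrier F → Set
Irreducible F κ = ∀ a b → ¬ ((a + b ≡ 1#) × (a * b ≡ κ))
  where open FiniteField F

data Sign : Set where
  plus minus : Sign

sgn : Sign → ℤ
sgn plus = 1ℤ
sgn minus = -1ℤ

data Idx : Set where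
  i1 i2 i3 i4 : Idx

Even Odd : ℕ → Set
Even n = ∃[ k ] n ≡ 2 Nat.* k
Odd n = ∃[ k ] n ≡ suc (2 Nat.* k)

-- the (ε,i,n) for which DC_i^ε(n,q) is defined
Valid : Sign → Idx → ℕ → Set
Valid plus i1 n = Even n × 2 Nat.≤ n
Valid plus i2 n = Even n × 2 Nat.≤ n
Valid plus i3 n = Even n × 2 Nat.≤ n
Valid plus i4 n = Even n × 4 Nat.≤ n
Valid minus i1 n = Odd n × 1 Nat.≤ n
Valid minus i2 n = Odd n × 3 Nat.≤ n
Valid minus i3 n = Odd n × 3 Nat.≤ n
Valid minus i4 n = Odd n × 3 Nat.≤ n

CondA : Sign → Idx → ℕ → ℕ → Set
CondA plus i1 n q = Even n × 2 Nat.≤ n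
CondA plus i3 n q = Even n × ((4 Nat.≤ n) ⊎ ((n ≡ 2) × (8 Nat.≤ q)))
CondA minus i1 n q = Odd n × 1 Nat.≤ n
CondA minus i3 n q = Odd n × 3 Nat.≤ n
CondA _ _ n q = ⊥'
  where open import Data.Empty renaming (⊥ to ⊥')

CondB : Sign → Idx → ℕ → ℕ → Set
CondB plus i2 n q = Even n × 2 Nat.≤ n × 4 Nat.≤ q
CondB minus i2 n q = Odd n × 3 Nat.≤ n × 4 Nat.≤ q
CondB _ _ n q = ⊥'
  where open import Data.Empty renaming (⊥ to ⊥')

CondC : Sign → Idx → ℕ → ℕ → Set
CondC plus i4 n q = Even n × 4 Nat.≤ n × 4 Nat.≤ q
CondC minus i4 n q = Odd n × 3 Nat.≤ n × 4 Nat.≤ q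
CondC _ _ n q = ⊥'
  where open import Data.Empty renaming (⊥ to ⊥')

module Constants (n q : ℕ) where
  open Nat using (_+_; _*_; _∸_; _^_; _/_)

  P1+ P2+ P1- P2- P1-' P2-' : ℕ
  P1+ = prodFrom1 ((n ∸ 2) / 2) (λ j → q ^ (2 * j ∸ 1) ∸ 1)
  P2+ = prodFrom1 ((n ∸ 2) / 2) (λ j → q ^ (2 * j) ∸ 1)
  P1- = prodFrom1 ((n ∸ 1) / 2) (λ j → q ^ (2 * j ∸ 1) ∸ 1)
  P2- = prodFrom1 ((n ∸ 1) / 2) (λ j → q ^ (2 * j) ∸ 1)
  P1-' = prodFrom1 ((n ∸ 3) / 2) (λ j → q ^ (2 * j ∸ 1) ∸ 1)
  P2-' = prodFrom1 ((n ∸ 3) / 2) (λ j → q ^ (2 * j) ∸ 1)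

  Aᶜ : Sign → Idx → ℕ
  Aᶜ plus i1 = q ^ ((5 * n * n ∸ 2 * n ∸ 4) / 4) * (q ^ (n ∸ 1) ∸ 1) * P1+
  Aᶜ plus i2 = q ^ ((5 * n * n ∸ 2 * n ∸ 8) / 4) * gauss q (n ∸ 1) 1 * P1+
  Aᶜ plus i3 = (q + 1) * q ^ ((5 * n * n ∸ 2 * n ∸ 8) / 4) * gauss q (n ∸ 1) 1 * P1+
  Aᶜ plus i4 = (q + 1) * q ^ ((5 * n * n ∸ 6 * n ∸ 4) / 4) * gauss q (n ∸ 1) 2 * P1+
  Aᶜ minus i1 = q ^ ((5 * (n * n ∸ 1)) / 4) * P1-
  Aᶜ minus i2 = q ^ ((5 * n * n ∸ 4 * n ∸ 5) / 4) * gauss q (n ∸ 1) 1 * P1-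
  Aᶜ minus i3 = (q + 1) * q ^ ((5 * n * n ∸ 4 * n ∸ 5) / 4) * gauss q (n ∸ 1) 1 * P1-
  Aᶜ minus i4 = (q + 1) * q ^ ((5 * n * n ∸ 4 * n ∸ 9) / 4) * gauss q (n ∸ 1) 2 * P1-'

  Bᶜ : Sign → Idx → ℕ
  Bᶜ plus i1 = (q + 1) * q ^ ((n * n) / 4) * P2+
  Bᶜ plus i2 = (q + 1) * q ^ (((n ∸ 2) * (n ∸ 2)) / 4) * (q ^ (n ∸ 1) ∸ 1) * P2+
  Bᶜ plus i3 = q ^ (((n ∸ 2) * (n ∸ 2)) / 4) * (q ^ (n ∸ 1) ∸ 1) * P2+
  Bᶜ plus i4 = q ^ (((n ∸ 2) * (n ∸ 2)) / 4) * (q ^ (n ∸ 1) ∸ 1) * P2+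
  Bᶜ minus i1 = (q + 1) * q ^ (((n ∸ 1) * (n ∸ 1)) / 4) * P2-
  Bᶜ minus i2 = (q + 1) * q ^ (((n ∸ 1) * (n ∸ 1)) / 4) * P2-
  Bᶜ minus i3 = q ^ (((n ∸ 1) * (n ∸ 1)) / 4) * P2-
  Bᶜ minus i4 = q ^ (((n ∸ 3) * (n ∸ 3)) / 4) * (q ^ (n ∸ 2) ∸ 1) * (q ^ (n ∸ 1) ∸ 1) * P2-'

module Setup (𝔽 : FiniteField) (r : ℕ) (κ : FiniteField.Carrier 𝔽) where
  open FiniteField 𝔽

  q : ℕ
  q = size

  _==_ : Carrier → Carrier → Bool
  a == b = ⌊ a ≟ b ⌋

  _^F_ : Carrier → ℕ → Carrier
  x ^F zero = 1#
  x ^F suc k = x * (x ^F k)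

  sumF : List Carrier → Carrier
  sumF = foldr _+_ 0#

  _·F_ : ℕ → Carrier → Carrier
  zero ·F β = 0#
  suc ν ·F β = β + (ν ·F β)

  nonzeros : List Carrier
  nonzeros = filterᵇ (λ x → not (x == 0#)) elements

  tr : Carrier → Carrier
  tr x = sumF (map (λ k → x ^F (2 Nat.^ k)) (upTo r))

  -- λ(x) = (-1)^{tr(x)}  (tr(x) ∈ {0,1})
  λ' : Carrier → ℤ
  λ' x = if tr x == 0# then 1ℤ else -1ℤ

  K : Carrier → ℤ
  K a = sumℤ (map (λ α → λ' (α + a * α ⁻¹)) nonzeros)

  K₂ : Carrier → ℤ
  K₂ a = sumℤ (map (λ p → λ' (proj₁ p + proj₂ p + a * (proj₁ p) ⁻¹ * (proj₂ p) ⁻¹))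
                   (cartesianProduct nonzeros nonzeros))

  MK : ℕ → ℤ
  MK h = sumℤ (map (λ a → K a Int.^ h) nonzeros)

  MK₂ : ℕ → ℤ
  MK₂ h = sumℤ (map (λ a → K₂ a Int.^ h) nonzeros)

  Mat : ℕ → ℕ → Set
  Mat a b = Fin a → Fin b → Carrier

  sumFin : (a : ℕ) → (Fin a → Carrier) → Carrier
  sumFin a f = sumF (map f (allFin a))

  _⊗_ : {a b c : ℕ} → Mat a b → Mat b c → Mat a c
  _⊗_ {b = b} M P i k = sumFin b (λ j → M i j * P j k)

  idM : {a : ℕ} → Mat a a
  idM i j = if ⌊ i Data.Fin.≟ j ⌋ then 1# else 0#
    where import Data.Fin

  zeroM : {a b : ℕ} → Mat a b
  zeroM i j = 0#

  ᵗ : {a b : ℕ} → Mat a b → Mat b a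
  ᵗ M i j = M j i

  _+M_ : {a b : ℕ} → Mat a b → Mat a b → Mat a b
  (M +M P) i j = M i j + P i j

  eqM : {a b : ℕ} → Mat a b → Mat a b → Bool
  eqM {a} {b} M P = all (λ i → all (λ j → M i j == P i j) (allFin b)) (allFin a)

  Tr : {a : ℕ} → Mat a a → Carrier
  Tr {a} M = sumFin a (λ i → M i i)

  allMats : (a b : ℕ) → List (Mat a b)
  allMats a b = allFns a (allFns b elements)

  alternating : {a : ℕ} → Mat a a → Bool
  alternating {a} M = all (λ i → (M i i == 0#) ∧ all (λ j → M i j == M j i) (allFin a)) (allFin a)

  mat2 : Carrier → Carrier → Carrier → Carrier → Mat 2 2
  mat2 a b c d Fin.zero Fin.zero = a
  mat2 a b c d Fin.zero (Fin.suc Fin.zero) = b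
  mat2 a b c d (Fin.suc Fin.zero) Fin.zero = c
  mat2 a b c d (Fin.suc Fin.zero) (Fin.suc Fin.zero) = d

  δ η : Mat 2 2
  δ = mat2 1# 1# 0# κ
  η = mat2 0# 1# 1# 0#

  -- Block matrices for n = suc m: blocks of sizes m, m, 2

  module Blocks (m : ℕ) where
    d : ℕ
    d = m Nat.+ (m Nat.+ 2)

    data Part : Set where
      p1 p2 : Fin m → Part
      p3 : Fin 2 → Part

    part : Fin d → Part
    part x with splitAt m x
    ... | inj₁ k = p1 k
    ... | inj₂ y with splitAt m y
    ...   | inj₁ k = p2 k
    ...   | inj₂ k = p3 k

    block : Mat m m → Mat m m → Mat m 2 →
            Mat m m → Mat m m → Mat m 2 →
            Mat 2 m → Mat 2 m → Mat 2 2 → Mat d d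
    block M11 M12 M13 M21 M22 M23 M31 M32 M33 x y with part x | part y
    ... | p1 i | p1 j = M11 i j
    ... | p1 i | p2 j = M12 i j
    ... | p1 i | p3 j = M13 i j
    ... | p2 i | p1 j = M21 i j
    ... | p2 i | p2 j = M22 i j
    ... | p2 i | p3 j = M23 i j
    ... | p3 i | p1 j = M31 i j
    ... | p3 i | p2 j = M32 i j
    ... | p3 i | p3 j = M33 i j

    -- the elements of Q = Q^-(2n,q), listed via all admissible parameters
    -- (A, A⁻¹, i = i(d1,d2), B, h)
    Qelem : Mat m m → Mat m m → Mat 2 2 → Mat m m → Mat 2 m → Mat d d
    Qelem A A' i B h =
      block A zeroM zeroM zeroM (ᵗ A') zeroM zeroM zeroM i
      ⊗ block idM B (ᵗ h ⊗ (ᵗ i ⊗ (η ⊗ i))) zeroM idM zeroM zeroM h idM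

    SOminus : List (Mat 2 2)
    SOminus = map (λ p → mat2 (proj₁ p) (κ * proj₂ p) (proj₂ p) (proj₁ p + proj₂ p))
                  (filterᵇ (λ p → (proj₁ p * proj₁ p + proj₁ p * proj₂ p + κ * proj₂ p * proj₂ p) == 1#)
                           (cartesianProduct elements elements))

    GLpairs : List (Mat m m × Mat m m)
    GLpairs = filterᵇ (λ p → eqM (proj₁ p ⊗ proj₂ p) idM ∧ eqM (proj₂ p ⊗ proj₁ p) idM)
                      (cartesianProduct (allMats m m) (allMats m m))

    Qlist : List (Mat d d)
    Qlist =
      concatMap (λ AA →
      concatMap (λ i →
      concatMap (λ B →
      map (λ h → Qelem (proj₁ AA) (proj₂ AA) i B h)
          (filterᵇ (λ h → alternating (ᵗ B +M (ᵗ h ⊗ (δ ⊗ h)))) (allMats 2 m)))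
        (allMats m m)) SOminus) GLpairs

    ρ : Mat d d
    ρ = block idM zeroM zeroM zeroM idM zeroM zeroM zeroM (mat2 1# 1# 0# 1#)

    σperm : ℕ → Fin d → Fin d
    σperm s x with part x
    ... | p1 k = if toℕ k Nat.<ᵇ s then m ↑ʳ (k ↑ˡ 2) else x
    ... | p2 k = if toℕ k Nat.<ᵇ s then k ↑ˡ (m Nat.+ 2) else x
    ... | p3 k = x

    σ : ℕ → Mat d d
    σ s x y = if ⌊ σperm s x Data.Fin.≟ y ⌋ then 1# else 0#
      where import Data.Fin

    inDC : Mat d d → ℕ → Mat d d → Bool
    inDC pre s g = any (λ x → any (λ y → eqM g (pre ⊗ (x ⊗ (σ s ⊗ y)))) Qlist) Qlist

    DC : Idx → List (Mat d d)
    DC i1 = filterᵇ (inDC idM m) (allMats d d)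
    DC i2 = filterᵇ (inDC idM (m Nat.∸ 1)) (allMats d d)
    DC i3 = filterᵇ (inDC ρ (m Nat.∸ 1)) (allMats d d)
    DC i4 = filterᵇ (inDC ρ (m Nat.∸ 2)) (allMats d d)

    Nsize : Idx → ℕ
    Nsize i = length (DC i)

    -- weight distribution of C(DC_i): number of u ∈ F_2^N of weight j with
    -- Σ_k u_k Tr(g_k) = 0 (one sub-sequence of DC i per u)
    Cw : Idx → ℕ → ℕ
    Cw i j = count (λ S → (length S ==ℕ j) ∧ (sumF (map Tr S) == 0#)) (subseqs (DC i))

  module Pieces (ε : Sign) (i : Idx) (m : ℕ) where
    open Blocks m public
    open Constants (suc m) q public

    e : ℤ
    e = sgn ε

    A B N : ℕ
    A = Aᶜ ε i
    B = Bᶜ ε i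
    N = Nsize i

    Σh : ℕ → ℚ
    Σh h = divℚ ((+ q) Int.* sumRangeℤ 0 (N Nat.⊓ h) (λ j →
               (-1ℤ Int.^ j) Int.* (+ Cw i j) Int.*
               sumRangeℤ j h (λ t → (+ (t !)) Int.* stirling2 h t Int.* (+ (2 Nat.^ (h Nat.∸ t)))
                                    Int.* binℤ ((+ N) Int.- (+ j)) ((+ N) Int.- (+ t)))))
             (A Nat.^ h)

    recSum : ℤ → ℤ → (ℕ → ℤ) → ℕ → ℤ
    recSum s c M h = Int.- sumRangeℤ 0 (h Nat.∸ 1) (λ l → (s Int.^ l) Int.* (+ (h C l)) Int.* (c Int.^ (h Nat.∸ l)) Int.* M l)

    top : ℤ → ℤ
    top c = divℤ ((+ A) Int.* ((+ B) Int.+ e Int.* c)) q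

    families : ℕ → List (List (Carrier × ℕ))
    families j = filterᵇ (λ ν → (sumℕ (map proj₂ ν) ==ℕ j)
                                 ∧ (sumF (map (λ p → proj₂ p ·F proj₁ p) ν) == 0#))
                         (assignments elements j)

    ν⟨_⟩ : List (Carrier × ℕ) → Carrier → ℕ
    ν⟨ [] ⟩ β = 0
    ν⟨ (x , v) ∷ ν ⟩ β = if x == β then v else ν⟨ ν ⟩ β

    weightA : ℕ → ℕ
    weightA j = sumℕ (map (λ ν →
        binT (top 1ℤ) (ν⟨ ν ⟩ 0#)
        Nat.* prodℕ (map (λ β → binT (top ((+ q) Int.+ 1ℤ)) (ν⟨ ν ⟩ β))
                       (filterᵇ (λ β → tr (β ⁻¹) == 0#) nonzeros))
        Nat.* prodℕ (map (λ β → binT (top (Int.- (+ q) Int.+ 1ℤ)) (ν⟨ ν ⟩ β))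
                       (filterᵇ (λ β → tr (β ⁻¹) == 1#) nonzeros)))
      (families j))

    -- integers τ with |τ| < 2√q (i.e. τ² < 4q) and τ ≡ -1 (mod 4)
    taus : List ℤ
    taus = filterᵇ (λ τ → ⌊ (τ Int.* τ) Int.<? (+ (4 Nat.* q)) ⌋ ∧ (((τ Int.+ 1ℤ) Int.% (+ 4)) ==ℕ 0))
                   (map (λ k → (+ k) Int.- (+ (2 Nat.* q))) (upTo (suc (4 Nat.* q))))

    weightBC : ℤ → (ℤ → ℤ) → ℕ → ℕ
    weightBC c0 cτ j = sumℕ (map (λ ν →
        binT (top c0) (ν⟨ ν ⟩ 0#)
        Nat.* prodℕ (map (λ τ → prodℕ (map (λ β → binT (top (cτ τ)) (ν⟨ ν ⟩ β))
                                         (filterᵇ (λ β → K (β ⁻¹) ==ℤ τ) nonzeros)))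
                       taus))
      (families j))

    q' : ℤ
    q' = + q

    PartA : Set
    PartA =
      (∀ h → 1 Nat.≤ h →
         toℚ (((Int.- e) Int.^ h) Int.* MK h) ≡ toℚ (recSum (Int.- e) (+ B) MK h) Rat.+ Σh h)
      × (∀ j → j Nat.≤ N → Cw i j ≡ weightA j)

    PartB : Set
    PartB =
      (∀ h → 1 Nat.≤ h →
         (toℚ ((e Int.^ h) Int.* MK₂ h) ≡ toℚ (recSum e ((+ B) Int.+ e Int.* q') MK₂ h) Rat.+ Σh h)
         × (toℚ ((e Int.^ h) Int.* MK (2 Nat.* h)) ≡ toℚ (recSum e (+ B) (λ l → MK (2 Nat.* l)) h) Rat.+ Σh h))
      × (∀ j → j Nat.≤ N →
           Cw i j ≡ weightBC (q' Int.+ 1ℤ Int.- q' Int.* q') (λ τ → q' Int.+ 1ℤ Int.- q' Int.* τ) j)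

    PartC : Set
    PartC =
      (∀ h → 1 Nat.≤ h →
         (toℚ ((e Int.^ h) Int.* MK₂ h) ≡ toℚ (recSum e ((+ B) Int.+ e Int.* (q' Int.* q')) MK₂ h) Rat.+ Σh h)
         × (toℚ ((e Int.^ h) Int.* MK (2 Nat.* h))
              ≡ toℚ (recSum e ((+ B) Int.+ e Int.* (q' Int.* q' Int.- q')) (λ l → MK (2 Nat.* l)) h) Rat.+ Σh h))
      × (∀ j → j Nat.≤ N →
           Cw i j ≡ weightBC (q' Int.* q' Int.+ 1ℤ Int.- q' Int.* q' Int.* q') (λ τ → q' Int.* q' Int.+ 1ℤ Int.- q' Int.* τ) j)

{-# OPTIONS --safe #-}
-- The code C(D) is dual to the trace code, whose nonzero words have weights (N − S(a))/2 with S(a) = Σ_{g ∈ D} λ(a Tr g).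
-- The map (x , y) ↦ pre x σ y from Q × Q onto a double coset D has fibres of size |Q ∩ σQσ|, and Tr is cyclic, so
-- |Q ∩ σQσ| S(a) = |Q| Σ_{w ∈ Q} λ(a Tr(σ pre w)); in block coordinates the last sum is the product of a power of q, a sum over
-- SO⁻(2), a Gauss sum over the nonsingular symmetric matrices of size s and a Kloosterman sum over GL_t, t ≤ 2. Hence S(a) is a
-- constant times K(a), K(a)² or K(a)² + q² − q. The power moments are Pless identities, and Fourier inversion of S gives the
-- number of g ∈ D of each trace, hence the weights. The ranges of τ need the Hasse bound K² < 4q, which is proved by Manin's
-- method: heights along the arithmetic progression P + nQ on an elliptic curve over 𝔽_q(x) form a nonnegative quadratic polynomial in n.
module Submission where

open import Defs
open import Algebra.Bundles using (CommutativeRing; RawRing)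
open import Algebra.Structures using (IsCommutativeRing)
open import Algebra.Solver.Ring.AlmostCommutativeRing using (fromCommutativeRing; _-Raw-AlmostCommutative⟶_)
import Algebra.Solver.Ring
import Algebra.Properties.Ring as RingProperties
open import Data.Bool using (Bool; true; false; if_then_else_; _∧_; not; T; _xor_)
open import Data.Bool.Properties using (T-∧; T-≡)
open import Data.Empty using (⊥; ⊥-elim)
open import Data.Unit using (⊤; tt)
import Level
import Data.Bool.ListAction as ListAction
import Data.Nat as ℕ
open ℕ using (ℕ; zero; suc; _!; z≤n; s≤s; _≤_; _<_; _∸_; _⊓_; _⊔_) renaming (_+_ to _∔_; _*_ to _·_; _^_ to _**_)
import Data.Nat.Properties as N
open import Data.Nat.Tactic.RingSolver using () renaming (solve-∀ to ringℕ)
open import Data.Nat.DivMod using (m%n<n; m≡m%n+[m/n]*n; m*[n/m]≡n; m*n/n≡m; m/n*n≡m)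
open import Data.Nat.Divisibility using (_∣_; divides; ∣1⇒≡1; ∣m+n∣m⇒∣n; ∣-trans; m∣m*n; n∣m*n; *-monoʳ-∣; *-pres-∣; ∣m∣n⇒∣m+n)
open import Data.Integer.DivMod using (div-pos-is-/ℕ; n%ℕd<d; a≡a%ℕn+[a/ℕn]*n)
import Data.Rational as ℚ
import Data.Rational.Properties as ℚP
import Data.Rational.Unnormalised as ℚᵘ
import Data.Rational.Unnormalised.Properties as ℚᵘP
open import Data.Nat.Coprimality using (coprime-divisor)
open import Data.Integer using (ℤ; 0ℤ; 1ℤ; -1ℤ; _+_; _*_; _-_; -_; _^_; -[1+_]) renaming (+_ to pos)
import Data.Integer as ℤ
import Data.Integer.Properties as Z
open import Data.Integer.Tactic.RingSolver using () renaming (solve-∀ to ring)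
open import Data.Fin using (Fin; toℕ; splitAt; _↑ˡ_; _↑ʳ_; punchIn) renaming (zero to fz; suc to fs)
import Data.Fin as Fin
import Data.Fin.Properties as FinP
open import Data.List using (List; []; _∷_; _++_; map; foldr; length; filterᵇ; concatMap; upTo; allFin; cartesianProduct; tabulate)
import Data.List.Properties as ListP
open import Data.List.Membership.Propositional using (_∈_; find)
open import Data.List.Membership.Propositional.Properties using (∈-map⁺; ∈-map⁻; ∈-filter⁺; ∈-filter⁻; ∈-++⁻; ∈-allFin; ∈-concatMap⁻; ∈-upTo⁺)
open import Data.List.Membership.Propositional.Properties.WithK using (unique∧set⇒bag)
open import Data.List.Relation.Binary.BagAndSetEquality using (∼bag⇒↭)
open import Data.List.Relation.Binary.Permutation.Propositional using (_↭_; ↭⇒↭ₛ)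
open import Data.List.Relation.Binary.Permutation.Setoid.Properties using (foldr-commMonoid)
import Data.List.Relation.Unary.Unique.Propositional.Properties as UniqueP
open import Data.Maybe using (Maybe; just; nothing)
open import Data.List.Relation.Unary.Any using (Any; here; there; any?)
open import Data.List.Relation.Unary.All using (All; []; _∷_; all?)
import Data.List.Relation.Unary.All as All
import Data.List.Relation.Unary.Any as Any
open import Data.List.Relation.Unary.All.Properties using (all⁺; all⁻)
open import Data.List.Relation.Unary.Any.Properties using (any⁺; any⁻)
open import Data.List.Relation.Unary.AllPairs using ([]; _∷_)
open import Data.List.Relation.Unary.Unique.Propositional using (Unique)
open import Data.Product using (Σ; _×_; _,_; proj₁; proj₂; ∃-syntax)
open import Data.Sum using (_⊎_; inj₁; inj₂)
open import Function using (_∘_; id; Equivalence; mk⇔)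
import Data.Vec.Functional as V
open V using (insertAt)
open import Data.Vec.Functional.Properties using (lookup-++ˡ; lookup-++ʳ; insertAt-lookup; insertAt-punchIn; insertAt-removeAt)
open import Relation.Binary.PropositionalEquality using (_≡_; _≢_; refl; sym; trans; cong; cong₂; subst; subst₂; module ≡-Reasoning; setoid)
open import Relation.Binary.Definitions using (DecidableEquality)
open import Relation.Nullary using (¬_; Dec; yes; no; does; contradiction)
open import Relation.Nullary.Decidable using (⌊_⌋; _×-dec_; _→-dec_; ¬?; T?; toWitness; fromWitness; map′)
open ≡-Reasoning

-- The equation N = AB and the values S(a) come from one identity. Put c = |Q ∩ σQσ|. If the
-- character sum over w ∈ Q equals W V(a) with W independent of a, then A = |Q| W / c and B = |Q| /
-- W, so that AB = |Q|² / c = |D| and S(a) = A V(a). The sign ε has two sources. The sum over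
-- SO⁻(2,q) of the coset without ρ is -K(a), while with ρ it is the constant q + 1. The Gauss sum
-- over symmetric matrices of size s has sign (-1)^s, and the parity of n fixes that of s. The
-- recursions for K₂ and for K² share the term Σ_h because K(a)² = q + K₂(a): they are the same
-- binomial expansion around two different centres. The condition q ≥ 4 enters with the set of the
-- integers τ: K ≡ -1 mod 4 needs 4 | q, and the strict inequality K² < 4q needs that q is not of
-- the form v(v + 1). Matrices are functions and equality of functions is not extensional, so all
-- sums run over finite setoids. Two sums are compared through the graph of a correspondence, and
-- every function that is summed has to respect pointwise equality.

infixr 5 _∙_
_∙_ : ∀ {ℓ} {X : Set ℓ} {x y z : X} → x ≡ y → y ≡ z → x ≡ z
_∙_ = trans

-- Finite sums of integers and indicator functions

variable
 𝑋 𝑌 : Set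

∑ : List 𝑋 → (𝑋 → ℤ) → ℤ
∑ xs f = sumℤ(map f xs)

∑-cong∈ : (xs : List 𝑋) {f g : 𝑋 → ℤ} → (∀ x → x ∈ xs → f x ≡ g x) → ∑ xs f ≡ ∑ xs g
∑-cong∈ [] e = refl
∑-cong∈(x ∷ xs) e = cong₂ _+_ (e x(here refl))(∑-cong∈ xs λ y i → e y(there i))

∑-cong : (xs : List 𝑋) {f g : 𝑋 → ℤ} → (∀ x → f x ≡ g x) → ∑ xs f ≡ ∑ xs g
∑-cong xs e = ∑-cong∈ xs(λ x _ → e x)

+-interchange : ∀ a b c d → (a + b) + (c + d) ≡ (a + c) + (b + d)
+-interchange a b c d = Z.+-assoc a b(c + d) ∙ cong(ℤ._+_ a)(sym(Z.+-assoc b c d) ∙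
 cong(λ z → z + d)(Z.+-comm b c) ∙ Z.+-assoc c b d) ∙ sym(Z.+-assoc a c(b + d))

*-swapˡ : ∀ a b c → a * (b * c) ≡ b * (a * c)
*-swapˡ a b c = sym(Z.*-assoc a b c) ∙ cong(λ z → z * c)(Z.*-comm a b) ∙ Z.*-assoc b a c

∑-+ : (xs : List 𝑋)(f g : 𝑋 → ℤ) → ∑ xs(λ x → f x + g x) ≡ ∑ xs f + ∑ xs g
∑-+ [] f g = refl
∑-+(x ∷ xs) f g = cong(ℤ._+_ (f x + g x))(∑-+ xs f g) ∙ +-interchange(f x)(g x)(∑ xs f)(∑ xs g)

∑-*ˡ : (xs : List 𝑋)(c : ℤ)(f : 𝑋 → ℤ) → ∑ xs(λ x → c * f x) ≡ c * ∑ xs f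
∑-*ˡ [] c f = sym(Z.*-zeroʳ c)
∑-*ˡ(x ∷ xs) c f = cong(ℤ._+_ (c * f x))(∑-*ˡ xs c f) ∙ sym(Z.*-distribˡ-+ c(f x)(∑ xs f))

∑-*ʳ : (xs : List 𝑋)(c : ℤ)(f : 𝑋 → ℤ) → ∑ xs(λ x → f x * c) ≡ ∑ xs f * c
∑-*ʳ xs c f = ∑-cong xs(λ x → Z.*-comm(f x) c) ∙ ∑-*ˡ xs c f ∙ Z.*-comm c(∑ xs f)

∑-zero : (xs : List 𝑋) → ∑ xs(λ _ → 0ℤ) ≡ 0ℤ
∑-zero [] = refl
∑-zero(x ∷ xs) = Z.+-identityˡ(∑ xs λ _ → 0ℤ) ∙ ∑-zero xs

∑-const : (xs : List 𝑋)(c : ℤ) → ∑ xs(λ _ → c) ≡ pos(length xs) * c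
∑-const [] c = sym(Z.*-zeroˡ c)
∑-const(x ∷ xs) c = cong(ℤ._+_ c)(∑-const xs c) ∙ sym(Z.suc-*(pos(length xs)) c)

∑-neg : (xs : List 𝑋)(f : 𝑋 → ℤ) → ∑ xs(λ x → - f x) ≡ - ∑ xs f
∑-neg [] f = refl
∑-neg(x ∷ xs) f = cong(ℤ._+_ (- f x))(∑-neg xs f) ∙ sym(Z.neg-distrib-+(f x)(∑ xs f))

∑-++ : (xs ys : List 𝑋)(f : 𝑋 → ℤ) → ∑(xs ++ ys) f ≡ ∑ xs f + ∑ ys f
∑-++ [] ys f = sym(Z.+-identityˡ(∑ ys f))
∑-++(x ∷ xs) ys f = cong(ℤ._+_ (f x))(∑-++ xs ys f) ∙ sym(Z.+-assoc(f x)(∑ xs f)(∑ ys f))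

∑-map : (g : 𝑌 → 𝑋)(xs : List 𝑌)(f : 𝑋 → ℤ) → ∑(map g xs) f ≡ ∑ xs(f ∘ g)
∑-map g [] f = refl
∑-map g(x ∷ xs) f = cong(ℤ._+_ (f(g x)))(∑-map g xs f)

∑-concatMap : (g : 𝑌 → List 𝑋)(xs : List 𝑌)(f : 𝑋 → ℤ) → ∑(concatMap g xs) f ≡ ∑ xs(λ x → ∑(g x) f)
∑-concatMap g [] f = refl
∑-concatMap g(x ∷ xs) f = ∑-++(g x)(concatMap g xs) f ∙ cong(ℤ._+_ (∑(g x) f))(∑-concatMap g xs f)

∑-swap : (xs : List 𝑋)(ys : List 𝑌)(f : 𝑋 → 𝑌 → ℤ) → ∑ xs(λ x → ∑ ys(f x)) ≡ ∑ ys(λ y → ∑ xs λ x → f x y)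
∑-swap [] ys f = sym(∑-zero ys)
∑-swap(x ∷ xs) ys f = cong(ℤ._+_ (∑ ys(f x)))(∑-swap xs ys f) ∙ sym(∑-+ ys(f x) λ y → ∑ xs λ x → f x y)

∑-cartesianProduct : (xs : List 𝑋)(ys : List 𝑌)(f : 𝑋 × 𝑌 → ℤ) →
 ∑(cartesianProduct xs ys) f ≡ ∑ xs(λ x → ∑ ys λ y → f(x , y))
∑-cartesianProduct [] ys f = refl
∑-cartesianProduct(x ∷ xs) ys f = ∑-++(map(x ,_) ys)(cartesianProduct xs ys) f ∙
 cong₂ _+_ (∑-map(x ,_) ys f)(∑-cartesianProduct xs ys f)

∑-* : (xs : List 𝑋)(ys : List 𝑌)(f : 𝑋 → ℤ)(g : 𝑌 → ℤ) → ∑ xs(λ x → ∑ ys λ y → f x * g y) ≡ ∑ xs f * ∑ ys g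
∑-* xs ys f g = ∑-cong xs(λ x → ∑-*ˡ ys(f x) g) ∙ ∑-*ʳ xs(∑ ys g) f

χ : {P : Set} → Dec P → ℤ
χ p = if does p then 1ℤ else 0ℤ

module _ {P : Set} where
 χ-yes : (p : Dec P) → P → χ p ≡ 1ℤ
 χ-yes(yes _) _ = refl
 χ-yes(no ¬x) x = contradiction x ¬x

 χ-no : (p : Dec P) → ¬ P → χ p ≡ 0ℤ
 χ-no(yes x) ¬x = contradiction x ¬x
 χ-no(no _) _ = refl

 χ-guard : (p : Dec P) {x y : ℤ} → (P → x ≡ y) → χ p * x ≡ χ p * y
 χ-guard(yes p) e = cong(1ℤ *_)(e p)
 χ-guard(no _) {x} {y} e = Z.*-zeroˡ x ∙ sym(Z.*-zeroˡ y)

 χ-idem : (p : Dec P) → χ p * χ p ≡ χ p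
 χ-idem(yes _) = refl
 χ-idem(no _) = refl

 χ-¬ : (p : Dec P) → χ(¬? p) ≡ 1ℤ - χ p
 χ-¬(yes _) = refl
 χ-¬(no _) = refl

module _ {P Q : Set} where
 χ-⇔ : (p : Dec P)(q : Dec Q) → (P → Q) → (Q → P) → χ p ≡ χ q
 χ-⇔(yes x) q f g = sym(χ-yes q(f x))
 χ-⇔(no ¬x) q f g = sym(χ-no q(¬x ∘ g))

 χ-× : (p : Dec P)(q : Dec Q) → χ(p ×-dec q) ≡ χ p * χ q
 χ-×(yes _)(yes _) = refl
 χ-×(yes _)(no _) = refl
 χ-×(no _) q = sym(Z.*-zeroˡ(χ q))

 χ-match : (p : Dec P)(q : Dec Q) {x y : ℤ} → (P → Q × x ≡ y) → (Q → P) → χ p * x ≡ χ q * y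
 χ-match p q {x} {y} f g = χ-guard p(λ z → proj₂(f z)) ∙ cong(_* y)(χ-⇔ p q(proj₁ ∘ f) g)

∑-filterᵇ : (p : 𝑋 → Bool)(xs : List 𝑋)(f : 𝑋 → ℤ) → ∑(filterᵇ p xs) f ≡ ∑ xs(λ x → χ(T?(p x)) * f x)
∑-filterᵇ p [] f = refl
∑-filterᵇ p(x ∷ xs) f with p x
... | true = cong₂ _+_ (sym(Z.*-identityˡ(f x)))(∑-filterᵇ p xs f)
... | false = ∑-filterᵇ p xs f ∙ sym(cong(_+ ∑ xs λ x → χ(T?(p x)) * f x)(Z.*-zeroˡ(f x)) ∙ Z.+-identityˡ _)

∑-length : (xs : List 𝑋) → ∑ xs(λ _ → 1ℤ) ≡ pos(length xs)
∑-length xs = ∑-const xs 1ℤ ∙ Z.*-identityʳ _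

-- Indicators are nonnegative, so one term equal to 1 makes the sum positive. In this way identities
-- between counts become statements about existence.
∑χ≡0⇒none : {P : 𝑋 → Set} (P? : ∀ x → Dec(P x))(xs : List 𝑋) → ∑ xs(λ x → χ(P? x)) ≡ 0ℤ → All(λ x → ¬ P x) xs
∑χ≡0⇒none {P = P} P? xs e = go xs(λ {x} i p → Z.<⇒≢(pos⁺ xs i p)(sym e))
 where
 nonneg : ∀ ys → 0ℤ ℤ.≤ ∑ ys(λ x → χ(P? x))
 nonneg [] = Z.≤-refl
 nonneg(y ∷ ys) with P? y
 ... | yes _ = Z.≤-trans(nonneg ys)(Z.i≤j+i(∑ ys λ x → χ(P? x)) 1ℤ)
 ... | no _ = subst(0ℤ ℤ.≤_)(sym(Z.+-identityˡ _))(nonneg ys)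
 pos⁺ : ∀ ys {x} → x ∈ ys → P x → 0ℤ ℤ.< ∑ ys(λ x → χ(P? x))
 pos⁺(y ∷ ys)(here refl) p with P? y
 ... | yes _ = Z.+-mono-<-≤ {0ℤ} {1ℤ} (ℤ.+<+(s≤s z≤n))(nonneg ys)
 ... | no ¬p = contradiction p ¬p
 pos⁺(y ∷ ys)(there i) p with P? y
 ... | yes _ = Z.<-≤-trans(pos⁺ ys i p)(Z.i≤j+i(∑ ys λ x → χ(P? x)) 1ℤ)
 ... | no _ = subst(0ℤ ℤ.<_)(sym(Z.+-identityˡ _))(pos⁺ ys i p)
 go : ∀ ys → (∀ {x} → x ∈ ys → ¬ P x) → All(λ x → ¬ P x) ys
 go [] f = []
 go(y ∷ ys) f = f(here refl) ∷ go ys(f ∘ there)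

-- 𝑋 finite setoid: the law ∑-δ says that the enumeration meets every class exactly once.
record FS : Set₁ where
 infix 4 _≈_ _≈?_
 field
  Carrier : Set
  _≈_ : Carrier → Carrier → Set
  ≈-refl : ∀ {x} → x ≈ x
  ≈-sym : ∀ {x y} → x ≈ y → y ≈ x
  ≈-trans : ∀ {x y z} → x ≈ y → y ≈ z → x ≈ z
  _≈?_ : ∀ x y → Dec(x ≈ y)
  enum : List Carrier
  ∑-δ : ∀ x → ∑ enum(λ y → χ(y ≈? x)) ≡ 1ℤ

 Cong : (Carrier → ℤ) → Set
 Cong f = ∀ {x y} → x ≈ y → f x ≡ f y

 Resp : (Carrier → Set) → Set
 Resp P = ∀ {x y} → x ≈ y → P x → P y

 represented : ∀ x → Any(_≈ x) enum
 represented x with any?(_≈? x) enum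
 ... | yes a = a
 ... | no ¬a = contradiction(sym(∑-δ x) ∙ ∑-cong∈ enum(λ y i → χ-no(y ≈? x) λ e → ¬a(Any.map(λ { refl → e }) i)) ∙ ∑-zero enum) λ ()

 ∀? : {P : Carrier → Set} → Resp P → (∀ x → Dec(P x)) → Dec(∀ x → P x)
 ∀? {P} r P? = map′(λ a x → from a(represented x))(λ f → All.tabulate λ {x} _ → f x)(all? P? enum)
  where
  from : ∀ {x xs} → All P xs → Any(_≈ x) xs → P x
  from(p ∷ _)(here e) = r e p
  from(_ ∷ a)(there i) = from a i

open FS public using () renaming (Carrier to El; enum to enum)

-- Reindexing sums over finite setoids

module _ (X : FS) where
 open FS X using (_≈?_; Cong; ∑-δ)

 ∑-sift : (x : El X) {f : El X → ℤ} → Cong f → ∑(enum X)(λ y → χ(y ≈? x) * f y) ≡ f x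
 ∑-sift x {f} c = begin
  _ ≡⟨ ∑-cong(enum X)(λ y → χ-guard(y ≈? x) c) ⟩
  ∑(enum X)(λ y → χ(y ≈? x) * f x) ≡⟨ ∑-*ʳ(enum X)(f x)(λ y → χ(y ≈? x)) ⟩
  ∑(enum X)(λ y → χ(y ≈? x)) * f x ≡⟨ cong(_* f x)(∑-δ x) ⟩
  1ℤ * f x ≡⟨ Z.*-identityˡ(f x) ⟩
  _ ∎

module _ (X Y : FS) where
 private
  module X = FS X
  module Y = FS Y

 -- Both sums are the sum over the graph of the correspondence, since every x meets exactly one
 -- class `y ≈ to x` and every y exactly one class `x ≈ from y`. Stating the hypothesis on the graph
 -- avoids separate proofs that the two maps respect ≈ and are mutually inverse.
 ∑-match : {f : El X → ℤ} {g : El Y → ℤ} (to : El X → El Y)(from : El Y → El X) →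
  (∀ x y → χ(y Y.≈? to x) * f x ≡ χ(x X.≈? from y) * g y) → ∑(enum X) f ≡ ∑(enum Y) g
 ∑-match {f} {g} to from e = begin
  _ ≡⟨ ∑-cong(enum X)(λ x → sym(∑-*ʳ(enum Y)(f x) _ ∙ cong(_* f x)(Y.∑-δ(to x)) ∙ Z.*-identityˡ(f x))) ⟩
  ∑(enum X)(λ x → ∑(enum Y) λ y → χ(y Y.≈? to x) * f x) ≡⟨ ∑-swap(enum X)(enum Y) _ ⟩
  ∑(enum Y)(λ y → ∑(enum X) λ x → χ(y Y.≈? to x) * f x) ≡⟨ ∑-cong(enum Y)(λ y → ∑-cong(enum X) λ x → e x y) ⟩
  ∑(enum Y)(λ y → ∑(enum X) λ x → χ(x X.≈? from y) * g y) ≡⟨ ∑-cong(enum Y)(λ y → ∑-*ʳ(enum X)(g y) _ ∙ cong(_* g y)(X.∑-δ(from y)) ∙ Z.*-identityˡ(g y)) ⟩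
  _ ∎

 ∑-reindex : {f : El X → ℤ} {g : El Y → ℤ} (to : El X → El Y)(from : El Y → El X) →
  (∀ {x y} → y Y.≈ to x → x X.≈ from y × f x ≡ g y) → (∀ {x y} → x X.≈ from y → y Y.≈ to x) →
  ∑(enum X) f ≡ ∑(enum Y) g
 ∑-reindex to from h k = ∑-match to from(λ x y → χ-match(y Y.≈? to x)(x X.≈? from y) h k)

 ∑-bij : {P : El X → Set} {Q : El Y → Set} (P? : ∀ x → Dec(P x))(Q? : ∀ y → Dec(Q y))
  {f : El X → ℤ} {g : El Y → ℤ} (to : El X → El Y)(from : El Y → El X) →
  (∀ {x y} → P x → y Y.≈ to x → Q y × x X.≈ from y × f x ≡ g y) →
  (∀ {x y} → Q y → x X.≈ from y → P x × y Y.≈ to x) →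
  ∑(enum X)(λ x → χ(P? x) * f x) ≡ ∑(enum Y)(λ y → χ(Q? y) * g y)
 ∑-bij P? Q? {f} {g} to from h k = ∑-match to from λ x y → begin
  _ ≡⟨ sym(Z.*-assoc(χ(y Y.≈? to x))(χ(P? x))(f x)) ⟩
  χ(y Y.≈? to x) * χ(P? x) * f x ≡⟨ cong(_* f x)(sym(χ-×(y Y.≈? to x)(P? x))) ⟩
  χ(y Y.≈? to x ×-dec P? x) * f x ≡⟨ χ-match(y Y.≈? to x ×-dec P? x)(x X.≈? from y ×-dec Q? y)
   (λ { (e , p) → let (a , b , c) = h p e in (b , a) , c })(λ { (e , p) → let (a , b) = k p e in b , a }) ⟩
  χ(x X.≈? from y ×-dec Q? y) * g y ≡⟨ cong(_* g y)(χ-×(x X.≈? from y)(Q? y)) ⟩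
  χ(x X.≈? from y) * χ(Q? y) * g y ≡⟨ Z.*-assoc(χ(x X.≈? from y))(χ(Q? y))(g y) ⟩
  _ ∎

module _ (X : FS) where
 open FS X using (_≈_; _≈?_; ≈-sym; ≈-trans; ∑-δ; represented)

 -- By injectivity each fibre has as many classes as the indicator of being hit. Summed over all y
 -- the fibres exhaust the setoid, so the number of hit classes is the number of all classes and
 -- none is missed. This later produces inverses of matrices with trivial kernel.
 injective⇒surjective : (f : El X → El X) → (∀ {x y} → x ≈ y → f x ≈ f y) → (∀ {x y} → f x ≈ f y → x ≈ y) →
  ∀ y → ∃[ x ] f x ≈ y
 injective⇒surjective f f-cong inj y₀ = decide(hit? y₀)
  where
  Hit : El X → Set
  Hit y = Any(λ x → f x ≈ y)(enum X)
  hit? : ∀ y → Dec(Hit y)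
  hit? y = any?(λ x → f x ≈? y)(enum X)
  fibre : ∀ y → ∑(enum X)(λ x → χ(f x ≈? y)) ≡ χ(hit? y)
  fibre y with hit? y
  ... | yes a = let (x₀ , e) = Any.satisfied a in
   ∑-cong(enum X)(λ x → χ-⇔(f x ≈? y)(x ≈? x₀)(λ e' → inj(≈-trans e'(≈-sym e))) λ e' → ≈-trans(f-cong e') e) ∙ ∑-δ x₀
  ... | no ¬a = ∑-cong∈(enum X)(λ x i → χ-no(f x ≈? y) λ e → ¬a(Any.map(λ { refl → e }) i)) ∙ ∑-zero(enum X)
  total : ∑(enum X)(λ y → χ(hit? y)) ≡ ∑(enum X)(λ _ → 1ℤ)
  total = begin
   _ ≡⟨ ∑-cong(enum X)(λ y → sym(fibre y)) ⟩
   ∑(enum X)(λ y → ∑(enum X) λ x → χ(f x ≈? y)) ≡⟨ ∑-swap(enum X)(enum X) _ ⟩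
   ∑(enum X)(λ x → ∑(enum X) λ y → χ(f x ≈? y)) ≡⟨ ∑-cong(enum X)(λ x → ∑-cong(enum X)(λ y → χ-⇔(f x ≈? y)(y ≈? f x) ≈-sym ≈-sym) ∙ ∑-δ(f x)) ⟩
   _ ∎
  missed : ∑(enum X)(λ y → χ(¬? (hit? y))) ≡ 0ℤ
  missed = begin
   _ ≡⟨ ∑-cong(enum X)(λ y → χ-¬(hit? y)) ⟩
   ∑(enum X)(λ y → 1ℤ + - χ(hit? y)) ≡⟨ ∑-+(enum X)(λ _ → 1ℤ)(λ y → - χ(hit? y)) ⟩
   ∑(enum X)(λ _ → 1ℤ) + ∑(enum X)(λ y → - χ(hit? y)) ≡⟨ cong₂ _+_ (sym total)(∑-neg(enum X) λ y → χ(hit? y)) ⟩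
   ∑(enum X)(λ y → χ(hit? y)) + - ∑(enum X)(λ y → χ(hit? y)) ≡⟨ Z.+-inverseʳ(∑(enum X) λ y → χ(hit? y)) ⟩
   _ ∎
  transfer : ∀ {y ys} → All(λ z → ¬ ¬ Hit z) ys → Any(_≈ y) ys → ¬ ¬ Hit y
  transfer(p ∷ _)(here e) ¬h = p(λ h → ¬h(Any.map(λ e' → ≈-trans e' e) h))
  transfer(_ ∷ a)(there i) ¬h = transfer a i ¬h
  decide : Dec(Hit y₀) → ∃[ x ] f x ≈ y₀
  decide(yes a) = Any.satisfied a
  decide(no ¬a) = ⊥-elim(transfer(∑χ≡0⇒none(λ y → ¬? (hit? y))(enum X) missed)(represented y₀) ¬a)

_×ᶠ_ : FS → FS → FS
X ×ᶠ Y = record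
 { Carrier = El X × El Y
 ; _≈_ = λ p q → proj₁ p X.≈ proj₁ q × proj₂ p Y.≈ proj₂ q
 ; ≈-refl = X.≈-refl , Y.≈-refl
 ; ≈-sym = λ (a , b) → X.≈-sym a , Y.≈-sym b
 ; ≈-trans = λ (a , b)(c , d) → X.≈-trans a c , Y.≈-trans b d
 ; _≈?_ = λ p q → (proj₁ p X.≈? proj₁ q) ×-dec(proj₂ p Y.≈? proj₂ q)
 ; enum = cartesianProduct(enum X)(enum Y)
 ; ∑-δ = λ (x , y) → ∑-cartesianProduct(enum X)(enum Y) _ ∙
   ∑-cong(enum X)(λ x' → ∑-cong(enum Y) λ y' → χ-×(x' X.≈? x)(y' Y.≈? y)) ∙
    ∑-*(enum X)(enum Y) _ _ ∙ cong₂ _*_ (X.∑-δ x)(Y.∑-δ y)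
 }
 where
 module X = FS X
 module Y = FS Y

infixr 5 _∷ᶠ_
_∷ᶠ_ : {n : ℕ} → 𝑋 → (Fin n → 𝑋) → Fin(suc n) → 𝑋
(a ∷ᶠ f) fz = a
(a ∷ᶠ f)(fs k) = f k

module _ {𝑋 : Set} (_≈_ : 𝑋 → 𝑋 → Set)(≈-refl : ∀ {x} → x ≈ x) where
 -- `allFns` builds its functions with a pattern lambda of its own, which agrees with `a ∷ᶠ v` only
 -- pointwise. Hence the condition that f respects pointwise equivalence.
 ∑-allFns-suc : (n : ℕ)(xs : List 𝑋)(f : (Fin(suc n) → 𝑋) → ℤ) → (∀ {u v} → (∀ i → u i ≈ v i) → f u ≡ f v) →
  ∑(allFns(suc n) xs) f ≡ ∑ xs(λ a → ∑(allFns n xs) λ v → f(a ∷ᶠ v))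
 ∑-allFns-suc n xs f c = ∑-concatMap _ xs f ∙ ∑-cong xs(λ a → ∑-map _ (allFns n xs) f ∙
  ∑-cong(allFns n xs) λ v → c λ { fz → ≈-refl ; (fs k) → ≈-refl })

Πᶠ : ℕ → FS → FS
Πᶠ n X = record
 { Carrier = Fin n → El X
 ; _≈_ = λ u v → ∀ i → u i X.≈ v i
 ; ≈-refl = λ i → X.≈-refl
 ; ≈-sym = λ e i → X.≈-sym(e i)
 ; ≈-trans = λ e e' i → X.≈-trans(e i)(e' i)
 ; _≈?_ = eq?
 ; enum = allFns n(enum X)
 ; ∑-δ = delta n
 }
 where
 module X = FS X
 eq? : ∀ {n} (u v : Fin n → El X) → Dec(∀ i → u i X.≈ v i)
 eq? u v = FinP.all?(λ i → u i X.≈? v i)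
 delta : ∀ n (u : Fin n → El X) → ∑(allFns n(enum X))(λ v → χ(eq? v u)) ≡ 1ℤ
 delta zero u = refl
 delta(suc n) u = ∑-allFns-suc X._≈_ X.≈-refl n(enum X)(λ v → χ(eq? v u))
   (λ {v} {w} e → χ-⇔(eq? v u)(eq? w u)(λ h i → X.≈-trans(X.≈-sym(e i))(h i)) λ h i → X.≈-trans(e i)(h i)) ∙
  ∑-cong(enum X)(λ a → ∑-cong(allFns n(enum X)) λ v → χ-⇔(eq?(a ∷ᶠ v) u)((a X.≈? u fz) ×-dec eq? v(u ∘ fs))(λ h → h fz , λ i → h(fs i))(λ { (p , q) fz → p ; (p , q)(fs i) → q i }) ∙
    χ-×(a X.≈? u fz)(eq? v(u ∘ fs))) ∙
   ∑-*(enum X)(allFns n(enum X)) _ _ ∙ cong₂ _*_ (X.∑-δ(u fz))(delta n(u ∘ fs))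

∑-Π-suc : (X : FS)(n : ℕ) {f : (Fin(suc n) → El X) → ℤ} → FS.Cong(Πᶠ(suc n) X) f →
 ∑(enum(Πᶠ(suc n) X)) f ≡ ∑(enum X)(λ a → ∑(enum(Πᶠ n X)) λ v → f(a ∷ᶠ v))
∑-Π-suc X n {f} c = ∑-allFns-suc(FS._≈_ X)(FS.≈-refl X) n(enum X) f c

∑-Π-1 : (X : FS)(n : ℕ) → ∑(enum(Πᶠ n X))(λ _ → 1ℤ) ≡ ∑(enum X)(λ _ → 1ℤ) ^ n
∑-Π-1 X zero = refl
∑-Π-1 X(suc n) = begin
 _ ≡⟨ ∑-Π-suc X n(λ _ → refl) ⟩
 ∑(enum X)(λ _ → ∑(enum(Πᶠ n X)) λ _ → 1ℤ) ≡⟨ ∑-cong(enum X)(λ _ → ∑-Π-1 X n ∙ sym(Z.*-identityˡ _)) ⟩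
 ∑(enum X)(λ _ → 1ℤ * ∑(enum X)(λ _ → 1ℤ) ^ n) ≡⟨ ∑-*ʳ(enum X)(∑(enum X)(λ _ → 1ℤ) ^ n)(λ _ → 1ℤ) ⟩
 _ ∎

∑-unique : (_≟_ : DecidableEquality 𝑋)(xs : List 𝑋) → Unique xs → ∀ x → x ∈ xs → ∑ xs(λ y → χ(y ≟ x)) ≡ 1ℤ
∑-unique _≟_ (y ∷ ys)(ne ∷ u) x(here refl) = cong₂ _+_ (χ-yes(x ≟ x) refl)
 (∑-cong∈ ys(λ z i → χ-no(z ≟ x) λ e → All.lookup ne i(sym e)) ∙ ∑-zero ys)
∑-unique _≟_ (y ∷ ys)(ne ∷ u) x(there i) = cong₂ _+_ (χ-no(y ≟ x) λ e → All.lookup ne i e)(∑-unique _≟_ ys u x i)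

-- With coefficients in 𝔽₂ the ring solver cancels x + x by itself, so identities valid only in
-- characteristic 2 are decided, and signs disappear. `con true` and `con false` stand for 1 and 0.
module Char2Solver {c ℓ} (R : CommutativeRing c ℓ)
 (2≈0 : CommutativeRing._≈_ R(CommutativeRing._+_ R(CommutativeRing.1# R)(CommutativeRing.1# R))(CommutativeRing.0# R)) where
 private
  module R = CommutativeRing R
  module RP = RingProperties R.ring

  𝔽₂ : RawRing _ _
  𝔽₂ = record { Carrier = Bool ; _≈_ = _≡_ ; _+_ = _xor_ ; _*_ = _∧_ ; -_ = id ; 0# = false ; 1# = true }

  ⟦_⟧₂ : Bool → R.Carrier
  ⟦ true ⟧₂ = R.1#
  ⟦ false ⟧₂ = R.0#

  -1≈1 : R.1# R.≈ R.- R.1#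
  -1≈1 = RP.+-inverseˡ-unique R.1# R.1# 2≈0

  morphism : 𝔽₂ -Raw-AlmostCommutative⟶ fromCommutativeRing R
  morphism = record
   { ⟦_⟧ = ⟦_⟧₂
   ; +-homo = λ { true true → R.sym 2≈0 ; true false → R.sym(R.+-identityʳ R.1#) ; false b → R.sym(R.+-identityˡ ⟦ b ⟧₂) }
   ; *-homo = λ { true b → R.sym(R.*-identityˡ ⟦ b ⟧₂) ; false b → R.sym(R.zeroˡ ⟦ b ⟧₂) }
   ; -‿homo = λ { true → -1≈1 ; false → R.sym RP.-0#≈0# }
   ; 0-homo = R.refl
   ; 1-homo = R.refl
   }

  coeff≟ : ∀ a b → Maybe(⟦ a ⟧₂ R.≈ ⟦ b ⟧₂)
  coeff≟ true true = just R.refl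
  coeff≟ false false = just R.refl
  coeff≟ _ _ = nothing

 open Algebra.Solver.Ring 𝔽₂(fromCommutativeRing R) morphism coeff≟ public using (solve; _:=_; _:+_; _:*_; con)

 x+x≈0 : ∀ x → (x R.+ x) R.≈ R.0#
 x+x≈0 = solve 1(λ x → x :+ x := con false) R.refl

 +≈0⇒≈ : ∀ {x y} → (x R.+ y) R.≈ R.0# → x R.≈ y
 +≈0⇒≈ {x} {y} e = R.trans(solve 2(λ x y → x := (x :+ y) :+ y) R.refl x y)(R.trans(R.+-congʳ e)(R.+-identityˡ y))

 ≈⇒+≈0 : ∀ {x y} → x R.≈ y → (x R.+ y) R.≈ R.0#
 ≈⇒+≈0 {x} {y} e = R.trans(R.+-congʳ e)(x+x≈0 y)

-- A bijection of a list without repetitions onto itself only reorders it. Applied to a translation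
-- it gives q · 1 = 0, applied to a multiplication it gives Fermat's theorem.
permutation-↭ : {xs : List 𝑋} → Unique xs → (f g : 𝑋 → 𝑋) → (∀ {x} → x ∈ xs → f x ∈ xs) → (∀ {x} → x ∈ xs → g x ∈ xs) →
 (∀ x → g(f x) ≡ x) → (∀ {x} → x ∈ xs → f(g x) ≡ x) → map f xs ↭ xs
permutation-↭ {xs = xs} u f g f∈ g∈ gf fg = ∼bag⇒↭(unique∧set⇒bag
 (UniqueP.map⁺(λ {x} {y} e → sym(gf x) ∙ cong g e ∙ gf y) u) u
 (mk⇔(λ i → let (y , j , e) = ∈-map⁻ f i in subst(_∈ xs)(sym e)(f∈ j))
    λ i → subst(_∈ map f xs)(fg i)(∈-map⁺ f(g∈ i))))

-- Arithmetic of the field: characteristic 2, Fermat, Frobenius, trace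

record FieldData : Set₁ where
 field
  r : ℕ
  r≥1 : 1 ≤ r
  𝔽 : FiniteField
  size≡ : FiniteField.size 𝔽 ≡ 2 ** r
  κ : FiniteField.Carrier 𝔽
  irreducible : Irreducible 𝔽 κ

module FieldArithmetic (𝒟 : FieldData) where
 open FieldData 𝒟 public
 open FiniteField 𝔽 public using (0#; 1#; _⁻¹; 0≢1; ⁻¹-inverse; elements-complete; elements-unique; isCommutativeRing)
  renaming (Carrier to Fq; elements to Fs; _≟_ to infix 4 _≟_; _+_ to infixl 6 _⊕_; _*_ to infixl 7 _⊙_; -_ to ⊖_)
 open Setup 𝔽 r κ public renaming (nonzeros to F*; allMats to Mats)
 open IsCommutativeRing isCommutativeRing public using ()
  renaming (+-comm to ⊕-comm; +-assoc to ⊕-assoc; +-identityˡ to ⊕-idˡ; +-identityʳ to ⊕-idʳ; *-comm to ⊙-comm; *-assoc to ⊙-assoc;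
   *-identityˡ to ⊙-idˡ; *-identityʳ to ⊙-idʳ; zeroˡ to ⊙-0ˡ; zeroʳ to ⊙-0ʳ; distribˡ to ⊙-distribˡ; distribʳ to ⊙-distribʳ;
   +-isCommutativeMonoid to ⊕-isCommutativeMonoid; *-isCommutativeMonoid to ⊙-isCommutativeMonoid)

 commutativeRing : CommutativeRing _ _
 commutativeRing = record { isCommutativeRing = isCommutativeRing }

 ⊙-nonzeroʳ : ∀ {x y} → x ≢ 0# → x ⊙ y ≡ 0# → y ≡ 0#
 ⊙-nonzeroʳ {x} {y} nz e = begin
  y ≡⟨ sym(⊙-idˡ y) ⟩
  1# ⊙ y ≡⟨ cong(_⊙ y)(sym(⁻¹-inverse x nz) ∙ ⊙-comm x(x ⁻¹)) ⟩
  x ⁻¹ ⊙ x ⊙ y ≡⟨ ⊙-assoc(x ⁻¹) x y ⟩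
  x ⁻¹ ⊙ (x ⊙ y) ≡⟨ cong(x ⁻¹ ⊙_) e ∙ ⊙-0ʳ(x ⁻¹) ⟩
  _ ∎

 ⊙-≢0 : ∀ {x y} → x ≢ 0# → y ≢ 0# → x ⊙ y ≢ 0#
 ⊙-≢0 nx ny e = ny(⊙-nonzeroʳ nx e)

 ^F-≡0 : ∀ {x} n → x ^F n ≡ 0# → x ≡ 0#
 ^F-≡0 zero e = ⊥-elim(0≢1(sym e))
 ^F-≡0 {x} (suc n) e with x ≟ 0#
 ... | yes x≡0 = x≡0
 ... | no nz = ^F-≡0 n(⊙-nonzeroʳ nz e)

 ^F-+ : ∀ x a b → x ^F (a ∔ b) ≡ x ^F a ⊙ x ^F b
 ^F-+ x zero b = sym(⊙-idˡ _)
 ^F-+ x(suc a) b = cong(x ⊙_)(^F-+ x a b) ∙ sym(⊙-assoc x _ _)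

 -- Translation by 1 permutes 𝔽, so q · 1 = 0; as q is a power of 2 this forces 1 + 1 = 0.
 2≡0 : 1# ⊕ 1# ≡ 0#
 2≡0 = ^F-≡0 r(sym(2^-· r) ∙ cong(_·F 1#)(sym size≡) ∙ q·1≡0)
  where
  translate : ∀ xs → sumF(map(1# ⊕_) xs) ≡ sumF xs ⊕ (length xs ·F 1#)
  translate [] = sym(⊕-idˡ 0#)
  translate(x ∷ xs) = begin
   _ ≡⟨ cong₂ _⊕_ (⊕-comm 1# x)(translate xs) ⟩
   (x ⊕ 1#) ⊕ (sumF xs ⊕ (length xs ·F 1#)) ≡⟨ ⊕-assoc x 1# _ ⟩
   x ⊕ (1# ⊕ (sumF xs ⊕ (length xs ·F 1#))) ≡⟨ cong(x ⊕_)(sym(⊕-assoc 1# _ _) ∙ cong(_⊕ (length xs ·F 1#))(⊕-comm 1# _) ∙ ⊕-assoc _ 1# _) ⟩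
   x ⊕ (sumF xs ⊕ (1# ⊕ (length xs ·F 1#))) ≡⟨ sym(⊕-assoc x _ _) ⟩
   _ ∎
  neg1 : ∀ x → (⊖ 1#) ⊕ (1# ⊕ x) ≡ x
  neg1 x = sym(⊕-assoc(⊖ 1#) 1# x) ∙ cong(_⊕ x)(IsCommutativeRing.-‿inverseˡ isCommutativeRing 1#) ∙ ⊕-idˡ x
  1neg : ∀ x → 1# ⊕ ((⊖ 1#) ⊕ x) ≡ x
  1neg x = sym(⊕-assoc 1#(⊖ 1#) x) ∙ cong(_⊕ x)(IsCommutativeRing.-‿inverseʳ isCommutativeRing 1#) ∙ ⊕-idˡ x
  q·1≡0 : q ·F 1# ≡ 0#
  q·1≡0 = RingProperties.+-identityʳ-unique(CommutativeRing.ring commutativeRing)(sumF Fs)(q ·F 1#)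
   (sym(translate Fs) ∙ foldr-commMonoid(setoid Fq) ⊕-isCommutativeMonoid
    (↭⇒↭ₛ(permutation-↭ elements-unique(1# ⊕_)((⊖ 1#) ⊕_)(λ _ → elements-complete _)(λ _ → elements-complete _) neg1 λ {x} _ → 1neg x)))
  ·F-+ : ∀ a b → (a ∔ b) ·F 1# ≡ (a ·F 1#) ⊕ (b ·F 1#)
  ·F-+ zero b = sym(⊕-idˡ _)
  ·F-+(suc a) b = cong(1# ⊕_)(·F-+ a b) ∙ sym(⊕-assoc 1# _ _)
  2^-· : ∀ k → (2 ** k) ·F 1# ≡ (1# ⊕ 1#) ^F k
  2^-· zero = ⊕-idʳ 1#
  2^-·(suc k) = begin
   _ ≡⟨ cong(λ z → (2 ** k ∔ z) ·F 1#)(N.+-identityʳ(2 ** k)) ⟩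
   (2 ** k ∔ 2 ** k) ·F 1# ≡⟨ ·F-+(2 ** k)(2 ** k) ⟩
   ((2 ** k) ·F 1#) ⊕ ((2 ** k) ·F 1#) ≡⟨ cong₂ _⊕_ (2^-· k)(2^-· k) ⟩
   p ⊕ p ≡⟨ sym(cong₂ _⊕_ (⊙-idˡ p)(⊙-idˡ p)) ⟩
   1# ⊙ p ⊕ 1# ⊙ p ≡⟨ sym(⊙-distribʳ p 1# 1#) ⟩
   _ ∎
   where p = (1# ⊕ 1#) ^F k

 open Char2Solver commutativeRing 2≡0 public renaming (x+x≈0 to x⊕x≡0; +≈0⇒≈ to ⊕≡0⇒≡; ≈⇒+≈0 to ≡⇒⊕≡0)

 ⊕-cancel : ∀ x y → x ⊕ y ⊕ y ≡ x
 ⊕-cancel = solve 2(λ x y → x :+ y :+ y := x) refl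

 ⊕-shift : ∀ {x y z} → x ⊕ y ≡ z → x ≡ z ⊕ y
 ⊕-shift {x} {y} e = sym(⊕-cancel x y) ∙ cong(_⊕ y) e

 ⁻¹-inverseˡ : ∀ {x} → x ≢ 0# → x ⁻¹ ⊙ x ≡ 1#
 ⁻¹-inverseˡ {x} nz = ⊙-comm(x ⁻¹) x ∙ ⁻¹-inverse x nz

 ⊙-cancelˡ : ∀ {x y z} → x ≢ 0# → x ⊙ y ≡ x ⊙ z → y ≡ z
 ⊙-cancelˡ {x} {y} {z} nz e = ⊕≡0⇒≡(⊙-nonzeroʳ nz(⊙-distribˡ x y z ∙ ≡⇒⊕≡0 e))

 ⁻¹-unique : ∀ {x y} → x ⊙ y ≡ 1# → x ⁻¹ ≡ y
 ⁻¹-unique {x} {y} e = ⊙-cancelˡ nz(⁻¹-inverse x nz ∙ sym e)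
  where
  nz : x ≢ 0#
  nz refl = 0≢1(sym(⊙-0ˡ y) ∙ e)

 1⊙⇒≢0 : ∀ {x y} → x ⊙ y ≡ 1# → x ≢ 0#
 1⊙⇒≢0 {x} {y} e refl = 0≢1(sym(⊙-0ˡ y) ∙ e)

 ⁻¹-≢0 : ∀ {x} → x ≢ 0# → x ⁻¹ ≢ 0#
 ⁻¹-≢0 nz = 1⊙⇒≢0(⁻¹-inverseˡ nz)

 ⁻¹-involutive : ∀ {x} → x ≢ 0# → (x ⁻¹) ⁻¹ ≡ x
 ⁻¹-involutive nz = ⁻¹-unique(⁻¹-inverseˡ nz)

 ⁻¹-⊙ : ∀ {x y} → x ≢ 0# → y ≢ 0# → (x ⊙ y) ⁻¹ ≡ x ⁻¹ ⊙ y ⁻¹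
 ⁻¹-⊙ {x} {y} nx ny = ⁻¹-unique(begin
  _ ≡⟨ solve 4(λ x y x' y' → x :* y :* (x' :* y') := (x :* x') :* (y :* y')) refl x y(x ⁻¹)(y ⁻¹) ⟩
  (x ⊙ x ⁻¹) ⊙ (y ⊙ y ⁻¹) ≡⟨ cong₂ _⊙_ (⁻¹-inverse x nx)(⁻¹-inverse y ny) ⟩
  1# ⊙ 1# ≡⟨ ⊙-idˡ 1# ⟩
  _ ∎)

 ==⇒≡ : ∀ {x y} → T(x == y) → x ≡ y
 ==⇒≡ {x} {y} = toWitness {a? = x ≟ y}

 ≡⇒== : ∀ {x y} → x ≡ y → T(x == y)
 ≡⇒== {x} {y} = fromWitness {a? = x ≟ y}

 ≢⇒not== : ∀ {x y} → x ≢ y → T(not(x == y))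
 ≢⇒not== {x} {y} ne with x ≟ y
 ... | yes e = ne e
 ... | no _ = tt

 not==⇒≢ : ∀ {x y} → T(not(x == y)) → x ≢ y
 not==⇒≢ {x} {y} t with x ≟ y
 ... | no ne = ne

 ∈nonzeros⁺ : ∀ {x} → x ≢ 0# → x ∈ F*
 ∈nonzeros⁺ {x} nz = ∈-filter⁺(λ x → T?(not(x == 0#)))(elements-complete x)(≢⇒not== nz)

 ∈nonzeros⁻ : ∀ {x} → x ∈ F* → x ≢ 0#
 ∈nonzeros⁻ {x} i = not==⇒≢(proj₂(∈-filter⁻(λ x → T?(not(x == 0#))) {xs = Fs} i))

 nonzeros-unique : Unique F*
 nonzeros-unique = UniqueP.filter⁺(λ x → T?(not(x == 0#))) elements-unique

 𝔽ˢ : FS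
 𝔽ˢ = record
  { Carrier = Fq ; _≈_ = _≡_ ; ≈-refl = refl ; ≈-sym = sym ; ≈-trans = trans ; _≈?_ = _≟_
  ; enum = Fs ; ∑-δ = λ x → ∑-unique _≟_ Fs elements-unique x(elements-complete x) }

 Q : ℤ
 Q = pos q

 ∑1≡q : ∑ Fs(λ _ → 1ℤ) ≡ Q
 ∑1≡q = ∑-length Fs

 nonzero? : ∀ x → Dec(x ≢ 0#)
 nonzero? x = ¬? (x ≟ 0#)

 ∑-nonzeros : (f : Fq → ℤ) → ∑ F* f ≡ ∑ Fs(λ x → χ(nonzero? x) * f x)
 ∑-nonzeros f = ∑-filterᵇ(λ x → not(x == 0#)) Fs f ∙
  ∑-cong Fs(λ x → cong(_* f x)(χ-⇔(T?(not(x == 0#)))(nonzero? x) not==⇒≢ ≢⇒not==))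

 ∑-split₀ : (f : Fq → ℤ) → ∑ Fs f ≡ f 0# + ∑ F* f
 ∑-split₀ f = begin
  _ ≡⟨ ∑-cong Fs(λ x → sym(lemma(x ≟ 0#)(f x))) ⟩
  ∑ Fs(λ x → χ(x ≟ 0#) * f x + χ(nonzero? x) * f x) ≡⟨ ∑-+ Fs _ _ ⟩
  ∑ Fs(λ x → χ(x ≟ 0#) * f x) + ∑ Fs(λ x → χ(nonzero? x) * f x) ≡⟨ cong₂ _+_ (∑-sift 𝔽ˢ 0#(cong f))(sym(∑-nonzeros f)) ⟩
  _ ∎
  where
  lemma : {P : Set} (p : Dec P)(z : ℤ) → χ p * z + χ(¬? p) * z ≡ z
  lemma(yes _) z = cong₂ _+_ (Z.*-identityˡ z)(Z.*-zeroˡ z) ∙ Z.+-identityʳ z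
  lemma(no _) z = cong₂ _+_ (Z.*-zeroˡ z)(Z.*-identityˡ z) ∙ Z.+-identityˡ z

 length-nonzeros : suc(length F*) ≡ q
 length-nonzeros = Z.+-injective(cong(ℤ._+_ 1ℤ)(sym(∑-length F*)) ∙ sym(∑-split₀ λ _ → 1ℤ) ∙ ∑1≡q)

 ∑-nz-reindex : {f g : Fq → ℤ} (to from : Fq → Fq) → (∀ {x} → x ≢ 0# → to x ≢ 0# × from(to x) ≡ x × f x ≡ g(to x)) →
  (∀ {x} → x ≢ 0# → from x ≢ 0# × to (from x) ≡ x) → ∑ F* f ≡ ∑ F* g
 ∑-nz-reindex {f} {g} to from h k = ∑-nonzeros f ∙ ∑-bij 𝔽ˢ 𝔽ˢ nonzero? nonzero? to from
  (λ { nz refl → let (a , b , c) = h nz in a , sym b , c })(λ { nz refl → let (a , b) = k nz in a , sym b }) ∙ sym(∑-nonzeros g)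

 ∑-nz-cong : {f g : Fq → ℤ} → (∀ x → x ≢ 0# → f x ≡ g x) → ∑ F* f ≡ ∑ F* g
 ∑-nz-cong e = ∑-cong∈ F*(λ x i → e x(∈nonzeros⁻ i))

 -- For x ≠ 0, multiplication by x permutes the nonzero elements. Their product is nonzero and can
 -- be cancelled, which leaves x^(q-1) = 1.
 fermat : ∀ x → x ^F q ≡ x
 fermat x with x ≟ 0#
 ... | yes refl = cong(0# ^F_)(sym length-nonzeros) ∙ ⊙-0ˡ _
 ... | no nz = cong(x ^F_)(sym length-nonzeros) ∙ cong(x ⊙_) x^≡1 ∙ ⊙-idʳ x
  where
  Π : List Fq → Fq
  Π = foldr _⊙_ 1#
  scale : ∀ xs → Π(map(x ⊙_) xs) ≡ x ^F length xs ⊙ Π xs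
  scale [] = sym(⊙-idˡ 1#)
  scale(y ∷ ys) = cong(x ⊙ y ⊙_)(scale ys) ∙
   solve 4(λ x y p π → x :* y :* (p :* π) := x :* p :* (y :* π)) refl x y(x ^F length ys)(Π ys)
  Π≢0 : ∀ xs → All(_≢ 0#) xs → Π xs ≢ 0#
  Π≢0 [] [] e = 0≢1(sym e)
  Π≢0(y ∷ ys)(ny ∷ a) = ⊙-≢0 ny(Π≢0 ys a)
  invˡ : ∀ y → x ⁻¹ ⊙ (x ⊙ y) ≡ y
  invˡ y = sym(⊙-assoc(x ⁻¹) x y) ∙ cong(_⊙ y)(⁻¹-inverseˡ nz) ∙ ⊙-idˡ y
  invʳ : ∀ y → x ⊙ (x ⁻¹ ⊙ y) ≡ y
  invʳ y = sym(⊙-assoc x(x ⁻¹) y) ∙ cong(_⊙ y)(⁻¹-inverse x nz) ∙ ⊙-idˡ y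
  p : map(x ⊙_) F* ↭ F*
  p = permutation-↭ nonzeros-unique(x ⊙_)(x ⁻¹ ⊙_)(λ i → ∈nonzeros⁺(⊙-≢0 nz(∈nonzeros⁻ i)))
   (λ i → ∈nonzeros⁺(⊙-≢0(⁻¹-≢0 nz)(∈nonzeros⁻ i))) invˡ(λ {y} _ → invʳ y)
  x^≡1 : x ^F length F* ≡ 1#
  x^≡1 = ⊙-cancelˡ(Π≢0 F*(All.tabulate ∈nonzeros⁻))(⊙-comm(Π F*) _ ∙ sym(scale F*) ∙
   foldr-commMonoid(setoid Fq) ⊙-isCommutativeMonoid(↭⇒↭ₛ p) ∙ sym(⊙-idʳ _))

 sq : Fq → Fq
 sq x = x ⊙ x

 sq-⊕ : ∀ x y → sq(x ⊕ y) ≡ sq x ⊕ sq y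
 sq-⊕ = solve 2(λ x y → (x :+ y) :* (x :+ y) := x :* x :+ y :* y) refl

 sq-⊙ : ∀ x y → sq(x ⊙ y) ≡ sq x ⊙ sq y
 sq-⊙ = solve 2(λ x y → (x :* y) :* (x :* y) := x :* x :* (y :* y)) refl

 sq-injective : ∀ {x y} → sq x ≡ sq y → x ≡ y
 sq-injective {x} {y} e = ⊕≡0⇒≡(^F-≡0 2(cong((x ⊕ y) ⊙_)(⊙-idʳ _) ∙ sq-⊕ x y ∙ ≡⇒⊕≡0 e))

 ^F-2* : ∀ x n → x ^F (2 · n) ≡ sq(x ^F n)
 ^F-2* x n = cong(x ^F_)(cong(n ∔_)(N.+-identityʳ n)) ∙ ^F-+ x n n

 ^F-sq : ∀ x n → sq x ^F n ≡ sq(x ^F n)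
 ^F-sq x zero = sym(⊙-idˡ 1#)
 ^F-sq x(suc n) = cong(sq x ⊙_)(^F-sq x n) ∙ sym(sq-⊙ x _)

 -- The inverse of the Frobenius map: q/2 = 2^(r-1), and x^q = x.
 √ : Fq → Fq
 √ x = x ^F (2 ** ℕ.pred r)

 q≡2*2^ : q ≡ 2 · 2 ** ℕ.pred r
 q≡2*2^ = size≡ ∙ lemma r≥1
  where
  lemma : ∀ {r} → 1 ≤ r → 2 ** r ≡ 2 · 2 ** ℕ.pred r
  lemma(s≤s z≤n) = refl

 sq-√ : ∀ x → sq(√ x) ≡ x
 sq-√ x = sym(^F-2* x(2 ** ℕ.pred r)) ∙ cong(x ^F_)(sym q≡2*2^) ∙ fermat x

 √-sq : ∀ x → √(sq x) ≡ x
 √-sq x = sq-injective(sq-√(sq x))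

 √-≢0 : ∀ {x} → x ≢ 0# → √ x ≢ 0#
 √-≢0 {x} nz e = nz(sym(sq-√ x) ∙ cong sq e ∙ ⊙-0ˡ 0#)

 ^2^-⊕ : ∀ k x y → (x ⊕ y) ^F (2 ** k) ≡ x ^F (2 ** k) ⊕ y ^F (2 ** k)
 ^2^-⊕ zero x y = ⊙-idʳ _ ∙ sym(cong₂ _⊕_ (⊙-idʳ x)(⊙-idʳ y))
 ^2^-⊕(suc k) x y = ^F-2*(x ⊕ y)(2 ** k) ∙ cong sq(^2^-⊕ k x y) ∙ sq-⊕ _ _ ∙
  sym(cong₂ _⊕_ (^F-2* x(2 ** k))(^F-2* y(2 ** k)))

 trace : ℕ → Fq → Fq
 trace n x = sumF(map(λ k → x ^F (2 ** k))(upTo n))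

 trace-suc : ∀ n x → trace(suc n) x ≡ trace n x ⊕ x ^F (2 ** n)
 trace-suc n x = cong(λ l → sumF(map(λ k → x ^F (2 ** k)) l))(sym(ListP.upTo-∷ʳ n)) ∙ snoc(upTo n)
  where
  f = λ k → x ^F (2 ** k)
  snoc : ∀ l → sumF(map f(l ++ n ∷ [])) ≡ sumF(map f l) ⊕ f n
  snoc [] = ⊕-idʳ _ ∙ sym(⊕-idˡ _)
  snoc(y ∷ l) = cong(f y ⊕_)(snoc l) ∙ sym(⊕-assoc(f y) _ (f n))

 trace-⊕ : ∀ n x y → trace n(x ⊕ y) ≡ trace n x ⊕ trace n y
 trace-⊕ zero x y = sym(⊕-idˡ 0#)
 trace-⊕(suc n) x y = trace-suc n(x ⊕ y) ∙ cong₂ _⊕_ (trace-⊕ n x y)(^2^-⊕ n x y) ∙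
  solve 4(λ a b c d → (a :+ b) :+ (c :+ d) := (a :+ c) :+ (b :+ d)) refl(trace n x)(trace n y) _ _ ∙
   sym(cong₂ _⊕_ (trace-suc n x)(trace-suc n y))

 sq-trace : ∀ n x → sq(trace n x) ≡ trace n(sq x)
 sq-trace zero x = ⊙-0ˡ 0#
 sq-trace(suc n) x = cong sq(trace-suc n x) ∙ sq-⊕ _ _ ∙
  cong₂ _⊕_ (sq-trace n x)(sym(^F-sq x(2 ** n))) ∙ sym(trace-suc n(sq x))

 -- Squaring shifts the summation index by one, so only the end terms differ. For n = r they agree
 -- by Fermat's theorem. Hence tr(x²) = tr(x), and the trace is idempotent, with values 0 and 1.
 trace-telescope : ∀ n x → trace n(sq x) ⊕ x ≡ trace n x ⊕ x ^F (2 ** n)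
 trace-telescope zero x = cong(0# ⊕_)(sym(⊙-idʳ x))
 trace-telescope(suc n) x = begin
  _ ≡⟨ cong(_⊕ x)(trace-suc n(sq x)) ⟩
  trace n(sq x) ⊕ sq x ^F (2 ** n) ⊕ x ≡⟨ solve 3(λ a b c → a :+ b :+ c := a :+ c :+ b) refl _ _ x ⟩
  trace n(sq x) ⊕ x ⊕ sq x ^F (2 ** n) ≡⟨ cong₂ _⊕_ (trace-telescope n x ∙ sym(trace-suc n x))(^F-sq x(2 ** n) ∙ sym(^F-2* x(2 ** n))) ⟩
  _ ∎

 tr-⊕ : ∀ x y → tr(x ⊕ y) ≡ tr x ⊕ tr y
 tr-⊕ = trace-⊕ r

 tr-sq : ∀ x → tr(sq x) ≡ tr x
 tr-sq x = ⊕≡0⇒≡(begin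
  _ ≡⟨ solve 3(λ a b x → a :+ b := (a :+ x) :+ (b :+ x)) refl(tr(sq x))(tr x) x ⟩
  (tr(sq x) ⊕ x) ⊕ (tr x ⊕ x) ≡⟨ ≡⇒⊕≡0(trace-telescope r x ∙ cong(tr x ⊕_)(cong(x ^F_)(sym size≡) ∙ fermat x)) ⟩
  _ ∎)

 tr-01 : ∀ x → tr x ≡ 0# ⊎ tr x ≡ 1#
 tr-01 x with tr x ≟ 0#
 ... | yes e = inj₁ e
 ... | no nz = inj₂(⊙-cancelˡ nz(sq-trace r x ∙ tr-sq x ∙ sym(⊙-idʳ _)))

 tr-0 : tr 0# ≡ 0#
 tr-0 = sym(cong tr(⊕-idˡ 0#)) ∙ tr-⊕ 0# 0# ∙ x⊕x≡0(tr 0#)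

 λ-1 : ∀ {x} → tr x ≡ 0# → λ' x ≡ 1ℤ
 λ-1 {x} e with tr x ≟ 0#
 ... | yes _ = refl
 ... | no ne = contradiction e ne

 λ--1 : ∀ {x} → tr x ≡ 1# → λ' x ≡ -1ℤ
 λ--1 {x} e with tr x ≟ 0#
 ... | yes e' = contradiction(sym e' ∙ e) 0≢1
 ... | no _ = refl

 λ-⊕ : ∀ x y → λ'(x ⊕ y) ≡ λ' x * λ' y
 λ-⊕ x y with tr-01 x | tr-01 y
 ... | inj₁ a | inj₁ b = λ-1(tr-⊕ x y ∙ cong₂ _⊕_ a b ∙ ⊕-idˡ 0#) ∙ sym(cong₂ _*_ (λ-1 a)(λ-1 b))
 ... | inj₁ a | inj₂ b = λ--1(tr-⊕ x y ∙ cong₂ _⊕_ a b ∙ ⊕-idˡ 1#) ∙ sym(cong₂ _*_ (λ-1 a)(λ--1 b))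
 ... | inj₂ a | inj₁ b = λ--1(tr-⊕ x y ∙ cong₂ _⊕_ a b ∙ ⊕-idʳ 1#) ∙ sym(cong₂ _*_ (λ--1 a)(λ-1 b))
 ... | inj₂ a | inj₂ b = λ-1(tr-⊕ x y ∙ cong₂ _⊕_ a b ∙ 2≡0) ∙ sym(cong₂ _*_ (λ--1 a)(λ--1 b))

 λ-0 : λ' 0# ≡ 1ℤ
 λ-0 = λ-1 tr-0

 λ-sq : ∀ x → λ'(sq x) ≡ λ' x
 λ-sq x = cong(λ t → if t == 0# then 1ℤ else -1ℤ)(tr-sq x)

-- Polynomials over the field: degree bounds, evaluation, roots

module Polynomials (𝒟 : FieldData) where
 open FieldArithmetic 𝒟

 Series : Set
 Series = ℕ → Fq

 tail : Series → Series
 tail f n = f(suc n)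

 infixl 7 _·ₛ_
 _·ₛ_ : Series → Series → Series
 (f ·ₛ g) zero = f 0 ⊙ g 0
 (f ·ₛ g)(suc n) = f 0 ⊙ g(suc n) ⊕ (tail f ·ₛ g) n

 infix 4 _≗ₛ_
 _≗ₛ_ : Series → Series → Set
 f ≗ₛ g = ∀ n → f n ≡ g n

 ·ₛ-cong : ∀ {f f' g g'} → f ≗ₛ f' → g ≗ₛ g' → f ·ₛ g ≗ₛ f' ·ₛ g'
 ·ₛ-cong e e' zero = cong₂ _⊙_ (e 0)(e' 0)
 ·ₛ-cong e e'(suc n) = cong₂ _⊕_ (cong₂ _⊙_ (e 0)(e'(suc n)))(·ₛ-cong(e ∘ suc) e' n)

 ·ₛ-distribʳ : ∀ f g h → (λ n → f n ⊕ g n) ·ₛ h ≗ₛ λ n → (f ·ₛ h) n ⊕ (g ·ₛ h) n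
 ·ₛ-distribʳ f g h zero = ⊙-distribʳ(h 0)(f 0)(g 0)
 ·ₛ-distribʳ f g h(suc n) = cong((f 0 ⊕ g 0) ⊙ h(suc n) ⊕_)(·ₛ-distribʳ(tail f)(tail g) h n) ∙
  solve 5(λ a b c d e → (a :+ b) :* c :+ (d :+ e) := (a :* c :+ d) :+ (b :* c :+ e)) refl(f 0)(g 0)(h(suc n)) _ _

 ·ₛ-scale : ∀ c f g → (λ n → c ⊙ f n) ·ₛ g ≗ₛ λ n → c ⊙ (f ·ₛ g) n
 ·ₛ-scale c f g zero = ⊙-assoc c(f 0)(g 0)
 ·ₛ-scale c f g(suc n) = cong(c ⊙ f 0 ⊙ g(suc n) ⊕_)(·ₛ-scale c(tail f) g n) ∙
  solve 4(λ c f g e → c :* f :* g :+ c :* e := c :* (f :* g :+ e)) refl c(f 0)(g(suc n)) _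

 ·ₛ-zeroˡ : ∀ {f} g → (∀ n → f n ≡ 0#) → ∀ n → (f ·ₛ g) n ≡ 0#
 ·ₛ-zeroˡ g e zero = cong(_⊙ g 0)(e 0) ∙ ⊙-0ˡ(g 0)
 ·ₛ-zeroˡ g e(suc n) = cong₂ _⊕_ (cong(_⊙ g(suc n))(e 0) ∙ ⊙-0ˡ _)(·ₛ-zeroˡ g(e ∘ suc) n) ∙ ⊕-idˡ 0#

 ·ₛ-suc : ∀ f g n → (f ·ₛ g)(suc n) ≡ (f ·ₛ tail g) n ⊕ f(suc n) ⊙ g 0
 ·ₛ-suc f g zero = refl
 ·ₛ-suc f g(suc n) = cong(f 0 ⊙ g(suc(suc n)) ⊕_)(·ₛ-suc(tail f) g n) ∙ sym(⊕-assoc _ _ _)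

 ·ₛ-comm : ∀ f g → f ·ₛ g ≗ₛ g ·ₛ f
 ·ₛ-comm f g zero = ⊙-comm(f 0)(g 0)
 ·ₛ-comm f g(suc n) = ·ₛ-suc f g n ∙ cong₂ _⊕_ (·ₛ-comm f(tail g) n)(⊙-comm(f(suc n))(g 0)) ∙ ⊕-comm _ _

 ·ₛ-assoc : ∀ f g h → (f ·ₛ g) ·ₛ h ≗ₛ f ·ₛ (g ·ₛ h)
 ·ₛ-assoc f g h zero = ⊙-assoc(f 0)(g 0)(h 0)
 ·ₛ-assoc f g h(suc n) = cong(f 0 ⊙ g 0 ⊙ h(suc n) ⊕_)(·ₛ-distribʳ(λ k → f 0 ⊙ g(suc k))(tail f ·ₛ g) h n ∙
   cong₂ _⊕_ (·ₛ-scale(f 0)(tail g) h n)(·ₛ-assoc(tail f) g h n)) ∙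
  solve 5(λ f g h e k → f :* g :* h :+ (f :* e :+ k) := f :* (g :* h :+ e) :+ k) refl(f 0)(g 0)(h(suc n)) _ _

 1ₛ : Series
 1ₛ zero = 1#
 1ₛ(suc _) = 0#

 ·ₛ-identityˡ : ∀ f → 1ₛ ·ₛ f ≗ₛ f
 ·ₛ-identityˡ f zero = ⊙-idˡ(f 0)
 ·ₛ-identityˡ f(suc n) = cong₂ _⊕_ (⊙-idˡ _)(·ₛ-zeroˡ f(λ _ → refl) n) ∙ ⊕-idʳ _

 Deg≤ : Series → ℕ → Set
 Deg≤ f n = ∀ k → n < k → f k ≡ 0#

 Deg≤-mono : ∀ {f m n} → m ≤ n → Deg≤ f m → Deg≤ f n
 Deg≤-mono le d k lt = d k(N.≤-<-trans le lt)

 Deg≤-⊕ : ∀ {f g n} → Deg≤ f n → Deg≤ g n → Deg≤(λ k → f k ⊕ g k) n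
 Deg≤-⊕ d e k lt = cong₂ _⊕_ (d k lt)(e k lt) ∙ ⊕-idˡ 0#

 Deg≤-· : ∀ {f g} a b → Deg≤ f a → Deg≤ g b → Deg≤(f ·ₛ g)(a ∔ b)
 Deg≤-· {f} {g} zero b d e(suc k) lt = cong₂ _⊕_ (cong(f 0 ⊙_)(e(suc k) lt) ∙ ⊙-0ʳ _)
  (·ₛ-zeroˡ g(λ n → d(suc n)(s≤s z≤n)) k) ∙ ⊕-idˡ 0#
 Deg≤-· {f} {g} (suc a) b d e(suc k)(s≤s lt) = cong₂ _⊕_ (cong(f 0 ⊙_)
   (e(suc k)(N.≤-trans(N.≤-trans(s≤s(N.m≤n+m b a)) lt)(N.n≤1+n k))) ∙ ⊙-0ʳ _)
  (Deg≤-· a b(λ j l → d(suc j)(s≤s l)) e k lt) ∙ ⊕-idˡ 0#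

 top-· : ∀ {f g} a b → Deg≤ f a → Deg≤ g b → (f ·ₛ g)(a ∔ b) ≡ f a ⊙ g b
 top-· zero zero d e = refl
 top-· {f} {g} zero(suc b) d e = cong(f 0 ⊙ g(suc b) ⊕_)(·ₛ-zeroˡ g(λ n → d(suc n)(s≤s z≤n)) b) ∙ ⊕-idʳ _
 top-· {f} {g} (suc a) b d e = cong₂ _⊕_ (cong(f 0 ⊙_)(e(suc a ∔ b)(s≤s(N.m≤n+m b a))) ∙ ⊙-0ʳ _)
  (top-· a b(λ j l → d(suc j)(s≤s l)) e) ∙ ⊕-idˡ _

 -- `bound` is some bound for the degree, not the degree, so that the ring operations never have to
 -- test a coefficient for zero. Equality compares coefficients alone, and two polynomials with
 -- different bounds can be equal.
 record Poly : Set where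
  no-eta-equality
  constructor poly
  field
   coef : Series
   bound : ℕ
   bounded : Deg≤ coef bound
 open Poly public

 infix 4 _≈ₚ_
 record _≈ₚ_ (f g : Poly) : Set where
  constructor coefs
  field coef≡ : coef f ≗ₛ coef g
 open _≈ₚ_ public

 infixl 6 _+ₚ_
 infixl 7 _*ₚ_
 _+ₚ_ _*ₚ_ : Poly → Poly → Poly
 coef(f +ₚ g) n = coef f n ⊕ coef g n
 bound(f +ₚ g) = bound f ⊔ bound g
 bounded(f +ₚ g) = Deg≤-⊕ {coef f} {coef g} (Deg≤-mono {coef f} (N.m≤m⊔n(bound f)(bound g))(bounded f))
  (Deg≤-mono {coef g} (N.m≤n⊔m(bound f)(bound g))(bounded g))
 coef(f *ₚ g) = coef f ·ₛ coef g
 bound(f *ₚ g) = bound f ∔ bound g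
 bounded(f *ₚ g) = Deg≤-·(bound f)(bound g)(bounded f)(bounded g)

 monoₛ : Fq → ℕ → Series
 monoₛ c zero zero = c
 monoₛ c zero(suc n) = 0#
 monoₛ c(suc k) zero = 0#
 monoₛ c(suc k)(suc n) = monoₛ c k n

 monoₛ-Deg≤ : ∀ c k → Deg≤(monoₛ c k) k
 monoₛ-Deg≤ c zero(suc n) _ = refl
 monoₛ-Deg≤ c(suc k)(suc n)(s≤s lt) = monoₛ-Deg≤ c k n lt

 monoₛ-top : ∀ c k → monoₛ c k k ≡ c
 monoₛ-top c zero = refl
 monoₛ-top c(suc k) = monoₛ-top c k

 mono : Fq → ℕ → Poly
 coef(mono c k) = monoₛ c k
 bound(mono c k) = k
 bounded(mono c k) = monoₛ-Deg≤ c k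

 0ₚ 1ₚ : Poly
 coef 0ₚ _ = 0#
 bound 0ₚ = 0
 bounded 0ₚ _ _ = refl
 coef 1ₚ = 1ₛ
 bound 1ₚ = 0
 bounded 1ₚ(suc k) _ = refl

 polyRing : CommutativeRing _ _
 polyRing = record
  { Carrier = Poly ; _≈_ = _≈ₚ_ ; _+_ = _+ₚ_ ; _*_ = _*ₚ_ ; -_ = id ; 0# = 0ₚ ; 1# = 1ₚ
  ; isCommutativeRing = record
   { isRing = record
    { +-isAbelianGroup = record
     { isGroup = record
      { isMonoid = record
       { isSemigroup = record
        { isMagma = record { isEquivalence = record { refl = coefs(λ _ → refl) ; sym = λ e → coefs(λ n → sym(coef≡ e n)) ; trans = λ e e' → coefs(λ n → coef≡ e n ∙ coef≡ e' n) }
                  ; ∙-cong = λ e e' → coefs(λ n → cong₂ _⊕_ (coef≡ e n)(coef≡ e' n)) }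
        ; assoc = λ f g h → coefs(λ n → ⊕-assoc(coef f n)(coef g n)(coef h n)) }
       ; identity = (λ f → coefs λ n → ⊕-idˡ(coef f n)) , (λ f → coefs λ n → ⊕-idʳ(coef f n)) }
      ; inverse = (λ f → coefs λ n → x⊕x≡0(coef f n)) , (λ f → coefs λ n → x⊕x≡0(coef f n))
      ; ⁻¹-cong = id }
     ; comm = λ f g → coefs(λ n → ⊕-comm(coef f n)(coef g n)) }
    ; *-cong = λ e e' → coefs(·ₛ-cong(coef≡ e)(coef≡ e'))
    ; *-assoc = λ f g h → coefs(·ₛ-assoc(coef f)(coef g)(coef h))
    ; *-identity = (λ f → coefs(·ₛ-identityˡ(coef f))) , (λ f → coefs λ n → ·ₛ-comm(coef f) 1ₛ n ∙ ·ₛ-identityˡ(coef f) n)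
    ; distrib = (λ f g h → coefs λ n → ·ₛ-comm(coef f)(coef(g +ₚ h)) n ∙ ·ₛ-distribʳ(coef g)(coef h)(coef f) n ∙
       cong₂ _⊕_ (·ₛ-comm(coef g)(coef f) n)(·ₛ-comm(coef h)(coef f) n))
      , (λ f g h → coefs(·ₛ-distribʳ(coef g)(coef h)(coef f))) }
   ; *-comm = λ f g → coefs(·ₛ-comm(coef f)(coef g)) } }

 2≈0ₚ : 1ₚ +ₚ 1ₚ ≈ₚ 0ₚ
 2≈0ₚ = coefs(λ n → x⊕x≡0(1ₛ n))

 mono-*-mono : ∀ c d j k → mono c j *ₚ mono d k ≈ₚ mono(c ⊙ d)(j ∔ k)
 mono-*-mono c d j k = coefs(go j k)
  where
  go : ∀ j k → monoₛ c j ·ₛ monoₛ d k ≗ₛ monoₛ(c ⊙ d)(j ∔ k)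
  go zero zero zero = refl
  go zero(suc k) zero = ⊙-0ʳ c
  go zero zero(suc n) = cong₂ _⊕_ (⊙-0ʳ c)(·ₛ-zeroˡ(monoₛ d 0)(λ _ → refl) n) ∙ ⊕-idˡ 0#
  go zero(suc k)(suc n) = cong₂ _⊕_ (scalar k n ∙ refl)(·ₛ-zeroˡ(monoₛ d(suc k))(λ _ → refl) n) ∙ ⊕-idʳ _
   where
   scalar : ∀ k n → c ⊙ monoₛ d k n ≡ monoₛ(c ⊙ d) k n
   scalar zero zero = refl
   scalar zero(suc n) = ⊙-0ʳ c
   scalar(suc k) zero = ⊙-0ʳ c
   scalar(suc k)(suc n) = scalar k n
  go(suc j) k zero = ⊙-0ˡ _
  go(suc j) k(suc n) = cong₂ _⊕_ (⊙-0ˡ _)(go j k n) ∙ ⊕-idˡ _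

 evalₛ : ℕ → Series → Fq → Fq
 evalₛ zero f α = 0#
 evalₛ(suc n) f α = f 0 ⊕ α ⊙ evalₛ n(tail f) α

 eval : Poly → Fq → Fq
 eval f α = evalₛ(suc(bound f))(coef f) α

 evalₛ-cong : ∀ n {f g} → f ≗ₛ g → ∀ α → evalₛ n f α ≡ evalₛ n g α
 evalₛ-cong zero e α = refl
 evalₛ-cong(suc n) e α = cong₂ _⊕_ (e 0)(cong(α ⊙_)(evalₛ-cong n(e ∘ suc) α))

 evalₛ-zero : ∀ n {f} → (∀ k → f k ≡ 0#) → ∀ α → evalₛ n f α ≡ 0#
 evalₛ-zero zero e α = refl
 evalₛ-zero(suc n) e α = cong₂ _⊕_ (e 0)(cong(α ⊙_)(evalₛ-zero n(e ∘ suc) α) ∙ ⊙-0ʳ α) ∙ ⊕-idˡ 0#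

 evalₛ-stable : ∀ {f} n m → n ≤ m → (∀ k → n ≤ k → f k ≡ 0#) → ∀ α → evalₛ m f α ≡ evalₛ n f α
 evalₛ-stable zero m le e α = evalₛ-zero m(λ k → e k z≤n) α
 evalₛ-stable {f} (suc n)(suc m)(s≤s le) e α = cong(λ z → f 0 ⊕ α ⊙ z)(evalₛ-stable n m le(λ k l → e(suc k)(s≤s l)) α)

 eval-at : ∀ f n → Deg≤(coef f) n → ∀ α → eval f α ≡ evalₛ(suc n)(coef f) α
 eval-at f n d α = sym(evalₛ-stable(suc(bound f))(suc(bound f) ⊔ suc n)(N.m≤m⊔n(suc(bound f))(suc n))(bounded f) α) ∙
  evalₛ-stable(suc n)(suc(bound f) ⊔ suc n)(N.m≤n⊔m(suc(bound f))(suc n)) d α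

 evalₛ-⊕ : ∀ n f g α → evalₛ n(λ k → f k ⊕ g k) α ≡ evalₛ n f α ⊕ evalₛ n g α
 evalₛ-⊕ zero f g α = sym(⊕-idˡ 0#)
 evalₛ-⊕(suc n) f g α = cong(λ z → f 0 ⊕ g 0 ⊕ α ⊙ z)(evalₛ-⊕ n(tail f)(tail g) α) ∙
  solve 5(λ a b x y z → a :+ b :+ x :* (y :+ z) := (a :+ x :* y) :+ (b :+ x :* z)) refl(f 0)(g 0) α _ _

 eval-+ : ∀ f g α → eval(f +ₚ g) α ≡ eval f α ⊕ eval g α
 eval-+ f g α = evalₛ-⊕(suc(bound f ⊔ bound g))(coef f)(coef g) α ∙ sym(cong₂ _⊕_
  (eval-at f _ (Deg≤-mono {coef f} (N.m≤m⊔n(bound f)(bound g))(bounded f)) α)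
  (eval-at g _ (Deg≤-mono {coef g} (N.m≤n⊔m(bound f)(bound g))(bounded g)) α))

 eval-mono : ∀ c k α → eval(mono c k) α ≡ c ⊙ α ^F k
 eval-mono c zero α = cong(c ⊕_)(⊙-0ʳ α) ∙ ⊕-idʳ c ∙ sym(⊙-idʳ c)
 eval-mono c(suc k) α = cong(λ z → 0# ⊕ α ⊙ z)(eval-mono c k α) ∙
  solve 3(λ a c p → con false :+ a :* (c :* p) := c :* (a :* p)) refl α c(α ^F k)

 lin : Fq → Poly
 lin α = mono 1# 1 +ₚ mono α 0

 const : Fq → Poly
 const c = mono c 0

 coef-lin-zero : ∀ α g → coef(lin α *ₚ g) 0 ≡ α ⊙ coef g 0
 coef-lin-zero α g = cong(_⊙ coef g 0)(⊕-idˡ α)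

 coef-lin-suc : ∀ α g n → coef(lin α *ₚ g)(suc n) ≡ coef g n ⊕ α ⊙ coef g(suc n)
 coef-lin-suc α g n = cong₂ _⊕_ (cong(_⊙ coef g(suc n))(⊕-idˡ α))(·ₛ-cong {g = coef g} one(λ _ → refl) n ∙ ·ₛ-identityˡ(coef g) n) ∙
  ⊕-comm _ _
  where
  one : tail(λ k → monoₛ 1# 1 k ⊕ monoₛ α 0 k) ≗ₛ 1ₛ
  one zero = ⊕-idʳ 1#
  one(suc k) = ⊕-idʳ 0#

 eval-lin : ∀ α g β → eval(lin α *ₚ g) β ≡ (β ⊕ α) ⊙ eval g β
 eval-lin α g β = go(suc(bound g))
   (λ k l → coef-lin-suc α g k ∙ cong₂ _⊕_ (bounded g k l)(cong(α ⊙_)(bounded g(suc k)(N.m<n⇒m<1+n l)) ∙ ⊙-0ʳ α) ∙ ⊕-idˡ 0#)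
  where
  sum : ∀ n (h g : Series) → (∀ k → h k ≡ g k ⊕ α ⊙ g(suc k)) → evalₛ n h β ≡ evalₛ n g β ⊕ α ⊙ evalₛ n(tail g) β
  sum zero h g e = sym(⊕-idˡ _ ∙ ⊙-0ʳ α)
  sum(suc n) h g e = cong₂(λ a b → a ⊕ β ⊙ b)(e 0)(sum n(tail h)(tail g)(e ∘ suc)) ∙
   solve 6(λ g₀ g₁ a b x y → g₀ :+ a :* g₁ :+ b :* (x :+ a :* y) := (g₀ :+ b :* x) :+ a :* (g₁ :+ b :* y)) refl(g 0)(g 1) α β _ _
  go : ∀ n → (∀ k → n ≤ k → tail(coef(lin α *ₚ g)) k ≡ 0#) → eval(lin α *ₚ g) β ≡ (β ⊕ α) ⊙ eval g β
  go n d = begin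
   _ ≡⟨ cong₂(λ a b → a ⊕ β ⊙ b)(coef-lin-zero α g)(sum(suc(bound g)) _ (coef g)(coef-lin-suc α g)) ⟩
   α ⊙ coef g 0 ⊕ β ⊙ (eval g β ⊕ α ⊙ evalₛ(suc(bound g))(tail(coef g)) β) ≡⟨ cong(λ z → α ⊙ coef g 0 ⊕ β ⊙ (eval g β ⊕ α ⊙ z))
    (evalₛ-stable(bound g)(suc(bound g))(N.n≤1+n _)(λ k l → bounded g(suc k)(s≤s l)) β) ⟩
   α ⊙ coef g 0 ⊕ β ⊙ (eval g β ⊕ α ⊙ t) ≡⟨ solve 5(λ a b g₀ e t → a :* g₀ :+ b :* (e :+ a :* t) := b :* e :+ a :* (g₀ :+ b :* t)) refl α β(coef g 0)(eval g β) t ⟩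
   β ⊙ eval g β ⊕ α ⊙ eval g β ≡⟨ sym(⊙-distribʳ(eval g β) β α) ⟩
   _ ∎
   where t = evalₛ(bound g)(tail(coef g)) β

 record Division (f : Poly)(α : Fq) : Set where
  field
   quotient : Poly
   division : f ≈ₚ const(eval f α) +ₚ lin α *ₚ quotient
   degree : ∀ n → Deg≤(coef f)(suc n) → Deg≤(coef quotient) n × coef quotient n ≡ coef f(suc n)

 -- Synthetic division. The partial Horner values satisfy e k = f_k + α e (k + 1): e 0 is the
 -- remainder f(α), and the others are the coefficients of the quotient.
 divide : ∀ f α → Division f α
 divide f α = record { quotient = g ; division = coefs eq ; degree = deg }
  where
  N = suc(bound f)
  e : ℕ → Fq
  e k = evalₛ N(λ j → coef f(j ∔ k)) α
  rec : ∀ k → e k ≡ coef f k ⊕ α ⊙ e(suc k)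
  rec k = cong(λ z → coef f k ⊕ α ⊙ z)(evalₛ-cong(bound f)(λ j → cong(coef f)(sym(N.+-suc j k))) α ∙
   sym(evalₛ-stable(bound f) N(N.n≤1+n _)(λ j l → bounded f(j ∔ suc k)(N.≤-trans(s≤s l)(N.≤-trans(N.≤-reflexive(sym(N.+-comm j 1)))(N.+-monoʳ-≤ j(s≤s z≤n))))) α))
  e-zero : ∀ n → Deg≤(coef f) n → ∀ k → n < k → e k ≡ 0#
  e-zero n d k l = evalₛ-zero N(λ j → d(j ∔ k)(N.≤-trans l(N.m≤n+m k j))) α
  g : Poly
  g = poly(e ∘ suc)(bound f)(λ k l → e-zero(bound f)(bounded f)(suc k)(N.m<n⇒m<1+n l))
  eval≡ : eval f α ≡ e 0
  eval≡ = evalₛ-cong N(λ j → cong(coef f)(sym(N.+-identityʳ j))) α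
  eq : coef f ≗ₛ coef(const(eval f α) +ₚ lin α *ₚ g)
  eq zero = ⊕-shift(sym(rec 0)) ∙ cong₂ _⊕_ (sym eval≡)(sym(coef-lin-zero α g))
  eq(suc n) = ⊕-shift(sym(rec(suc n))) ∙ sym(⊕-idˡ _ ∙ coef-lin-suc α g n)
  deg : ∀ n → Deg≤(coef f)(suc n) → Deg≤(coef g) n × coef g n ≡ coef f(suc n)
  deg n d = (λ k l → e-zero(suc n) d(suc k)(s≤s l)) ,
   rec(suc n) ∙ cong(coef f(suc n) ⊕_)(cong(α ⊙_)(e-zero(suc n) d(suc(suc n)) N.≤-refl) ∙ ⊙-0ʳ α) ∙ ⊕-idʳ _

 eval-cong : ∀ {f g} → f ≈ₚ g → ∀ α → eval f α ≡ eval g α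
 eval-cong {f} {g} e α = eval-at f n(Deg≤-mono {coef f} (N.m≤m⊔n(bound f)(bound g))(bounded f)) α ∙ evalₛ-cong(suc n)(coef≡ e) α ∙
  sym(eval-at g n(Deg≤-mono {coef g} (N.m≤n⊔m(bound f)(bound g))(bounded g)) α)
  where n = bound f ⊔ bound g

 Π-lin : List Fq → Poly
 Π-lin [] = 1ₚ
 Π-lin(z ∷ zs) = lin z *ₚ Π-lin zs

 private
  module P = CommutativeRing polyRing

 module Root (f : Poly)(z : Fq)(root : eval f z ≡ 0#) where
  open Division(divide f z) public using (quotient; degree)

  f≈lin*quotient : f ≈ₚ lin z *ₚ quotient
  f≈lin*quotient = P.trans(Division.division(divide f z))(P.trans(P.+-congʳ {lin z *ₚ quotient} {const(eval f z)} {0ₚ} (coefs λ { zero → root ; (suc k) → refl }))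
   (P.+-identityˡ(lin z *ₚ quotient)))

  eval-f : ∀ β → eval f β ≡ (β ⊕ z) ⊙ eval quotient β
  eval-f β = eval-cong f≈lin*quotient β ∙ eval-lin z quotient β

  other-roots : ∀ {zs} → All(z ≢_) zs → All(λ y → eval f y ≡ 0#) zs → All(λ y → eval quotient y ≡ 0#) zs
  other-roots ne rs = All.zipWith(λ {y} (z≢y , e) → ⊙-nonzeroʳ(λ e' → z≢y(sym(⊕≡0⇒≡ e')))(sym(eval-f y) ∙ e))(ne , rs)

 -- The Hasse bound needs the exact degree of the cofactor and control of its zeros. Therefore the
 -- top coefficient and the inclusion of its zeros in those of f are recorded along with the
 -- equation.
 record Factorisation (zs : List Fq)(f : Poly)(n : ℕ) : Set where
  field
   cofactor : Poly
   factors : f ≈ₚ Π-lin zs *ₚ cofactor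
   degree : Deg≤(coef cofactor) n
   top : coef cofactor n ≡ coef f(length zs ∔ n)
   vanishing : ∀ β → eval cofactor β ≡ 0# → eval f β ≡ 0#

 factor : ∀ zs → Unique zs → ∀ f n → Deg≤(coef f)(length zs ∔ n) → All(λ z → eval f z ≡ 0#) zs → Factorisation zs f n
 factor [] [] f n d [] = record { cofactor = f ; factors = P.sym(P.*-identityˡ f) ; degree = d ; top = refl ; vanishing = λ _ e → e }
 factor(z ∷ zs)(ne ∷ u) f n d(r ∷ rs) = record
  { cofactor = Fz.cofactor
  ; factors = P.trans f≈lin*quotient(P.trans(P.*-congˡ {lin z} {quotient} Fz.factors)(P.sym(P.*-assoc(lin z)(Π-lin zs) Fz.cofactor)))
  ; degree = Fz.degree
  ; top = Fz.top ∙ proj₂(degree(length zs ∔ n) d)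
  ; vanishing = λ β e → eval-f β ∙ cong((β ⊕ z) ⊙_)(Fz.vanishing β e) ∙ ⊙-0ʳ _ }
  where
  open Root f z r
  module Fz = Factorisation(factor zs u quotient n(proj₁(degree(length zs ∔ n) d))(other-roots ne rs))

 roots-bound : ∀ zs → Unique zs → ∀ f n → Deg≤(coef f) n → coef f n ≢ 0# → All(λ z → eval f z ≡ 0#) zs → length zs ≤ n
 roots-bound [] _ f n d nz _ = z≤n
 roots-bound(z ∷ zs) u f zero d nz(r ∷ _) = ⊥-elim(nz(sym(cong(coef f 0 ⊕_)(⊙-0ʳ z) ∙ ⊕-idʳ _) ∙ sym(eval-at f 0 d z) ∙ r))
 roots-bound(z ∷ zs)(ne ∷ u) f(suc n) d nz(r ∷ rs) = s≤s(roots-bound zs u quotient n(proj₁(degree n d))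
   (λ e → nz(sym(proj₂(degree n d)) ∙ e))
   (other-roots ne rs))
  where open Root f z r

+-cancelˡ : ∀ a {x y} → a + x ≡ a + y → x ≡ y
+-cancelˡ a {x} {y} = RingProperties.+-cancelˡ Z.+-*-ring a x y

≡-neg⇒≡0 : ∀ {x} → x ≡ - x → x ≡ 0ℤ
≡-neg⇒≡0 {pos zero} e = refl

-- Additive characters, Kloosterman sums and their Fourier transforms

module Characters (𝒟 : FieldData) where
 open FieldArithmetic 𝒟
 open Polynomials 𝒟 using (Poly; _+ₚ_; 0ₚ; mono; coef; Deg≤; monoₛ-Deg≤; monoₛ-top; eval; eval-+; eval-mono; roots-bound; evalₛ-zero)

 private
  tracePoly : ℕ → Poly
  tracePoly zero = 0ₚ
  tracePoly(suc n) = tracePoly n +ₚ mono 1#(2 ** n)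

  eval-tracePoly : ∀ n α → eval(tracePoly n) α ≡ trace n α
  eval-tracePoly zero α = evalₛ-zero 1(λ _ → refl) α
  eval-tracePoly(suc n) α = eval-+(tracePoly n)(mono 1#(2 ** n)) α ∙
   cong₂ _⊕_ (eval-tracePoly n α)(eval-mono 1#(2 ** n) α ∙ ⊙-idˡ _) ∙ sym(trace-suc n α)

  2^n<2^1+n : ∀ n → 2 ** n < 2 ** suc n
  2^n<2^1+n n = N.^-monoʳ-< 2(s≤s(s≤s z≤n))(N.n<1+n n)

  tracePoly-small : ∀ n k → 2 ** n ≤ k → coef(tracePoly n) k ≡ 0#
  tracePoly-small zero k _ = refl
  tracePoly-small(suc n) k l = cong₂ _⊕_ (tracePoly-small n k(N.≤-trans(N.<⇒≤(2^n<2^1+n n)) l))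
   (monoₛ-Deg≤ 1#(2 ** n) k(N.<-≤-trans(2^n<2^1+n n) l)) ∙ ⊕-idˡ 0#

  trace-nontrivial : ∀ n → ¬ (∀ x → trace(suc n) x ≡ 0#) ⊎ q ≤ 2 ** n
  trace-nontrivial n with FS.∀? 𝔽ˢ {λ x → trace(suc n) x ≡ 0#} (λ { refl e → e })(λ x → trace(suc n) x ≟ 0#)
  ... | no ¬a = inj₁ ¬a
  ... | yes a = inj₂(roots-bound Fs elements-unique(tracePoly(suc n))(2 ** n)
   (λ k l → cong₂ _⊕_ (tracePoly-small n k(N.<⇒≤ l))(monoₛ-Deg≤ 1#(2 ** n) k l) ∙ ⊕-idˡ 0#)
   (λ e → 0≢1(sym(sym(cong₂ _⊕_ (tracePoly-small n(2 ** n) N.≤-refl)(monoₛ-top 1#(2 ** n)) ∙ ⊕-idˡ 1#) ∙ e)))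
   (All.tabulate λ {x} _ → eval-tracePoly(suc n) x ∙ a x))

  r≡ : r ≡ suc(ℕ.pred r)
  r≡ = lemma r≥1
   where
   lemma : ∀ {r} → 1 ≤ r → r ≡ suc(ℕ.pred r)
   lemma(s≤s z≤n) = refl

  tr-surjective : ∃[ x ] tr x ≡ 1#
  tr-surjective with any?(λ x → tr x ≟ 1#) Fs
  ... | yes a = Any.satisfied a
  ... | no ¬a with trace-nontrivial(ℕ.pred r)
  ...   | inj₂ l = ⊥-elim(N.<⇒≱(2^n<2^1+n(ℕ.pred r))(subst(_≤ 2 ** ℕ.pred r) q≡2*2^ l))
  ...   | inj₁ ¬z = ⊥-elim(¬z λ x → cong(λ n → trace n x)(sym r≡) ∙ zero-at x(tr-01 x))
   where
   zero-at : ∀ x → tr x ≡ 0# ⊎ tr x ≡ 1# → tr x ≡ 0#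
   zero-at x(inj₁ e) = e
   zero-at x(inj₂ e) = ⊥-elim(¬a(Any.map(λ { refl → e })(elements-complete x)))

 instance
  q-nonZero : ℕ.NonZero q
  q-nonZero = ℕ.>-nonZero(subst(0 <_)(sym size≡)(N.m^n>0 2 r))

 -- Translation by an element of trace 1 permutes the field and changes the sign of every term.
 ∑λ≡0 : ∑ Fs λ' ≡ 0ℤ
 ∑λ≡0 = let (x₀ , e) = tr-surjective in ≡-neg⇒≡0(begin
  _ ≡⟨ ∑-reindex 𝔽ˢ 𝔽ˢ {g = λ y → λ'(y ⊕ x₀)} (_⊕ x₀)(_⊕ x₀)
   (λ { {x} refl → sym(⊕-cancel x x₀) , cong λ'(sym(⊕-cancel x x₀)) })(λ { {y = y} refl → sym(⊕-cancel y x₀) }) ⟩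
  ∑ Fs(λ y → λ'(y ⊕ x₀)) ≡⟨ ∑-cong Fs(λ y → λ-⊕ y x₀ ∙ cong(λ' y *_)(λ--1 e) ∙ Z.*-comm(λ' y) -1ℤ ∙ Z.-1*i≡-i(λ' y)) ⟩
  ∑ Fs(λ y → - λ' y) ≡⟨ ∑-neg Fs λ' ⟩
  _ ∎)

 ∑-scale : ∀ {a} → a ≢ 0# → (f : Fq → ℤ) → ∑ Fs(λ x → f(a ⊙ x)) ≡ ∑ Fs f
 ∑-scale {a} nz f = ∑-reindex 𝔽ˢ 𝔽ˢ(a ⊙_)(a ⁻¹ ⊙_)
  (λ { {x} refl → sym(inv x) , refl })(λ { {y = y} refl → sym(inv' y) })
  where
  inv : ∀ x → a ⁻¹ ⊙ (a ⊙ x) ≡ x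
  inv x = sym(⊙-assoc _ a x) ∙ cong(_⊙ x)(⁻¹-inverseˡ nz) ∙ ⊙-idˡ x
  inv' : ∀ x → a ⊙ (a ⁻¹ ⊙ x) ≡ x
  inv' x = sym(⊙-assoc a _ x) ∙ cong(_⊙ x)(⁻¹-inverse a nz) ∙ ⊙-idˡ x

 ∑λ-⊙ : ∀ a → ∑ Fs(λ x → λ'(a ⊙ x)) ≡ Q * χ(a ≟ 0#)
 ∑λ-⊙ a with a ≟ 0#
 ... | yes refl = ∑-cong Fs(λ x → cong λ'(⊙-0ˡ x) ∙ λ-0) ∙ ∑1≡q ∙ sym(Z.*-identityʳ Q)
 ... | no nz = ∑-scale nz λ' ∙ ∑λ≡0 ∙ sym(Z.*-zeroʳ Q)

 ∑λ-detect : ∀ x y → ∑ Fs(λ a → λ'(a ⊙ (x ⊕ y))) ≡ Q * χ(x ≟ y)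
 ∑λ-detect x y = ∑-cong Fs(λ a → cong λ'(⊙-comm a(x ⊕ y))) ∙ ∑λ-⊙(x ⊕ y) ∙
  cong(Q *_)(χ-⇔(x ⊕ y ≟ 0#)(x ≟ y) ⊕≡0⇒≡ ≡⇒⊕≡0)

 λ-⊙sq : ∀ a x → λ'(a ⊙ sq x) ≡ λ'(√ a ⊙ x)
 λ-⊙sq a x = cong λ'(cong(_⊙ sq x)(sym(sq-√ a)) ∙ sym(sq-⊙(√ a) x)) ∙ λ-sq(√ a ⊙ x)

 -- Since tr(z²) = tr(z), the square term λ(a x²) equals λ(√a x), and the quadratic sum is a linear
 -- one in disguise.
 ∑λ-quadratic : ∀ a b → ∑ Fs(λ x → λ'(a ⊙ sq x ⊕ b ⊙ x)) ≡ Q * χ(√ a ≟ b)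
 ∑λ-quadratic a b = ∑-cong Fs(λ x → λ-⊕(a ⊙ sq x)(b ⊙ x) ∙ cong(_* λ'(b ⊙ x))(λ-⊙sq a x) ∙
  sym(λ-⊕(√ a ⊙ x)(b ⊙ x)) ∙ cong λ'(sym(⊙-distribʳ x(√ a) b))) ∙
  ∑λ-⊙(√ a ⊕ b) ∙ cong(Q *_)(χ-⇔(√ a ⊕ b ≟ 0#)(√ a ≟ b) ⊕≡0⇒≡ ≡⇒⊕≡0)

 q-cancel : ∀ {x y} → Q * x ≡ Q * y → x ≡ y
 q-cancel {x} {y} = Z.*-cancelˡ-≡ Q x y

 -- Detecting the equation u² + u = c by characters leaves the frequencies a with √a = a, that is a
 -- = 0 and a = 1. They contribute 1 and λ(c).
 artin-schreier-count : ∀ c → ∑ Fs(λ u → χ(sq u ⊕ u ≟ c)) ≡ 1ℤ + λ' c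
 artin-schreier-count c = q-cancel(begin
  _ ≡⟨ sym(∑-*ˡ Fs Q _) ⟩
  ∑ Fs(λ u → Q * χ(sq u ⊕ u ≟ c)) ≡⟨ ∑-cong Fs(λ u → sym(∑λ-detect(sq u ⊕ u) c)) ⟩
  ∑ Fs(λ u → ∑ Fs λ a → λ'(a ⊙ (sq u ⊕ u ⊕ c))) ≡⟨ ∑-swap Fs Fs _ ⟩
  ∑ Fs(λ a → ∑ Fs λ u → λ'(a ⊙ (sq u ⊕ u ⊕ c))) ≡⟨ ∑-cong Fs inner ⟩
  ∑ Fs(λ a → Q * (χ(a ≟ 0#) * λ'(a ⊙ c) + χ(a ≟ 1#) * λ'(a ⊙ c))) ≡⟨ ∑-*ˡ Fs Q _ ∙ cong(Q *_)(∑-+ Fs _ _) ⟩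
  Q * (∑ Fs(λ a → χ(a ≟ 0#) * λ'(a ⊙ c)) + ∑ Fs λ a → χ(a ≟ 1#) * λ'(a ⊙ c)) ≡⟨ cong(Q *_)(cong₂ _+_
   (∑-sift 𝔽ˢ 0#(cong λ a → λ'(a ⊙ c)) ∙ cong λ'(⊙-0ˡ c) ∙ λ-0)(∑-sift 𝔽ˢ 1#(cong λ a → λ'(a ⊙ c)) ∙ cong λ'(⊙-idˡ c))) ⟩
  _ ∎)
  where
  fixed : ∀ a → χ(√ a ≟ a) ≡ χ(a ≟ 0#) + χ(a ≟ 1#)
  fixed a with a ≟ 0# | a ≟ 1#
  ... | yes e | yes e' = ⊥-elim(0≢1(sym e ∙ e'))
  ... | yes refl | no _ = χ-yes(√ 0# ≟ 0#)(sq-injective(sq-√ 0# ∙ sym(⊙-0ˡ 0#)))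
  ... | no _ | yes refl = χ-yes(√ 1# ≟ 1#)(sq-injective(sq-√ 1# ∙ sym(⊙-idˡ 1#)))
  ... | no n0 | no n1 = χ-no(√ a ≟ a)(λ e → n1(⊙-cancelˡ n0(sym(cong sq e) ∙ sq-√ a ∙ sym(⊙-idʳ a))))
  inner : ∀ a → ∑ Fs(λ u → λ'(a ⊙ (sq u ⊕ u ⊕ c))) ≡ Q * (χ(a ≟ 0#) * λ'(a ⊙ c) + χ(a ≟ 1#) * λ'(a ⊙ c))
  inner a = begin
   _ ≡⟨ ∑-cong Fs(λ u → cong λ'(solve 4(λ a s u c → a :* (s :+ u :+ c) := a :* s :+ a :* u :+ a :* c) refl a(sq u) u c) ∙ λ-⊕ _ (a ⊙ c)) ⟩
   ∑ Fs(λ u → λ'(a ⊙ sq u ⊕ a ⊙ u) * λ'(a ⊙ c)) ≡⟨ ∑-*ʳ Fs(λ'(a ⊙ c)) _ ⟩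
   ∑ Fs(λ u → λ'(a ⊙ sq u ⊕ a ⊙ u)) * λ'(a ⊙ c) ≡⟨ cong(_* λ'(a ⊙ c))(∑λ-quadratic a a ∙ cong(Q *_)(fixed a)) ⟩
   Q * (χ(a ≟ 0#) + χ(a ≟ 1#)) * λ'(a ⊙ c) ≡⟨ Z.*-assoc Q _ _ ∙ cong(Q *_)(Z.*-distribʳ-+(λ'(a ⊙ c))(χ(a ≟ 0#))(χ(a ≟ 1#))) ⟩
   _ ∎

 -- A root u of u² + u = κ would give the factors z + u and z + u + 1 of z² + z + κ. Irreducibility
 -- therefore makes the number 1 + λ(κ) of roots zero.
 λκ : λ' κ ≡ -1ℤ
 λκ with tr-01 κ
 ... | inj₂ e = λ--1 e
 ... | inj₁ e with any?(λ u → sq u ⊕ u ≟ κ) Fs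
 ...   | yes a = let (u , e') = Any.satisfied a in ⊥-elim(irreducible u(u ⊕ 1#)
   (solve 1(λ u → u :+ (u :+ con true) := con true) refl u , solve 1(λ u → u :* (u :+ con true) := u :* u :+ u) refl u ∙ e'))
 ...   | no ¬a = contradiction(sym(∑-cong∈ Fs(λ u i → χ-no(sq u ⊕ u ≟ κ) λ e' → ¬a(Any.map(λ { refl → e' }) i)) ∙ ∑-zero Fs) ∙
   artin-schreier-count κ ∙ cong(ℤ._+_ 1ℤ)(λ-1 e)) λ ()

 -- α ↦ α + p/α is at most two-to-one on 𝔽*; the fibre over s ≠ 0 has 1 + λ(p/s²) elements.
 ∑-fold : ∀ {p} → p ≢ 0# → (g : Fq → ℤ) → ∑ F*(λ α → g(α ⊕ p ⊙ α ⁻¹)) ≡ ∑ Fs g + ∑ F*(λ s → g s * λ'(√ p ⊙ s ⁻¹))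
 ∑-fold {p} nz g = begin
  _ ≡⟨ ∑-nz-cong(λ α nα → sym(∑-sift 𝔽ˢ(α ⊕ p ⊙ α ⁻¹)(cong g))) ⟩
  ∑ F*(λ α → ∑ Fs λ s → χ(s ≟ α ⊕ p ⊙ α ⁻¹) * g s) ≡⟨ ∑-swap F* Fs _ ∙ ∑-cong Fs(λ s → ∑-*ʳ F*(g s) _) ⟩
  ∑ Fs(λ s → ∑ F*(λ α → χ(s ≟ α ⊕ p ⊙ α ⁻¹)) * g s) ≡⟨ ∑-cong Fs(λ s → cong(_* g s)(fibre s)) ∙
   ∑-split₀(λ s → ∑ Fs(λ α → χ(sq α ⊕ s ⊙ α ≟ p)) * g s) ∙ cong₂ _+_ (cong(_* g 0#) count₀ ∙ Z.*-identityˡ(g 0#))(∑-nz-cong countₛ) ⟩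
  g 0# + ∑ F*(λ s → g s + g s * λ'(√ p ⊙ s ⁻¹)) ≡⟨ cong(ℤ._+_ (g 0#))(∑-+ F* g _) ⟩
  g 0# + (∑ F* g + ∑ F* λ s → g s * λ'(√ p ⊙ s ⁻¹)) ≡⟨ sym(Z.+-assoc(g 0#) _ _) ⟩
  g 0# + ∑ F* g + ∑ F*(λ s → g s * λ'(√ p ⊙ s ⁻¹)) ≡⟨ cong(λ z → z + ∑ F* λ s → g s * λ'(√ p ⊙ s ⁻¹))(sym(∑-split₀ g)) ⟩
  _ ∎
  where
  clear : ∀ {α} → α ≢ 0# → α ⊙ (p ⊙ α ⁻¹) ≡ p
  clear {α} nα = solve 3(λ a p b → a :* (p :* b) := p :* (a :* b)) refl α p(α ⁻¹) ∙ cong(p ⊙_)(⁻¹-inverse α nα) ∙ ⊙-idʳ p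
  fibre : ∀ s → ∑ F*(λ α → χ(s ≟ α ⊕ p ⊙ α ⁻¹)) ≡ ∑ Fs(λ α → χ(sq α ⊕ s ⊙ α ≟ p))
  fibre s = ∑-nz-cong(λ α nα → χ-⇔(s ≟ α ⊕ p ⊙ α ⁻¹)(sq α ⊕ s ⊙ α ≟ p)
    (λ { refl → solve 2(λ a b → a :* a :+ (a :+ b) :* a := a :* b) refl α(p ⊙ α ⁻¹) ∙ clear nα })
    λ e → ⊙-cancelˡ nα(solve 2(λ a s → a :* s := a :* a :+ (a :* a :+ s :* a)) refl α s ∙ cong(sq α ⊕_)(e ∙ sym(clear nα)) ∙ sym(⊙-distribˡ α α _))) ∙
   sym(∑-split₀ _ ∙ cong(_+ ∑ F* λ α → χ(sq α ⊕ s ⊙ α ≟ p))(χ-no(sq 0# ⊕ s ⊙ 0# ≟ p) λ e → nz(sym e ∙ cong₂ _⊕_ (⊙-0ˡ 0#)(⊙-0ʳ s) ∙ ⊕-idˡ 0#)) ∙ Z.+-identityˡ _)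
  count₀ : ∑ Fs(λ α → χ(sq α ⊕ 0# ⊙ α ≟ p)) ≡ 1ℤ
  count₀ = ∑-cong Fs(λ α → χ-⇔(sq α ⊕ 0# ⊙ α ≟ p)(α ≟ √ p)
   (λ e → sq-injective(sym(cong(sq α ⊕_)(⊙-0ˡ α) ∙ ⊕-idʳ _) ∙ e ∙ sym(sq-√ p)))
   λ { refl → cong₂ _⊕_ (sq-√ p)(⊙-0ˡ _) ∙ ⊕-idʳ p }) ∙ FS.∑-δ 𝔽ˢ(√ p)
  countₛ : ∀ s → s ≢ 0# → ∑ Fs(λ α → χ(sq α ⊕ s ⊙ α ≟ p)) * g s ≡ g s + g s * λ'(√ p ⊙ s ⁻¹)
  countₛ s ns = cong(_* g s)(begin
   _ ≡⟨ sym(∑-scale ns λ α → χ(sq α ⊕ s ⊙ α ≟ p)) ⟩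
   ∑ Fs(λ u → χ(sq(s ⊙ u) ⊕ s ⊙ (s ⊙ u) ≟ p)) ≡⟨ ∑-cong Fs(λ u → χ-⇔(sq(s ⊙ u) ⊕ s ⊙ (s ⊙ u) ≟ p)(sq u ⊕ u ≟ sq(√ p ⊙ s ⁻¹))
    (λ e → ⊙-cancelˡ(⊙-≢0 ns ns)(homog u ∙ e ∙ sym p≡)) λ e → sym(homog u) ∙ cong(sq s ⊙_) e ∙ p≡) ⟩
   ∑ Fs(λ u → χ(sq u ⊕ u ≟ sq(√ p ⊙ s ⁻¹))) ≡⟨ artin-schreier-count _ ∙ cong(ℤ._+_ 1ℤ)(λ-sq _) ⟩
   _ ∎) ∙ expand(λ'(√ p ⊙ s ⁻¹))(g s)
   where
   expand : ∀ l g → (1ℤ + l) * g ≡ g + g * l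
   expand = ring
   homog : ∀ u → sq s ⊙ (sq u ⊕ u) ≡ sq(s ⊙ u) ⊕ s ⊙ (s ⊙ u)
   homog = solve 2(λ s u → s :* s :* (u :* u :+ u) := s :* u :* (s :* u) :+ s :* (s :* u)) refl s
   p≡ : sq s ⊙ sq(√ p ⊙ s ⁻¹) ≡ p
   p≡ = sym(sq-⊙ s _) ∙ cong sq(solve 3(λ s p t → s :* (p :* t) := p :* (s :* t)) refl s(√ p)(s ⁻¹) ∙
    cong(√ p ⊙_)(⁻¹-inverse s ns) ∙ ⊙-idʳ _) ∙ sq-√ p

 ∑nz-λ : ∑ F* λ' ≡ -1ℤ
 ∑nz-λ = +-cancelˡ 1ℤ(cong(_+ ∑ F* λ')(sym λ-0) ∙ sym(∑-split₀ λ') ∙ ∑λ≡0)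

 K-0 : K 0# ≡ -1ℤ
 K-0 = ∑-cong F*(λ α → cong λ'(cong(α ⊕_)(⊙-0ˡ _) ∙ ⊕-idʳ α)) ∙ ∑nz-λ

 sq-⁻¹ : ∀ {x} → x ≢ 0# → sq(x ⁻¹) ≡ (sq x) ⁻¹
 sq-⁻¹ nz = sym(⁻¹-⊙ nz nz)

 ∑nz-sq : (f : Fq → ℤ) → ∑ F*(λ x → f(sq x)) ≡ ∑ F* f
 ∑nz-sq f = ∑-nz-reindex sq √(λ {x} nz → ⊙-≢0 nz nz , √-sq x , refl)(λ {x} nz → √-≢0 nz , sq-√ x)

 K-sq : ∀ a → K(sq a) ≡ K a
 K-sq a = sym(∑nz-sq _) ∙ ∑-nz-cong(λ α nα → cong λ'(cong(λ z → sq α ⊕ sq a ⊙ z)(sym(sq-⁻¹ nα)) ∙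
  cong(sq α ⊕_)(sym(sq-⊙ a _)) ∙ sym(sq-⊕ α _)) ∙ λ-sq(α ⊕ a ⊙ α ⁻¹))

 K₂-∑∑ : ∀ a → K₂ a ≡ ∑ F*(λ s → ∑ F* λ t → λ'(s ⊕ t ⊕ a ⊙ s ⁻¹ ⊙ t ⁻¹))
 K₂-∑∑ a = ∑-cartesianProduct F* F* _

 -- Carlitz's identity. With p = αβ the product of two terms of K(a²) is λ(c_p (α + p/α)), where c_p
 -- = 1 + a²/p, and folding α + p/α turns the sum over α into two sums over s. The first is q when
 -- c_p = 0, that is for p = a² alone. The second becomes K₂(a). Passing from a to a² leaves K
 -- unchanged and makes the square roots explicit.
 K²≡q+K₂ : ∀ {a} → a ≢ 0# → K a * K a ≡ Q + K₂ a
 K²≡q+K₂ {a} na = begin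
  _ ≡⟨ sym(cong₂ _*_ (K-sq a)(K-sq a)) ⟩
  K(sq a) * K(sq a) ≡⟨ sym(∑-* F* F* _ _) ⟩
  ∑ F*(λ α → ∑ F* λ β → λ'(α ⊕ sq a ⊙ α ⁻¹) * λ'(β ⊕ sq a ⊙ β ⁻¹)) ≡⟨ ∑-nz-cong(λ α nα → by-product α nα) ⟩
  ∑ F*(λ α → ∑ F* λ p → λ'(c p ⊙ (α ⊕ p ⊙ α ⁻¹))) ≡⟨ ∑-swap F* F* _ ⟩
  ∑ F*(λ p → ∑ F* λ α → λ'(c p ⊙ (α ⊕ p ⊙ α ⁻¹))) ≡⟨ ∑-nz-cong(λ p np → ∑-fold np(λ s → λ'(c p ⊙ s)) ∙ cong(_+ Tₚ p)(∑λ-⊙(c p))) ⟩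
  ∑ F*(λ p → Q * χ(c p ≟ 0#) + Tₚ p) ≡⟨ ∑-+ F* _ Tₚ ⟩
  ∑ F*(λ p → Q * χ(c p ≟ 0#)) + ∑ F* Tₚ ≡⟨ cong₂ _+_ (∑-*ˡ F* Q _ ∙ cong(Q *_) one ∙ Z.*-identityʳ Q) second ⟩
  _ ∎
  where
  c : Fq → Fq
  c p = 1# ⊕ sq a ⊙ p ⁻¹
  Tₚ : Fq → ℤ
  Tₚ p = ∑ F*(λ s → λ'(c p ⊙ s) * λ'(√ p ⊙ s ⁻¹))
  by-product : ∀ α → α ≢ 0# → ∑ F*(λ β → λ'(α ⊕ sq a ⊙ α ⁻¹) * λ'(β ⊕ sq a ⊙ β ⁻¹)) ≡ ∑ F*(λ p → λ'(c p ⊙ (α ⊕ p ⊙ α ⁻¹)))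
  by-product α nα = ∑-nz-reindex(α ⊙_)(α ⁻¹ ⊙_)
   (λ {β} nβ → ⊙-≢0 nα nβ , sym(⊙-assoc _ α β) ∙ cong(_⊙ β)(⁻¹-inverseˡ nα) ∙ ⊙-idˡ β ,
    sym(λ-⊕ _ _) ∙ cong λ'(sym(begin
     _ ≡⟨ cong₂(λ u v → (1# ⊕ sq a ⊙ u) ⊙ (α ⊕ v))(⁻¹-⊙ nα nβ)
      (solve 3(λ a b c → a :* b :* c := b :* (a :* c)) refl α β(α ⁻¹) ∙ cong(β ⊙_)(⁻¹-inverse α nα) ∙ ⊙-idʳ β) ⟩
     (1# ⊕ sq a ⊙ (α ⁻¹ ⊙ β ⁻¹)) ⊙ (α ⊕ β) ≡⟨ solve 5(λ A x y x' y' → (con true :+ A :* (x' :* y')) :* (x :+ y) := x :+ y :+ A :* y' :* (x :* x') :+ A :* x' :* (y :* y')) refl(sq a) α β(α ⁻¹)(β ⁻¹) ⟩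
     α ⊕ β ⊕ sq a ⊙ β ⁻¹ ⊙ (α ⊙ α ⁻¹) ⊕ sq a ⊙ α ⁻¹ ⊙ (β ⊙ β ⁻¹) ≡⟨ cong₂(λ u v → α ⊕ β ⊕ sq a ⊙ β ⁻¹ ⊙ u ⊕ sq a ⊙ α ⁻¹ ⊙ v)(⁻¹-inverse α nα)(⁻¹-inverse β nβ) ⟩
     α ⊕ β ⊕ sq a ⊙ β ⁻¹ ⊙ 1# ⊕ sq a ⊙ α ⁻¹ ⊙ 1# ≡⟨ solve 5(λ A x y x' y' → x :+ y :+ A :* y' :* con true :+ A :* x' :* con true := x :+ A :* x' :+ (y :+ A :* y')) refl(sq a) α β(α ⁻¹)(β ⁻¹) ⟩
     _ ∎)))
   (λ {p} np → ⊙-≢0(⁻¹-≢0 nα) np , sym(⊙-assoc α _ p) ∙ cong(_⊙ p)(⁻¹-inverse α nα) ∙ ⊙-idˡ p)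
  one : ∑ F*(λ p → χ(c p ≟ 0#)) ≡ 1ℤ
  one = ∑-nz-cong(λ p np → χ-⇔(c p ≟ 0#)(p ≟ sq a)
    (λ e → sym(⁻¹-involutive np) ∙ ⁻¹-unique(⊙-comm _ (sq a) ∙ sym(⊕≡0⇒≡ e)))
    λ { refl → ≡⇒⊕≡0(sym(⁻¹-inverse(sq a) np)) }) ∙
   ∑-unique _≟_ F* nonzeros-unique(sq a)(∈nonzeros⁺(⊙-≢0 na na))
  second : ∑ F* Tₚ ≡ K₂ a
  second = begin
   _ ≡⟨ ∑-swap F* F* _ ⟩
   ∑ F*(λ s → ∑ F* λ p → λ'(c p ⊙ s) * λ'(√ p ⊙ s ⁻¹)) ≡⟨ sym(∑nz-sq _) ⟩
   ∑ F*(λ t → ∑ F* λ p → λ'(c p ⊙ sq t) * λ'(√ p ⊙ (sq t) ⁻¹)) ≡⟨ ∑-nz-cong inner ⟩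
   ∑ F*(λ t → ∑ F* λ u → λ'(t ⊕ u ⊕ a ⊙ t ⁻¹ ⊙ u ⁻¹)) ≡⟨ sym(K₂-∑∑ a) ⟩
   _ ∎
   where
   inner : ∀ t → t ≢ 0# → ∑ F*(λ p → λ'(c p ⊙ sq t) * λ'(√ p ⊙ (sq t) ⁻¹)) ≡ ∑ F*(λ u → λ'(t ⊕ u ⊕ a ⊙ t ⁻¹ ⊙ u ⁻¹))
   -- With s = t² and p = (t² u)² one has √p / s = u, while c_p t² is the square of t + a/(tu). So
   -- the two characters combine to λ(t + u + a/(tu)).
   inner t nt = sym(∑-nz-reindex(λ u → sq(sq t ⊙ u))(λ p → (sq t) ⁻¹ ⊙ √ p)
    (λ {u} nu → let nn = ⊙-≢0 nt2 nu in ⊙-≢0 nn nn , cong((sq t) ⁻¹ ⊙_)(√-sq _) ∙ undo u , term u nu)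
    λ {p} np → ⊙-≢0(⁻¹-≢0 nt2)(√-≢0 np) , cong sq(undo'(√ p)) ∙ sq-√ p)
    where
    nt2 = ⊙-≢0 nt nt
    undo : ∀ u → (sq t) ⁻¹ ⊙ (sq t ⊙ u) ≡ u
    undo u = sym(⊙-assoc _ (sq t) u) ∙ cong(_⊙ u)(⁻¹-inverseˡ nt2) ∙ ⊙-idˡ u
    undo' : ∀ u → sq t ⊙ ((sq t) ⁻¹ ⊙ u) ≡ u
    undo' u = sym(⊙-assoc(sq t) _ u) ∙ cong(_⊙ u)(⁻¹-inverse(sq t) nt2) ∙ ⊙-idˡ u
    term : ∀ u → u ≢ 0# → λ'(t ⊕ u ⊕ a ⊙ t ⁻¹ ⊙ u ⁻¹) ≡ λ'(c(sq(sq t ⊙ u)) ⊙ sq t) * λ'(√(sq(sq t ⊙ u)) ⊙ (sq t) ⁻¹)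
    term u nu = begin
     _ ≡⟨ cong λ'(solve 3(λ t u w → t :+ u :+ w := (t :+ w) :+ u) refl t u w) ⟩
     λ'((t ⊕ w) ⊕ u) ≡⟨ λ-⊕(t ⊕ w) u ⟩
     λ'(t ⊕ w) * λ' u ≡⟨ cong₂ _*_ (sym(λ-sq(t ⊕ w)))(cong λ'(sym(cong(_⊙ (sq t) ⁻¹)(√-sq _) ∙ ⊙-comm _ _ ∙ undo u))) ⟩
     λ'(sq(t ⊕ w)) * λ'(√(sq(sq t ⊙ u)) ⊙ (sq t) ⁻¹) ≡⟨ cong(_* λ'(√(sq(sq t ⊙ u)) ⊙ (sq t) ⁻¹))(cong λ'(sym sq≡)) ⟩
     _ ∎
     where
     w = a ⊙ t ⁻¹ ⊙ u ⁻¹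
     t' = t ⁻¹
     u' = u ⁻¹
     sq≡ : c(sq(sq t ⊙ u)) ⊙ sq t ≡ sq(t ⊕ w)
     sq≡ = begin
      _ ≡⟨ cong(λ z → (1# ⊕ sq a ⊙ z) ⊙ sq t)(sym(sq-⁻¹(⊙-≢0 nt2 nu)) ∙ cong sq(⁻¹-⊙ nt2 nu ∙ cong(_⊙ u')(⁻¹-⊙ nt nt))) ⟩
      (1# ⊕ sq a ⊙ sq(t' ⊙ t' ⊙ u')) ⊙ sq t ≡⟨ solve 4(λ a t t' u' → (con true :+ a :* a :* (t' :* t' :* u' :* (t' :* t' :* u'))) :* (t :* t)
       := t :* t :+ (a :* t' :* u') :* (a :* t' :* u') :* ((t :* t') :* (t :* t'))) refl a t t' u' ⟩
      sq t ⊕ sq w ⊙ ((t ⊙ t') ⊙ (t ⊙ t')) ≡⟨ cong(λ z → sq t ⊕ sq w ⊙ (z ⊙ z))(⁻¹-inverse t nt) ⟩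
      sq t ⊕ sq w ⊙ (1# ⊙ 1#) ≡⟨ solve 2(λ t w → t :* t :+ w :* w :* (con true :* con true) := (t :+ w) :* (t :+ w)) refl t w ⟩
      _ ∎

 χtr=1 : Fq → ℤ
 χtr=1 x = χ(tr x ≟ 1#)

 λ≡1-2χ : ∀ x → λ' x ≡ 1ℤ + - (pos 2 * χtr=1 x)
 λ≡1-2χ x with tr-01 x
 ... | inj₁ e = λ-1 e ∙ sym(cong(λ z → 1ℤ + - (pos 2 * z))(χ-no(tr x ≟ 1#) λ e' → 0≢1(sym e ∙ e')))
 ... | inj₂ e = λ--1 e ∙ sym(cong(λ z → 1ℤ + - (pos 2 * z))(χ-yes(tr x ≟ 1#) e))

 ∑nz-1 : ∑ F*(λ _ → 1ℤ) ≡ Q - 1ℤ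
 ∑nz-1 = ∑-length F* ∙ sym(cancel(pos(length F*))) ∙ cong(λ z → pos z - 1ℤ) length-nonzeros
  where
  cancel : ∀ n → 1ℤ + n - 1ℤ ≡ n
  cancel = ring

 Z₁ : Fq → ℤ
 Z₁ b = ∑ F*(λ α → χtr=1(α ⊕ b ⊙ α ⁻¹))

 K≡q-1-2Z₁ : ∀ b → K b ≡ Q - 1ℤ - pos 2 * Z₁ b
 K≡q-1-2Z₁ b = ∑-cong F*(λ α → λ≡1-2χ _) ∙ ∑-+ F* _ _ ∙ cong₂ _+_ ∑nz-1(∑-neg F* _ ∙ cong -_ (∑-*ˡ F*(pos 2) _))

 -- α and b/α have the same value α + b/α, and they coincide only for α = √b, where this value is 0
 -- and has trace 0. The folding formula expresses this pairing. As K = q - 1 - 2 Z₁, it gives K ≡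
 -- -1 mod 4 as soon as 4 divides q.
 Z₁-even : ∀ {b} → b ≢ 0# → ∃[ j ] Z₁ b ≡ pos 2 * j
 Z₁-even {b} nb = ∑ F*(λ s → χtr=1 s * half s) , (begin
  _ ≡⟨ ∑-fold nb χtr=1 ⟩
  ∑ Fs χtr=1 + ∑ F*(λ s → χtr=1 s * λ'(√ b ⊙ s ⁻¹)) ≡⟨ cong(_+ ∑ F* λ s → χtr=1 s * λ'(√ b ⊙ s ⁻¹))
   (∑-split₀ χtr=1 ∙ cong(_+ ∑ F* χtr=1)(χ-no(tr 0# ≟ 1#) λ e → 0≢1(sym tr-0 ∙ e)) ∙ Z.+-identityˡ(∑ F* χtr=1)) ⟩
  ∑ F* χtr=1 + ∑ F*(λ s → χtr=1 s * λ'(√ b ⊙ s ⁻¹)) ≡⟨ sym(∑-+ F* _ _) ⟩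
  ∑ F*(λ s → χtr=1 s + χtr=1 s * λ'(√ b ⊙ s ⁻¹)) ≡⟨ ∑-cong F*(λ s → cong(λ z → χtr=1 s + χtr=1 s * z)(λ≡1-2χ _) ∙ double(χtr=1 s)(χtr=1(√ b ⊙ s ⁻¹))) ⟩
  ∑ F*(λ s → pos 2 * (χtr=1 s * half s)) ≡⟨ ∑-*ˡ F*(pos 2) _ ⟩
  _ ∎)
  where
  half : Fq → ℤ
  half s = 1ℤ - χtr=1(√ b ⊙ s ⁻¹)
  double : ∀ x y → x + x * (1ℤ + - (pos 2 * y)) ≡ pos 2 * (x * (1ℤ - y))
  double = ring

 θ₀ : Fq → Fq → Fq
 θ₀ x y = x ⊙ x ⊕ x ⊙ y ⊕ κ ⊙ y ⊙ y

 -- The sum over x is quadratic and vanishes unless y = 1/√a. At that y the remaining term of θ₀ is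
 -- λ(κ) = -1, the origin of the minus sign.
 ∑∑λ-θ₀ : ∀ {a} → a ≢ 0# → ∀ c → ∑ Fs(λ x → ∑ Fs λ y → λ'(a ⊙ θ₀ x y ⊕ c ⊙ y)) ≡ - Q * λ'(c ⊙ (√ a) ⁻¹)
 ∑∑λ-θ₀ {a} na c = begin
  _ ≡⟨ ∑-swap Fs Fs _ ⟩
  ∑ Fs(λ y → ∑ Fs λ x → λ'(a ⊙ θ₀ x y ⊕ c ⊙ y)) ≡⟨ ∑-cong Fs inner ⟩
  ∑ Fs(λ y → Q * (χ(y ≟ √a⁻¹) * E y)) ≡⟨ ∑-*ˡ Fs Q _ ∙ cong(Q *_)(∑-sift 𝔽ˢ √a⁻¹(cong E)) ⟩
  Q * E √a⁻¹ ≡⟨ cong(Q *_)(λ-⊕ _ _ ∙ cong(_* λ'(c ⊙ √a⁻¹))(cong λ' unit ∙ λκ)) ⟩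
  Q * (-1ℤ * λ'(c ⊙ √a⁻¹)) ≡⟨ sign Q(λ'(c ⊙ √a⁻¹)) ⟩
  _ ∎
  where
  sign : ∀ x y → x * (-1ℤ * y) ≡ - x * y
  sign = ring
  √a⁻¹ = (√ a) ⁻¹
  E : Fq → ℤ
  E y = λ'(a ⊙ (κ ⊙ y ⊙ y) ⊕ c ⊙ y)
  unit : a ⊙ (κ ⊙ √a⁻¹ ⊙ √a⁻¹) ≡ κ
  unit = cong(_⊙ (κ ⊙ √a⁻¹ ⊙ √a⁻¹))(sym(sq-√ a)) ∙ solve 3(λ s k i → s :* s :* (k :* i :* i) := k :* ((s :* i) :* (s :* i))) refl(√ a) κ √a⁻¹ ∙
   cong(λ z → κ ⊙ (z ⊙ z))(⁻¹-inverse _ (√-≢0 na)) ∙ cong(κ ⊙_)(⊙-idˡ 1#) ∙ ⊙-idʳ κ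
  √a≡ay : ∀ {y} → √ a ≡ a ⊙ y → y ≡ √a⁻¹
  √a≡ay {y} e = ⊙-cancelˡ(√-≢0 na)(⊙-cancelˡ(√-≢0 na)(sym(⊙-assoc(√ a)(√ a) y) ∙ cong(_⊙ y)(sq-√ a) ∙ sym e ∙
   sym(cong(√ a ⊙_)(⁻¹-inverse _ (√-≢0 na)) ∙ ⊙-idʳ _)))
  ay≡√a : ∀ {y} → y ≡ √a⁻¹ → √ a ≡ a ⊙ y
  ay≡√a refl = sym(cong(_⊙ √a⁻¹)(sym(sq-√ a)) ∙ ⊙-assoc(√ a)(√ a) _ ∙ cong(√ a ⊙_)(⁻¹-inverse _ (√-≢0 na)) ∙ ⊙-idʳ _)
  inner : ∀ y → ∑ Fs(λ x → λ'(a ⊙ θ₀ x y ⊕ c ⊙ y)) ≡ Q * (χ(y ≟ √a⁻¹) * E y)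
  inner y = begin
   _ ≡⟨ ∑-cong Fs(λ x → cong λ'(solve 5(λ a x y k c → a :* (x :* x :+ x :* y :+ k :* y :* y) :+ c :* y
    := (a :* (x :* x) :+ a :* y :* x) :+ (a :* (k :* y :* y) :+ c :* y)) refl a x y κ c) ∙ λ-⊕ _ _) ⟩
   ∑ Fs(λ x → λ'(a ⊙ sq x ⊕ a ⊙ y ⊙ x) * E y) ≡⟨ ∑-*ʳ Fs(E y) _ ⟩
   ∑ Fs(λ x → λ'(a ⊙ sq x ⊕ a ⊙ y ⊙ x)) * E y ≡⟨ cong(_* E y)(∑λ-quadratic a(a ⊙ y) ∙ cong(Q *_)(χ-⇔(√ a ≟ a ⊙ y)(y ≟ √a⁻¹) √a≡ay ay≡√a)) ⟩
   Q * χ(y ≟ √a⁻¹) * E y ≡⟨ Z.*-assoc Q _ _ ⟩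
   _ ∎

 -- The norm equation θ₀ = 1 is detected by characters λ(aθ₀ + a). For a ≠ 0 write a = b²: the inner
 -- sum is -q λ(c/b), and the sum over b is a Kloosterman sum. At c = 0 the result is q + 1, the
 -- order of SO⁻(2,q), because K(0) = -1.
 ∑SO : ∀ c → ∑ Fs(λ x → ∑ Fs λ y → χ(θ₀ x y ≟ 1#) * λ'(c ⊙ y)) ≡ Q * χ(c ≟ 0#) - K c
 ∑SO c = q-cancel(begin
  _ ≡⟨ sym(∑-*ˡ Fs Q _) ∙ ∑-cong Fs(λ x → sym(∑-*ˡ Fs Q _)) ⟩
  ∑ Fs(λ x → ∑ Fs λ y → Q * (χ(θ₀ x y ≟ 1#) * λ'(c ⊙ y))) ≡⟨ ∑-cong Fs(λ x → ∑-cong Fs(expand x) ∙ ∑-swap Fs Fs _) ⟩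
  ∑ Fs(λ x → ∑ Fs λ a → ∑ Fs λ y → λ' a * λ'(a ⊙ θ₀ x y ⊕ c ⊙ y)) ≡⟨ ∑-swap Fs Fs _ ⟩
  ∑ Fs(λ a → ∑ Fs λ x → ∑ Fs λ y → λ' a * λ'(a ⊙ θ₀ x y ⊕ c ⊙ y)) ≡⟨ ∑-cong Fs(λ a → ∑-cong Fs(λ x → ∑-*ˡ Fs(λ' a) _) ∙ ∑-*ˡ Fs(λ' a) _) ⟩
  ∑ Fs(λ a → λ' a * Θ a) ≡⟨ ∑-split₀ _ ⟩
  λ' 0# * Θ 0# + ∑ F*(λ a → λ' a * Θ a) ≡⟨ cong₂ _+_ (cong₂ _*_ λ-0 Θ0 ∙ Z.*-identityˡ _) rest ⟩
  Q * (Q * χ(c ≟ 0#)) + - Q * K c ≡⟨ combine Q(χ(c ≟ 0#))(K c) ⟩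
  _ ∎)
  where
  Θ : Fq → ℤ
  Θ a = ∑ Fs(λ x → ∑ Fs λ y → λ'(a ⊙ θ₀ x y ⊕ c ⊙ y))
  combine : ∀ q t k → q * (q * t) + - q * k ≡ q * (q * t - k)
  combine = ring
  expand : ∀ x y → Q * (χ(θ₀ x y ≟ 1#) * λ'(c ⊙ y)) ≡ ∑ Fs(λ a → λ' a * λ'(a ⊙ θ₀ x y ⊕ c ⊙ y))
  expand x y = sym(Z.*-assoc Q _ _) ∙ cong(_* λ'(c ⊙ y))(sym(∑λ-detect(θ₀ x y) 1#)) ∙ sym(∑-*ʳ Fs(λ'(c ⊙ y)) _) ∙
   ∑-cong Fs(λ a → sym(λ-⊕ _ _) ∙ cong λ'(solve 3(λ a t d → a :* (t :+ con true) :+ d := a :+ (a :* t :+ d)) refl a(θ₀ x y)(c ⊙ y)) ∙ λ-⊕ _ _)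
  Θ0 : Θ 0# ≡ Q * (Q * χ(c ≟ 0#))
  Θ0 = ∑-cong Fs(λ x → ∑-cong Fs(λ y → cong λ'(cong(_⊕ c ⊙ y)(⊙-0ˡ(θ₀ x y)) ∙ ⊕-idˡ _)) ∙ ∑λ-⊙ c) ∙ ∑-const Fs _
  rest : ∑ F*(λ a → λ' a * Θ a) ≡ - Q * K c
  rest = sym(∑nz-sq _) ∙ ∑-nz-cong(λ b nb → begin
   _ ≡⟨ cong₂ _*_ (λ-sq b)(∑∑λ-θ₀(⊙-≢0 nb nb) c ∙ cong(λ z → - Q * λ'(c ⊙ z ⁻¹))(√-sq b)) ⟩
   λ' b * (- Q * λ'(c ⊙ b ⁻¹)) ≡⟨ *-swapˡ(λ' b)(- Q) _ ⟩
   - Q * (λ' b * λ'(c ⊙ b ⁻¹)) ≡⟨ cong(- Q *_)(sym(λ-⊕ b _)) ⟩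
   _ ∎) ∙ ∑-*ˡ F*(- Q) _

 detect-inverse : ∀ {β} → β ≢ 0# → (f : Fq → ℤ) → ∑ F*(λ α → f α * χ(β ≟ α ⁻¹)) ≡ f(β ⁻¹)
 detect-inverse {β} nβ f = ∑-nz-cong(λ α nα → Z.*-comm(f α) _ ∙ χ-match(β ≟ α ⁻¹)(α ≟ β ⁻¹)
   (λ { refl → sym(⁻¹-involutive nα) , cong f(sym(⁻¹-involutive nα)) }) λ { refl → sym(⁻¹-involutive nβ) }) ∙
  ∑-*ʳ F*(f(β ⁻¹)) _ ∙ cong(_* f(β ⁻¹))(∑-unique _≟_ F* nonzeros-unique(β ⁻¹)(∈nonzeros⁺(⁻¹-≢0 nβ))) ∙ Z.*-identityˡ _

 detect-inverse₀ : (f : Fq → ℤ) → ∑ F*(λ α → f α * χ(0# ≟ α ⁻¹)) ≡ 0ℤ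
 detect-inverse₀ f = ∑-nz-cong(λ α nα → cong(f α *_)(χ-no(0# ≟ α ⁻¹) λ e → ⁻¹-≢0 nα(sym e)) ∙ Z.*-zeroʳ(f α)) ∙ ∑-zero F*

 ∑λK : ∀ β → ∑ Fs(λ a → λ'(a ⊙ β) * K a) ≡ Q * ∑ F*(λ α → λ' α * χ(β ≟ α ⁻¹))
 ∑λK β = begin
  _ ≡⟨ ∑-cong Fs(λ a → sym(∑-*ˡ F*(λ'(a ⊙ β)) _)) ⟩
  ∑ Fs(λ a → ∑ F* λ α → λ'(a ⊙ β) * λ'(α ⊕ a ⊙ α ⁻¹)) ≡⟨ ∑-swap Fs F* _ ⟩
  ∑ F*(λ α → ∑ Fs λ a → λ'(a ⊙ β) * λ'(α ⊕ a ⊙ α ⁻¹)) ≡⟨ ∑-cong F*(λ α → ∑-cong Fs(λ a → rearrange a α) ∙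
   ∑-*ˡ Fs(λ' α) _ ∙ cong(λ' α *_)(∑λ-detect β(α ⁻¹)) ∙ *-swapˡ(λ' α) Q _) ⟩
  ∑ F*(λ α → Q * (λ' α * χ(β ≟ α ⁻¹))) ≡⟨ ∑-*ˡ F* Q _ ⟩
  _ ∎
  where
  rearrange : ∀ a α → λ'(a ⊙ β) * λ'(α ⊕ a ⊙ α ⁻¹) ≡ λ' α * λ'(a ⊙ (β ⊕ α ⁻¹))
  rearrange a α = sym(λ-⊕ _ _) ∙ cong λ'(solve 4(λ a b x y → a :* b :+ (x :+ a :* y) := x :+ a :* (b :+ y)) refl a β α(α ⁻¹)) ∙ λ-⊕ _ _

 ∑λK₂ : ∀ β → ∑ Fs(λ a → λ'(a ⊙ β) * K₂ a) ≡ Q * ∑ F*(λ s → ∑ F* λ t → λ'(s ⊕ t) * χ(β ≟ s ⁻¹ ⊙ t ⁻¹))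
 ∑λK₂ β = begin
  _ ≡⟨ ∑-cong Fs(λ a → cong(λ'(a ⊙ β) *_)(K₂-∑∑ a) ∙ sym(∑-*ˡ F*(λ'(a ⊙ β)) _) ∙ ∑-cong F* λ s → sym(∑-*ˡ F*(λ'(a ⊙ β)) _)) ⟩
  ∑ Fs(λ a → ∑ F* λ s → ∑ F* λ t → λ'(a ⊙ β) * λ'(s ⊕ t ⊕ a ⊙ s ⁻¹ ⊙ t ⁻¹)) ≡⟨ ∑-swap Fs F* _ ∙ ∑-cong F*(λ s → ∑-swap Fs F* _) ⟩
  ∑ F*(λ s → ∑ F* λ t → ∑ Fs λ a → λ'(a ⊙ β) * λ'(s ⊕ t ⊕ a ⊙ s ⁻¹ ⊙ t ⁻¹)) ≡⟨ ∑-cong F*(λ s → ∑-cong F*(λ t → ∑-cong Fs(λ a → rearrange a s t) ∙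
   ∑-*ˡ Fs(λ'(s ⊕ t)) _ ∙ cong(λ'(s ⊕ t) *_)(∑λ-detect β(s ⁻¹ ⊙ t ⁻¹)) ∙ *-swapˡ(λ'(s ⊕ t)) Q _) ∙ ∑-*ˡ F* Q _) ⟩
  ∑ F*(λ s → Q * ∑ F* λ t → λ'(s ⊕ t) * χ(β ≟ s ⁻¹ ⊙ t ⁻¹)) ≡⟨ ∑-*ˡ F* Q _ ⟩
  _ ∎
  where
  rearrange : ∀ a s t → λ'(a ⊙ β) * λ'(s ⊕ t ⊕ a ⊙ s ⁻¹ ⊙ t ⁻¹) ≡ λ'(s ⊕ t) * λ'(a ⊙ (β ⊕ s ⁻¹ ⊙ t ⁻¹))
  rearrange a s t = sym(λ-⊕ _ _) ∙ cong λ'(solve 5(λ a b x s t → a :* b :+ (x :+ a :* s :* t) := x :+ a :* (b :+ s :* t)) refl a β(s ⊕ t)(s ⁻¹)(t ⁻¹)) ∙ λ-⊕ _ _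

 ∑λK₂-0 : ∑ Fs(λ a → λ'(a ⊙ 0#) * K₂ a) ≡ 0ℤ
 ∑λK₂-0 = ∑λK₂ 0# ∙ cong(Q *_)(∑-nz-cong(λ s ns → ∑-nz-cong(λ t nt →
  cong(λ'(s ⊕ t) *_)(χ-no(0# ≟ s ⁻¹ ⊙ t ⁻¹) λ e → ⊙-≢0(⁻¹-≢0 ns)(⁻¹-≢0 nt)(sym e)) ∙ Z.*-zeroʳ(λ'(s ⊕ t))) ∙ ∑-zero F*) ∙ ∑-zero F*) ∙ Z.*-zeroʳ Q

 -- Orthogonality forces t = 1/(sβ), and the sum over s that is left is K(1/β). So the frequencies
 -- of the traces in the cases 2 and 4 are governed by Kloosterman sums again.
 ∑λK₂-≢0 : ∀ {β} → β ≢ 0# → ∑ Fs(λ a → λ'(a ⊙ β) * K₂ a) ≡ Q * K(β ⁻¹)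
 ∑λK₂-≢0 {β} nβ = ∑λK₂ β ∙ cong(Q *_)(∑-nz-cong λ s ns → ∑-nz-cong(λ t nt → cong(λ'(s ⊕ t) *_)(χ-⇔(β ≟ s ⁻¹ ⊙ t ⁻¹)(s ⊙ β ≟ t ⁻¹)
    (λ { refl → sym(⊙-assoc s _ _) ∙ cong(_⊙ t ⁻¹)(⁻¹-inverse s ns) ∙ ⊙-idˡ _ })
    λ e → sym(sym(⊙-assoc _ s β) ∙ cong(_⊙ β)(⁻¹-inverseˡ ns) ∙ ⊙-idˡ β) ∙ cong(s ⁻¹ ⊙_) e)) ∙
   detect-inverse(⊙-≢0 ns nβ)(λ t → λ'(s ⊕ t)) ∙ cong(λ z → λ'(s ⊕ z))(⁻¹-⊙ ns nβ ∙ ⊙-comm _ _))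

 K₂-0 : K₂ 0# ≡ 1ℤ
 K₂-0 = K₂-∑∑ 0# ∙ ∑-cong F*(λ s → ∑-cong F* λ t → cong λ'(solve 4(λ s t x y → s :+ t :+ con false :* x :* y := s :+ t) refl s t(s ⁻¹)(t ⁻¹)) ∙ λ-⊕ s t) ∙
  ∑-* F* F* λ' λ' ∙ cong₂ _*_ ∑nz-λ ∑nz-λ

-- The neighbour relation on the abscissas of an elliptic curve

-- With X = A/B and X' = C/D, the relation Rel is the symmetric biquadratic equation
-- (XX')² + x²(X² + X'²) + xXX' + b² = 0; it relates the abscissas of P and P + Q on an elliptic curve,
-- Q having abscissa x. For fixed X it is a quadratic equation for X' whose two roots are the two neighbours of X.
module VietaJump {c ℓ} (R : CommutativeRing c ℓ)
 (2≈0 : CommutativeRing._≈_ R(CommutativeRing._+_ R(CommutativeRing.1# R)(CommutativeRing.1# R))(CommutativeRing.0# R))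
 (x b b' : CommutativeRing.Carrier R)(bb'≈1 : CommutativeRing._≈_ R(CommutativeRing._*_ R b b')(CommutativeRing.1# R)) where
 open CommutativeRing R using (Carrier; _≈_; 0#; 1#) renaming (_+_ to infixl 6 _⊞_; _*_ to infixl 7 _⊠_)
 private
  module R = CommutativeRing R
 open Char2Solver R 2≈0

 Rel : (A B C D : Carrier) → Set ℓ
 Rel A B C D = (A ⊠ A ⊠ (C ⊠ C) ⊞ x ⊠ x ⊠ (B ⊠ B ⊠ (C ⊠ C) ⊞ A ⊠ A ⊠ (D ⊠ D)) ⊞ x ⊠ A ⊠ B ⊠ C ⊠ D ⊞ b ⊠ b ⊠ (B ⊠ B ⊠ (D ⊠ D))) ≈ 0#

 lead mid last : Carrier → Carrier → Carrier
 lead A B = (A ⊞ x ⊠ B) ⊠ (A ⊞ x ⊠ B)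
 mid A B = x ⊠ A ⊠ B
 last A B = x ⊠ x ⊠ (A ⊠ A) ⊞ b ⊠ b ⊠ (B ⊠ B)

 Rel-sym : ∀ {A B C D} → Rel A B C D → Rel C D A B
 Rel-sym {A} {B} {C} {D} e = R.trans(solve 6(λ A B C D x b →
   C :* C :* (A :* A) :+ x :* x :* (D :* D :* (A :* A) :+ C :* C :* (B :* B)) :+ x :* C :* D :* A :* B :+ b :* b :* (D :* D :* (B :* B))
   := A :* A :* (C :* C) :+ x :* x :* (B :* B :* (C :* C) :+ A :* A :* (D :* D)) :+ x :* A :* B :* C :* D :+ b :* b :* (B :* B :* (D :* D))) R.refl A B C D x b) e

 private
  quadratic : ∀ A B C D → (lead A B ⊠ (C ⊠ C) ⊞ mid A B ⊠ (C ⊠ D) ⊞ last A B ⊠ (D ⊠ D))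
   ≈ (A ⊠ A ⊠ (C ⊠ C) ⊞ x ⊠ x ⊠ (B ⊠ B ⊠ (C ⊠ C) ⊞ A ⊠ A ⊠ (D ⊠ D)) ⊞ x ⊠ A ⊠ B ⊠ C ⊠ D ⊞ b ⊠ b ⊠ (B ⊠ B ⊠ (D ⊠ D)))
  quadratic A B C D = solve 6(λ A B C D x b →
   (A :+ x :* B) :* (A :+ x :* B) :* (C :* C) :+ x :* A :* B :* (C :* D) :+ (x :* x :* (A :* A) :+ b :* b :* (B :* B)) :* (D :* D)
   := A :* A :* (C :* C) :+ x :* x :* (B :* B :* (C :* C) :+ A :* A :* (D :* D)) :+ x :* A :* B :* C :* D :+ b :* b :* (B :* B :* (D :* D))) R.refl A B C D x b

 quadratic⇒Rel : ∀ {A B C D} → (lead A B ⊠ (C ⊠ C) ⊞ mid A B ⊠ (C ⊠ D) ⊞ last A B ⊠ (D ⊠ D)) ≈ 0# → Rel A B C D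
 quadratic⇒Rel {A} {B} {C} {D} e = R.trans(R.sym(quadratic A B C D)) e

 -- Bézout coefficients are carried along in place of a gcd: they turn the divisions below into
 -- explicit formulas, over any commutative ring of characteristic 2.
 Coprime : Carrier → Carrier → Set _
 Coprime A B = Σ Carrier λ U → Σ Carrier λ V → (U ⊠ A ⊞ V ⊠ B) ≈ 1#

 Coprime-* : ∀ {A B C} → Coprime A B → Coprime A C → Coprime A(B ⊠ C)
 Coprime-* {A} {B} {C} (U , V , e)(U' , V' , e') = U ⊠ U' ⊠ A ⊞ U ⊠ V' ⊠ C ⊞ U' ⊠ V ⊠ B , V ⊠ V' , R.trans
  (solve 7(λ A B C U V U' V' → (U :* U' :* A :+ U :* V' :* C :+ U' :* V :* B) :* A :+ V :* V' :* (B :* C) := (U :* A :+ V :* B) :* (U' :* A :+ V' :* C)) R.refl A B C U V U' V')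
  (R.trans(R.*-cong e e')(R.*-identityˡ 1#))

 Coprime-sym : ∀ {A B} → Coprime A B → Coprime B A
 Coprime-sym(U , V , e) = V , U , R.trans(R.+-comm _ _) e

 record Neighbour (A B C D : Carrier) : Set(c Level.⊔ ℓ) where
  field
   C' D' : Carrier
   leads : (D ⊠ D') ≈ lead A B
   mids : (C ⊠ D' ⊞ C' ⊠ D) ≈ mid A B
   lasts : (C ⊠ C') ≈ last A B
   relation : Rel A B C' D'
   coprime : Coprime C' D'

 -- The second root of a quadratic with coprime numerator and denominator of the first root given:
 -- Bézout coefficients make both divisions explicit.
 neighbour : ∀ {A B C D} → Coprime A B → Coprime C D → Rel A B C D → Neighbour A B C D
 neighbour {A} {B} {C} {D} (U₀ , V₀ , e₀)(U , V , e) rel = record { C' = C' ; D' = D' ; leads = leads ; mids = mids ; lasts = lasts ; relation = relation ; coprime = mem-1 }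
  where
  L = lead A B
  M = mid A B
  N = last A B
  D' = U ⊠ U ⊠ (M ⊠ C ⊞ N ⊠ D) ⊞ L ⊠ (V ⊠ V) ⊠ D
  C' = V ⊠ V ⊠ (L ⊠ C ⊞ M ⊠ D) ⊞ N ⊠ (U ⊠ U) ⊠ C
  w = U ⊠ C ⊞ V ⊠ D
  quad : (L ⊠ (C ⊠ C) ⊞ M ⊠ (C ⊠ D) ⊞ N ⊠ (D ⊠ D)) ≈ 0#
  quad = R.trans(quadratic A B C D) rel
  unit : ∀ Y Z → (Y ⊠ (w ⊠ w) ⊞ Z ⊠ (L ⊠ (C ⊠ C) ⊞ M ⊠ (C ⊠ D) ⊞ N ⊠ (D ⊠ D))) ≈ Y
  unit Y Z = R.trans(R.+-cong(R.*-congˡ(R.trans(R.*-cong e e)(R.*-identityˡ 1#)))(R.trans(R.*-congˡ quad)(R.zeroʳ Z)))(R.trans(R.+-identityʳ _)(R.*-identityʳ Y))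
  leads : (D ⊠ D') ≈ L
  leads = R.trans(solve 7(λ L M N C D U V → D :* (U :* U :* (M :* C :+ N :* D) :+ L :* (V :* V) :* D)
   := L :* ((U :* C :+ V :* D) :* (U :* C :+ V :* D)) :+ U :* U :* (L :* (C :* C) :+ M :* (C :* D) :+ N :* (D :* D))) R.refl L M N C D U V)(unit L(U ⊠ U))
  lasts : (C ⊠ C') ≈ N
  lasts = R.trans(solve 7(λ L M N C D U V → C :* (V :* V :* (L :* C :+ M :* D) :+ N :* (U :* U) :* C)
   := N :* ((U :* C :+ V :* D) :* (U :* C :+ V :* D)) :+ V :* V :* (L :* (C :* C) :+ M :* (C :* D) :+ N :* (D :* D))) R.refl L M N C D U V)(unit N(V ⊠ V))
  mids : (C ⊠ D' ⊞ C' ⊠ D) ≈ M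
  mids = R.trans(solve 7(λ L M N C D U V → C :* (U :* U :* (M :* C :+ N :* D) :+ L :* (V :* V) :* D) :+ (V :* V :* (L :* C :+ M :* D) :+ N :* (U :* U) :* C) :* D
   := M :* ((U :* C :+ V :* D) :* (U :* C :+ V :* D)) :+ con false :* (L :* (C :* C) :+ M :* (C :* D) :+ N :* (D :* D))) R.refl L M N C D U V)(unit M 0#)
  relation : Rel A B C' D'
  relation = quadratic⇒Rel(R.trans(R.+-cong(R.+-cong(R.*-congʳ(R.sym leads))(R.*-congʳ(R.sym mids)))(R.*-congʳ(R.sym lasts)))
   (solve 4(λ C D C' D' → D :* D' :* (C' :* C') :+ (C :* D' :+ C' :* D) :* (C' :* D') :+ C :* C' :* (D' :* D') := con false) R.refl C D C' D'))
  -- The ideal generated by C' and D'. It contains the three coefficients L, M, N. Using the Bézout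
  -- relation of A, B and the inverse of b, it is seen to contain in turn x³, x, then A² and B², and
  -- finally 1.
  Mem : Carrier → Set _
  Mem z = Σ Carrier λ u → Σ Carrier λ v → (u ⊠ C' ⊞ v ⊠ D') ≈ z
  comb : ∀ {y z} t α β → t ≈ (α ⊠ y ⊞ β ⊠ z) → Mem y → Mem z → Mem t
  comb {y} {z} t α β eq(u , v , p)(u' , v' , p') = α ⊠ u ⊞ β ⊠ u' , α ⊠ v ⊞ β ⊠ v' , R.trans
   (solve 8(λ α β u v u' v' C D → (α :* u :+ β :* u') :* C :+ (α :* v :+ β :* v') :* D := α :* (u :* C :+ v :* D) :+ β :* (u' :* C :+ v' :* D)) R.refl α β u v u' v' C' D')
   (R.trans(R.+-cong(R.*-congˡ p)(R.*-congˡ p'))(R.sym eq))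
  mem-L : Mem L
  mem-L = 0# , D , R.trans(R.+-congʳ(R.zeroˡ C'))(R.trans(R.+-identityˡ _) leads)
  mem-N : Mem N
  mem-N = C , 0# , R.trans(R.+-congˡ(R.zeroˡ D'))(R.trans(R.+-identityʳ _) lasts)
  mem-M : Mem M
  mem-M = D , C , R.trans(R.trans(R.+-comm _ _)(R.+-congˡ(R.*-comm D C'))) mids
  sq4 : ∀ z → z ≈ (z ⊠ (U₀ ⊠ U₀ ⊠ (U₀ ⊠ U₀) ⊠ (A ⊠ A ⊠ (A ⊠ A)) ⊞ V₀ ⊠ V₀ ⊠ (V₀ ⊠ V₀) ⊠ (B ⊠ B ⊠ (B ⊠ B))))
  sq4 z = R.trans(R.sym(R.*-identityʳ z))(R.*-congˡ(R.trans(R.sym(R.trans(R.*-cong(R.*-cong e₀ e₀)(R.*-cong e₀ e₀))(R.trans(R.*-cong(R.*-identityˡ 1#)(R.*-identityˡ 1#))(R.*-identityˡ 1#))))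
   (solve 4(λ A B U V → (U :* A :+ V :* B) :* (U :* A :+ V :* B) :* ((U :* A :+ V :* B) :* (U :* A :+ V :* B)) := U :* U :* (U :* U) :* (A :* A :* (A :* A)) :+ V :* V :* (V :* V) :* (B :* B :* (B :* B))) R.refl A B U₀ V₀)))
  sq2 : ∀ z → z ≈ (z ⊠ (U₀ ⊠ U₀ ⊠ (A ⊠ A) ⊞ V₀ ⊠ V₀ ⊠ (B ⊠ B)))
  sq2 z = R.trans(R.sym(R.*-identityʳ z))(R.*-congˡ(R.trans(R.sym(R.trans(R.*-cong e₀ e₀)(R.*-identityˡ 1#)))
   (solve 4(λ A B U V → (U :* A :+ V :* B) :* (U :* A :+ V :* B) := U :* U :* (A :* A) :+ V :* V :* (B :* B)) R.refl A B U₀ V₀)))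
  b'²b²≈1 : (b' ⊠ b' ⊠ (b ⊠ b)) ≈ 1#
  b'²b²≈1 = R.trans(solve 2(λ b b' → b' :* b' :* (b :* b) := (b :* b') :* (b :* b')) R.refl b b')(R.trans(R.*-cong bb'≈1 bb'≈1)(R.*-identityˡ 1#))
  unb : ∀ z → z ≈ (b' ⊠ b' ⊠ (b ⊠ b ⊠ z))
  unb z = R.sym(R.trans(R.sym(R.*-assoc _ _ z))(R.trans(R.*-congʳ b'²b²≈1)(R.*-identityˡ z)))
  mem-x³B³ : Mem(x ⊠ x ⊠ x ⊠ (B ⊠ B ⊠ B))
  mem-x³B³ = comb _ (x ⊠ B) A(solve 3(λ x A B → x :* x :* x :* (B :* B :* B) := x :* B :* ((A :+ x :* B) :* (A :+ x :* B)) :+ A :* (x :* A :* B)) R.refl x A B) mem-L mem-M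
  mem-xA³ : Mem(x ⊠ (A ⊠ A ⊠ A))
  mem-xA³ = comb _ (x ⊠ A)(x ⊠ x ⊠ B)(solve 3(λ x A B → x :* (A :* A :* A) := x :* A :* ((A :+ x :* B) :* (A :+ x :* B)) :+ x :* x :* B :* (x :* A :* B)) R.refl x A B) mem-L mem-M
  mem-x³ : Mem(x ⊠ x ⊠ x)
  mem-x³ = comb _ (x ⊠ x ⊠ (U₀ ⊠ U₀ ⊠ (U₀ ⊠ U₀)) ⊠ A)(V₀ ⊠ V₀ ⊠ (V₀ ⊠ V₀) ⊠ B)(R.trans(sq4(x ⊠ x ⊠ x))
   (solve 5(λ x A B U V → x :* x :* x :* (U :* U :* (U :* U) :* (A :* A :* (A :* A)) :+ V :* V :* (V :* V) :* (B :* B :* (B :* B)))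
    := x :* x :* (U :* U :* (U :* U)) :* A :* (x :* (A :* A :* A)) :+ V :* V :* (V :* V) :* B :* (x :* x :* x :* (B :* B :* B))) R.refl x A B U₀ V₀)) mem-xA³ mem-x³B³
  mem-xB² : Mem(x ⊠ (B ⊠ B))
  mem-xB² = comb _ (b' ⊠ b' ⊠ x)(b' ⊠ b' ⊠ (A ⊠ A))(R.trans(unb _)
   (solve 5(λ x A B b b' → b' :* b' :* (b :* b :* (x :* (B :* B))) := b' :* b' :* x :* (x :* x :* (A :* A) :+ b :* b :* (B :* B)) :+ b' :* b' :* (A :* A) :* (x :* x :* x)) R.refl x A B b b')) mem-N mem-x³
  mem-xA² : Mem(x ⊠ (A ⊠ A))
  mem-xA² = comb _ x(B ⊠ B)(solve 3(λ x A B → x :* (A :* A) := x :* ((A :+ x :* B) :* (A :+ x :* B)) :+ B :* B :* (x :* x :* x)) R.refl x A B) mem-L mem-x³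
  mem-x : Mem x
  mem-x = comb _ (U₀ ⊠ U₀)(V₀ ⊠ V₀)(R.trans(sq2 x)(solve 5(λ x A B U V → x :* (U :* U :* (A :* A) :+ V :* V :* (B :* B)) := U :* U :* (x :* (A :* A)) :+ V :* V :* (x :* (B :* B))) R.refl x A B U₀ V₀)) mem-xA² mem-xB²
  mem-A² : Mem(A ⊠ A)
  mem-A² = comb _ 1#(x ⊠ (B ⊠ B))(solve 3(λ x A B → A :* A := con true :* ((A :+ x :* B) :* (A :+ x :* B)) :+ x :* (B :* B) :* x) R.refl x A B) mem-L mem-x
  mem-B² : Mem(B ⊠ B)
  mem-B² = comb _ (b' ⊠ b')(b' ⊠ b' ⊠ x ⊠ (A ⊠ A))(R.trans(unb _)
   (solve 5(λ x A B b b' → b' :* b' :* (b :* b :* (B :* B)) := b' :* b' :* (x :* x :* (A :* A) :+ b :* b :* (B :* B)) :+ b' :* b' :* x :* (A :* A) :* x) R.refl x A B b b')) mem-N mem-x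
  mem-1 : Mem 1#
  mem-1 = comb _ (U₀ ⊠ U₀)(V₀ ⊠ V₀)(R.trans(sq2 1#)(R.*-identityˡ _)) mem-A² mem-B²

odd-divides-2^ : ∀ {d} k r → d ≡ suc(2 · k) → d ∣ 2 ** r → d ≡ 1
odd-divides-2^ k zero e d∣ = ∣1⇒≡1 d∣
odd-divides-2^ {d} k(suc r) e d∣ = odd-divides-2^ k r e(coprime-divisor {d} {2} {2 ** r} coprime d∣)
 where
 coprime : ∀ {i} → i ∣ d × i ∣ 2 → i ≡ 1
 coprime {i} (i∣d , i∣2) = ∣1⇒≡1(∣m+n∣m⇒∣n(subst(i ∣_)(e ∙ N.+-comm 1(2 · k)) i∣d)(∣-trans i∣2(m∣m*n k)))

-- Of v and v + 1 one is odd, and an odd divisor of a power of 2 is 1. Hence v ≤ 1, and the product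
-- is at most 2 < 2^r. This makes the bound q ≥ v(v + 1) strict.
pronic≢2^ : ∀ v r → 2 ≤ r → v · suc v ≢ 2 ** r
pronic≢2^ v r r≥2 e = go(v ℕ.% 2)(v ℕ./ 2)(m%n<n v 2)(m≡m%n+[m/n]*n v 2)
 where
 small : 2 < 2 ** r
 small = N.^-monoʳ-< 2(s≤s(s≤s z≤n)) r≥2
 go : ∀ c k → c < 2 → v ≡ c ∔ k · 2 → ⊥
 go 0 k _ v≡ = N.<⇒≢(N.<-trans(s≤s z≤n) small)(cong(_· suc v)(sym v≡0) ∙ e)
  where
  v≡0 : v ≡ 0
  v≡0 = N.suc-injective(odd-divides-2^ k r(cong suc(v≡ ∙ N.*-comm k 2))(divides v(sym e)))
 go 1 k _ v≡ = N.<⇒≢ small(cong(λ w → w · suc w)(sym v≡1) ∙ e)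
  where
  v≡1 : v ≡ 1
  v≡1 = odd-divides-2^ k r(v≡ ∙ cong suc(N.*-comm k 2))(divides(suc v)(sym e ∙ N.*-comm v(suc v)))
 go(suc(suc _)) k(s≤s(s≤s())) _

-- The Hasse bound: heights along a progression of points

module WeilBound (𝒟 : FieldData)(β : FiniteField.Carrier(FieldData.𝔽 𝒟))(β≢0 : β ≢ FiniteField.0#(FieldData.𝔽 𝒟)) where
 open FieldArithmetic 𝒟 hiding (solve; _:=_; _:+_; _:*_; con)
 open Polynomials 𝒟
 open Characters 𝒟

 private
  module P = CommutativeRing polyRing
 open Char2Solver polyRing 2≈0ₚ using (solve; _:=_; _:+_; _:*_; con)

 mono-cong : ∀ {c d j k} → c ≡ d → j ≡ k → mono c j ≈ₚ mono d k
 mono-cong refl refl = P.refl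

 mono-1 : mono 1# 0 ≈ₚ 1ₚ
 mono-1 = coefs(λ { zero → refl ; (suc _) → refl })

 𝑥 𝑏 𝑏' : Poly
 𝑥 = mono 1# 1
 𝑏 = mono β 0
 𝑏' = mono(β ⁻¹) 0

 𝑏𝑏'≈1 : 𝑏 *ₚ 𝑏' ≈ₚ 1ₚ
 𝑏𝑏'≈1 = P.trans(mono-*-mono β(β ⁻¹) 0 0)(P.trans(mono-cong(⁻¹-inverse β β≢0) refl) mono-1)

 open VietaJump polyRing 2≈0ₚ 𝑥 𝑏 𝑏' 𝑏𝑏'≈1

 record Height (A B : Poly)(h : ℕ) : Set where
  field
   degˡ : Deg≤(coef A) h
   degʳ : Deg≤(coef B) h
   attained : coef A h ≢ 0# ⊎ coef B h ≢ 0#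
 open Height

 -- A common degree bound is lowered until one of the two coefficients at it is nonzero. The search
 -- cannot run through, because A = B = 0 contradicts the Bézout relation.
 height-exists : ∀ {A B} → Coprime A B → ∃[ h ] Height A B h
 height-exists {A} {B} (U , V , e) = search(bound A ⊔ bound B)(Deg≤-mono {coef A} (N.m≤m⊔n(bound A) _)(bounded A))(Deg≤-mono {coef B} (N.m≤n⊔m(bound A) _)(bounded B))
  where
  vanish : ∀ {f g} → (∀ n → coef g n ≡ 0#) → coef(f *ₚ g) 0 ≡ 0#
  vanish {f} {g} z = cong(coef f 0 ⊙_)(z 0) ∙ ⊙-0ʳ _
  lower : ∀ {f} n → Deg≤ f(suc n) → f(suc n) ≡ 0# → Deg≤ f n
  lower n d z k l with N.m≤n⇒m<n∨m≡n l
  ... | inj₁ l' = d k l'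
  ... | inj₂ refl = z
  search : ∀ n → Deg≤(coef A) n → Deg≤(coef B) n → ∃[ h ] Height A B h
  search n a b with coef A n ≟ 0# | coef B n ≟ 0#
  ... | no nz | _ = n , record { degˡ = a ; degʳ = b ; attained = inj₁ nz }
  ... | yes _ | no nz = n , record { degˡ = a ; degʳ = b ; attained = inj₂ nz }
  search(suc n) a b | yes za | yes zb = search n(lower n a za)(lower n b zb)
  search zero a b | yes za | yes zb = ⊥-elim(0≢1(sym(cong₂ _⊕_ (vanish {U} {A} (all a za))(vanish {V} {B} (all b zb)) ∙ ⊕-idˡ 0#) ∙ coef≡ e 0))
   where
   all : ∀ {f} → Deg≤ f 0 → f 0 ≡ 0# → ∀ n → f n ≡ 0#
   all d z zero = z
   all d z(suc n) = d(suc n)(s≤s z≤n)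

 -- The content at infinity is multiplicative (Gauss).
 height-gauss : ∀ {C D C' D' L M N h h'} H → Height C D h → Height C' D' h' → D *ₚ D' ≈ₚ L → C *ₚ D' +ₚ C' *ₚ D ≈ₚ M → C *ₚ C' ≈ₚ N →
  Deg≤(coef L) H → Deg≤(coef M) H → Deg≤(coef N) H → h ∔ h' ≤ H
 height-gauss {C} {D} {C'} {D'} {L} {M} {N} {h} {h'} H p p' eL eM eN dL dM dN with (h ∔ h') ℕ.≤? H
 ... | yes l = l
 ... | no nl = ⊥-elim(clash(attained p)(attained p'))
  where
  H< = N.≰⇒> nl
  dd' : coef D h ⊙ coef D' h' ≡ 0#
  dd' = sym(top-· h h'(degʳ p)(degʳ p')) ∙ coef≡ eL _ ∙ dL _ H<
  cc' : coef C h ⊙ coef C' h' ≡ 0#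
  cc' = sym(top-· h h'(degˡ p)(degˡ p')) ∙ coef≡ eN _ ∙ dN _ H<
  cross : coef C h ⊙ coef D' h' ⊕ coef C' h' ⊙ coef D h ≡ 0#
  cross = sym(cong₂ _⊕_ (top-· h h'(degˡ p)(degʳ p'))(cong(coef(C' *ₚ D))(N.+-comm h h') ∙ top-· h' h(degˡ p')(degʳ p))) ∙ coef≡ eM _ ∙ dM _ H<
  clash : coef C h ≢ 0# ⊎ coef D h ≢ 0# → coef C' h' ≢ 0# ⊎ coef D' h' ≢ 0# → ⊥
  clash(inj₁ c)(inj₁ c') = c'(⊙-nonzeroʳ c cc')
  clash(inj₂ d)(inj₂ d') = d'(⊙-nonzeroʳ d dd')
  clash(inj₁ c)(inj₂ d') = d'(⊙-nonzeroʳ c(sym(⊕-idʳ _) ∙ cong(coef C h ⊙ coef D' h' ⊕_)(sym(cong(_⊙ coef D h)(⊙-nonzeroʳ c cc') ∙ ⊙-0ˡ _)) ∙ cross))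
  clash(inj₂ d)(inj₁ c') = c'(⊙-nonzeroʳ d(⊙-comm _ _ ∙ sym(⊕-idˡ _) ∙ cong(_⊕ coef C' h' ⊙ coef D h)(sym(cong(coef C h ⊙_)(⊙-nonzeroʳ d dd') ∙ ⊙-0ʳ _)) ∙ cross))

 private
  +≤ : ∀ a b → suc a ∔ b ≤ suc a ∔ suc b
  +≤ a b = N.+-monoʳ-≤(suc a)(N.n≤1+n b)

 -- The 2 in 2h + 2 is the degree in x of the quadratic equation. It becomes the second difference
 -- of the heights.
 coefficient-degrees : ∀ {A B h} → Height A B h → let H = suc h ∔ suc h in
  Deg≤(coef(lead A B)) H × Deg≤(coef(mid A B)) H × Deg≤(coef(last A B)) H
 coefficient-degrees {A} {B} {h} p = Deg≤-·(suc h)(suc h) s s ,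
  Deg≤-mono {coef(mid A B)} (+≤ h h)(Deg≤-·(suc h) h(Deg≤-· 1 h dx(degˡ p))(degʳ p)) ,
  Deg≤-⊕ {coef(𝑥 *ₚ 𝑥 *ₚ (A *ₚ A))} {coef(𝑏 *ₚ 𝑏 *ₚ (B *ₚ B))}
   (Deg≤-mono {coef(𝑥 *ₚ 𝑥 *ₚ (A *ₚ A))} (N.≤-reflexive(cong suc(sym(N.+-suc h h))))(Deg≤-· 2(h ∔ h)(Deg≤-· 1 1 dx dx)(Deg≤-· h h(degˡ p)(degˡ p))))
   (Deg≤-mono {coef(𝑏 *ₚ 𝑏 *ₚ (B *ₚ B))} (N.≤-trans(N.n≤1+n _)(+≤ h h))(Deg≤-· 0(h ∔ h)(Deg≤-· 0 0 db db)(Deg≤-· h h(degʳ p)(degʳ p))))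
  where
  dx = monoₛ-Deg≤ 1# 1
  db = monoₛ-Deg≤ β 0
  s : Deg≤(coef(A +ₚ 𝑥 *ₚ B))(suc h)
  s = Deg≤-⊕ {coef A} {coef(𝑥 *ₚ B)} (Deg≤-mono {coef A} (N.n≤1+n h)(degˡ p))(Deg≤-· 1 h dx(degʳ p))

 -- Two adjacent points of an arithmetic progression on the curve, represented by their abscissas
 -- A/B and C/D in lowest terms with heights h and h'.
 record Link (h h' : ℕ) : Set where
  field
   {A B C D} : Poly
   coprimeˡ : Coprime A B
   coprimeʳ : Coprime C D
   heightˡ : Height A B h
   heightʳ : Height C D h'
   related : Rel A B C D

 swap-link : ∀ {h h'} → Link h h' → Link h' h
 swap-link l = record { coprimeˡ = coprimeʳ ; coprimeʳ = coprimeˡ ; heightˡ = heightʳ ; heightʳ = heightˡ ; related = Rel-sym related }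
  where open Link l

 -- The inequality half of the parallelogram law: h(P - Q) + h(P + Q) ≤ 2 h(P) + 2. The other
 -- neighbour is the second root of the quadratic equation, and Gauss's lemma at infinity bounds the
 -- two heights jointly.
 next-link : ∀ {h h'} → Link h h' → ∃[ h″ ] Link h h″ × h' ∔ h″ ≤ suc h ∔ suc h
 next-link {h} l = let (h″ , p″) = height-exists coprime ; (dL , dM , dN) = coefficient-degrees heightˡ in h″ ,
   record { coprimeˡ = coprimeˡ ; coprimeʳ = coprime ; heightˡ = heightˡ ; heightʳ = p″ ; related = relation } ,
   height-gauss(suc h ∔ suc h) heightʳ p″ leads mids lasts dL dM dN
  where
  open Link l
  open Neighbour(neighbour coprimeˡ coprimeʳ related)

 private
  step₁ : ∀ h h' h″ → h″ - h' ≡ (h + h″ + - (pos 2 + pos 2 * h')) + (h' - h) + pos 2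
  step₁ = ring
  step₂ : ∀ d n → 0ℤ + (d + pos 2 * n) + pos 2 ≡ d + pos 2 * (1ℤ + n)
  step₂ = ring
  step₃ : ∀ h h' → h' ≡ h + (h' - h)
  step₃ = ring
  step₄ : ∀ h n d → h + n * d + n * (n - 1ℤ) + (d + pos 2 * n) ≡ h + (1ℤ + n) * d + (1ℤ + n) * (1ℤ + n - 1ℤ)
  step₄ = ring
  step₀ : ∀ d → d + pos 2 * 0ℤ ≡ d
  step₀ = ring
  step₀' : ∀ h d → h + 0ℤ * d + 0ℤ * (0ℤ - 1ℤ) ≡ h
  step₀' = ring
  twice : ∀ h → pos 2 + pos 2 * h ≡ (1ℤ + h) + (1ℤ + h)
  twice = ring

 -- Second differences at most 2 and a first difference at most d keep the n-th height below h₀ + nd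
 -- + n(n - 1). The bound on the current difference is carried along to make the induction work.
 chain : ∀ {h₀ h₁} → Link h₁ h₀ → (d : ℤ) → pos h₁ - pos h₀ ℤ.≤ d → ∀ n →
  ∃[ h ] ∃[ h' ] Link h' h × pos h' - pos h ℤ.≤ d + pos 2 * pos n × pos h ℤ.≤ pos h₀ + pos n * d + pos n * (pos n - 1ℤ)
 chain {h₀} {h₁} l d le zero = h₀ , h₁ , l , Z.≤-trans le(Z.≤-reflexive(sym(step₀ d))) , Z.≤-reflexive(sym(step₀'(pos h₀) d))
 chain {h₀} {h₁} l d le(suc n) =
  let (h , h' , lₙ , a , b) = chain l d le n
      (h″ , lₙ₊₁ , c) = next-link lₙ
      c' : pos h + pos h″ + - (pos 2 + pos 2 * pos h') ℤ.≤ 0ℤ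
      c' = Z.i≤j⇒i-j≤0(Z.≤-trans(ℤ.+≤+ c)(Z.≤-reflexive(sym(twice(pos h')))))
  in h' , h″ , swap-link lₙ₊₁ ,
   Z.≤-trans(Z.≤-reflexive(step₁(pos h)(pos h')(pos h″)))(Z.≤-trans(Z.+-monoˡ-≤(pos 2)(Z.+-mono-≤ c' a))(Z.≤-reflexive(step₂ d(pos n)))) ,
   Z.≤-trans(Z.≤-reflexive(step₃(pos h)(pos h')))(Z.≤-trans(Z.+-mono-≤ b a)(Z.≤-reflexive(step₄(pos h₀)(pos n) d)))

 ℓ : ℕ
 ℓ = length F*

 half : ℕ
 half = 2 ** ℕ.pred r

 -- This is x^(q/2) (x + β/x)^(2^i), a polynomial as long as 2^i ≤ q/2.
 S-term : ℕ → Poly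
 S-term i = mono 1#(half ∔ 2 ** i) +ₚ mono(β ^F (2 ** i))(half ∸ 2 ** i)

 -- S-poly r is x^{q/2} tr(x + β/x) cleared of denominators.
 S-poly : ℕ → Poly
 S-poly zero = 0ₚ
 S-poly(suc n) = S-poly n +ₚ S-term n

 -- With y = x + β/x and T = y + y² + ... + y^(2^(n-1)) one has T² + T = y^(2^n) + y. The statement
 -- is this identity multiplied by x^q.
 S-telescope : ∀ n → n ≤ r → S-poly n *ₚ S-poly n +ₚ mono 1# half *ₚ S-poly n
  ≈ₚ mono 1#(2 · half ∔ 2 ** n) +ₚ mono 1#(2 · half ∔ 1) +ₚ (mono(β ^F (2 ** n))(2 · half ∸ 2 ** n) +ₚ mono β(2 · half ∸ 1))
 S-telescope zero _ = P.trans(solve 1(λ h → con false :* con false :+ h :* con false := con false) P.refl(mono 1# half))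
  (P.sym(P.trans(P.+-congˡ(P.+-congʳ(mono-cong(⊙-idʳ β) refl)))(solve 2(λ a c → a :+ a :+ (c :+ c) := con false) P.refl(mono 1#(2 · half ∔ 1))(mono β(2 · half ∸ 1)))))
 S-telescope(suc n) n<r = P.trans
  (solve 3(λ s t h → (s :+ t) :* (s :+ t) :+ h :* (s :+ t) := (s :* s :+ h :* s) :+ (t :* t :+ h :* t)) P.refl(S-poly n)(S-term n)(mono 1# half))
  (P.trans(P.+-cong(S-telescope n(N.<⇒≤ n<r)) term)(solve 6(λ a b c d e f → (a :+ b :+ (c :+ d)) :+ ((e :+ f) :+ (a :+ c)) := e :+ b :+ (f :+ d)) P.refl _ _ _ _ _ _))
  where
  2^n≤half : 2 ** n ≤ half
  2^n≤half = N.^-monoʳ-≤ 2(N.pred-mono-≤ n<r)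
  dbl : ∀ a → a ∔ a ≡ 2 · a
  dbl a = cong(a ∔_)(sym(N.+-identityʳ a))
  term : S-term n *ₚ S-term n +ₚ mono 1# half *ₚ S-term n ≈ₚ
   (mono 1#(2 · half ∔ 2 ** suc n) +ₚ mono(β ^F (2 ** suc n))(2 · half ∸ 2 ** suc n)) +ₚ (mono 1#(2 · half ∔ 2 ** n) +ₚ mono(β ^F (2 ** n))(2 · half ∸ 2 ** n))
  term = P.trans(solve 3(λ u v h → (u :+ v) :* (u :+ v) :+ h :* (u :+ v) := (u :* u :+ v :* v) :+ (h :* u :+ h :* v)) P.refl _ _ (mono 1# half))
   (P.+-cong(P.+-cong(P.trans(mono-*-mono 1# 1# _ _)(mono-cong(⊙-idˡ 1#)(dbl(half ∔ 2 ** n) ∙ N.*-distribˡ-+ 2 half(2 ** n))))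
             (P.trans(mono-*-mono _ _ _ _)(mono-cong(sym(^F-2* β(2 ** n)))(dbl(half ∸ 2 ** n) ∙ N.*-distribˡ-∸ 2 half(2 ** n)))))
        (P.+-cong(P.trans(mono-*-mono 1# 1# _ _)(mono-cong(⊙-idˡ 1#)(sym(N.+-assoc half half _) ∙ cong(_∔ 2 ** n)(dbl half))))
             (P.trans(mono-*-mono 1# _ _ _)(mono-cong(⊙-idˡ _)(sym(N.+-∸-assoc half 2^n≤half) ∙ cong(_∸ 2 ** n)(dbl half))))))

 𝑆 𝐸 𝑊 : Poly
 𝑆 = S-poly r
 𝐸 = mono 1# ℓ +ₚ 1ₚ
 𝑊 = mono 1#(suc q) +ₚ 𝑏

 2half≡q : 2 · half ≡ q
 2half≡q = sym q≡2*2^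

 -- At n = r the right side is x^q (y^q + y), which factors as (x^(q-1) + 1)(x^(q+1) + β): the first
 -- factor vanishes exactly at the nonzero field elements.
 S-equation : 𝑆 *ₚ 𝑆 +ₚ mono 1# half *ₚ 𝑆 ≈ₚ 𝐸 *ₚ 𝑊
 S-equation = P.trans(S-telescope r N.≤-refl)(P.trans
  (P.+-cong(P.+-cong(mono-cong refl(cong₂ _∔_ 2half≡q(sym size≡) ∙ cong(_∔ q)(sym length-nonzeros) ∙ sym(N.+-suc ℓ q)))(mono-cong refl(cong(_∔ 1) 2half≡q ∙ N.+-comm q 1)))
       (P.+-cong(mono-cong(cong(β ^F_)(sym size≡) ∙ fermat β)(cong₂ _∸_ 2half≡q(sym size≡) ∙ N.n∸n≡0 q))
            (mono-cong refl(cong(_∸ 1) 2half≡q ∙ cong ℕ.pred(sym length-nonzeros)))))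
  (P.sym(P.trans(solve 3(λ e w b → (e :+ con true) :* (w :+ b) := (e :* w :+ w) :+ (b :+ e :* b)) P.refl(mono 1# ℓ)(mono 1#(suc q)) 𝑏)
   (P.+-cong(P.+-congʳ(P.trans(mono-*-mono 1# 1# ℓ(suc q))(mono-cong(⊙-idˡ 1#) refl)))
    (P.+-congˡ(P.trans(mono-*-mono 1# β ℓ 0)(mono-cong(⊙-idˡ β)(N.+-identityʳ ℓ))))))))

 ^F-⊙ : ∀ x y n → (x ⊙ y) ^F n ≡ x ^F n ⊙ y ^F n
 ^F-⊙ x y zero = sym(⊙-idˡ 1#)
 ^F-⊙ x y(suc n) = cong(x ⊙ y ⊙_)(^F-⊙ x y n) ∙ FA.solve 4(λ x y a b → x FA.:* y FA.:*(a FA.:* b) FA.:= x FA.:* a FA.:*(y FA.:* b)) refl x y _ _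
  where module FA = FieldArithmetic 𝒟

 ^F-∸ : ∀ {α} → α ≢ 0# → ∀ {k n} → k ≤ n → α ^F (n ∸ k) ≡ α ^F n ⊙ (α ⁻¹) ^F k
 ^F-∸ {α} nα {k} {n} le = ⊙-cancelˡ {α ^F k} (λ e → nα(^F-≡0 k e))(begin
  α ^F k ⊙ α ^F (n ∸ k) ≡⟨ sym(^F-+ α k(n ∸ k)) ∙ cong(α ^F_)(N.m+[n∸m]≡n le) ⟩
  α ^F n ≡⟨ sym(cong(α ^F n ⊙_)(sym(^F-⊙ α(α ⁻¹) k) ∙ cong(_^F k)(⁻¹-inverse α nα) ∙ 1^ k) ∙ ⊙-idʳ _) ⟩
  α ^F n ⊙ (α ^F k ⊙ (α ⁻¹) ^F k) ≡⟨ sym(⊙-assoc _ _ _) ∙ cong(_⊙ (α ⁻¹) ^F k)(⊙-comm _ _) ∙ ⊙-assoc _ _ _ ⟩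
  α ^F k ⊙ (α ^F n ⊙ (α ⁻¹) ^F k) ∎)
  where
  1^ : ∀ k → 1# ^F k ≡ 1#
  1^ zero = refl
  1^(suc k) = ⊙-idˡ _ ∙ 1^ k

 eval-S : ∀ {α} → α ≢ 0# → ∀ n → n ≤ r → eval(S-poly n) α ≡ α ^F half ⊙ trace n(α ⊕ β ⊙ α ⁻¹)
 eval-S {α} nα zero _ = evalₛ-zero 1(λ _ → refl) α ∙ sym(⊙-0ʳ _)
 eval-S {α} nα(suc n) n<r = begin
  eval(S-poly n +ₚ S-term n) α ≡⟨ eval-+(S-poly n)(S-term n) α ∙ cong₂ _⊕_ (eval-S nα n(N.<⇒≤ n<r))
   (eval-+(mono 1#(half ∔ 2 ** n))(mono(β ^F (2 ** n))(half ∸ 2 ** n)) α ∙ cong₂ _⊕_ (eval-mono 1#(half ∔ 2 ** n) α ∙ ⊙-idˡ _ ∙ ^F-+ α half(2 ** n))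
    (eval-mono(β ^F (2 ** n))(half ∸ 2 ** n) α ∙ cong(β ^F (2 ** n) ⊙_)(^F-∸ nα(N.^-monoʳ-≤ 2(N.pred-mono-≤ n<r))) ∙ sym(⊙-assoc _ _ _) ∙ cong(_⊙ (α ⁻¹) ^F (2 ** n))(⊙-comm _ _) ∙ ⊙-assoc _ _ _)) ⟩
  α ^F half ⊙ t ⊕ (α ^F half ⊙ α ^F (2 ** n) ⊕ α ^F half ⊙ (β ^F (2 ** n) ⊙ (α ⁻¹) ^F (2 ** n))) ≡⟨ sym(⊙-distribˡ _ t _ ∙ cong(α ^F half ⊙ t ⊕_)(⊙-distribˡ _ _ _)) ⟩
  α ^F half ⊙ (t ⊕ (α ^F (2 ** n) ⊕ β ^F (2 ** n) ⊙ (α ⁻¹) ^F (2 ** n))) ≡⟨ cong(λ z → α ^F half ⊙ (t ⊕ z))(sym(^2^-⊕ n α _ ∙ cong(α ^F (2 ** n) ⊕_)(^F-⊙ β _ (2 ** n)))) ⟩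
  α ^F half ⊙ (t ⊕ (α ⊕ β ⊙ α ⁻¹) ^F (2 ** n)) ≡⟨ cong(α ^F half ⊙_)(sym(trace-suc n _)) ⟩
  α ^F half ⊙ trace(suc n)(α ⊕ β ⊙ α ⁻¹) ∎
  where t = trace n(α ⊕ β ⊙ α ⁻¹)

 S-small : ∀ n k → half ∔ 2 ** n ≤ k → coef(S-poly n) k ≡ 0#
 S-small zero k _ = refl
 S-small(suc n) k l = cong₂ _⊕_ (S-small n k(N.<⇒≤ lt))(cong₂ _⊕_ (monoₛ-Deg≤ 1# _ k lt)
   (monoₛ-Deg≤ _ _ k(N.≤-<-trans(N.≤-trans(N.m∸n≤m half(2 ** n))(N.m≤m+n half(2 ** n))) lt)) ∙ ⊕-idˡ 0#) ∙ ⊕-idˡ 0#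
  where
  lt : half ∔ 2 ** n < k
  lt = N.<-≤-trans(N.+-monoʳ-< half(N.^-monoʳ-< 2(s≤s(s≤s z≤n))(N.n<1+n n))) l

 S-degree : ∀ {r'} → r' ≡ r → Deg≤(coef(S-poly r')) q × coef(S-poly r') q ≡ 1#
 S-degree {zero} refl = ⊥-elim(N.<⇒≱ r≥1 z≤n)
 S-degree {suc n} refl = subst(λ z → Deg≤(coef(S-poly(suc n))) z × coef(S-poly(suc n)) z ≡ 1#)(cong(half ∔_)(sym(N.+-identityʳ half)) ∙ 2half≡q)
  ( (λ k l → cong₂ _⊕_ (S-small n k(N.<⇒≤ l))(cong₂ _⊕_ (monoₛ-Deg≤ 1# _ k l)(monoₛ-Deg≤ _ _ k(N.≤-<-trans(N.≤-trans(N.m∸n≤m half half)(N.m≤m+n half half)) l)) ∙ ⊕-idˡ 0#) ∙ ⊕-idˡ 0#)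
  , cong₂ _⊕_ (S-small n(half ∔ half) N.≤-refl)(cong₂ _⊕_ (monoₛ-top 1#(half ∔ half))
    (monoₛ-Deg≤ _ _ (half ∔ half)(N.≤-<-trans(N.≤-reflexive(N.n∸n≡0 half))(N.<-≤-trans(N.m^n>0 2 n)(N.m≤m+n half half)))) ∙ ⊕-idʳ 1#) ∙ ⊕-idˡ 1#)

 eval-E : ∀ {α} → α ≢ 0# → eval 𝐸 α ≡ 0#
 eval-E {α} nα = eval-+(mono 1# ℓ) 1ₚ α ∙ ≡⇒⊕≡0(eval-mono 1# ℓ α ∙ ⊙-idˡ _ ∙ ⊙-cancelˡ nα(cong(α ^F_) length-nonzeros ∙ fermat α ∙ sym(⊙-idʳ α)) ∙ sym(cong(1# ⊕_)(⊙-0ʳ α) ∙ ⊕-idʳ 1#))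

 Tβ : Fq → Fq
 Tβ α = tr(α ⊕ β ⊙ α ⁻¹)

 -- The nonzero elements split by the trace of α + β/α. The two lists give the factors of x^(q-1) +
 -- 1, and the length of the second is the number that determines K(β).
 zs₀ zs₁ : List Fq
 zs₀ = Data.List.filter(λ α → Tβ α ≟ 0#) F*
 zs₁ = Data.List.filter(λ α → Tβ α ≟ 1#) F*

 ∈zs₀ : ∀ {z} → z ∈ zs₀ → z ≢ 0# × Tβ z ≡ 0#
 ∈zs₀ i = let (j , e) = ∈-filter⁻(λ α → Tβ α ≟ 0#) {xs = F*} i in ∈nonzeros⁻ j , e

 ∈zs₁ : ∀ {z} → z ∈ zs₁ → z ≢ 0# × Tβ z ≡ 1#
 ∈zs₁ i = let (j , e) = ∈-filter⁻(λ α → Tβ α ≟ 1#) {xs = F*} i in ∈nonzeros⁻ j , e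

 zs-unique : Unique(zs₀ ++ zs₁)
 zs-unique = UniqueP.++⁺(UniqueP.filter⁺(λ α → Tβ α ≟ 0#) nonzeros-unique)(UniqueP.filter⁺(λ α → Tβ α ≟ 1#) nonzeros-unique)
  (λ (i , j) → 0≢1(sym(proj₂(∈zs₀ i)) ∙ proj₂(∈zs₁ j)))

 length-filter : {Q : Fq → Set} (Q? : ∀ x → Dec(Q x))(xs : List Fq) → pos(length(Data.List.filter Q? xs)) ≡ ∑ xs(λ x → χ(Q? x))
 length-filter Q? [] = refl
 length-filter Q?(x ∷ xs) with does(Q? x)
 ... | true = cong(ℤ._+_ 1ℤ)(length-filter Q? xs)
 ... | false = length-filter Q? xs ∙ sym(Z.+-identityˡ _)

 length-zs : length zs₀ ∔ length zs₁ ≡ ℓ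
 length-zs = Z.+-injective(cong₂ _+_ (length-filter(λ α → Tβ α ≟ 0#) F*)(length-filter(λ α → Tβ α ≟ 1#) F*) ∙
  sym(∑-+ F* _ _) ∙ ∑-cong F*(λ α → both α(tr-01(α ⊕ β ⊙ α ⁻¹))) ∙ ∑-length F*)
  where
  both : ∀ α → Tβ α ≡ 0# ⊎ Tβ α ≡ 1# → χ(Tβ α ≟ 0#) + χ(Tβ α ≟ 1#) ≡ 1ℤ
  both α(inj₁ e) = cong₂ _+_ (χ-yes(Tβ α ≟ 0#) e)(χ-no(Tβ α ≟ 1#) λ e' → 0≢1(sym e ∙ e'))
  both α(inj₂ e) = cong₂ _+_ (χ-no(Tβ α ≟ 0#) λ e' → 0≢1(sym e' ∙ e))(χ-yes(Tβ α ≟ 1#) e)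

 z₁ : ℕ
 z₁ = length zs₁

 Π₀ Π₁ : Poly
 Π₀ = Π-lin zs₀
 Π₁ = Π-lin zs₁

 Π-lin-++ : ∀ xs ys → Π-lin(xs ++ ys) ≈ₚ Π-lin xs *ₚ Π-lin ys
 Π-lin-++ [] ys = P.sym(P.*-identityˡ(Π-lin ys))
 Π-lin-++(x ∷ xs) ys = P.trans(P.*-congˡ {lin x} (Π-lin-++ xs ys))(P.sym(P.*-assoc(lin x)(Π-lin xs)(Π-lin ys)))

 Π-lin-degree : ∀ xs → Deg≤(coef(Π-lin xs))(length xs)
 Π-lin-degree [] = bounded 1ₚ
 Π-lin-degree(x ∷ xs) = Deg≤-· 1(length xs)(bounded(lin x))(Π-lin-degree xs)

 E≈Π₀Π₁ : 𝐸 ≈ₚ Π₀ *ₚ Π₁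
 E≈Π₀Π₁ = P.trans factors(P.trans(P.*-congˡ {Π-lin(zs₀ ++ zs₁)} {cofactor} {1ₚ} one)(P.trans(P.*-identityʳ _)(Π-lin-++ zs₀ zs₁)))
  where
  len : length(zs₀ ++ zs₁) ∔ 0 ≡ ℓ
  len = N.+-identityʳ _ ∙ ListP.length-++ zs₀ ∙ length-zs
  ℓ≥ : ∀ k → ℓ < k → coef 𝐸 k ≡ 0#
  ℓ≥(suc k) l = ⊕-idʳ _ ∙ monoₛ-Deg≤ 1# ℓ(suc k) l
  nz : ∀ {z} → z ∈ zs₀ ++ zs₁ → z ≢ 0#
  nz i with ∈-++⁻ zs₀ i
  ... | inj₁ j = proj₁(∈zs₀ j)
  ... | inj₂ j = proj₁(∈zs₁ j)
  open Factorisation(factor(zs₀ ++ zs₁) zs-unique 𝐸 0(subst(Deg≤(coef 𝐸))(sym len) ℓ≥)(All.tabulate λ i → eval-E(nz i)))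
  topE : ∀ {n} → n ≡ ℓ → n ≢ 0 → coef 𝐸 n ≡ 1#
  topE {zero} e ne = ⊥-elim(ne refl)
  topE {suc n} e ne = ⊕-idʳ _ ∙ cong(λ k → monoₛ 1# k(suc n))(sym e) ∙ monoₛ-top 1#(suc n)
  ℓ≢0 : ℓ ≢ 0
  ℓ≢0 e = N.<⇒≢(subst(1 <_)(sym size≡)(N.^-monoʳ-< 2(s≤s(s≤s z≤n)) r≥1))(cong suc(sym e) ∙ length-nonzeros)
  one : cofactor ≈ₚ 1ₚ
  one = coefs λ { zero → top ∙ cong(coef 𝐸) len ∙ topE refl ℓ≢0 ; (suc k) → degree(suc k)(s≤s z≤n) }

 q≡ : length zs₀ ∔ suc z₁ ≡ q
 q≡ = N.+-suc(length zs₀) z₁ ∙ cong suc length-zs ∙ length-nonzeros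

 S-factorisation : Factorisation zs₀ 𝑆(suc z₁)
 S-factorisation = factor zs₀(UniqueP.filter⁺(λ α → Tβ α ≟ 0#) nonzeros-unique) 𝑆(suc z₁)(subst(Deg≤(coef 𝑆))(sym q≡)(proj₁(S-degree refl)))
  (All.tabulate λ i → let (nz , e) = ∈zs₀ i in eval-S nz r N.≤-refl ∙ cong(_ ⊙_) e ∙ ⊙-0ʳ _)

 open Factorisation S-factorisation renaming (cofactor to 𝑈; factors to S≈Π₀U; degree to U-degree; top to U-top; vanishing to U-vanishing)

 -- The coefficients satisfy g_n = z g_(n+1), and those beyond the bound are zero.
 lin-cancel : ∀ z g → lin z *ₚ g ≈ₚ 0ₚ → g ≈ₚ 0ₚ
 lin-cancel z g e = coefs(λ n → go(suc(bound g)) n(N.m≤n+m(suc(bound g)) n))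
  where
  go : ∀ j n → bound g < n ∔ j → coef g n ≡ 0#
  go zero n l = bounded g n(subst(bound g <_)(N.+-identityʳ n) l)
  go(suc j) n l = ⊕-shift(sym(coef-lin-suc z g n) ∙ coef≡ e(suc n)) ∙ ⊕-idˡ _ ∙ cong(z ⊙_)(go j(suc n)(subst(bound g <_)(N.+-suc n j) l)) ∙ ⊙-0ʳ z

 Π-cancel : ∀ zs g → Π-lin zs *ₚ g ≈ₚ 0ₚ → g ≈ₚ 0ₚ
 Π-cancel [] g e = P.trans(P.sym(P.*-identityˡ g)) e
 Π-cancel(z ∷ zs) g e = Π-cancel zs g(lin-cancel z(Π-lin zs *ₚ g)(P.trans(P.sym(P.*-assoc(lin z)(Π-lin zs) g)) e))

 -- The polynomial 𝑆 vanishes on `zs₀`, so 𝑆 = Π₀ 𝑈, and one factor Π₀ cancels from the equation for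
 -- 𝑆.
 U-equation : Π₀ *ₚ (𝑈 *ₚ 𝑈) +ₚ mono 1# half *ₚ 𝑈 +ₚ Π₁ *ₚ 𝑊 ≈ₚ 0ₚ
 U-equation = Π-cancel zs₀ _ (P.trans
  (solve 5(λ p u h p' w → p :* (p :* (u :* u) :+ h :* u :+ p' :* w) := ((p :* u) :* (p :* u) :+ h :* (p :* u)) :+ (p :* p') :* w) P.refl Π₀ 𝑈(mono 1# half) Π₁ 𝑊)
  (P.trans(P.+-cong(P.+-cong(P.*-cong(P.sym S≈Π₀U)(P.sym S≈Π₀U))(P.*-congˡ(P.sym S≈Π₀U)))(P.*-congʳ(P.sym E≈Π₀Π₁)))
   (P.trans(P.+-congʳ S-equation)(solve 1(λ z → z :+ z := con false) P.refl(𝐸 *ₚ 𝑊)))))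

 U₀≢0 : coef 𝑈 0 ≢ 0#
 U₀≢0 e = ⊙-≢0(Π0 zs₁ λ i → proj₁(∈zs₁ i)) β≢0(sym(cong₂ _⊕_ (cong₂ _⊕_ (cong(λ z → coef Π₀ 0 ⊙ (z ⊙ z)) e ∙ cong(coef Π₀ 0 ⊙_)(⊙-0ˡ 0#) ∙ ⊙-0ʳ _)
    (cong(coef(mono 1# half) 0 ⊙_) e ∙ ⊙-0ʳ _) ∙ ⊕-idˡ 0#)(cong(coef Π₁ 0 ⊙_)(⊕-idˡ β)) ∙ ⊕-idˡ _) ∙ coef≡ U-equation 0)
  where
  Π0 : ∀ zs → (∀ {z} → z ∈ zs → z ≢ 0#) → coef(Π-lin zs) 0 ≢ 0#
  Π0 [] _ e = 0≢1(sym e)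
  Π0(z ∷ zs) nz = ⊙-≢0(λ e → nz(here refl)(sym(⊕-idˡ z) ∙ e))(Π0 zs(nz ∘ there))

 coprime-lin : ∀ f z → eval f z ≢ 0# → Coprime f(lin z)
 coprime-lin f z nz = const((eval f z) ⁻¹) , const((eval f z) ⁻¹) *ₚ quotient , P.trans(P.+-congʳ(P.*-congˡ {const((eval f z) ⁻¹)} {f} division))
  (P.trans(solve 4(λ c e l g → c :* (e :+ l :* g) :+ c :* g :* l := c :* e) P.refl(const((eval f z) ⁻¹))(const(eval f z))(lin z) quotient)
   (P.trans(mono-*-mono _ _ 0 0)(P.trans(mono-cong(⁻¹-inverseˡ nz) refl) mono-1)))
  where open Division(divide f z)

 coprime-Π : ∀ f zs → All(λ z → eval f z ≢ 0#) zs → Coprime f(Π-lin zs)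
 coprime-Π f [] [] = 0ₚ , 1ₚ , solve 1(λ f → con false :* f :+ con true :* con true := con true) P.refl f
 coprime-Π f(z ∷ zs)(nz ∷ a) = Coprime-*(coprime-lin f z nz)(coprime-Π f zs a)

 coprime-U-x : Coprime 𝑈 𝑥
 coprime-U-x = let (a , b , e) = coprime-lin 𝑈 0#(λ e → U₀≢0(sym(cong(coef 𝑈 0 ⊕_)(⊙-0ˡ _) ∙ ⊕-idʳ _) ∙ e)) in a , b ,
  P.trans(P.+-congˡ(P.*-congˡ(coefs λ { zero → sym(⊕-idʳ 0#) ; (suc n) → sym(⊕-idʳ _) }))) e

 -- At a point z of `zs₁` the value of 𝑆 is z^(q/2), which is nonzero, while a zero of 𝑈 would be a
 -- zero of 𝑆.
 coprime-U-Π₁ : Coprime 𝑈 Π₁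
 coprime-U-Π₁ = coprime-Π 𝑈 zs₁(All.tabulate λ {z} i e → let (nz , t) = ∈zs₁ i in
  nz(^F-≡0 half(sym(cong(z ^F half ⊙_) t ∙ ⊙-idʳ _) ∙ sym(eval-S nz r N.≤-refl) ∙ U-vanishing z e)))

 h₁ : ℕ
 h₁ = suc z₁ ∔ suc z₁

 -- The curve is Y² + XY = X³ + aX² + β² up to twist. The abscissa x^q belongs to the Frobenius
 -- image of the generic point, whose own abscissa is x. Its neighbour U²/(xΠ₁²) is the abscissa of
 -- the sum or difference of the two. The heights are q and h₁ = 2(z₁ + 1) = q + 1 - K(β): this is
 -- where the point count enters.
 start : Link q h₁
 start = record
  { A = mono 1# q ; B = 1ₚ ; C = 𝑈 *ₚ 𝑈 ; D = 𝑥 *ₚ (Π₁ *ₚ Π₁)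
  ; coprimeˡ = 0ₚ , 1ₚ , solve 1(λ f → con false :* f :+ con true :* con true := con true) P.refl(mono 1# q)
  ; coprimeʳ = Coprime-sym(Coprime-*(Coprime-sym cop)(Coprime-sym cop))
  ; heightˡ = record { degˡ = monoₛ-Deg≤ 1# q ; degʳ = Deg≤-mono {coef 1ₚ} z≤n(bounded 1ₚ) ; attained = inj₁(λ e → 0≢1(sym(sym(monoₛ-top 1# q) ∙ e))) }
  ; heightʳ = record
   { degˡ = Deg≤-·(suc z₁)(suc z₁) U-degree U-degree
   ; degʳ = Deg≤-mono {coef(𝑥 *ₚ (Π₁ *ₚ Π₁))} (s≤s(N.+-monoʳ-≤ z₁(N.n≤1+n z₁)))(Deg≤-· 1(z₁ ∔ z₁)(monoₛ-Deg≤ 1# 1)(Deg≤-· z₁ z₁(Π-lin-degree zs₁)(Π-lin-degree zs₁)))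
   ; attained = inj₁(λ e → 0≢1(sym(sym(top-·(suc z₁)(suc z₁) U-degree U-degree ∙ cong₂ _⊙_ U1 U1 ∙ ⊙-idˡ 1#) ∙ e))) }
  ; related = quadratic⇒Rel rel }
  where
  U1 : coef 𝑈(suc z₁) ≡ 1#
  U1 = U-top ∙ cong(coef 𝑆) q≡ ∙ proj₂(S-degree refl)
  cop : Coprime 𝑈(𝑥 *ₚ (Π₁ *ₚ Π₁))
  cop = Coprime-* coprime-U-x(Coprime-* coprime-U-Π₁ coprime-U-Π₁)
  lead≈ : mono 1# q +ₚ 𝑥 *ₚ 1ₚ ≈ₚ 𝑥 *ₚ (Π₀ *ₚ Π₁)
  lead≈ = P.trans(P.+-congʳ(P.trans(mono-cong(sym(⊙-idˡ 1#))(sym length-nonzeros))(P.sym(mono-*-mono 1# 1# 1 ℓ))))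
   (P.trans(solve 2(λ x e → x :* e :+ x :* con true := x :* (e :+ con true)) P.refl 𝑥(mono 1# ℓ))(P.*-congˡ E≈Π₀Π₁))
  mono-q : mono 1# q ≈ₚ mono 1# half *ₚ mono 1# half
  mono-q = P.sym(P.trans(mono-*-mono 1# 1# half half)(mono-cong(⊙-idˡ 1#)(cong(half ∔_)(sym(N.+-identityʳ half)) ∙ 2half≡q)))
  last≈ : last(mono 1# q) 1ₚ ≈ₚ 𝑊 *ₚ 𝑊
  last≈ = P.trans(solve 3(λ x m b → x :* x :* (m :* m) :+ b :* b :* (con true :* con true) := (x :* m :+ b) :* (x :* m :+ b)) P.refl 𝑥(mono 1# q) 𝑏)
   (P.*-cong w w)
   where
   w : 𝑥 *ₚ mono 1# q +ₚ 𝑏 ≈ₚ 𝑊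
   w = P.+-congʳ(P.trans(mono-*-mono 1# 1# 1 q)(mono-cong(⊙-idˡ 1#) refl))
  rel : lead(mono 1# q) 1ₚ *ₚ (𝑈 *ₚ 𝑈 *ₚ (𝑈 *ₚ 𝑈)) +ₚ mid(mono 1# q) 1ₚ *ₚ (𝑈 *ₚ 𝑈 *ₚ (𝑥 *ₚ (Π₁ *ₚ Π₁))) +ₚ last(mono 1# q) 1ₚ *ₚ (𝑥 *ₚ (Π₁ *ₚ Π₁) *ₚ (𝑥 *ₚ (Π₁ *ₚ Π₁))) ≈ₚ 0ₚ
  -- In characteristic 2 the whole relation is x² Π₁² times the square of the equation for 𝑈.
  rel = P.trans(P.+-cong(P.+-cong(P.*-congʳ(P.*-cong lead≈ lead≈))(P.*-congʳ(P.*-congʳ(P.*-congˡ mono-q))))(P.*-congʳ last≈))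
   (P.trans(solve 6(λ x p p' u h w → (x :* (p :* p')) :* (x :* (p :* p')) :* (u :* u :* (u :* u)) :+ x :* (h :* h) :* con true :* (u :* u :* (x :* (p' :* p'))) :+ w :* w :* (x :* (p' :* p') :* (x :* (p' :* p')))
    := x :* x :* (p' :* p') :* ((p :* (u :* u) :+ h :* u :+ p' :* w) :* (p :* (u :* u) :+ h :* u :+ p' :* w))) P.refl 𝑥 Π₀ Π₁ 𝑈(mono 1# half) 𝑊)
    (P.trans(P.*-congˡ(P.*-cong U-equation U-equation))(solve 2(λ x p → x :* x :* (p :* p) :* (con false :* con false) := con false) P.refl 𝑥 Π₁)))

 Z₁≡ : Z₁ β ≡ pos z₁
 Z₁≡ = sym(length-filter(λ α → Tβ α ≟ 1#) F*)

 private
  hK : ∀ q z → (1ℤ + z) + (1ℤ + z) ≡ q + 1ℤ - (q - 1ℤ - pos 2 * z)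
  hK = ring
  up : ∀ q k → q + 1ℤ - k - q ≡ 1ℤ - k
  up = ring
  down : ∀ q k → 1ℤ + q + (1ℤ + q) - (q + 1ℤ - k) - q ≡ 1ℤ + k
  down = ring
  finish : ∀ q n k → q + n * (1ℤ + k) + n * (n - 1ℤ) ≡ q + n * k + n * n
  finish = ring
  move : ∀ a b → b ≡ a + b - a
  move = ring

 h₁≡ : pos h₁ ≡ Q + 1ℤ - K β
 h₁≡ = hK Q(pos z₁) ∙ cong(λ k → Q + 1ℤ - k)(sym(K≡q-1-2Z₁ β ∙ cong(λ z → Q - 1ℤ - pos 2 * z) Z₁≡))

 -- The initial slope is h₁ - q = 1 - K, and the height reached after n steps is nonnegative.
 discriminant⁻ : ∀ n → 0ℤ ℤ.≤ Q + pos n * (- K β) + pos n * pos n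
 discriminant⁻ n = let (h , _ , _ , _ , b) = chain(swap-link start)(1ℤ - K β)(Z.≤-reflexive(cong(_- Q) h₁≡ ∙ up Q(K β))) n in
  Z.≤-trans(ℤ.+≤+ z≤n)(Z.≤-trans b(Z.≤-reflexive(finish Q(pos n)(- K β))))

 -- The progression in the opposite direction: the other neighbour of x^q has height at most 2q + 2
 -- - h₁ = q + 1 + K, so the initial slope is at most 1 + K.
 discriminant⁺ : ∀ n → 0ℤ ℤ.≤ Q + pos n * K β + pos n * pos n
 discriminant⁺ n = let
   (h' , l , le) = next-link start
   bnd : pos h' - Q ℤ.≤ 1ℤ + K β
   bnd = Z.≤-trans(Z.+-monoˡ-≤(- Q)(Z.≤-trans(Z.≤-reflexive(move(pos h₁)(pos h')))(Z.+-monoˡ-≤(- pos h₁)(ℤ.+≤+ le))))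
    (Z.≤-reflexive(cong(λ z → 1ℤ + Q + (1ℤ + Q) - z - Q) h₁≡ ∙ down Q(K β)))
   (h , _ , _ , _ , b) = chain(swap-link l)(1ℤ + K β) bnd n
  in Z.≤-trans(ℤ.+≤+ z≤n)(Z.≤-trans b(Z.≤-reflexive(finish Q(pos n)(K β))))

 private
  odd⁺ : ∀ q w → q + w * - (pos 2 * w + 1ℤ) + w * w ≡ q - w * (1ℤ + w)
  odd⁺ = ring
  odd⁻ : ∀ q w → q + w * (pos 2 * (- (1ℤ + w)) + 1ℤ) + w * w ≡ q - w * (1ℤ + w)
  odd⁻ = ring
  sq⁺ : ∀ w → (pos 2 * w + 1ℤ) * (pos 2 * w + 1ℤ) ≡ pos 4 * (w * (1ℤ + w)) + 1ℤ
  sq⁺ = ring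
  sq⁻ : ∀ w → (pos 2 * (- (1ℤ + w)) + 1ℤ) * (pos 2 * (- (1ℤ + w)) + 1ℤ) ≡ pos 4 * (w * (1ℤ + w)) + 1ℤ
  sq⁻ = ring
  rearrange : ∀ h z → h + (h + 0ℤ) - 1ℤ - pos 2 * z ≡ pos 2 * (h - 1ℤ - z) + 1ℤ
  rearrange = ring

 -- K is odd, say |K| = 2v + 1. The quadratic polynomial at the integer n = v, next to its minimum,
 -- gives q ≥ v(v + 1), and the inequality is strict since q is a power of 2 with exponent at least
 -- 2. Then K² = 4v(v + 1) + 1 is less than 4q. The sign of K decides the direction of the
 -- progression.
 weil : 2 ≤ r → K β * K β ℤ.< pos(4 · q)
 weil r≥2 = go(pos half - 1ℤ - Z₁ β) K≡
  where
  K≡ : K β ≡ pos 2 * (pos half - 1ℤ - Z₁ β) + 1ℤ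
  K≡ = K≡q-1-2Z₁ β ∙ cong(λ z → pos z - 1ℤ - pos 2 * Z₁ β) q≡2*2^ ∙ rearrange(pos half)(Z₁ β)
  bnd : ∀ v → 0ℤ ℤ.≤ Q - pos v * (1ℤ + pos v) → K β * K β ≡ pos 4 * (pos v * (1ℤ + pos v)) + 1ℤ → K β * K β ℤ.< pos(4 · q)
  bnd v le e = Z.≤-<-trans(Z.≤-reflexive(e ∙ cong(λ z → pos 4 * z + 1ℤ)(sym(Z.pos-* v(suc v)))))(Z.<-≤-trans
    (Z.≤-<-trans(Z.≤-reflexive(cong(_+ 1ℤ)(sym(Z.pos-* 4(v · suc v)))))(ℤ.+<+(N.≤-trans(N.≤-reflexive(arith(v · suc v)))
     (N.+-monoʳ-≤(4 · (v · suc v)) {2} {4} (s≤s(s≤s z≤n))))))(ℤ.+≤+(N.≤-trans(N.≤-reflexive(arith'(v · suc v)))(N.*-monoʳ-≤ 4 lt))))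
   where
   arith : ∀ a → suc(4 · a ∔ 1) ≡ 4 · a ∔ 2
   arith a = sym(N.+-suc(4 · a) 1)
   arith' : ∀ a → 4 · a ∔ 4 ≡ 4 · suc a
   arith' a = N.+-comm(4 · a) 4 ∙ sym(N.*-suc 4 a)
   le' : v · suc v ≤ q
   le' = Z.drop‿+≤+(Z.0≤i-j⇒j≤i(subst(λ z → 0ℤ ℤ.≤ Q - z)(sym(Z.pos-* v(suc v))) le))
   lt : v · suc v < q
   lt = N.≤∧≢⇒< le'(λ e' → pronic≢2^ v r r≥2(e' ∙ size≡))
  go : ∀ w → K β ≡ pos 2 * w + 1ℤ → K β * K β ℤ.< pos(4 · q)
  go(pos v) e = bnd v(subst(0ℤ ℤ.≤_)(cong(λ z → Q + pos v * - z + pos v * pos v) e ∙ odd⁺ Q(pos v))(discriminant⁻ v))(cong₂ _*_ e e ∙ sq⁺(pos v))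
  go -[1+ v ] e = bnd v(subst(0ℤ ℤ.≤_)(cong(λ z → Q + pos v * z + pos v * pos v) e ∙ odd⁻ Q(pos v))(discriminant⁺ v))(cong₂ _*_ e e ∙ sq⁻(pos v))

-- Linear algebra over the field

punch-elim : {n : ℕ} (k : Fin(suc n))(P : Fin(suc n) → Set) → P k → (∀ j → P(punchIn k j)) → ∀ i → P i
punch-elim k P p f i with k Fin.≟ i
... | yes refl = p
... | no ne = subst P(FinP.punchIn-punchOut ne)(f(Fin.punchOut ne))

module _ (X : FS) {n : ℕ} (k : Fin(suc n)) where
 private
  module X = FS X

 ∑-insert : {f : (Fin(suc n) → El X) → ℤ} → FS.Cong(Πᶠ(suc n) X) f →
  ∑(enum(Πᶠ(suc n) X)) f ≡ ∑(enum X)(λ a → ∑(enum(Πᶠ n X)) λ v → f(insertAt v k a))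
 ∑-insert {f} c = ∑-reindex(Πᶠ(suc n) X)(X ×ᶠ Πᶠ n X) {g = λ (a , v) → f(insertAt v k a)} (λ u → u k , u ∘ punchIn k)(λ (a , v) → insertAt v k a)
   (λ {u} {(a , v)} (p , e) →
    let e' : ∀ i → u i X.≈ insertAt v k a i
        e' = glue u a v p e in e' , c e')
   (λ {u} {(a , v)} e → X.≈-sym(subst(u k X.≈_)(insertAt-lookup v k a)(e k)) , λ j → X.≈-sym(subst(u(punchIn k j) X.≈_)(insertAt-punchIn v k a j)(e(punchIn k j)))) ∙
  ∑-cartesianProduct(enum X)(enum(Πᶠ n X)) _
  where
  glue : ∀ u a v → a X.≈ u k → (∀ j → v j X.≈ u(punchIn k j)) → ∀ i → u i X.≈ insertAt v k a i
  glue u a v p e = punch-elim k(λ i → u i X.≈ insertAt v k a i)(subst(u k X.≈_)(sym(insertAt-lookup v k a))(X.≈-sym p))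
   (λ j → subst(u(punchIn k j) X.≈_)(sym(insertAt-punchIn v k a j))(X.≈-sym(e j)))

T-all⁺ : {n : ℕ} (p : Fin n → Bool) → T(ListAction.all p(allFin n)) → ∀ i → T(p i)
T-all⁺ p t i = All.lookup(all⁺ p(allFin _) t)(∈-allFin i)

T-all⁻ : {n : ℕ} (p : Fin n → Bool) → (∀ i → T(p i)) → T(ListAction.all p(allFin n))
T-all⁻ {n} p f = all⁻ p {allFin n} (All.tabulate λ {i} _ → f i)

-- n(n - 1)/2, the dimension of the space of alternating matrices of size n.
tri : ℕ → ℕ
tri zero = 0
tri(suc n) = n ∔ tri n

module LinearAlgebra (𝒟 : FieldData) where
 open FieldArithmetic 𝒟
 open Characters 𝒟

 -- Sums over Fin n are kept abstract: the unfolded foldr defeats unification.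
 abstract
  ⨁ : ∀ {n} → (Fin n → Fq) → Fq
  ⨁ {n} f = sumFin n f

  ⨁≡sumFin : ∀ {n} (f : Fin n → Fq) → sumFin n f ≡ ⨁ f
  ⨁≡sumFin f = refl

  ⨁-[] : (f : Fin 0 → Fq) → ⨁ f ≡ 0#
  ⨁-[] f = refl

  ⨁-suc : ∀ {n} (f : Fin(suc n) → Fq) → ⨁ f ≡ f fz ⊕ ⨁(f ∘ fs)
  ⨁-suc {n} f = cong(λ l → f fz ⊕ sumF l)(ListP.map-tabulate fs f ∙ sym(ListP.map-tabulate id(f ∘ fs)))

  ⨁-cong : ∀ {n} {f g : Fin n → Fq} → (∀ i → f i ≡ g i) → ⨁ f ≡ ⨁ g
  ⨁-cong {n} e = cong sumF(ListP.map-cong e(allFin n))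

 ⨁-zero : ∀ {n} {f : Fin n → Fq} → (∀ i → f i ≡ 0#) → ⨁ f ≡ 0#
 ⨁-zero {zero} {f} e = ⨁-[] f
 ⨁-zero {suc n} {f} e = ⨁-suc f ∙ cong₂ _⊕_ (e fz)(⨁-zero(e ∘ fs)) ∙ ⊕-idˡ 0#

 ⨁-⊕ : ∀ {n} (f g : Fin n → Fq) → ⨁(λ i → f i ⊕ g i) ≡ ⨁ f ⊕ ⨁ g
 ⨁-⊕ {zero} f g = ⨁-[] _ ∙ sym(cong₂ _⊕_ (⨁-[] f)(⨁-[] g) ∙ ⊕-idˡ 0#)
 ⨁-⊕ {suc n} f g = ⨁-suc _ ∙ cong(f fz ⊕ g fz ⊕_)(⨁-⊕(f ∘ fs)(g ∘ fs)) ∙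
  solve 4(λ a b c d → a :+ b :+ (c :+ d) := (a :+ c) :+ (b :+ d)) refl(f fz)(g fz) _ _ ∙ sym(cong₂ _⊕_ (⨁-suc f)(⨁-suc g))

 ⨁-⊙ˡ : ∀ {n} c (f : Fin n → Fq) → ⨁(λ i → c ⊙ f i) ≡ c ⊙ ⨁ f
 ⨁-⊙ˡ {zero} c f = ⨁-[] _ ∙ sym(cong(c ⊙_)(⨁-[] f) ∙ ⊙-0ʳ c)
 ⨁-⊙ˡ {suc n} c f = ⨁-suc _ ∙ cong(c ⊙ f fz ⊕_)(⨁-⊙ˡ c(f ∘ fs)) ∙ sym(⊙-distribˡ c _ _) ∙ cong(c ⊙_)(sym(⨁-suc f))

 ⨁-⊙ʳ : ∀ {n} c (f : Fin n → Fq) → ⨁(λ i → f i ⊙ c) ≡ ⨁ f ⊙ c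
 ⨁-⊙ʳ c f = ⨁-cong(λ i → ⊙-comm(f i) c) ∙ ⨁-⊙ˡ c f ∙ ⊙-comm c _

 ⨁-swap : ∀ {m n} (f : Fin m → Fin n → Fq) → ⨁(λ i → ⨁(f i)) ≡ ⨁(λ j → ⨁ λ i → f i j)
 ⨁-swap {zero} f = ⨁-[] _ ∙ sym(⨁-zero λ j → ⨁-[] λ i → f i j)
 ⨁-swap {suc m} f = ⨁-suc _ ∙ cong(⨁(f fz) ⊕_)(⨁-swap(f ∘ fs)) ∙ sym(⨁-⊕(f fz) _) ∙ ⨁-cong(λ j → sym(⨁-suc λ i → f i j))

 ⨁-punch : ∀ {n} (k : Fin(suc n))(f : Fin(suc n) → Fq) → ⨁ f ≡ f k ⊕ ⨁(f ∘ punchIn k)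
 ⨁-punch fz f = ⨁-suc f
 ⨁-punch {suc n} (fs k) f = ⨁-suc f ∙ cong(f fz ⊕_)(⨁-punch k(f ∘ fs)) ∙
  solve 3(λ a b c → a :+ (b :+ c) := b :+ (a :+ c)) refl(f fz)(f(fs k)) _ ∙ cong(f(fs k) ⊕_)(sym(⨁-suc(f ∘ punchIn(fs k))))

 ⨁-single : ∀ {n} (f : Fin n → Fq) i → (∀ j → j ≢ i → f j ≡ 0#) → ⨁ f ≡ f i
 ⨁-single {suc n} f i e = ⨁-punch i f ∙ cong(f i ⊕_)(⨁-zero λ j → e(punchIn i j)(FinP.punchInᵢ≢i i j)) ∙ ⊕-idʳ(f i)

 ⨁-split : ∀ m {n} (f : Fin(m ∔ n) → Fq) → ⨁ f ≡ ⨁(λ i → f(i ↑ˡ n)) ⊕ ⨁(λ j → f(m ↑ʳ j))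
 ⨁-split zero f = sym(cong(_⊕ ⨁ f)(⨁-[] _) ∙ ⊕-idˡ _)
 ⨁-split(suc m) f = ⨁-suc f ∙ cong(f fz ⊕_)(⨁-split m(f ∘ fs)) ∙ sym(⊕-assoc _ _ _) ∙ cong(_⊕ ⨁ λ j → f(suc m ↑ʳ j))(sym(⨁-suc λ i → f(i ↑ˡ _)))

 Vecᶠ : ℕ → Set
 Vecᶠ n = Fin n → Fq

 𝕍 : ℕ → FS
 𝕍 n = Πᶠ n 𝔽ˢ

 𝕄 : ℕ → ℕ → FS
 𝕄 a b = Πᶠ a(𝕍 b)

 infix 4 _≋_
 _≋_ : ∀ {a b} → Mat a b → Mat a b → Set
 M ≋ P = ∀ i j → M i j ≡ P i j

 eqM⁺ : ∀ {a b} {M P : Mat a b} → T(eqM M P) → M ≋ P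
 eqM⁺ t i j = ==⇒≡ (T-all⁺ _ (T-all⁺ _ t i) j)

 eqM⁻ : ∀ {a b} {M P : Mat a b} → M ≋ P → T(eqM M P)
 eqM⁻ e = T-all⁻ _ (λ i → T-all⁻ _ λ j → ≡⇒== (e i j))

 dot : ∀ {n} → Vecᶠ n → Vecᶠ n → Fq
 dot {n} u v = ⨁(λ i → u i ⊙ v i)

 dot-cong : ∀ {n} {u u' v v' : Vecᶠ n} → (∀ i → u i ≡ u' i) → (∀ i → v i ≡ v' i) → dot u v ≡ dot u' v'
 dot-cong e e' = ⨁-cong(λ i → cong₂ _⊙_ (e i)(e' i))

 dot-comm : ∀ {n} (u v : Vecᶠ n) → dot u v ≡ dot v u
 dot-comm u v = ⨁-cong(λ i → ⊙-comm(u i)(v i))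

 dot-⊕ʳ : ∀ {n} (u v w : Vecᶠ n) → dot u(λ i → v i ⊕ w i) ≡ dot u v ⊕ dot u w
 dot-⊕ʳ u v w = ⨁-cong(λ i → ⊙-distribˡ(u i)(v i)(w i)) ∙ ⨁-⊕ _ _

 dot-⊕ˡ : ∀ {n} (u v w : Vecᶠ n) → dot(λ i → u i ⊕ v i) w ≡ dot u w ⊕ dot v w
 dot-⊕ˡ u v w = ⨁-cong(λ i → ⊙-distribʳ(w i)(u i)(v i)) ∙ ⨁-⊕ _ _

 dot-⊙ʳ : ∀ {n} c (u v : Vecᶠ n) → dot u(λ i → c ⊙ v i) ≡ c ⊙ dot u v
 dot-⊙ʳ c u v = ⨁-cong(λ i → solve 3(λ u c v → u :* (c :* v) := c :* (u :* v)) refl(u i) c(v i)) ∙ ⨁-⊙ˡ c _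

 dot-⊙ˡ : ∀ {n} c (u v : Vecᶠ n) → dot(λ i → c ⊙ u i) v ≡ c ⊙ dot u v
 dot-⊙ˡ c u v = ⨁-cong(λ i → ⊙-assoc c(u i)(v i)) ∙ ⨁-⊙ˡ c _

 dot-zeroʳ : ∀ {n} (u : Vecᶠ n) {v} → (∀ i → v i ≡ 0#) → dot u v ≡ 0#
 dot-zeroʳ u e = ⨁-zero(λ i → cong(u i ⊙_)(e i) ∙ ⊙-0ʳ _)

 dot-punch : ∀ {n} (k : Fin(suc n))(u v : Vecᶠ(suc n)) → dot u v ≡ u k ⊙ v k ⊕ dot(u ∘ punchIn k)(v ∘ punchIn k)
 dot-punch k u v = ⨁-punch k(λ i → u i ⊙ v i)

 dot-insertʳ : ∀ {n} (k : Fin(suc n))(u : Vecᶠ(suc n)) a v → dot u(insertAt v k a) ≡ u k ⊙ a ⊕ dot(u ∘ punchIn k) v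
 dot-insertʳ k u a v = dot-punch k u(insertAt v k a) ∙ cong₂ _⊕_ (cong(u k ⊙_)(insertAt-lookup v k a))(dot-cong(λ _ → refl)(insertAt-punchIn v k a))

 apply : ∀ {a b} → Mat a b → Vecᶠ b → Vecᶠ a
 apply M v i = dot(M i) v

 apply-cong : ∀ {a b} {M P : Mat a b} {u v : Vecᶠ b} → M ≋ P → (∀ i → u i ≡ v i) → ∀ i → apply M u i ≡ apply P v i
 apply-cong e e' i = dot-cong(e i) e'

 infixl 7 _⊛_
 _⊛_ : ∀ {a b c} → Mat a b → Mat b c → Mat a c
 (M ⊛ P) i k = dot(M i)(λ j → P j k)

 ⊗≋⊛ : ∀ {a b c} (M : Mat a b)(P : Mat b c) → M ⊗ P ≋ M ⊛ P
 ⊗≋⊛ M P i k = ⨁≡sumFin _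

 Trᵃ : ∀ {a} → Mat a a → Fq
 Trᵃ M = ⨁(λ i → M i i)

 Tr≡Trᵃ : ∀ {a} (M : Mat a a) → Tr M ≡ Trᵃ M
 Tr≡Trᵃ M = ⨁≡sumFin _

 idM-diag : ∀ {n} (i : Fin n) → idM i i ≡ 1#
 idM-diag i with i Fin.≟ i
 ... | yes _ = refl
 ... | no ne = contradiction refl ne

 idM-off : ∀ {n} {i j : Fin n} → i ≢ j → idM i j ≡ 0#
 idM-off {i = i} {j} ne with i Fin.≟ j
 ... | yes e = contradiction e ne
 ... | no _ = refl

 idM-sym : ∀ {n} (i j : Fin n) → idM i j ≡ idM j i
 idM-sym i j with i Fin.≟ j
 ... | yes refl = sym(idM-diag i)
 ... | no ne = sym(idM-off(ne ∘ sym))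

 dot-idˡ : ∀ {n} (i : Fin n) v → dot(idM i) v ≡ v i
 dot-idˡ i v = ⨁-single _ i(λ j ne → cong(_⊙ v j)(idM-off(ne ∘ sym)) ∙ ⊙-0ˡ _) ∙ cong(_⊙ v i)(idM-diag i) ∙ ⊙-idˡ _

 dot-idʳ : ∀ {n} (v : Vecᶠ n) i → dot v(λ j → idM j i) ≡ v i
 dot-idʳ v i = dot-comm v _ ∙ dot-cong(λ j → idM-sym j i)(λ _ → refl) ∙ dot-idˡ i v

 ⊛-cong : ∀ {a b c} {M M' : Mat a b} {P P' : Mat b c} → M ≋ M' → P ≋ P' → M ⊛ P ≋ M' ⊛ P'
 ⊛-cong e e' i k = ⨁-cong(λ j → cong₂ _⊙_ (e i j)(e' j k))

 ⊛-congˡ : ∀ {a b c} (M : Mat a b) {P P' : Mat b c} → P ≋ P' → M ⊛ P ≋ M ⊛ P'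
 ⊛-congˡ M e = ⊛-cong {M = M} (λ _ _ → refl) e

 ⊛-congʳ : ∀ {a b c} {M M' : Mat a b} (P : Mat b c) → M ≋ M' → M ⊛ P ≋ M' ⊛ P
 ⊛-congʳ P e = ⊛-cong {P = P} e(λ _ _ → refl)

 ⊛-identityˡ : ∀ {a b} (M : Mat a b) → idM ⊛ M ≋ M
 ⊛-identityˡ M i j = dot-idˡ i(λ k → M k j)

 ⊛-identityʳ : ∀ {a b} (M : Mat a b) → M ⊛ idM ≋ M
 ⊛-identityʳ M i j = dot-idʳ(M i) j

 apply-⊛ : ∀ {a b c} (M : Mat a b)(P : Mat b c) v i → apply(M ⊛ P) v i ≡ apply M(apply P v) i
 apply-⊛ M P v i = begin
  _ ≡⟨ ⨁-cong(λ k → sym(⨁-⊙ʳ(v k) _)) ⟩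
  ⨁(λ k → ⨁ λ j → M i j ⊙ P j k ⊙ v k) ≡⟨ ⨁-swap _ ⟩
  ⨁(λ j → ⨁ λ k → M i j ⊙ P j k ⊙ v k) ≡⟨ ⨁-cong(λ j → ⨁-cong(λ k → ⊙-assoc(M i j)(P j k)(v k)) ∙ ⨁-⊙ˡ(M i j) _) ⟩
  _ ∎

 ⊛-assoc : ∀ {a b c d} (M : Mat a b)(P : Mat b c)(R : Mat c d) → (M ⊛ P) ⊛ R ≋ M ⊛ (P ⊛ R)
 ⊛-assoc M P R i l = apply-⊛ M P(λ k → R k l) i

 Trᵃ-cong : ∀ {a} {M P : Mat a a} → M ≋ P → Trᵃ M ≡ Trᵃ P
 Trᵃ-cong e = ⨁-cong(λ i → e i i)

 Trᵃ-comm : ∀ {a b} (M : Mat a b)(P : Mat b a) → Trᵃ(M ⊛ P) ≡ Trᵃ(P ⊛ M)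
 Trᵃ-comm M P = ⨁-swap _ ∙ ⨁-cong(λ j → ⨁-cong λ i → ⊙-comm(M i j)(P j i))

 dot-apply-ᵗ : ∀ {a b} (M : Mat a b) u v → dot u(apply M v) ≡ dot(apply(ᵗ M) u) v
 dot-apply-ᵗ M u v = begin
  _ ≡⟨ ⨁-cong(λ i → sym(⨁-⊙ˡ(u i) _)) ⟩
  ⨁(λ i → ⨁ λ j → u i ⊙ (M i j ⊙ v j)) ≡⟨ ⨁-swap _ ⟩
  ⨁(λ j → ⨁ λ i → u i ⊙ (M i j ⊙ v j)) ≡⟨ ⨁-cong(λ j → ⨁-cong(λ i → solve 3(λ u m v → u :* (m :* v) := m :* u :* v) refl(u i)(M i j)(v j)) ∙ ⨁-⊙ʳ(v j) _) ⟩
  _ ∎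

 infix 5 _≈0
 _≈0 : ∀ {n} → Vecᶠ n → Set
 v ≈0 = ∀ i → v i ≡ 0#

 ≈0? : ∀ {n} (v : Vecᶠ n) → Dec(v ≈0)
 ≈0? v = FinP.all?(λ i → v i ≟ 0#)

 -- Invertibility as triviality of the kernel: it is decided by enumeration, and passes to bordered
 -- matrices by solving equations, without determinants.
 Nonsing : ∀ {n} → Mat n n → Set
 Nonsing M = ∀ x → apply M x ≈0 → x ≈0

 abstract
  nonsing? : ∀ {n} (M : Mat n n) → Dec(Nonsing M)
  nonsing? {n} M = FS.∀?(𝕍 n)(λ e h z i → sym(e i) ∙ h(λ j → dot-cong(λ _ → refl) e ∙ z j) i)(λ x → ≈0?(apply M x) →-dec ≈0? x)

 Nonsing-cong : ∀ {n} {M P : Mat n n} → M ≋ P → Nonsing M → Nonsing P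
 Nonsing-cong e h x z = h x(λ i → dot-cong(e i)(λ _ → refl) ∙ z i)

 χNonsing-cong : ∀ {n} {M P : Mat n n} → M ≋ P → χ(nonsing? M) ≡ χ(nonsing? P)
 χNonsing-cong {M = M} {P} e = χ-⇔(nonsing? M)(nonsing? P)(Nonsing-cong e)(Nonsing-cong λ i j → sym(e i j))

 apply-⊕ : ∀ {a b} (M : Mat a b) u v i → apply M(λ j → u j ⊕ v j) i ≡ apply M u i ⊕ apply M v i
 apply-⊕ M u v i = dot-⊕ʳ(M i) u v

 apply-injective : ∀ {n} {M : Mat n n} → Nonsing M → ∀ {u v} → (∀ i → apply M u i ≡ apply M v i) → ∀ i → u i ≡ v i
 apply-injective {M = M} h {u} {v} e i = ⊕≡0⇒≡(h(λ j → u j ⊕ v j)(λ j → apply-⊕ M u v j ∙ ≡⇒⊕≡0(e j)) i)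

 leftInverse⇒Nonsing : ∀ {n} {M N : Mat n n} → N ⊛ M ≋ idM → Nonsing M
 leftInverse⇒Nonsing {M = M} {N} e x z i = sym(dot-idˡ i x) ∙ sym(dot-cong(e i) λ _ → refl) ∙ apply-⊛ N M x i ∙ dot-zeroʳ(N i) z

 inverse : ∀ {n} (M : Mat n n) → Nonsing M → ∃[ N ] M ⊛ N ≋ idM × N ⊛ M ≋ idM
 inverse {n} M h = N , right , λ i j → apply-injective h {λ k → (N ⊛ M) k j} {λ k → idM k j} (λ l → sym(⊛-assoc M N M l j) ∙
   ⊛-congʳ M right l j ∙ ⊛-identityˡ M l j ∙ sym(⊛-identityʳ M l j)) i
  where
  solution : ∀ (b : Vecᶠ n) → ∃[ x ] (∀ i → apply M x i ≡ b i)
  solution = injective⇒surjective(𝕍 n)(apply M)(λ e i → dot-cong(λ _ → refl) e)(apply-injective h)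
  N : Mat n n
  N j k = proj₁(solution λ i → idM i k) j
  right : M ⊛ N ≋ idM
  right i k = proj₂(solution λ i → idM i k) i

 inverse-unique : ∀ {n} {M N N' : Mat n n} → N ⊛ M ≋ idM → M ⊛ N' ≋ idM → N ≋ N'
 inverse-unique {M = M} {N} {N'} l r i j = sym(⊛-identityʳ N i j) ∙ sym(⊛-congˡ N r i j) ∙ sym(⊛-assoc N M N' i j) ∙ ⊛-congʳ N' l i j ∙ ⊛-identityˡ N' i j

 left⇒right : ∀ {n} {M N : Mat n n} → N ⊛ M ≋ idM → M ⊛ N ≋ idM
 left⇒right {M = M} {N} e = let (N' , r , l) = inverse M(leftInverse⇒Nonsing e) in
  λ i j → ⊛-congˡ M(inverse-unique e r) i j ∙ r i j

 InvPair? : ∀ {n} (A A' : Mat n n) → Dec(A ⊛ A' ≋ idM × A' ⊛ A ≋ idM)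
 InvPair? {n} A A' = FS._≈?_ (𝕄 n n)(A ⊛ A') idM ×-dec FS._≈?_ (𝕄 n n)(A' ⊛ A) idM

 -- `Qlist` runs over pairs of a matrix and its inverse. A nonsingular matrix has exactly one
 -- partner, a singular one has none.
 ∑GL-forget : ∀ {n} {f : Mat n n → ℤ} → (∀ {M P} → M ≋ P → f M ≡ f P) →
  ∑(Mats n n)(λ A → ∑(Mats n n) λ A' → χ(InvPair? A A') * f A) ≡ ∑(Mats n n)(λ A → χ(nonsing? A) * f A)
 ∑GL-forget {n} {f} c = ∑-cong(Mats n n)(λ A → ∑-*ʳ(Mats n n)(f A) _ ∙ cong(_* f A)(number A))
  where
  number : ∀ A → ∑(Mats n n)(λ A' → χ(InvPair? A A')) ≡ χ(nonsing? A)
  number A = go A(nonsing? A)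
   where
   go : ∀ A (d : Dec(Nonsing A)) → ∑(Mats n n)(λ A' → χ(InvPair? A A')) ≡ χ d
   go A(yes h) = let (N , r , l) = inverse A h in ∑-cong(Mats n n)(λ A' → χ-⇔(InvPair? A A')(FS._≈?_ (𝕄 n n) A' N)
     (λ (_ , l') → inverse-unique l' r) λ e → (λ i j → ⊛-congˡ A e i j ∙ r i j) , λ i j → ⊛-congʳ A e i j ∙ l i j) ∙
     FS.∑-δ(𝕄 n n) N
   go A(no ¬h) = ∑-cong(Mats n n)(λ A' → χ-no(InvPair? A A') λ (_ , l) → ¬h(leftInverse⇒Nonsing l)) ∙ ∑-zero(Mats n n)

 ∑𝕍-1 : ∀ n → ∑(enum(𝕍 n))(λ _ → 1ℤ) ≡ Q ^ n
 ∑𝕍-1 n = ∑-Π-1 𝔽ˢ n ∙ cong(_^ n) ∑1≡q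

 ∑𝕍-const : ∀ n c → ∑(enum(𝕍 n))(λ _ → c) ≡ Q ^ n * c
 ∑𝕍-const n c = ∑-cong(enum(𝕍 n))(λ _ → sym(Z.*-identityˡ c)) ∙ ∑-*ʳ(enum(𝕍 n)) c(λ _ → 1ℤ) ∙ cong(_* c)(∑𝕍-1 n)

 ∑λ-dot : ∀ {n} (c : Vecᶠ n) → ∑(enum(𝕍 n))(λ v → λ'(dot c v)) ≡ Q ^ n * χ(≈0? c)
 ∑λ-dot {zero} c = cong(_+ 0ℤ)(cong λ'(⨁-[] _) ∙ λ-0)
 ∑λ-dot {suc n} c = begin
  _ ≡⟨ ∑-Π-suc 𝔽ˢ n(λ e → cong λ'(dot-cong(λ _ → refl) e)) ⟩
  ∑ Fs(λ a → ∑(enum(𝕍 n)) λ v → λ'(dot c(a ∷ᶠ v))) ≡⟨ ∑-cong Fs(λ a → ∑-cong(enum(𝕍 n)) λ v → cong λ'(⨁-suc _) ∙ λ-⊕ _ _) ⟩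
  ∑ Fs(λ a → ∑(enum(𝕍 n)) λ v → λ'(c fz ⊙ a) * λ'(dot(c ∘ fs) v)) ≡⟨ ∑-* Fs(enum(𝕍 n)) _ _ ⟩
  ∑ Fs(λ a → λ'(c fz ⊙ a)) * ∑(enum(𝕍 n))(λ v → λ'(dot(c ∘ fs) v)) ≡⟨ cong₂ _*_ (∑λ-⊙(c fz))(∑λ-dot(c ∘ fs)) ⟩
  Q * χ(c fz ≟ 0#) * (Q ^ n * χ(≈0?(c ∘ fs))) ≡⟨ interchange Q(χ(c fz ≟ 0#))(Q ^ n)(χ(≈0?(c ∘ fs))) ⟩
  Q * Q ^ n * (χ(c fz ≟ 0#) * χ(≈0?(c ∘ fs))) ≡⟨ cong(Q * Q ^ n *_)(sym(χ-×(c fz ≟ 0#)(≈0?(c ∘ fs))) ∙ χ-⇔((c fz ≟ 0#) ×-dec ≈0?(c ∘ fs))(≈0? c)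
   (λ { (p , e) fz → p ; (p , e)(fs i) → e i }) λ e → e fz , e ∘ fs) ⟩
  _ ∎
  where
  interchange : ∀ a b c d → a * b * (c * d) ≡ a * c * (b * d)
  interchange = ring

 border : ∀ {n} → Fq → Vecᶠ n → Vecᶠ n → Mat n n → Mat(suc n)(suc n)
 border a u v Z = (a ∷ᶠ u) ∷ᶠ (λ i → v i ∷ᶠ Z i)

 ∑-∷ : ∀ {a b} {f : Mat a(suc b) → ℤ} → FS.Cong(𝕄 a(suc b)) f →
  ∑(Mats a(suc b)) f ≡ ∑(enum(𝕍 a))(λ v → ∑(Mats a b) λ Z → f λ i → v i ∷ᶠ Z i)
 ∑-∷ {a} {b} {f} c = ∑-reindex(𝕄 a(suc b))(𝕍 a ×ᶠ 𝕄 a b) {g = λ (v , Z) → f(λ i → v i ∷ᶠ Z i)} (λ M → (λ i → M i fz) , λ i → M i ∘ fs)(λ (v , Z) i → v i ∷ᶠ Z i)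
   (λ {M} {(v , Z)} (e , e') →
    let p : M ≋ (λ i → v i ∷ᶠ Z i)
        p = λ { i fz → sym(e i) ; i(fs j) → sym(e' i j) } in p , c p)
   (λ {M} {(v , Z)} e → (λ i → sym(e i fz)) , λ i j → sym(e i(fs j))) ∙
  ∑-cartesianProduct(enum(𝕍 a))(Mats a b) _

 Alternating : ∀ {n} → Mat n n → Set
 Alternating Z = (∀ i → Z i i ≡ 0#) × (∀ i j → Z i j ≡ Z j i)

 alt? : ∀ {n} (Z : Mat n n) → Dec(Alternating Z)
 alt? Z = FinP.all?(λ i → Z i i ≟ 0#) ×-dec FinP.all?(λ i → FinP.all? λ j → Z i j ≟ Z j i)

 Alternating-cong : ∀ {n} {M P : Mat n n} → M ≋ P → Alternating M → Alternating P
 Alternating-cong e(d , s) = (λ i → sym(e i i) ∙ d i) , λ i j → sym(e i j) ∙ s i j ∙ e j i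

 Symmetric : ∀ {n} → Mat n n → Set
 Symmetric S = ∀ i j → S i j ≡ S j i

 symmetric? : ∀ {n} (S : Mat n n) → Dec(Symmetric S)
 symmetric? S = FinP.all?(λ i → FinP.all? λ j → S i j ≟ S j i)

 Symmetric-cong : ∀ {n} {M P : Mat n n} → M ≋ P → Symmetric M → Symmetric P
 Symmetric-cong e s i j = sym(e i j) ∙ s i j ∙ e j i

 ⟪_,_⟫ : ∀ {a b} → Mat a b → Mat a b → Fq
 ⟪_,_⟫ {a} C Z = ⨁(λ i → dot(C i)(Z i))

 ⟪⟫-cong : ∀ {a b} {C C' Z Z' : Mat a b} → C ≋ C' → Z ≋ Z' → ⟪ C , Z ⟫ ≡ ⟪ C' , Z' ⟫
 ⟪⟫-cong e e' = ⨁-cong(λ i → dot-cong(e i)(e' i))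

 ∑-border-alternating : ∀ {n} {f : Mat(suc n)(suc n) → ℤ} → FS.Cong(𝕄(suc n)(suc n)) f →
  ∑(Mats(suc n)(suc n))(λ Z → χ(alt? Z) * f Z) ≡ ∑(enum(𝕍 n))(λ u → ∑(Mats n n) λ Z → χ(alt? Z) * f(border 0# u u Z))
 ∑-border-alternating {n} {f} c = ∑-bij(𝕄(suc n)(suc n))(𝕍 n ×ᶠ 𝕄 n n) alt?(λ (u , Z) → alt? Z) {g = λ (u , Z) → f(border 0# u u Z)}
   (λ M → (λ i → M(fs i) fz) , λ i j → M(fs i)(fs j))(λ (u , Z) → border 0# u u Z)
   (λ {M} {(u , Z)} (d , s)(e , e') →
    let p : M ≋ border 0# u u Z
        p = λ { fz fz → d fz ; fz(fs j) → s fz(fs j) ∙ sym(e j) ; (fs i) fz → sym(e i) ; (fs i)(fs j) → sym(e' i j) }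
    in Alternating-cong(λ i j → sym(e' i j))((λ i → d(fs i)) , λ i j → s(fs i)(fs j)) , p , c p)
   (λ {M} {(u , Z)} (d , s) e → Alternating-cong(λ i j → sym(e i j))((λ { fz → refl ; (fs i) → d i }) , λ { fz fz → refl ; fz(fs j) → refl ; (fs i) fz → refl ; (fs i)(fs j) → s i j }) ,
    (λ i → sym(e(fs i) fz)) , λ i j → sym(e(fs i)(fs j))) ∙
  ∑-cartesianProduct(enum(𝕍 n))(Mats n n) _

 -- On alternating Z the pairing is the sum of (C_ij + C_ji) Z_ij over i < j, with independent Z_ij.
 -- By orthogonality it survives only if C is symmetric.
 ∑-alternating : ∀ {n} (C : Mat n n) → ∑(Mats n n)(λ Z → χ(alt? Z) * λ' ⟪ C , Z ⟫) ≡ Q ^ tri n * χ(symmetric? C)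
 ∑-alternating {zero} C = cong(λ z → 1ℤ * z + 0ℤ)(cong λ'(⨁-[] _) ∙ λ-0)
 ∑-alternating {suc n} C = begin
  _ ≡⟨ ∑-border-alternating(λ e → cong λ'(⟪⟫-cong(λ _ _ → refl) e)) ⟩
  ∑(enum(𝕍 n))(λ u → ∑(Mats n n) λ Z → χ(alt? Z) * λ' ⟪ C , border 0# u u Z ⟫) ≡⟨ ∑-cong(enum(𝕍 n))(λ u → ∑-cong(Mats n n) λ Z →
   cong(χ(alt? Z) *_)(cong λ'(expand u Z) ∙ λ-⊕ _ _) ∙ *-swapˡ(χ(alt? Z))(λ'(dot e u)) _) ⟩
  ∑(enum(𝕍 n))(λ u → ∑(Mats n n) λ Z → λ'(dot e u) * (χ(alt? Z) * λ' ⟪ C' , Z ⟫)) ≡⟨ ∑-*(enum(𝕍 n))(Mats n n) _ _ ⟩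
  ∑(enum(𝕍 n))(λ u → λ'(dot e u)) * ∑(Mats n n)(λ Z → χ(alt? Z) * λ' ⟪ C' , Z ⟫) ≡⟨ cong₂ _*_ (∑λ-dot e)(∑-alternating C') ⟩
  Q ^ n * χ(≈0? e) * (Q ^ tri n * χ(symmetric? C')) ≡⟨ interchange(Q ^ n)(χ(≈0? e))(Q ^ tri n)(χ(symmetric? C')) ⟩
  Q ^ n * Q ^ tri n * (χ(≈0? e) * χ(symmetric? C')) ≡⟨ cong₂ _*_ (sym(Z.^-distribˡ-+-* Q n(tri n)))(sym(χ-×(≈0? e)(symmetric? C')) ∙ χ-⇔(≈0? e ×-dec symmetric? C')(symmetric? C)
   (λ { (z , s) fz fz → refl ; (z , s) fz(fs j) → ⊕≡0⇒≡(z j) ; (z , s)(fs i) fz → sym(⊕≡0⇒≡(z i)) ; (z , s)(fs i)(fs j) → s i j })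
   λ s → (λ i → ≡⇒⊕≡0(s fz(fs i))) , λ i j → s(fs i)(fs j)) ⟩
  _ ∎
  where
  interchange : ∀ a b c d → a * b * (c * d) ≡ a * c * (b * d)
  interchange = ring
  e : Vecᶠ n
  e i = C fz(fs i) ⊕ C(fs i) fz
  C' : Mat n n
  C' i j = C(fs i)(fs j)
  expand : ∀ u Z → ⟪ C , border 0# u u Z ⟫ ≡ dot e u ⊕ ⟪ C' , Z ⟫
  expand u Z = begin
   _ ≡⟨ ⨁-suc _ ∙ cong₂ _⊕_ (⨁-suc _ ∙ cong(_⊕ dot(λ j → C fz(fs j)) u)(⊙-0ʳ _) ∙ ⊕-idˡ _)(⨁-cong(λ i → ⨁-suc _) ∙ ⨁-⊕ _ _) ⟩
   dot(λ j → C fz(fs j)) u ⊕ (dot(λ i → C(fs i) fz) u ⊕ ⟪ C' , Z ⟫) ≡⟨ sym(⊕-assoc _ _ _) ⟩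
   dot(λ j → C fz(fs j)) u ⊕ dot(λ i → C(fs i) fz) u ⊕ ⟪ C' , Z ⟫ ≡⟨ cong(_⊕ ⟪ C' , Z ⟫)(sym(dot-⊕ˡ _ _ u)) ⟩
   _ ∎

-- The Gauss sum over nonsingular symmetric matrices

module SymmetricSums (𝒟 : FieldData) where
 open FieldArithmetic 𝒟
 open Characters 𝒟
 open LinearAlgebra 𝒟

 outer : ∀ {a b} → Vecᶠ a → Vecᶠ b → Mat a b
 outer p r i j = p i ⊙ r j

 apply-+M : ∀ {a b} (M P : Mat a b) x i → apply(M +M P) x i ≡ apply M x i ⊕ apply P x i
 apply-+M M P x i = dot-⊕ˡ(M i)(P i) x

 apply-outer : ∀ {a b} (p : Vecᶠ a)(r : Vecᶠ b) x i → apply(outer p r) x i ≡ p i ⊙ dot r x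
 apply-outer p r x i = dot-⊙ˡ(p i) r x

 ∑-translate : ∀ {a b} (P : Mat a b) {f : Mat a b → ℤ} → FS.Cong(𝕄 a b) f → ∑(Mats a b)(λ M → f(M +M P)) ≡ ∑(Mats a b) f
 ∑-translate P {f} c = ∑-reindex(𝕄 _ _)(𝕄 _ _)(_+M P)(_+M P)
  (λ {M} {N} e → (λ i j → sym(⊕-cancel _ _) ∙ cong(_⊕ P i j)(sym(e i j))) , c λ i j → sym(e i j))
  (λ {M} {N} e i j → sym(⊕-cancel _ _) ∙ cong(_⊕ P i j)(sym(e i j)))

 ∑-translate-sym : ∀ {n} (P : Mat n n) → Symmetric P → {f : Mat n n → ℤ} → FS.Cong(𝕄 n n) f →
  ∑(Mats n n)(λ S → χ(symmetric? S) * f(S +M P)) ≡ ∑(Mats n n)(λ S → χ(symmetric? S) * f S)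
 ∑-translate-sym {n} P s {f} c = ∑-cong(Mats n n)(λ S → cong(_* f(S +M P))(χ-⇔(symmetric? S)(symmetric?(S +M P))
   (λ t i j → cong₂ _⊕_ (t i j)(s i j)) λ t i j → sym(⊕-cancel _ (P i j)) ∙ cong₂ _⊕_ (t i j)(s i j) ∙ ⊕-cancel _ (P j i))) ∙
  ∑-translate P {λ S → χ(symmetric? S) * f S} (λ {M} {N} e → cong₂ _*_ (χ-⇔(symmetric? M)(symmetric? N)(Symmetric-cong e)(Symmetric-cong λ i j → sym(e i j)))(c e))

 ∑𝔽-translate : ∀ α (f : Fq → ℤ) → ∑ Fs(λ x → f(x ⊕ α)) ≡ ∑ Fs f
 ∑𝔽-translate α f = ∑-reindex 𝔽ˢ 𝔽ˢ(_⊕ α)(_⊕ α)(λ { {x} refl → sym(⊕-cancel x α) , refl })(λ { {y = y} refl → sym(⊕-cancel y α) })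

 pivot : ∀ {n} {v : Vecᶠ n} → ¬ v ≈0 → ∃[ k ] v k ≢ 0#
 pivot {n} {v} ne = FinP.¬∀⟶∃¬ n(λ i → v i ≡ 0#)(λ i → v i ≟ 0#) ne

 ∑-nonzero-vectors : ∀ n (c : ℤ)(f : Vecᶠ n → ℤ) → (∀ v → v ≈0 → f v ≡ 0ℤ) → (∀ v → ¬ v ≈0 → f v ≡ c) → ∑(enum(𝕍 n)) f ≡ (Q ^ n - 1ℤ) * c
 ∑-nonzero-vectors n c f z nz = begin
  _ ≡⟨ ∑-cong(enum(𝕍 n))(λ v → value v(≈0? v)) ⟩
  ∑(enum(𝕍 n))(λ v → (1ℤ + - χ(≈0? v)) * c) ≡⟨ ∑-*ʳ(enum(𝕍 n)) c _ ⟩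
  ∑(enum(𝕍 n))(λ v → 1ℤ + - χ(≈0? v)) * c ≡⟨ cong(_* c)(∑-+(enum(𝕍 n)) _ _ ∙ cong₂ _+_ (∑𝕍-1 n)(∑-neg(enum(𝕍 n)) _ ∙ cong -_ (FS.∑-δ(𝕍 n) λ _ → 0#))) ⟩
  _ ∎
  where
  value : ∀ v (d : Dec(v ≈0)) → f v ≡ (1ℤ + - χ d) * c
  value v(yes e) = z v e ∙ sym(Z.*-zeroˡ c)
  value v(no ne) = nz v ne ∙ sym(Z.*-identityˡ c)

 gl : ℕ → ℤ
 gl n = ∑(Mats n n)(λ A → χ(nonsing? A))

 gl-0 : gl 0 ≡ 1ℤ
 gl-0 = cong(_+ 0ℤ)(χ-yes(nonsing? {0} _) λ x z())

 module _ {n : ℕ} (k : Fin(suc n))(v : Vecᶠ(suc n))(vₖ≢0 : v k ≢ 0#) where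
  private
   p : Vecᶠ n
   p j = v(punchIn k j) ⊙ v k ⁻¹

  -- Elimination with the pivot v_k: a kernel vector x of the Schur complement extends by the first
  -- coordinate that solves row k.
  schur⇒ : ∀ ρ (W : Mat n n) → Nonsing(λ i → v i ∷ᶠ insertAt W k ρ i) → Nonsing(W +M outer p ρ)
  schur⇒ ρ W h x z i = h X(punch-elim k(λ i → apply(λ i → v i ∷ᶠ insertAt W k ρ i) X i ≡ 0#) at-k at-j)(fs i)
   where
   X = (v k ⁻¹ ⊙ dot ρ x) ∷ᶠ x
   at-k : apply(λ i → v i ∷ᶠ insertAt W k ρ i) X k ≡ 0#
   at-k = ⨁-suc _ ∙ ≡⇒⊕≡0(sym(⊙-assoc _ _ _) ∙ cong(_⊙ dot ρ x)(⁻¹-inverse _ vₖ≢0) ∙ ⊙-idˡ _ ∙ cong(λ w → dot w x)(sym(insertAt-lookup W k ρ)))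
   at-j : ∀ j → apply(λ i → v i ∷ᶠ insertAt W k ρ i) X(punchIn k j) ≡ 0#
   at-j j = ⨁-suc _ ∙ ⊕-comm _ _ ∙ cong₂ _⊕_ (cong(λ w → dot w x)(insertAt-punchIn W k ρ j))(sym(⊙-assoc _ _ _) ∙ sym(apply-outer p ρ x j)) ∙
    sym(apply-+M W(outer p ρ) x j) ∙ z j

  schur⇐ : ∀ ρ (W : Mat n n) → Nonsing(W +M outer p ρ) → Nonsing(λ i → v i ∷ᶠ insertAt W k ρ i)
  schur⇐ ρ W h X z = λ { fz → x₀≡0 ; (fs i) → x≡0 i }
   where
   x = X ∘ fs
   x₀ = X fz
   at-k : v k ⊙ x₀ ≡ dot ρ x
   at-k = ⊕≡0⇒≡(cong(v k ⊙ x₀ ⊕_)(cong(λ w → dot w x)(sym(insertAt-lookup W k ρ))) ∙ sym(⨁-suc _) ∙ z k)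
   x≡0 : x ≈0
   x≡0 = h x(λ j → apply-+M W(outer p ρ) x j ∙ cong(apply W x j ⊕_)(apply-outer p ρ x j ∙ cong(p j ⊙_)(sym at-k) ∙
     solve 4(λ a b c d → a :* b :* (c :* d) := (c :* b) :* (a :* d)) refl(v(punchIn k j))(v k ⁻¹)(v k) x₀ ∙ cong(_⊙ (v(punchIn k j) ⊙ x₀))(⁻¹-inverse _ vₖ≢0) ∙ ⊙-idˡ _) ∙
    ⊕-comm _ _ ∙ cong(v(punchIn k j) ⊙ x₀ ⊕_)(cong(λ w → dot w x)(sym(insertAt-punchIn W k ρ j))) ∙ sym(⨁-suc _) ∙ z(punchIn k j))
   x₀≡0 : x₀ ≡ 0#
   x₀≡0 = ⊙-nonzeroʳ vₖ≢0(at-k ∙ dot-zeroʳ ρ x≡0)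

  -- The Schur complement differs from W by a fixed matrix for each pivot row, so it runs through
  -- all matrices as W does. There are q^n pivot rows.
  ∑-first-column : ∑(Mats(suc n) n)(λ B → χ(nonsing? λ i → v i ∷ᶠ B i)) ≡ Q ^ n * gl n
  ∑-first-column = ∑-insert(𝕍 n) k(λ e → χNonsing-cong λ { i fz → refl ; i(fs j) → e i j }) ∙
   ∑-cong(enum(𝕍 n))(λ ρ → ∑-cong(Mats n n)(λ W → χ-⇔(nonsing? _)(nonsing?(W +M outer p ρ))(schur⇒ ρ W)(schur⇐ ρ W)) ∙
    ∑-translate(outer p ρ) {λ W → χ(nonsing? W)} χNonsing-cong) ∙ ∑𝕍-const n(gl n)

 gl-suc : ∀ n → gl(suc n) ≡ (Q ^ suc n - 1ℤ) * (Q ^ n * gl n)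
 gl-suc n = ∑-∷ χNonsing-cong ∙ ∑-nonzero-vectors(suc n)(Q ^ n * gl n) _
  (λ v z → ∑-cong(Mats(suc n) n)(λ B → χ-no(nonsing? λ i → v i ∷ᶠ B i) λ h → 0≢1(sym(h(1# ∷ᶠ λ _ → 0#)
   (λ i → ⨁-suc _ ∙ cong₂ _⊕_ (cong(_⊙ 1#)(z i) ∙ ⊙-0ˡ 1#)(dot-zeroʳ(B i) λ _ → refl) ∙ ⊕-idˡ 0#) fz))) ∙ ∑-zero(Mats(suc n) n))
  (λ v nz → let (k , vₖ) = pivot nz in ∑-first-column k v vₖ)

 form : ∀ {n} → Mat n n → Vecᶠ n → Vecᶠ n → Fq
 form S x y = dot x(apply S y)

 form-cong : ∀ {n} {S S' : Mat n n} {x x' y y'} → S ≋ S' → (∀ i → x i ≡ x' i) → (∀ i → y i ≡ y' i) → form S x y ≡ form S' x' y'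
 form-cong {S = S} {S'} e ex ey = dot-cong ex(apply-cong {M = S} {S'} e ey)

 form-+M : ∀ {n} (S P : Mat n n) x y → form(S +M P) x y ≡ form S x y ⊕ form P x y
 form-+M S P x y = dot-cong(λ _ → refl)(apply-+M S P y) ∙ dot-⊕ʳ x(apply S y)(apply P y)

 form-outer : ∀ {n} (p r : Vecᶠ n) x y → form(outer p r) x y ≡ dot p x ⊙ dot r y
 form-outer p r x y = dot-cong(λ _ → refl)(λ i → apply-outer p r y i ∙ ⊙-comm(p i)(dot r y)) ∙ dot-⊙ʳ(dot r y) x p ∙ ⊙-comm _ _ ∙ cong(_⊙ dot r y)(dot-comm x p)

 -- The pairing of S with ᵗh δ h for the matrix h with the two rows x and y. For n = 1 it is a
 -- multiple of θ₀.
 Φ : ∀ {n} → Mat n n → Vecᶠ n → Vecᶠ n → Fq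
 Φ S x y = form S x x ⊕ form S x y ⊕ κ ⊙ form S y y

 Φ-cong : ∀ {n} {S S' : Mat n n} {x x' y y'} → S ≋ S' → (∀ i → x i ≡ x' i) → (∀ i → y i ≡ y' i) → Φ S x y ≡ Φ S' x' y'
 Φ-cong {S = S} {S'} e ex ey = cong₂ _⊕_ (cong₂ _⊕_ (form-cong {S = S} {S'} e ex ex)(form-cong {S = S} {S'} e ex ey))(cong(κ ⊙_)(form-cong {S = S} {S'} e ey ey))

 symBorder : ∀ {n} → Fin(suc n) → Fq → Vecᶠ n → Mat n n → Mat(suc n)(suc n)
 symBorder k c ρ S = insertAt(λ j → insertAt(S j) k(ρ j)) k(insertAt ρ k c)

 module _ {n : ℕ} (k : Fin(suc n))(c : Fq)(ρ : Vecᶠ n)(S : Mat n n) where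
  private
   M = symBorder k c ρ S

  row-k : ∀ i → M k i ≡ insertAt ρ k c i
  row-k i = cong(λ f → f i)(insertAt-lookup(λ j → insertAt(S j) k(ρ j)) k(insertAt ρ k c))

  row-j : ∀ j i → M(punchIn k j) i ≡ insertAt(S j) k(ρ j) i
  row-j j i = cong(λ f → f i)(insertAt-punchIn(λ j → insertAt(S j) k(ρ j)) k(insertAt ρ k c) j)

  apply-k : ∀ x → apply M x k ≡ c ⊙ x k ⊕ dot ρ(x ∘ punchIn k)
  apply-k x = dot-cong row-k(λ _ → refl) ∙ dot-comm _ x ∙ dot-insertʳ k x c ρ ∙ cong₂ _⊕_ (⊙-comm _ _)(dot-comm _ ρ)

  apply-j : ∀ x j → apply M x(punchIn k j) ≡ ρ j ⊙ x k ⊕ apply S(x ∘ punchIn k) j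
  apply-j x j = dot-cong(row-j j)(λ _ → refl) ∙ dot-comm _ x ∙ dot-insertʳ k x(ρ j)(S j) ∙ cong₂ _⊕_ (⊙-comm _ _)(dot-comm _ (S j))

  form-border : ∀ a x b y → form M(insertAt x k a)(insertAt y k b) ≡ c ⊙ a ⊙ b ⊕ a ⊙ dot ρ y ⊕ b ⊙ dot ρ x ⊕ form S x y
  form-border a x b y = begin
   _ ≡⟨ dot-comm(insertAt x k a) _ ∙ dot-insertʳ k _ a x ⟩
   apply M(insertAt y k b) k ⊙ a ⊕ dot(λ j → apply M(insertAt y k b)(punchIn k j)) x ≡⟨ cong₂(λ u w → u ⊙ a ⊕ w)
    (apply-k _ ∙ cong₂(λ u w → c ⊙ u ⊕ w)(insertAt-lookup y k b)(dot-cong(λ _ → refl)(insertAt-punchIn y k b)))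
    (dot-cong(λ j → apply-j _ j ∙ cong₂(λ u w → ρ j ⊙ u ⊕ w)(insertAt-lookup y k b)(dot-cong(λ _ → refl)(insertAt-punchIn y k b))) λ _ → refl) ⟩
   (c ⊙ b ⊕ dot ρ y) ⊙ a ⊕ dot(λ j → ρ j ⊙ b ⊕ apply S y j) x ≡⟨ cong((c ⊙ b ⊕ dot ρ y) ⊙ a ⊕_)(dot-⊕ˡ(λ j → ρ j ⊙ b)(apply S y) x ∙
    cong₂ _⊕_ (dot-cong(λ j → ⊙-comm(ρ j) b)(λ _ → refl) ∙ dot-⊙ˡ b ρ x)(dot-comm(apply S y) x)) ⟩
   (c ⊙ b ⊕ dot ρ y) ⊙ a ⊕ (b ⊙ dot ρ x ⊕ form S x y) ≡⟨ solve 6(λ c b r a s f → (c :* b :+ r) :* a :+ (b :* s :+ f) := c :* a :* b :+ a :* r :+ b :* s :+ f) refl c b(dot ρ y) a(dot ρ x)(form S x y) ⟩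
   _ ∎

  symBorder-symmetric : Symmetric S → Symmetric M
  symBorder-symmetric s = punch-elim k(λ i → ∀ j → M i j ≡ M j i)
   (punch-elim k(λ j → M k j ≡ M j k) refl λ j → row-k(punchIn k j) ∙ insertAt-punchIn ρ k c j ∙ sym(row-j j k ∙ insertAt-lookup(S j) k(ρ j)))
   (λ i → punch-elim k(λ j → M(punchIn k i) j ≡ M j(punchIn k i))(row-j i k ∙ insertAt-lookup(S i) k(ρ i) ∙ sym(row-k(punchIn k i) ∙ insertAt-punchIn ρ k c i))
    λ j → row-j i(punchIn k j) ∙ insertAt-punchIn(S i) k(ρ i) j ∙ s i j ∙ sym(row-j j(punchIn k i) ∙ insertAt-punchIn(S j) k(ρ j) i))

 ∑-symBorder : ∀ {n} (k : Fin(suc n)) {f : Mat(suc n)(suc n) → ℤ} → FS.Cong(𝕄(suc n)(suc n)) f →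
  ∑(Mats(suc n)(suc n))(λ S → χ(symmetric? S) * f S) ≡ ∑ Fs(λ c → ∑(enum(𝕍 n)) λ ρ → ∑(Mats n n) λ S → χ(symmetric? S) * f(symBorder k c ρ S))
 ∑-symBorder {n} k {f} fc = ∑-bij(𝕄(suc n)(suc n))(𝔽ˢ ×ᶠ (𝕍 n ×ᶠ 𝕄 n n)) symmetric?(λ (c , ρ , S) → symmetric? S) {g = λ (c , ρ , S) → f(symBorder k c ρ S)}
   (λ M → M k k , (λ j → M(punchIn k j) k) , λ i j → M(punchIn k i)(punchIn k j))(λ (c , ρ , S) → symBorder k c ρ S)
   (λ {M} {(c , ρ , S)} s(ec , eρ , eS) →
    let p : M ≋ symBorder k c ρ S
        p = punch-elim k(λ i → ∀ j → M i j ≡ symBorder k c ρ S i j)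
          (punch-elim k(λ j → M k j ≡ symBorder k c ρ S k j)(sym ec ∙ sym(row-k k c ρ S k ∙ insertAt-lookup ρ k c))
            λ j → s k(punchIn k j) ∙ sym(eρ j) ∙ sym(row-k k c ρ S(punchIn k j) ∙ insertAt-punchIn ρ k c j))
          (λ i → punch-elim k(λ j → M(punchIn k i) j ≡ symBorder k c ρ S(punchIn k i) j)(sym(eρ i) ∙ sym(row-j k c ρ S i k ∙ insertAt-lookup(S i) k(ρ i)))
            λ j → sym(eS i j) ∙ sym(row-j k c ρ S i(punchIn k j) ∙ insertAt-punchIn(S i) k(ρ i) j))
    in Symmetric-cong(λ i j → sym(eS i j))(λ i j → s(punchIn k i)(punchIn k j)) , p , fc p)
   (λ {M} {(c , ρ , S)} s e → Symmetric-cong(λ i j → sym(e i j))(symBorder-symmetric k c ρ S s) ,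
    sym(e k k ∙ row-k k c ρ S k ∙ insertAt-lookup ρ k c) ,
    (λ j → sym(e(punchIn k j) k ∙ row-j k c ρ S j k ∙ insertAt-lookup(S j) k(ρ j))) ,
    λ i j → sym(e(punchIn k i)(punchIn k j) ∙ row-j k c ρ S i(punchIn k j) ∙ insertAt-punchIn(S i) k(ρ i) j)) ∙
  ∑-cartesianProduct Fs(cartesianProduct(enum(𝕍 n))(Mats n n)) _ ∙ ∑-cong Fs(λ c → ∑-cartesianProduct(enum(𝕍 n))(Mats n n) _)

 module GaussSum (a : Fq)(a≢0 : a ≢ 0#) where
  W : ∀ {n} → Mat n n → ℤ
  W {n} S = ∑(enum(𝕍 n))(λ x → ∑(enum(𝕍 n)) λ y → λ'(a ⊙ Φ S x y))

  W-cong : ∀ {n} {S S' : Mat n n} → S ≋ S' → W S ≡ W S'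
  W-cong {n} {S} {S'} e = ∑-cong(enum(𝕍 n))(λ x → ∑-cong(enum(𝕍 n)) λ y → cong(λ z → λ'(a ⊙ z))(Φ-cong {S = S} {S'} e(λ _ → refl) λ _ → refl))

  w : ∀ {n} → Mat n n → ℤ
  w S = χ(nonsing? S) * W S

  w-cong : ∀ {n} {S S' : Mat n n} → S ≋ S' → w S ≡ w S'
  w-cong {S = S} {S'} e = cong₂ _*_ (χNonsing-cong e)(W-cong {S = S} {S'} e)

  G : ℕ → ℤ
  G n = ∑(Mats n n)(λ S → χ(symmetric? S) * w S)

  ∑-shift : ∀ {n} (P : Mat n n) → Symmetric P → ∑(Mats n n)(λ S → χ(symmetric? S) * w(S +M P)) ≡ G n
  ∑-shift P s = ∑-translate-sym P s {w} w-cong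

  W-border : ∀ {n} (k : Fin(suc n)) c ρ (S : Mat n n) → W(symBorder k c ρ S) ≡
   ∑(enum(𝕍 n))(λ x → ∑(enum(𝕍 n)) λ y → ∑ Fs λ α → ∑ Fs λ β → λ'(a ⊙ Φ(symBorder k c ρ S)(insertAt x k α)(insertAt y k β)))
  W-border {n} k c ρ S = begin
   _ ≡⟨ ∑-insert 𝔽ˢ k {λ x → ∑(enum(𝕍(suc n)))(λ y → λ'(a ⊙ Φ M x y))} (λ e → ∑-cong(enum(𝕍(suc n))) λ y → cong(λ z → λ'(a ⊙ z))(Φ-cong {S = M} {M} (λ _ _ → refl) e λ _ → refl)) ⟩
   ∑ Fs(λ α → ∑(enum(𝕍 n)) λ x → ∑(enum(𝕍(suc n))) λ y → λ'(a ⊙ Φ M(insertAt x k α) y)) ≡⟨ ∑-swap Fs(enum(𝕍 n)) _ ⟩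
   ∑(enum(𝕍 n))(λ x → ∑ Fs λ α → ∑(enum(𝕍(suc n))) λ y → λ'(a ⊙ Φ M(insertAt x k α) y)) ≡⟨ ∑-cong(enum(𝕍 n))(λ x → ∑-cong Fs(λ α →
    ∑-insert 𝔽ˢ k {λ y → λ'(a ⊙ Φ M(insertAt x k α) y)} (λ e → cong(λ z → λ'(a ⊙ z))(Φ-cong {S = M} {M} (λ _ _ → refl)(λ _ → refl) e)) ∙ ∑-swap Fs(enum(𝕍 n)) _) ∙
    ∑-swap Fs(enum(𝕍 n)) _) ⟩
   _ ∎
   where M = symBorder k c ρ S

  Φ-border : ∀ {n} (k : Fin(suc n)) c ρ (S : Mat n n) α x β y → Φ(symBorder k c ρ S)(insertAt x k α)(insertAt y k β)
   ≡ c ⊙ θ₀ α β ⊕ (α ⊙ dot ρ y ⊕ β ⊙ dot ρ x) ⊕ Φ S x y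
  Φ-border k c ρ S α x β y = cong₂ _⊕_ (cong₂ _⊕_ (form-border k c ρ S α x α x)(form-border k c ρ S α x β y))(cong(κ ⊙_)(form-border k c ρ S β y β y)) ∙
   solve 9(λ c a b r s f g h k → (c :* a :* a :+ a :* r :+ a :* r :+ f) :+ (c :* a :* b :+ a :* s :+ b :* r :+ g) :+ k :* (c :* b :* b :+ b :* s :+ b :* s :+ h)
    := c :* (a :* a :+ a :* b :+ k :* b :* b) :+ (a :* s :+ b :* r) :+ (f :+ g :+ k :* h)) refl c α β(dot ρ x)(dot ρ y)(form S x x)(form S x y)(form S y y) κ

  -- Corner c ≠ 0. Completing the square with p = ρ/c splits off c θ₀(α + p·x, β + p·y), whose
  -- character sum is -q. What remains belongs to S plus a fixed symmetric matrix of rank at most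
  -- one, and this translate runs through the symmetric matrices as S does.
  module Anisotropic {n : ℕ} (c : Fq)(c≢0 : c ≢ 0#)(ρ : Vecᶠ n) where
   p : Vecᶠ n
   p j = ρ j ⊙ c ⁻¹

   P : Mat n n
   P = outer p ρ

   P-sym : Symmetric P
   P-sym i j = solve 3(λ a b c → a :* c :* b := b :* c :* a) refl(ρ i)(ρ j)(c ⁻¹)

   dot-p : ∀ x → c ⊙ dot p x ≡ dot ρ x
   dot-p x = sym(dot-⊙ˡ c p x) ∙ dot-cong(λ j → solve 3(λ c r d → c :* (r :* d) := r :* (c :* d)) refl c(ρ j)(c ⁻¹) ∙ cong(ρ j ⊙_)(⁻¹-inverse c c≢0) ∙ ⊙-idʳ _)(λ _ → refl)

   Φ-complete : ∀ S α x β y → Φ(symBorder fz c ρ S)(insertAt x fz α)(insertAt y fz β) ≡ c ⊙ θ₀(α ⊕ dot p x)(β ⊕ dot p y) ⊕ Φ(S +M P) x y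
   Φ-complete S α x β y = Φ-border fz c ρ S α x β y ∙ cong₂(λ u v → c ⊙ θ₀ α β ⊕ (α ⊙ u ⊕ β ⊙ v) ⊕ Φ S x y)(sym(dot-p y))(sym(dot-p x)) ∙
    solve 9(λ c a b s t f g h k → c :* (a :* a :+ a :* b :+ k :* b :* b) :+ (a :* (c :* t) :+ b :* (c :* s)) :+ (f :+ g :+ k :* h)
     := c :* ((a :+ s) :* (a :+ s) :+ (a :+ s) :* (b :+ t) :+ k :* (b :+ t) :* (b :+ t)) :+ ((f :+ s :* (c :* s)) :+ (g :+ s :* (c :* t)) :+ k :* (h :+ t :* (c :* t)))) refl c α β(dot p x)(dot p y)(form S x x)(form S x y)(form S y y) κ ∙
    cong(c ⊙ θ₀(α ⊕ dot p x)(β ⊕ dot p y) ⊕_)(sym(cong₂ _⊕_ (cong₂ _⊕_ (f x x)(f x y))(cong(κ ⊙_)(f y y))))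
    where
    f : ∀ x y → form(S +M P) x y ≡ form S x y ⊕ dot p x ⊙ (c ⊙ dot p y)
    f x y = form-+M S P x y ∙ cong(form S x y ⊕_)(form-outer p ρ x y ∙ cong(dot p x ⊙_)(sym(dot-p y)))

   W-complete : ∀ S → W(symBorder fz c ρ S) ≡ - Q * W(S +M P)
   W-complete S = W-border fz c ρ S ∙ ∑-cong(enum(𝕍 n))(λ x → ∑-cong(enum(𝕍 n))(λ y → inner x y) ∙ ∑-*ˡ(enum(𝕍 n))(- Q) _) ∙ ∑-*ˡ(enum(𝕍 n))(- Q) _
    where
    inner : ∀ x y → ∑ Fs(λ α → ∑ Fs λ β → λ'(a ⊙ Φ(symBorder fz c ρ S)(insertAt x fz α)(insertAt y fz β))) ≡ - Q * λ'(a ⊙ Φ(S +M P) x y)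
    inner x y = begin
     _ ≡⟨ ∑-cong Fs(λ α → ∑-cong Fs(λ β → cong λ'(cong(a ⊙_)(Φ-complete S α x β y) ∙
      solve 4(λ a c t f → a :* (c :* t :+ f) := (a :* c :* t :+ con false) :+ a :* f) refl a c(θ₀(α ⊕ dot p x)(β ⊕ dot p y))(Φ(S +M P) x y)) ∙ λ-⊕ _ _) ∙
      ∑-*ʳ Fs(λ'(a ⊙ Φ(S +M P) x y)) _) ⟩
     ∑ Fs(λ α → ∑ Fs(λ β → λ'(a ⊙ c ⊙ θ₀(α ⊕ dot p x)(β ⊕ dot p y) ⊕ 0#)) * λ'(a ⊙ Φ(S +M P) x y)) ≡⟨ ∑-*ʳ Fs(λ'(a ⊙ Φ(S +M P) x y)) _ ⟩
     ∑ Fs(λ α → ∑ Fs λ β → λ'(a ⊙ c ⊙ θ₀(α ⊕ dot p x)(β ⊕ dot p y) ⊕ 0#)) * λ'(a ⊙ Φ(S +M P) x y) ≡⟨ cong(_* λ'(a ⊙ Φ(S +M P) x y))(∑-cong Fs(λ α → ∑𝔽-translate(dot p y) λ β → λ'(a ⊙ c ⊙ θ₀(α ⊕ dot p x) β ⊕ 0#)) ∙ ∑𝔽-translate(dot p x)(λ α → ∑ Fs λ β → λ'(a ⊙ c ⊙ θ₀ α β ⊕ 0#)) ∙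
      ∑-cong Fs(λ α → ∑-cong Fs λ β → cong(λ z → λ'(a ⊙ c ⊙ θ₀ α β ⊕ z))(sym(⊙-0ˡ β))) ∙ ∑∑λ-θ₀(⊙-≢0 a≢0 c≢0) 0# ∙
      cong(- Q *_)(cong λ'(⊙-0ˡ _) ∙ λ-0) ∙ Z.*-identityʳ(- Q)) ⟩
     _ ∎

   nonsing⇒ : ∀ S → Nonsing(symBorder fz c ρ S) → Nonsing(S +M P)
   nonsing⇒ S h x z i = h(insertAt x fz(dot p x))(λ { fz → apply-k fz c ρ S _ ∙ ≡⇒⊕≡0(dot-p x)
    ; (fs j) → apply-j fz c ρ S _ j ∙ ⊕-comm _ _ ∙ cong(apply S x j ⊕_)(shuffle j x) ∙ sym(apply-+M S P x j) ∙ z j })(fs i)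
    where
    shuffle : ∀ j x → ρ j ⊙ dot p x ≡ apply P x j
    shuffle j x = cong(_⊙ dot p x)(sym(⊙-assoc _ _ _ ∙ cong(ρ j ⊙_)(⁻¹-inverseˡ c≢0) ∙ ⊙-idʳ _)) ∙ ⊙-assoc _ _ _ ∙ cong(p j ⊙_)(dot-p x) ∙ sym(apply-outer p ρ x j)

   nonsing⇐ : ∀ S → Nonsing(S +M P) → Nonsing(symBorder fz c ρ S)
   nonsing⇐ S h X z = λ { fz → x₀≡0 ; (fs i) → x≡0 i }
    where
    x = X ∘ fs
    eq₀ : c ⊙ X fz ≡ dot ρ x
    eq₀ = ⊕≡0⇒≡(sym(apply-k fz c ρ S X) ∙ z fz)
    x≡0 : x ≈0
    x≡0 = h x(λ j → apply-+M S P x j ∙ cong(apply S x j ⊕_)(apply-outer p ρ x j ∙ cong(p j ⊙_)(sym eq₀) ∙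
     solve 4(λ r d c y → r :* d :* (c :* y) := r :* y :* (c :* d)) refl(ρ j)(c ⁻¹) c(X fz) ∙ cong(ρ j ⊙ X fz ⊙_)(⁻¹-inverse c c≢0) ∙ ⊙-idʳ _) ∙
     ⊕-comm _ _ ∙ sym(apply-j fz c ρ S X j) ∙ z(fs j))
    x₀≡0 : X fz ≡ 0#
    x₀≡0 = ⊙-nonzeroʳ c≢0(eq₀ ∙ dot-zeroʳ ρ x≡0)

   ∑-anisotropic : ∑(Mats n n)(λ S → χ(symmetric? S) * w(symBorder fz c ρ S)) ≡ - Q * G n
   ∑-anisotropic = ∑-cong(Mats n n)(λ S → cong(χ(symmetric? S) *_)(cong₂ _*_ (χ-⇔(nonsing? _)(nonsing?(S +M P))(nonsing⇒ S)(nonsing⇐ S))(W-complete S) ∙ *-swapˡ(χ(nonsing?(S +M P)))(- Q) _) ∙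
    *-swapˡ(χ(symmetric? S))(- Q) _) ∙ ∑-*ˡ(Mats n n)(- Q) _ ∙ cong(- Q *_)(∑-shift P P-sym)

  -- Corner 0. The new coordinates α and β occur linearly, with coefficients ρ·y and ρ·x, so their
  -- summation gives q² and confines x and y to the hyperplane orthogonal to ρ.
  W-isotropic : ∀ {n} ρ (S : Mat n n) → W(symBorder fz 0# ρ S) ≡
   Q * Q * ∑(enum(𝕍 n))(λ x → ∑(enum(𝕍 n)) λ y → χ(dot ρ x ≟ 0#) * (χ(dot ρ y ≟ 0#) * λ'(a ⊙ Φ S x y)))
  W-isotropic {n} ρ S = W-border fz 0# ρ S ∙ ∑-cong(enum(𝕍 n))(λ x → ∑-cong(enum(𝕍 n))(λ y → inner x y) ∙ ∑-*ˡ(enum(𝕍 n))(Q * Q) _) ∙ ∑-*ˡ(enum(𝕍 n))(Q * Q) _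
   where
   regroup : ∀ q s t l → q * s * (q * t) * l ≡ q * q * (t * (s * l))
   regroup = ring
   detect : ∀ z → ∑ Fs(λ α → λ'(a ⊙ z ⊙ α)) ≡ Q * χ(z ≟ 0#)
   detect z = ∑λ-⊙(a ⊙ z) ∙ cong(Q *_)(χ-⇔(a ⊙ z ≟ 0#)(z ≟ 0#)(⊙-nonzeroʳ a≢0) λ e → cong(a ⊙_) e ∙ ⊙-0ʳ a)
   inner : ∀ x y → ∑ Fs(λ α → ∑ Fs λ β → λ'(a ⊙ Φ(symBorder fz 0# ρ S)(insertAt x fz α)(insertAt y fz β))) ≡ Q * Q * (χ(dot ρ x ≟ 0#) * (χ(dot ρ y ≟ 0#) * λ'(a ⊙ Φ S x y)))
   inner x y = begin
    _ ≡⟨ ∑-cong Fs(λ α → ∑-cong Fs λ β → cong λ'(cong(a ⊙_)(Φ-border fz 0# ρ S α x β y) ∙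
     solve 7(λ a α s β t f θ → a :* (con false :* θ :+ (α :* s :+ β :* t) :+ f) := (a :* s :* α :+ a :* t :* β) :+ a :* f) refl a α(dot ρ y) β(dot ρ x)(Φ S x y)(θ₀ α β)) ∙ λ-⊕ _ _ ∙ cong(_* λ'(a ⊙ Φ S x y))(λ-⊕ _ _)) ⟩
    ∑ Fs(λ α → ∑ Fs λ β → λ'(a ⊙ dot ρ y ⊙ α) * λ'(a ⊙ dot ρ x ⊙ β) * λ'(a ⊙ Φ S x y)) ≡⟨ ∑-cong Fs(λ α → ∑-*ʳ Fs(λ'(a ⊙ Φ S x y)) _) ∙ ∑-*ʳ Fs(λ'(a ⊙ Φ S x y)) _ ⟩
    ∑ Fs(λ α → ∑ Fs λ β → λ'(a ⊙ dot ρ y ⊙ α) * λ'(a ⊙ dot ρ x ⊙ β)) * λ'(a ⊙ Φ S x y) ≡⟨ cong(_* λ'(a ⊙ Φ S x y))(∑-* Fs Fs _ _ ∙ cong₂ _*_ (detect(dot ρ y))(detect(dot ρ x))) ⟩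
    Q * χ(dot ρ y ≟ 0#) * (Q * χ(dot ρ x ≟ 0#)) * λ'(a ⊙ Φ S x y) ≡⟨ regroup Q(χ(dot ρ y ≟ 0#))(χ(dot ρ x ≟ 0#))(λ'(a ⊙ Φ S x y)) ⟩
    _ ∎

  -- A hyperbolic plane splits off: S restricted to the hyperplane ρ · x = 0, solved for the pivot coordinate.
  module Hyperbolic {n : ℕ} (ρ : Vecᶠ(suc n))(k : Fin(suc n))(ρₖ≢0 : ρ k ≢ 0#)(c : Fq)(r : Vecᶠ n) where
   p : Vecᶠ n
   p j = ρ k ⁻¹ ⊙ ρ(punchIn k j)

   P : Mat n n
   P = outer p(λ j → c ⊙ p j) +M (outer p r +M outer r p)

   P-sym : Symmetric P
   P-sym i j = solve 5(λ a b c x y → a :* (c :* b) :+ (a :* y :+ x :* b) := b :* (c :* a) :+ (b :* x :+ y :* a)) refl(p i)(p j) c(r i)(r j)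

   module _ (S : Mat n n) where
    M = symBorder k c r S

    form-restrict : ∀ x y → form M(insertAt x k(dot p x))(insertAt y k(dot p y)) ≡ form(S +M P) x y
    form-restrict x y = form-border k c r S(dot p x) x(dot p y) y ∙ sym(begin
     _ ≡⟨ form-+M S P x y ∙ cong(form S x y ⊕_)(form-+M(outer p λ j → c ⊙ p j)(outer p r +M outer r p) x y ∙
      cong₂ _⊕_ (form-outer p _ x y ∙ cong(dot p x ⊙_)(dot-⊙ˡ c p y))(form-+M(outer p r)(outer r p) x y ∙ cong₂ _⊕_ (form-outer p r x y)(form-outer r p x y))) ⟩
     form S x y ⊕ (dot p x ⊙ (c ⊙ dot p y) ⊕ (dot p x ⊙ dot r y ⊕ dot r x ⊙ dot p y)) ≡⟨ solve 6(λ f s c t u v → f :+ (s :* (c :* t) :+ (s :* u :+ v :* t)) := c :* s :* t :+ s :* u :+ t :* v :+ f) refl(form S x y)(dot p x) c(dot p y)(dot r y)(dot r x) ⟩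
     _ ∎)

    Φ-restrict : ∀ x y → Φ M(insertAt x k(dot p x))(insertAt y k(dot p y)) ≡ Φ(S +M P) x y
    Φ-restrict x y = cong₂ _⊕_ (cong₂ _⊕_ (form-restrict x x)(form-restrict x y))(cong(κ ⊙_)(form-restrict y y))

    on-hyperplane⇒ : ∀ {α x} → dot ρ(insertAt x k α) ≡ 0# → α ≡ dot p x
    on-hyperplane⇒ {α} {x} e = ⊙-cancelˡ ρₖ≢0(⊕≡0⇒≡(sym(dot-insertʳ k ρ α x) ∙ e) ∙ sym(ρp x))
     where
     ρp : ∀ x → ρ k ⊙ dot p x ≡ dot(ρ ∘ punchIn k) x
     ρp x = cong(ρ k ⊙_)(dot-⊙ˡ(ρ k ⁻¹) _ x) ∙ sym(⊙-assoc _ _ _) ∙ cong(_⊙ dot(ρ ∘ punchIn k) x)(⁻¹-inverse _ ρₖ≢0) ∙ ⊙-idˡ _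

    on-hyperplane⇐ : ∀ {α x} → α ≡ dot p x → dot ρ(insertAt x k α) ≡ 0#
    on-hyperplane⇐ {α} {x} refl = dot-insertʳ k ρ α x ∙ ≡⇒⊕≡0(cong(ρ k ⊙_)(dot-⊙ˡ(ρ k ⁻¹) _ x) ∙ sym(⊙-assoc _ _ _) ∙ cong(_⊙ dot(ρ ∘ punchIn k) x)(⁻¹-inverse _ ρₖ≢0) ∙ ⊙-idˡ _)

    ∑-hyperplane : {f : Vecᶠ(suc n) → ℤ} → FS.Cong(𝕍(suc n)) f → ∑(enum(𝕍(suc n)))(λ x → χ(dot ρ x ≟ 0#) * f x) ≡ ∑(enum(𝕍 n))(λ x → f(insertAt x k(dot p x)))
    ∑-hyperplane {f} fc = ∑-insert 𝔽ˢ k {λ x → χ(dot ρ x ≟ 0#) * f x} (λ e → cong₂(λ u v → χ(u ≟ 0#) * v)(dot-cong(λ _ → refl) e)(fc e)) ∙ ∑-swap Fs(enum(𝕍 n)) _ ∙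
     ∑-cong(enum(𝕍 n))(λ x → ∑-cong Fs(λ α → cong(_* f(insertAt x k α))(χ-⇔(dot ρ(insertAt x k α) ≟ 0#)(α ≟ dot p x) on-hyperplane⇒ on-hyperplane⇐)) ∙
      ∑-sift 𝔽ˢ(dot p x)(cong λ α → f(insertAt x k α)))

    W-hyperbolic : W(symBorder fz 0# ρ M) ≡ Q * Q * W(S +M P)
    W-hyperbolic = W-isotropic ρ M ∙ cong(Q * Q *_)(begin
     _ ≡⟨ ∑-cong(enum(𝕍(suc n)))(λ x → ∑-*ˡ(enum(𝕍(suc n)))(χ(dot ρ x ≟ 0#)) _ ∙
      cong(χ(dot ρ x ≟ 0#) *_)(∑-hyperplane {λ y → λ'(a ⊙ Φ M x y)} λ e → cong(λ z → λ'(a ⊙ z))(Φ-cong {S = M} {M} (λ _ _ → refl)(λ _ → refl) e))) ⟩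
     ∑(enum(𝕍(suc n)))(λ x → χ(dot ρ x ≟ 0#) * ∑(enum(𝕍 n)) λ y → λ'(a ⊙ Φ M x(insertAt y k(dot p y)))) ≡⟨ ∑-hyperplane(λ e → ∑-cong(enum(𝕍 n)) λ y → cong(λ z → λ'(a ⊙ z))(Φ-cong {S = M} {M} (λ _ _ → refl) e λ _ → refl)) ⟩
     ∑(enum(𝕍 n))(λ x → ∑(enum(𝕍 n)) λ y → λ'(a ⊙ Φ M(insertAt x k(dot p x))(insertAt y k(dot p y)))) ≡⟨ ∑-cong(enum(𝕍 n))(λ x → ∑-cong(enum(𝕍 n)) λ y → cong(λ z → λ'(a ⊙ z))(Φ-restrict x y)) ⟩
     _ ∎)

    private
     eS : ∀ x j → apply(S +M P) x j ≡ p j ⊙ (c ⊙ dot p x ⊕ dot r x) ⊕ (r j ⊙ dot p x ⊕ apply S x j)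
     eS x j = apply-+M S P x j ∙ cong(apply S x j ⊕_)(apply-+M(outer p λ j → c ⊙ p j)(outer p r +M outer r p) x j ∙
       cong₂ _⊕_ (apply-outer p _ x j ∙ cong(p j ⊙_)(dot-⊙ˡ c p x))(apply-+M(outer p r)(outer r p) x j ∙ cong₂ _⊕_ (apply-outer p r x j)(apply-outer r p x j))) ∙
      solve 6(λ f p c s t r → f :+ (p :* (c :* s) :+ (p :* t :+ r :* s)) := p :* (c :* s :+ t) :+ (r :* s :+ f)) refl(apply S x j)(p j) c(dot p x)(dot r x)(r j)

    hyperbolic⇒ : Nonsing(symBorder fz 0# ρ M) → Nonsing(S +M P)
    hyperbolic⇒ h x z i = sym(insertAt-punchIn x k(dot p x) i) ∙ h X(λ { fz → apply-k fz 0# ρ M X ∙ cong₂ _⊕_ (⊙-0ˡ _)(on-hyperplane⇐ refl) ∙ ⊕-idˡ 0#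
       ; (fs j) → apply-j fz 0# ρ M X j ∙ punch-elim k(λ j → ρ j ⊙ x₀ ⊕ apply M x' j ≡ 0#) at-k at-j j })(fs(punchIn k i))
     where
     x' = insertAt x k(dot p x)
     t = c ⊙ dot p x ⊕ dot r x
     x₀ = ρ k ⁻¹ ⊙ t
     X = insertAt x' fz x₀
     at-k : ρ k ⊙ x₀ ⊕ apply M x' k ≡ 0#
     at-k = ≡⇒⊕≡0(sym(⊙-assoc _ _ _) ∙ cong(_⊙ t)(⁻¹-inverse _ ρₖ≢0) ∙ ⊙-idˡ t ∙
      sym(apply-k k c r S x' ∙ cong₂(λ u v → c ⊙ u ⊕ v)(insertAt-lookup x k _)(dot-cong(λ _ → refl)(insertAt-punchIn x k _))))
     at-j : ∀ j → ρ(punchIn k j) ⊙ x₀ ⊕ apply M x'(punchIn k j) ≡ 0#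
     at-j j = cong₂ _⊕_ (solve 3(λ a b t → a :* (b :* t) := b :* a :* t) refl(ρ(punchIn k j))(ρ k ⁻¹) t)
      (apply-j k c r S x' j ∙ cong₂(λ u v → r j ⊙ u ⊕ v)(insertAt-lookup x k _)(dot-cong(λ _ → refl)(insertAt-punchIn x k _))) ∙ sym(eS x j) ∙ z j

    hyperbolic⇐ : Nonsing(S +M P) → Nonsing(symBorder fz 0# ρ M)
    hyperbolic⇐ h X z = λ { fz → x₀≡0 ; (fs i) → x'≡0 i }
     where
     x' = X ∘ fs
     x₀ = X fz
     x = x' ∘ punchIn k
     glue : ∀ i → insertAt x k(x' k) i ≡ x' i
     glue = insertAt-removeAt x' k
     xₖ : x' k ≡ dot p x
     xₖ = on-hyperplane⇒(dot-cong(λ _ → refl) glue ∙ sym(cong(_⊕ dot ρ x')(⊙-0ˡ x₀) ∙ ⊕-idˡ _) ∙ sym(apply-k fz 0# ρ M X) ∙ z fz)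
     rows : ∀ j → ρ j ⊙ x₀ ⊕ apply M x' j ≡ 0#
     rows j = sym(apply-j fz 0# ρ M X j) ∙ z(fs j)
     t = c ⊙ dot p x ⊕ dot r x
     row-t : ρ k ⊙ x₀ ≡ t
     row-t = ⊕≡0⇒≡(rows k) ∙ apply-k k c r S x' ∙ cong(λ u → c ⊙ u ⊕ dot r x) xₖ
     x≡0 : x ≈0
     x≡0 = h x(λ j → eS x j ∙ cong₂ _⊕_ (cong(p j ⊙_)(sym row-t) ∙ solve 4(λ i a k y → i :* a :* (k :* y) := (k :* i) :* (a :* y)) refl(ρ k ⁻¹)(ρ(punchIn k j))(ρ k) x₀ ∙ cong(_⊙ (ρ(punchIn k j) ⊙ x₀))(⁻¹-inverse _ ρₖ≢0) ∙ ⊙-idˡ _)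
      (cong(λ u → r j ⊙ u ⊕ apply S x j)(sym xₖ) ∙ sym(apply-j k c r S x' j)) ∙ rows(punchIn k j))
     x'≡0 : x' ≈0
     x'≡0 = punch-elim k(λ i → x' i ≡ 0#)(xₖ ∙ dot-zeroʳ p x≡0) x≡0
     x₀≡0 : x₀ ≡ 0#
     x₀≡0 = ⊙-nonzeroʳ ρₖ≢0(row-t ∙ cong₂ _⊕_ (cong(c ⊙_)(dot-zeroʳ p x≡0) ∙ ⊙-0ʳ c)(dot-zeroʳ r x≡0) ∙ ⊕-idˡ 0#)

   ∑-hyperbolic : ∑(Mats n n)(λ S → χ(symmetric? S) * w(symBorder fz 0# ρ(symBorder k c r S))) ≡ Q * Q * G n
   ∑-hyperbolic = ∑-cong(Mats n n)(λ S → cong(χ(symmetric? S) *_)(cong₂ _*_ (χ-⇔(nonsing? _)(nonsing?(S +M P))(hyperbolic⇒ S)(hyperbolic⇐ S))(W-hyperbolic S) ∙ *-swapˡ(χ(nonsing?(S +M P)))(Q * Q) _) ∙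
    *-swapˡ(χ(symmetric? S))(Q * Q) _) ∙ ∑-*ˡ(Mats n n)(Q * Q) _ ∙ cong(Q * Q *_)(∑-shift P P-sym)

  symBorder-cong : ∀ {n} (k : Fin(suc n)) c ρ {S S' : Mat n n} → S ≋ S' → symBorder k c ρ S ≋ symBorder k c ρ S'
  symBorder-cong k c ρ {S} {S'} e = punch-elim k(λ i → ∀ j → symBorder k c ρ S i j ≡ symBorder k c ρ S' i j)
   (λ j → row-k k c ρ S j ∙ sym(row-k k c ρ S' j))
   (λ i → punch-elim k(λ j → symBorder k c ρ S(punchIn k i) j ≡ symBorder k c ρ S'(punchIn k i) j)
    (row-j k c ρ S i k ∙ insertAt-lookup(S i) k(ρ i) ∙ sym(row-j k c ρ S' i k ∙ insertAt-lookup(S' i) k(ρ i)))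
    λ j → row-j k c ρ S i(punchIn k j) ∙ insertAt-punchIn(S i) k(ρ i) j ∙ e i j ∙ sym(row-j k c ρ S' i(punchIn k j) ∙ insertAt-punchIn(S' i) k(ρ i) j))

  isotropic : ∀ n → Vecᶠ n → ℤ
  isotropic n ρ = ∑(Mats n n)(λ S → χ(symmetric? S) * w(symBorder fz 0# ρ S))

  isotropic-0 : ∀ n ρ → ρ ≈0 → isotropic n ρ ≡ 0ℤ
  isotropic-0 n ρ z = ∑-cong(Mats n n)(λ S → cong(λ t → χ(symmetric? S) * (t * W(symBorder fz 0# ρ S)))(χ-no(nonsing?(symBorder fz 0# ρ S))(singular S)) ∙
    cong(χ(symmetric? S) *_)(Z.*-zeroˡ(W(symBorder fz 0# ρ S))) ∙ Z.*-zeroʳ(χ(symmetric? S))) ∙ ∑-zero(Mats n n)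
   where
   singular : ∀ S → ¬ Nonsing(symBorder fz 0# ρ S)
   singular S h = 0≢1(sym(h X(λ { fz → apply-k fz 0# ρ S X ∙ cong₂ _⊕_ (⊙-0ˡ 1#)(dot-zeroʳ ρ λ _ → refl) ∙ ⊕-idˡ 0#
     ; (fs j) → apply-j fz 0# ρ S X j ∙ cong₂ _⊕_ (cong(_⊙ 1#)(z j) ∙ ⊙-0ˡ 1#)(dot-zeroʳ(S j) λ _ → refl) ∙ ⊕-idˡ 0# }) fz))
    where X = insertAt(λ _ → 0#) fz 1#

  -- A nonzero ρ has a pivot k, at which S is bordered once more by (c, r). The reduced sum q² G(n)
  -- does not depend on the q · q^n choices of c and r.
  isotropic-≢0 : ∀ n ρ → ¬ ρ ≈0 → isotropic(suc n) ρ ≡ Q ^ suc n * (Q * Q * G n)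
  isotropic-≢0 n ρ nz = let (k , ρₖ) = pivot nz in begin
   _ ≡⟨ ∑-symBorder k {λ S → w(symBorder fz 0# ρ S)} (λ e → w-cong(symBorder-cong fz 0# ρ e)) ⟩
   ∑ Fs(λ c → ∑(enum(𝕍 n)) λ r → ∑(Mats n n) λ S → χ(symmetric? S) * w(symBorder fz 0# ρ(symBorder k c r S))) ≡⟨ ∑-cong Fs(λ c → ∑-cong(enum(𝕍 n))(λ r → Hyperbolic.∑-hyperbolic ρ k ρₖ c r) ∙ ∑𝕍-const n(Q * Q * G n)) ⟩
   ∑ Fs(λ _ → Q ^ n * (Q * Q * G n)) ≡⟨ ∑-const Fs _ ∙ sym(Z.*-assoc Q(Q ^ n)(Q * Q * G n)) ⟩
   _ ∎

  -- The corner entry is separated into zero and nonzero values. The latter all give the same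
  -- multiple of the smaller Gauss sum.
  G-step : ∀ n → G(suc n) ≡ ∑(enum(𝕍 n))(isotropic n) + (Q - 1ℤ) * (Q ^ n * (- Q * G n))
  G-step n = ∑-symBorder fz w-cong ∙ ∑-split₀ _ ∙ cong(ℤ._+_ (∑(enum(𝕍 n))(isotropic n)))
   (∑-nz-cong(λ c nc → ∑-cong(enum(𝕍 n))(λ ρ → Anisotropic.∑-anisotropic c nc ρ) ∙ ∑𝕍-const n(- Q * G n) ∙ sym(Z.*-identityˡ _)) ∙
    ∑-*ʳ F*(Q ^ n * (- Q * G n))(λ _ → 1ℤ) ∙ cong(_* (Q ^ n * (- Q * G n))) ∑nz-1)

  G-0 : G 0 ≡ 1ℤ
  G-0 = cong(_+ 0ℤ)(Z.*-identityˡ(w {0} _) ∙ cong₂ _*_ (χ-yes(nonsing? {0} _) λ x z())(cong(λ z → z + 0ℤ + 0ℤ)(cong λ' value ∙ λ-0)) ∙ refl)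
   where
   value : ∀ {S : Mat 0 0} {x y} → a ⊙ Φ S x y ≡ 0#
   value {S} {x} {y} = cong(a ⊙_)(cong₂(λ u v → u ⊕ v ⊕ κ ⊙ form S y y)(⨁-[] _)(⨁-[] _) ∙ cong(λ z → 0# ⊕ 0# ⊕ κ ⊙ z)(⨁-[] _) ∙ solve 1(λ k → con false :+ con false :+ k :* con false := con false) refl κ) ∙ ⊙-0ʳ a

  G-1 : G 1 ≡ - (Q * (Q - 1ℤ))
  G-1 = G-step 0 ∙ cong₂(λ u v → u + (Q - 1ℤ) * (1ℤ * (- Q * v)))(cong(_+ 0ℤ)(isotropic-0 0 _ λ ())) G-0 ∙ arith Q
   where
   arith : ∀ q → 0ℤ + (q - 1ℤ) * (1ℤ * (- q * 1ℤ)) ≡ - (q * (q - 1ℤ))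
   arith = ring

  G-suc-suc : ∀ n → G(suc(suc n)) ≡ (Q ^ suc n - 1ℤ) * (Q ^ suc n * (Q * Q * G n)) + (Q - 1ℤ) * (Q ^ suc n * (- Q * G(suc n)))
  G-suc-suc n = G-step(suc n) ∙ cong(_+ (Q - 1ℤ) * (Q ^ suc n * (- Q * G(suc n))))(∑-nonzero-vectors(suc n)(Q ^ suc n * (Q * Q * G n))(isotropic(suc n))(isotropic-0(suc n))(isotropic-≢0 n))

-- Kloosterman sums over GL_t and block triangular matrices

split-elim : ∀ s {t} (P : Fin(s ∔ t) → Set) → (∀ i → P(i ↑ˡ t)) → (∀ j → P(s ↑ʳ j)) → ∀ k → P k
split-elim s {t} P f g k = subst P(FinP.join-splitAt s t k)(go(splitAt s k))
 where
 go : ∀ z → P(Fin.join s t z)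
 go(inj₁ i) = f i
 go(inj₂ j) = g j

∑-split : (X : FS)(s t : ℕ) {f : (Fin(s ∔ t) → El X) → ℤ} → FS.Cong(Πᶠ(s ∔ t) X) f →
 ∑(enum(Πᶠ(s ∔ t) X)) f ≡ ∑(enum(Πᶠ s X))(λ u → ∑(enum(Πᶠ t X)) λ v → f(u V.++ v))
∑-split X s t {f} c = ∑-reindex(Πᶠ(s ∔ t) X)(Πᶠ s X ×ᶠ Πᶠ t X) {g = λ (u , v) → f(u V.++ v)} (λ w → (λ i → w(i ↑ˡ t)) , λ j → w(s ↑ʳ j))(λ (u , v) → u V.++ v)
  (λ {w} {(u , v)} (e , e') → let p = glue w u v e e' in p , c p)
  (λ {w} {(u , v)} e → (λ i → X.≈-sym(subst(w(i ↑ˡ t) X.≈_)(lookup-++ˡ u v i)(e(i ↑ˡ t)))) , λ j → X.≈-sym(subst(w(s ↑ʳ j) X.≈_)(lookup-++ʳ u v j)(e(s ↑ʳ j)))) ∙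
 ∑-cartesianProduct(enum(Πᶠ s X))(enum(Πᶠ t X)) _
 where
 module X = FS X
 glue : ∀ w u v → (∀ i → u i X.≈ w(i ↑ˡ t)) → (∀ j → v j X.≈ w(s ↑ʳ j)) → ∀ k → w k X.≈(u V.++ v) k
 glue w u v e e' = split-elim s(λ k → w k X.≈(u V.++ v) k)(λ i → subst(w(i ↑ˡ t) X.≈_)(sym(lookup-++ˡ u v i))(X.≈-sym(e i)))(λ j → subst(w(s ↑ʳ j) X.≈_)(sym(lookup-++ʳ u v j))(X.≈-sym(e' j)))

module GeneralLinear (𝒟 : FieldData) where
 open FieldArithmetic 𝒟
 open Characters 𝒟
 open LinearAlgebra 𝒟
 open SymmetricSums 𝒟

 ∑GL : (n : ℕ) → (Mat n n → Mat n n → ℤ) → ℤ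
 ∑GL n f = ∑(Mats n n)(λ A → ∑(Mats n n) λ A' → χ(InvPair? A A') * f A A')

 ∑GL-pairs : ∀ n (f : Mat n n → Mat n n → ℤ) → ∑GL n f ≡ ∑(enum(𝕄 n n ×ᶠ 𝕄 n n))(λ (A , A') → χ(InvPair? A A') * f A A')
 ∑GL-pairs n f = sym(∑-cartesianProduct(Mats n n)(Mats n n) _)

 KGL : Fq → ℕ → ℤ
 KGL a n = ∑GL n(λ A A' → λ'(a ⊙ (Trᵃ A ⊕ Trᵃ A')))

 ⨁-1 : (f : Fin 1 → Fq) → ⨁ f ≡ f fz
 ⨁-1 f = ⨁-suc f ∙ cong(f fz ⊕_)(⨁-[] _) ∙ ⊕-idʳ _

 ⨁-2 : (f : Fin 2 → Fq) → ⨁ f ≡ f fz ⊕ f(fs fz)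
 ⨁-2 f = ⨁-suc f ∙ cong(f fz ⊕_)(⨁-1(f ∘ fs))

 KGL-0 : ∀ a → KGL a 0 ≡ 1ℤ
 KGL-0 a = ∑-cong(Mats 0 0) {g = λ _ → 1ℤ} (λ A → ∑-cong(Mats 0 0) {g = λ _ → 1ℤ} (trivial A)) ∙ refl
  where
  trivial : (A A' : Mat 0 0) → χ(InvPair? A A') * λ'(a ⊙ (Trᵃ A ⊕ Trᵃ A')) ≡ 1ℤ
  trivial A A' = cong₂ _*_ (χ-yes(InvPair? A A')((λ ()) , λ ()))(cong λ'(cong(a ⊙_)(cong₂ _⊕_ (⨁-[] _)(⨁-[] _) ∙ ⊕-idˡ 0#) ∙ ⊙-0ʳ a) ∙ λ-0)

 K-twist : ∀ {a} → a ≢ 0# → ∑ F*(λ α → λ'(a ⊙ (α ⊕ α ⁻¹))) ≡ K a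
 K-twist {a} na = ∑-nz-reindex(a ⊙_)(a ⁻¹ ⊙_)
   (λ {x} nx → ⊙-≢0 na nx , sym(⊙-assoc _ _ _) ∙ cong(_⊙ x)(⁻¹-inverseˡ na) ∙ ⊙-idˡ x ,
    cong λ'(sym(cong(λ z → a ⊙ x ⊕ sq a ⊙ z)(⁻¹-⊙ na nx) ∙ solve 4(λ a x a' x' → a :* x :+ a :* a :* (a' :* x') := a :* x :+ a :* x' :* (a :* a')) refl a x(a ⁻¹)(x ⁻¹) ∙
     cong(λ z → a ⊙ x ⊕ a ⊙ x ⁻¹ ⊙ z)(⁻¹-inverse a na) ∙ solve 3(λ a x x' → a :* x :+ a :* x' :* con true := a :* (x :+ x')) refl a x(x ⁻¹))))
   (λ {x} nx → ⊙-≢0(⁻¹-≢0 na) nx , sym(⊙-assoc _ _ _) ∙ cong(_⊙ x)(⁻¹-inverse a na) ∙ ⊙-idˡ x) ∙ K-sq a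

 KGL-1 : ∀ {a} → a ≢ 0# → KGL a 1 ≡ K a
 KGL-1 {a} na = ∑GL-pairs 1 _ ∙ ∑-bij(𝕄 1 1 ×ᶠ 𝕄 1 1) 𝔽ˢ(λ (A , A') → InvPair? A A') nonzero? {g = λ α → λ'(a ⊙ (α ⊕ α ⁻¹))} (λ (A , A') → A fz fz)(λ α → (λ _ _ → α) , λ _ _ → α ⁻¹)
   (λ { {(A , A')} (e , _) refl → let u = trans(sym(⨁-1 _))(e fz fz) in 1⊙⇒≢0 u , ((λ { fz fz → refl }) , λ { fz fz → sym(⁻¹-unique u) }) ,
    cong(λ z → λ'(a ⊙ z))(cong₂ _⊕_ (⨁-1 _)(⨁-1 _ ∙ sym(⁻¹-unique u))) })
   (λ { {(A , A')} {α} nα(e , e') → let u = trans(cong₂ _⊙_ (e fz fz)(e' fz fz))(⁻¹-inverse α nα) in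
    ((λ { fz fz → ⨁-1 _ ∙ u }) , λ { fz fz → ⨁-1 _ ∙ ⊙-comm _ _ ∙ u }) , sym(e fz fz) }) ∙
  sym(∑-nonzeros _) ∙ K-twist na

 det : Fq → Fq → Fq → Fq → Fq
 det x y z w = x ⊙ w ⊕ y ⊙ z

 det₂ : Mat 2 2 → Fq
 det₂ A = det(A fz fz)(A fz(fs fz))(A(fs fz) fz)(A(fs fz)(fs fz))

 adj : Fq → Fq → Fq → Fq → Mat 2 2
 adj x y z w = let d = (det x y z w) ⁻¹ in mat2(d ⊙ w)(d ⊙ y)(d ⊙ z)(d ⊙ x)

 ⊛-2 : (A A' : Mat 2 2) → ∀ i j → (A ⊛ A') i j ≡ A i fz ⊙ A' fz j ⊕ A i(fs fz) ⊙ A'(fs fz) j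
 ⊛-2 A A' i j = ⨁-2 _

 mat2-adj : ∀ x y z w → det x y z w ≢ 0# → mat2 x y z w ⊛ adj x y z w ≋ idM
 mat2-adj x y z w nz = λ
  { fz fz → ⊛-2 M N fz fz ∙ solve 5(λ x y z w d → x :* (d :* w) :+ y :* (d :* z) := (x :* w :+ y :* z) :* d) refl x y z w d ∙ ⁻¹-inverse _ nz
  ; fz(fs fz) → ⊛-2 M N fz(fs fz) ∙ solve 3(λ x y d → x :* (d :* y) :+ y :* (d :* x) := con false) refl x y d
  ; (fs fz) fz → ⊛-2 M N(fs fz) fz ∙ solve 3(λ x y d → x :* (d :* y) :+ y :* (d :* x) := con false) refl z w d
  ; (fs fz)(fs fz) → ⊛-2 M N(fs fz)(fs fz) ∙ solve 5(λ x y z w d → z :* (d :* y) :+ w :* (d :* x) := (x :* w :+ y :* z) :* d) refl x y z w d ∙ ⁻¹-inverse _ nz }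
  where
  d = (det x y z w) ⁻¹
  M = mat2 x y z w
  N = adj x y z w

 invertible⇒det : ∀ {A A'} → A ⊛ A' ≋ idM → det₂ A ⊙ det₂ A' ≡ 1#
 invertible⇒det {A} {A'} e = solve 8(λ x y z w x' y' z' w' → (x :* w :+ y :* z) :* (x' :* w' :+ y' :* z')
   := (x :* x' :+ y :* z') :* (z :* y' :+ w :* w') :+ (x :* y' :+ y :* w') :* (z :* x' :+ w :* z')) refl(A fz fz)(A fz(fs fz))(A(fs fz) fz)(A(fs fz)(fs fz))(A' fz fz)(A' fz(fs fz))(A'(fs fz) fz)(A'(fs fz)(fs fz)) ∙
  cong₂ _⊕_ (cong₂ _⊙_ (E fz fz)(E(fs fz)(fs fz)))(cong₂ _⊙_ (E fz(fs fz))(E(fs fz) fz)) ∙ solve 0(con true :* con true :+ con false :* con false := con true) refl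
  where
  E : ∀ i j → A i fz ⊙ A' fz j ⊕ A i(fs fz) ⊙ A'(fs fz) j ≡ idM i j
  E i j = sym(⊛-2 A A' i j) ∙ e i j

 -- Each of the q - 1 nonzero y determines z, while y = 0 admits every z if t = 0 and none
 -- otherwise.
 ∑∑-product : ∀ t → ∑ Fs(λ y → ∑ Fs λ z → χ(y ⊙ z ≟ t)) ≡ (Q - 1ℤ) + Q * χ(t ≟ 0#)
 ∑∑-product t = ∑-split₀ _ ∙ cong₂ _+_
   (∑-cong Fs(λ z → χ-⇔(0# ⊙ z ≟ t)(t ≟ 0#)(λ e → sym e ∙ ⊙-0ˡ z) λ e → ⊙-0ˡ z ∙ sym e) ∙ ∑-const Fs _)
   (∑-nz-cong(λ y ny → ∑-cong Fs(λ z → χ-⇔(y ⊙ z ≟ t)(z ≟ y ⁻¹ ⊙ t)(λ { refl → sym(sym(⊙-assoc _ _ _) ∙ cong(_⊙ z)(⁻¹-inverseˡ ny) ∙ ⊙-idˡ z) })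
    λ { refl → sym(⊙-assoc _ _ _) ∙ cong(_⊙ t)(⁻¹-inverse y ny) ∙ ⊙-idˡ t }) ∙ FS.∑-δ 𝔽ˢ _) ∙ ∑nz-1) ∙ Z.+-comm(Q * χ(t ≟ 0#))(Q - 1ℤ)

 module _ {a : Fq} (na : a ≢ 0#) where
  private
   c : Fq → Fq
   c Δ = a ⊙ (1# ⊕ Δ ⁻¹)

   F : Fq → Fq → Fq → ℤ
   F Δ x w = λ'(c Δ ⊙ (x ⊕ w))

   𝔽⁴ : FS
   𝔽⁴ = (𝔽ˢ ×ᶠ 𝔽ˢ) ×ᶠ (𝔽ˢ ×ᶠ 𝔽ˢ)

   ∑𝔽⁴ : (f : El 𝔽⁴ → ℤ) → ∑(enum 𝔽⁴) f ≡ ∑ Fs(λ x → ∑ Fs λ w → ∑ Fs λ y → ∑ Fs λ z → f((x , w) , (y , z)))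
   ∑𝔽⁴ f = ∑-cartesianProduct(cartesianProduct Fs Fs)(cartesianProduct Fs Fs) f ∙ ∑-cartesianProduct Fs Fs _ ∙
    ∑-cong Fs(λ x → ∑-cong Fs λ w → ∑-cartesianProduct Fs Fs _)

   to-entries : KGL a 2 ≡ ∑(enum 𝔽⁴)(λ ((x , w) , (y , z)) → χ(nonzero?(det x y z w)) * F(det x y z w) x w)
   to-entries = ∑GL-pairs 2 _ ∙ ∑-bij(𝕄 2 2 ×ᶠ 𝕄 2 2) 𝔽⁴(λ (A , A') → InvPair? A A')(λ ((x , w) , (y , z)) → nonzero?(det x y z w))
    (λ (A , A') → (A fz fz , A(fs fz)(fs fz)) , (A fz(fs fz) , A(fs fz) fz))(λ ((x , w) , (y , z)) → mat2 x y z w , adj x y z w)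
    (λ { {(A , A')} (e , e')((refl , refl) , (refl , refl)) →
     let nz = 1⊙⇒≢0(invertible⇒det {A} {A'} e)
         eta = λ { fz fz → refl ; fz(fs fz) → refl ; (fs fz) fz → refl ; (fs fz)(fs fz) → refl }
         A'≋ = inverse-unique {M = A} e'(λ i j → ⊛-congʳ(adj(A fz fz)(A fz(fs fz))(A(fs fz) fz)(A(fs fz)(fs fz))) eta i j ∙ mat2-adj _ _ _ _ nz i j)
     in nz , (eta , A'≋) , cong λ'(cong(a ⊙_)(cong₂ _⊕_ (⨁-2 _)(⨁-2 _ ∙ cong₂ _⊕_ (A'≋ fz fz)(A'≋(fs fz)(fs fz)))) ∙
      solve 4(λ a x w d → a :* (x :+ w :+ (d :* w :+ d :* x)) := a :* (con true :+ d) :* (x :+ w)) refl a(A fz fz)(A(fs fz)(fs fz))((det₂ A) ⁻¹)) })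
    (λ { {(A , A')} {((x , w) , (y , z))} nz(e , e') → let p = λ i j → trans(⊛-cong {M = A} {P = A'} e e' i j)(mat2-adj x y z w nz i j) in (p , left⇒right p) ,
     ((sym(e fz fz) , sym(e(fs fz)(fs fz))) , (sym(e fz(fs fz)) , sym(e(fs fz) fz))) })

   -- The trace of A plus that of its inverse is (1 + 1/Δ)(x + w), with diagonal x, w and
   -- determinant Δ. The off-diagonal entries enter only through yz = xw + Δ, so they are summed
   -- first, with Δ as a free variable.
   by-det : ∀ x w → ∑ Fs(λ y → ∑ Fs λ z → χ(nonzero?(det x y z w)) * F(det x y z w) x w) ≡ ∑ F*(λ Δ → ((Q - 1ℤ) + Q * χ(x ⊙ w ≟ Δ)) * F Δ x w)
   by-det x w = begin
    _ ≡⟨ ∑-cong Fs(λ y → ∑-cong Fs λ z → sym(∑-nonzeros _ ∙ ∑-cong Fs(λ Δ → *-swapˡ(χ(nonzero? Δ))(χ(Δ ≟ det x y z w))(F Δ x w)) ∙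
      ∑-sift 𝔽ˢ(det x y z w) λ { refl → refl })) ⟩
    ∑ Fs(λ y → ∑ Fs λ z → ∑ F* λ Δ → χ(Δ ≟ det x y z w) * F Δ x w) ≡⟨ ∑-cong Fs(λ y → ∑-swap Fs F* _) ∙ ∑-swap Fs F* _ ⟩
    ∑ F*(λ Δ → ∑ Fs λ y → ∑ Fs λ z → χ(Δ ≟ det x y z w) * F Δ x w) ≡⟨ ∑-cong F*(λ Δ → ∑-cong Fs(λ y → ∑-*ʳ Fs(F Δ x w) _) ∙ ∑-*ʳ Fs(F Δ x w) _ ∙ cong(_* F Δ x w)
      (∑-cong Fs(λ y → ∑-cong Fs λ z → χ-⇔(Δ ≟ det x y z w)(y ⊙ z ≟ x ⊙ w ⊕ Δ)(λ { refl → sym(solve 2(λ u v → u :+ (u :+ v) := v) refl(x ⊙ w)(y ⊙ z)) }) λ e → solve 2(λ u d → d := u :+ (u :+ d)) refl(x ⊙ w) Δ ∙ cong(x ⊙ w ⊕_)(sym e)) ∙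
       ∑∑-product(x ⊙ w ⊕ Δ) ∙ cong(λ t → (Q - 1ℤ) + Q * t)(χ-⇔(x ⊙ w ⊕ Δ ≟ 0#)(x ⊙ w ≟ Δ) ⊕≡0⇒≡ ≡⇒⊕≡0))) ⟩
    _ ∎

   -- For fixed Δ the sums over x and w vanish unless 1 + 1/Δ = 0, that is Δ = 1.
   free : ∑ F*(λ Δ → ∑ Fs λ x → ∑ Fs λ w → F Δ x w) ≡ Q * Q
   free = ∑-nz-cong(λ Δ nΔ → ∑-cong Fs(λ x → ∑-cong Fs λ w → cong λ'(⊙-distribˡ(c Δ) x w) ∙ λ-⊕ _ _) ∙ ∑-* Fs Fs _ _ ∙
     cong₂ _*_ (∑λ-⊙(c Δ))(∑λ-⊙(c Δ)) ∙ square Q(χ(c Δ ≟ 0#)) ∙ cong(Q * Q *_)(χ-idem(c Δ ≟ 0#) ∙ χ-⇔(c Δ ≟ 0#)(Δ ≟ 1#)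
      (λ e → sym(⁻¹-involutive nΔ) ∙ ⁻¹-unique(⊙-idʳ _ ∙ sym(⊕≡0⇒≡(⊙-nonzeroʳ na e)))) λ { refl → cong(a ⊙_)(≡⇒⊕≡0(sym(⁻¹-unique(⊙-idˡ 1#)))) ∙ ⊙-0ʳ a })) ∙
    ∑-*ˡ F*(Q * Q) _ ∙ cong(Q * Q *_)(∑-unique _≟_ F* nonzeros-unique 1#(∈nonzeros⁺(0≢1 ∘ sym))) ∙ Z.*-identityʳ _
    where
    square : ∀ q t → q * t * (q * t) ≡ q * q * (t * t)
    square = ring

   -- With Δ = xw the exponent splits as a(x + 1/x) + a(w + 1/w), and the double sum is the square
   -- of a Kloosterman sum.
   constrained : ∑ Fs(λ x → ∑ Fs λ w → ∑ F* λ Δ → χ(x ⊙ w ≟ Δ) * F Δ x w) ≡ K a * K a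
   constrained = begin
    _ ≡⟨ ∑-cong Fs(λ x → ∑-cong Fs λ w → ∑-nonzeros _ ∙ ∑-cong Fs(λ Δ → *-swapˡ(χ(nonzero? Δ))(χ(x ⊙ w ≟ Δ))(F Δ x w) ∙
      cong(_* (χ(nonzero? Δ) * F Δ x w))(χ-⇔(x ⊙ w ≟ Δ)(Δ ≟ x ⊙ w) sym sym)) ∙ ∑-sift 𝔽ˢ(x ⊙ w) λ { refl → refl }) ⟩
    ∑ Fs(λ x → ∑ Fs λ w → χ(nonzero?(x ⊙ w)) * F(x ⊙ w) x w) ≡⟨ ∑-cong Fs(λ x → ∑-cong Fs λ w → χ-match(nonzero?(x ⊙ w))(nonzero? x ×-dec nonzero? w)
      (λ n → let nx = λ { refl → n(⊙-0ˡ w) } ; nw = λ { refl → n(⊙-0ʳ x) } in (nx , nw) , term x w nx nw)(λ (nx , nw) → ⊙-≢0 nx nw) ∙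
      cong(_* (k x * k w))(χ-×(nonzero? x)(nonzero? w)) ∙ shuffle(χ(nonzero? x))(χ(nonzero? w))(k x)(k w)) ⟩
    ∑ Fs(λ x → ∑ Fs λ w → χ(nonzero? x) * k x * (χ(nonzero? w) * k w)) ≡⟨ ∑-* Fs Fs _ _ ⟩
    ∑ Fs(λ x → χ(nonzero? x) * k x) * ∑ Fs(λ w → χ(nonzero? w) * k w) ≡⟨ (let e = trans(sym(∑-nonzeros k))(K-twist na) in cong₂ _*_ e e) ⟩
    _ ∎
    where
    k : Fq → ℤ
    k x = λ'(a ⊙ (x ⊕ x ⁻¹))
    shuffle : ∀ p q x y → p * q * (x * y) ≡ p * x * (q * y)
    shuffle = ring
    term : ∀ x w → x ≢ 0# → w ≢ 0# → F(x ⊙ w) x w ≡ k x * k w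
    term x w nx nw = cong λ'(cong(λ z → a ⊙ (1# ⊕ z) ⊙ (x ⊕ w))(⁻¹-⊙ nx nw) ∙ solve 5(λ a x w x' w' → a :* (con true :+ x' :* w') :* (x :+ w) := a :* (x :+ w' :* (x :* x')) :+ a :* (w :+ x' :* (w :* w'))) refl a x w(x ⁻¹)(w ⁻¹) ∙
     cong₂(λ u v → a ⊙ (x ⊕ w ⁻¹ ⊙ u) ⊕ a ⊙ (w ⊕ x ⁻¹ ⊙ v))(⁻¹-inverse x nx)(⁻¹-inverse w nw) ∙ solve 5(λ a x w x' w' → a :* (x :+ w' :* con true) :+ a :* (w :+ x' :* con true) := a :* (x :+ x') :+ a :* (w :+ w')) refl a x w(x ⁻¹)(w ⁻¹)) ∙ λ-⊕ _ _

  KGL-2 : KGL a 2 ≡ Q * (K a * K a) + Q * Q * (Q - 1ℤ)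
  KGL-2 = begin
   _ ≡⟨ to-entries ∙ ∑𝔽⁴ _ ∙ ∑-cong Fs(λ x → ∑-cong Fs λ w → by-det x w ∙ ∑-cong F*(λ Δ → expand Q(χ(x ⊙ w ≟ Δ))(F Δ x w)) ∙ ∑-+ F* _ _ ∙ cong₂ _+_ (∑-*ˡ F*(Q - 1ℤ) _)(∑-*ˡ F* Q _)) ⟩
   ∑ Fs(λ x → ∑ Fs λ w → (Q - 1ℤ) * ∑ F*(λ Δ → F Δ x w) + Q * ∑ F* λ Δ → χ(x ⊙ w ≟ Δ) * F Δ x w) ≡⟨ ∑-cong Fs(λ x → ∑-+ Fs _ _ ∙ cong₂ _+_ (∑-*ˡ Fs(Q - 1ℤ) _)(∑-*ˡ Fs Q _)) ∙ ∑-+ Fs _ _ ∙ cong₂ _+_ (∑-*ˡ Fs(Q - 1ℤ) _)(∑-*ˡ Fs Q _) ⟩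
   (Q - 1ℤ) * ∑ Fs(λ x → ∑ Fs λ w → ∑ F* λ Δ → F Δ x w) + Q * ∑ Fs(λ x → ∑ Fs λ w → ∑ F* λ Δ → χ(x ⊙ w ≟ Δ) * F Δ x w)
    ≡⟨ cong₂(λ u v → (Q - 1ℤ) * u + Q * v)(∑-cong Fs(λ x → ∑-swap Fs F* _) ∙ ∑-swap Fs F* _ ∙ free) constrained ⟩
   (Q - 1ℤ) * (Q * Q) + Q * (K a * K a) ≡⟨ Z.+-comm((Q - 1ℤ) * (Q * Q))(Q * (K a * K a)) ∙ cong(ℤ._+_ (Q * (K a * K a)))(Z.*-comm(Q - 1ℤ)(Q * Q)) ⟩
   _ ∎
   where
   expand : ∀ q t f → ((q - 1ℤ) + q * t) * f ≡ (q - 1ℤ) * f + q * (t * f)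
   expand = ring

 module Blocked (s t : ℕ) where
  b₁₁ : Mat(s ∔ t)(s ∔ t) → Mat s s
  b₁₁ M i j = M(i ↑ˡ t)(j ↑ˡ t)
  b₁₂ : Mat(s ∔ t)(s ∔ t) → Mat s t
  b₁₂ M i j = M(i ↑ˡ t)(s ↑ʳ j)
  b₂₁ : Mat(s ∔ t)(s ∔ t) → Mat t s
  b₂₁ M i j = M(s ↑ʳ i)(j ↑ˡ t)
  b₂₂ : Mat(s ∔ t)(s ∔ t) → Mat t t
  b₂₂ M i j = M(s ↑ʳ i)(s ↑ʳ j)

  lower : Mat s s → Mat t s → Mat t t → Mat(s ∔ t)(s ∔ t)
  lower S R U = (λ i → S i V.++ λ _ → 0#) V.++ (λ i → R i V.++ U i)

  module _ (S : Mat s s)(R : Mat t s)(U : Mat t t) where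
   lower₁₁ : b₁₁(lower S R U) ≋ S
   lower₁₁ i j = cong(λ f → f(j ↑ˡ t))(lookup-++ˡ(λ i → S i V.++ λ _ → 0#)(λ i → R i V.++ U i) i) ∙ lookup-++ˡ(S i)(λ _ → 0#) j
   lower₁₂ : b₁₂(lower S R U) ≋ zeroM
   lower₁₂ i j = cong(λ f → f(s ↑ʳ j))(lookup-++ˡ(λ i → S i V.++ λ _ → 0#)(λ i → R i V.++ U i) i) ∙ lookup-++ʳ(S i)(λ _ → 0#) j
   lower₂₁ : b₂₁(lower S R U) ≋ R
   lower₂₁ i j = cong(λ f → f(j ↑ˡ t))(lookup-++ʳ(λ i → S i V.++ λ _ → 0#)(λ i → R i V.++ U i) i) ∙ lookup-++ˡ(R i)(U i) j
   lower₂₂ : b₂₂(lower S R U) ≋ U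
   lower₂₂ i j = cong(λ f → f(s ↑ʳ j))(lookup-++ʳ(λ i → S i V.++ λ _ → 0#)(λ i → R i V.++ U i) i) ∙ lookup-++ʳ(R i)(U i) j

  blocks≋ : ∀ {M N} → b₁₁ M ≋ b₁₁ N → b₁₂ M ≋ b₁₂ N → b₂₁ M ≋ b₂₁ N → b₂₂ M ≋ b₂₂ N → M ≋ N
  blocks≋ {M} {N} e₁₁ e₁₂ e₂₁ e₂₂ = split-elim s(λ i → ∀ j → M i j ≡ N i j)(λ i → split-elim s(λ j → M(i ↑ˡ t) j ≡ N(i ↑ˡ t) j)(e₁₁ i)(e₁₂ i))
   (λ i → split-elim s(λ j → M(s ↑ʳ i) j ≡ N(s ↑ʳ i) j)(e₂₁ i)(e₂₂ i))

  id-↑ˡ : ∀ i j → idM {s ∔ t} (i ↑ˡ t)(j ↑ˡ t) ≡ idM i j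
  id-↑ˡ i j with i Fin.≟ j
  ... | yes refl = idM-diag(i ↑ˡ t)
  ... | no ne = idM-off(λ e → ne(FinP.↑ˡ-injective t i j e))
  id-↑ʳ : ∀ i j → idM {s ∔ t} (s ↑ʳ i)(s ↑ʳ j) ≡ idM i j
  id-↑ʳ i j with i Fin.≟ j
  ... | yes refl = idM-diag(s ↑ʳ i)
  ... | no ne = idM-off(λ e → ne(FinP.↑ʳ-injective s i j e))
  ↑ˡ≢↑ʳ : ∀ (i : Fin s)(j : Fin t) → i ↑ˡ t ≢ s ↑ʳ j
  ↑ˡ≢↑ʳ i j e with trans(sym(FinP.splitAt-↑ˡ s i t))(cong(splitAt s) e ∙ FinP.splitAt-↑ʳ s t j)
  ... | ()

  block-⊛ : ∀ (M N : Mat(s ∔ t)(s ∔ t)) i j → (M ⊛ N) i j ≡ dot(λ k → M i(k ↑ˡ t))(λ k → N(k ↑ˡ t) j) ⊕ dot(λ k → M i(s ↑ʳ k))(λ k → N(s ↑ʳ k) j)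
  block-⊛ M N i j = ⨁-split s _

  -- The zero block passes to the inverse: the leading block of A' is a right inverse of that of A,
  -- hence also a left inverse, and it can be cancelled.
  module Extract {A A' : Mat(s ∔ t)(s ∔ t)} (e : A ⊛ A' ≋ idM)(z : b₁₂ A ≋ zeroM) where
   top-row : ∀ i j → dot(λ k → A(i ↑ˡ t)(k ↑ˡ t))(λ k → A'(k ↑ˡ t) j) ≡ idM(i ↑ˡ t) j
   top-row i j = sym(block-⊛ A A'(i ↑ˡ t) j ∙ cong(dot(λ k → A(i ↑ˡ t)(k ↑ˡ t))(λ k → A'(k ↑ˡ t) j) ⊕_)(dot-comm _ _ ∙ dot-zeroʳ _ (z i)) ∙ ⊕-idʳ _) ∙ e(i ↑ˡ t) j

   SS' : b₁₁ A ⊛ b₁₁ A' ≋ idM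
   SS' i j = top-row i(j ↑ˡ t) ∙ id-↑ˡ i j

   z' : b₁₂ A' ≋ zeroM
   z' i j = sym(⊛-identityˡ(b₁₂ A') i j) ∙ sym(⊛-congʳ(b₁₂ A')(left⇒right SS') i j) ∙ ⊛-assoc(b₁₁ A')(b₁₁ A)(b₁₂ A') i j ∙
    dot-zeroʳ(b₁₁ A' i)(λ k → top-row k(s ↑ʳ j) ∙ idM-off(↑ˡ≢↑ʳ k j))

   UU' : b₂₂ A ⊛ b₂₂ A' ≋ idM
   UU' i j = sym(block-⊛ A A'(s ↑ʳ i)(s ↑ʳ j) ∙ cong(_⊕ (b₂₂ A ⊛ b₂₂ A') i j)(dot-zeroʳ _ λ k → z' k j) ∙ ⊕-idˡ _) ∙ e(s ↑ʳ i)(s ↑ʳ j) ∙ id-↑ʳ i j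

   corner : b₂₁ A' ≋ b₂₂ A' ⊛ (b₂₁ A ⊛ b₁₁ A')
   corner i j = sym(⊛-congˡ(b₂₂ A')(λ k l → ⊕≡0⇒≡(sym(block-⊛ A A'(s ↑ʳ k)(l ↑ˡ t)) ∙ e(s ↑ʳ k)(l ↑ˡ t) ∙ idM-off(↑ˡ≢↑ʳ l k ∘ sym))) i j ∙
    sym(⊛-assoc(b₂₂ A')(b₂₂ A)(b₂₁ A') i j) ∙ ⊛-congʳ(b₂₁ A')(left⇒right UU') i j ∙ ⊛-identityˡ(b₂₁ A') i j)

  lower-inverse : ∀ {S S' U U'} R → S ⊛ S' ≋ idM → U ⊛ U' ≋ idM → lower S R U ⊛ lower S'(U' ⊛ (R ⊛ S')) U' ≋ idM
  lower-inverse {S} {S'} {U} {U'} R eS eU = blocks≋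
   (λ i j → split i(j ↑ˡ t) ∙ cong₂ _⊕_ (dot-cong(lower₁₁ S R U i)(λ k → lower₁₁ S' R' U' k j) ∙ eS i j)(dot-comm _ _ ∙ dot-zeroʳ _ (lower₁₂ S R U i)) ∙ ⊕-idʳ _ ∙ sym(id-↑ˡ i j))
   (λ i j → split i(s ↑ʳ j) ∙ cong₂ _⊕_ (dot-zeroʳ _ λ k → lower₁₂ S' R' U' k j)(dot-comm _ _ ∙ dot-zeroʳ _ (lower₁₂ S R U i)) ∙ ⊕-idʳ _ ∙ sym(idM-off(↑ˡ≢↑ʳ i j)))
   (λ i j → block-⊛(lower S R U)(lower S' R' U')(s ↑ʳ i)(j ↑ˡ t) ∙ cong₂ _⊕_ (dot-cong(lower₂₁ S R U i) λ k → lower₁₁ S' R' U' k j)(dot-cong(lower₂₂ S R U i)(λ k → lower₂₁ S' R' U' k j) ∙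
    sym(⊛-assoc U U'(R ⊛ S') i j) ∙ ⊛-congʳ(R ⊛ S') eU i j ∙ ⊛-identityˡ(R ⊛ S') i j) ∙ x⊕x≡0 _ ∙ sym(idM-off(↑ˡ≢↑ʳ j i ∘ sym)))
   (λ i j → block-⊛(lower S R U)(lower S' R' U')(s ↑ʳ i)(s ↑ʳ j) ∙ cong₂ _⊕_ (dot-zeroʳ _ λ k → lower₁₂ S' R' U' k j)(dot-cong(lower₂₂ S R U i)(λ k → lower₂₂ S' R' U' k j) ∙ eU i j) ∙ ⊕-idˡ _ ∙ sym(id-↑ʳ i j))
   where
   R' = U' ⊛ (R ⊛ S')
   split : ∀ i j → (lower S R U ⊛ lower S' R' U')(i ↑ˡ t) j ≡ _
   split i j = block-⊛(lower S R U)(lower S' R' U')(i ↑ˡ t) j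

  zero₁₂? : ∀ A → Dec(b₁₂ A ≋ zeroM)
  zero₁₂? A = FS._≈?_ (𝕄 s t)(b₁₂ A) zeroM

  -- A block lower triangular matrix is invertible exactly when its two diagonal blocks are. The
  -- corner R is arbitrary and contributes the factor q^(st), and the sum factors over the blocks.
  ∑-lower : (g : Mat s s → ℤ)(h : Mat t t → Mat t t → ℤ) → (∀ {M P} → M ≋ P → g M ≡ g P) → (∀ {M P M' P'} → M ≋ P → M' ≋ P' → h M M' ≡ h P P') →
   ∑GL(s ∔ t)(λ A A' → χ(zero₁₂? A) * (g(b₁₁ A) * h(b₂₂ A)(b₂₂ A'))) ≡ (Q ^ s) ^ t * (∑(Mats s s)(λ S → χ(nonsing? S) * g S) * ∑GL t h)
  ∑-lower g h gc hc = begin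
   _ ≡⟨ ∑GL-pairs(s ∔ t)(λ A A' → χ(zero₁₂? A) * (g(b₁₁ A) * h(b₂₂ A)(b₂₂ A'))) ∙ ∑-cong(enum X)(λ (A , A') → sym(Z.*-assoc(χ(InvPair? A A'))(χ(zero₁₂? A)) _) ∙ cong(_* (g(b₁₁ A) * h(b₂₂ A)(b₂₂ A')))(sym(χ-×(InvPair? A A')(zero₁₂? A)))) ⟩
   ∑(enum X)(λ (A , A') → χ(InvPair? A A' ×-dec zero₁₂? A) * (g(b₁₁ A) * h(b₂₂ A)(b₂₂ A'))) ≡⟨ ∑-bij X Y(λ (A , A') → InvPair? A A' ×-dec zero₁₂? A)(λ (R , (S , S') , (U , U')) → InvPair? S S' ×-dec InvPair? U U') {g = λ (R , (S , S') , (U , U')) → g S * h U U'}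
     (λ (A , A') → b₂₁ A , (b₁₁ A , b₁₁ A') , (b₂₂ A , b₂₂ A'))(λ (R , (S , S') , (U , U')) → lower S R U , lower S'(U' ⊛ (R ⊛ S')) U')
     (λ {(A , A')} {(R , (S , S') , (U , U'))} ((e , _) , z)(eR , (eS , eS') , (eU , eU')) → let
       open Extract {A} {A'} e z
       pS = λ i j → ⊛-cong {M = S} {P = S'} eS eS' i j ∙ SS' i j
       pU = λ i j → ⊛-cong {M = U} {P = U'} eU eU' i j ∙ UU' i j
      in ((pS , left⇒right pS) , (pU , left⇒right pU)) ,
       (blocks≋(λ i j → sym(eS i j) ∙ sym(lower₁₁ S R U i j))(λ i j → z i j ∙ sym(lower₁₂ S R U i j))(λ i j → sym(eR i j) ∙ sym(lower₂₁ S R U i j))(λ i j → sym(eU i j) ∙ sym(lower₂₂ S R U i j)) ,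
        blocks≋(λ i j → sym(eS' i j) ∙ sym(lower₁₁ S' _ U' i j))(λ i j → z' i j ∙ sym(lower₁₂ S'(U' ⊛ (R ⊛ S')) U' i j))
         (λ i j → corner i j ∙ sym(⊛-cong {M = U'} {P = R ⊛ S'} eU'(⊛-cong {M = R} {P = S'} eR eS') i j) ∙ sym(lower₂₁ S'(U' ⊛ (R ⊛ S')) U' i j)) λ i j → sym(eU' i j) ∙ sym(lower₂₂ S'(U' ⊛ (R ⊛ S')) U' i j)) ,
       cong₂ _*_ (gc λ i j → sym(eS i j))(hc(λ i j → sym(eU i j)) λ i j → sym(eU' i j)))
     (λ {(A , A')} {(R , (S , S') , (U , U'))} ((eS , _) , (eU , _))(e , e') → let p = λ i j → trans(⊛-cong {M = A} {P = A'} e e' i j)(lower-inverse R eS eU i j) in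
      ((p , left⇒right p) , λ i j → e(i ↑ˡ t)(s ↑ʳ j) ∙ lower₁₂ S R U i j) ,
      ((λ i j → sym(e(s ↑ʳ i)(j ↑ˡ t) ∙ lower₂₁ S R U i j)) ,
       ((λ i j → sym(e(i ↑ˡ t)(j ↑ˡ t) ∙ lower₁₁ S R U i j)) , λ i j → sym(e'(i ↑ˡ t)(j ↑ˡ t) ∙ lower₁₁ S'(U' ⊛ (R ⊛ S')) U' i j)) ,
       ((λ i j → sym(e(s ↑ʳ i)(s ↑ʳ j) ∙ lower₂₂ S R U i j)) , λ i j → sym(e'(s ↑ʳ i)(s ↑ʳ j) ∙ lower₂₂ S'(U' ⊛ (R ⊛ S')) U' i j)))) ⟩
   ∑(enum Y)(λ (R , (S , S') , (U , U')) → χ(InvPair? S S' ×-dec InvPair? U U') * (g S * h U U')) ≡⟨ ∑-cartesianProduct(Mats t s)(cartesianProduct PS PU) _ ∙ ∑-cong(Mats t s)(λ R → ∑-cartesianProduct PS PU _ ∙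
     ∑-cong PS(λ (S , S') → ∑-cong PU λ (U , U') → cong(_* (g S * h U U'))(χ-×(InvPair? S S')(InvPair? U U')) ∙ shuffle(χ(InvPair? S S'))(χ(InvPair? U U'))(g S)(h U U')) ∙ ∑-* PS PU _ _) ⟩
   ∑(Mats t s)(λ _ → ∑ PS(λ (S , S') → χ(InvPair? S S') * g S) * ∑ PU λ (U , U') → χ(InvPair? U U') * h U U') ≡⟨ ∑-cong(Mats t s)(λ _ → cong₂ _*_ (sym(∑GL-pairs s _) ∙ ∑GL-forget gc)(sym(∑GL-pairs t h)) ∙ sym(Z.*-identityˡ _)) ⟩
   ∑(Mats t s)(λ _ → 1ℤ * (∑(Mats s s)(λ S → χ(nonsing? S) * g S) * ∑GL t h)) ≡⟨ ∑-*ʳ(Mats t s) _ (λ _ → 1ℤ) ∙ cong(_* (∑(Mats s s)(λ S → χ(nonsing? S) * g S) * ∑GL t h))(∑-Π-1(𝕍 s) t ∙ cong(_^ t)(∑𝕍-1 s)) ⟩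
   _ ∎
   where
   X = 𝕄(s ∔ t)(s ∔ t) ×ᶠ 𝕄(s ∔ t)(s ∔ t)
   Y = 𝕄 t s ×ᶠ ((𝕄 s s ×ᶠ 𝕄 s s) ×ᶠ (𝕄 t t ×ᶠ 𝕄 t t))
   PS = cartesianProduct(Mats s s)(Mats s s)
   PU = cartesianProduct(Mats t t)(Mats t t)
   shuffle : ∀ p q x y → p * q * (x * y) ≡ p * x * (q * y)
   shuffle = ring

-- The group Q: intrinsic description and parametrisation

module QGroup (𝒟 : FieldData)(m : ℕ) where
 open FieldArithmetic 𝒟
 open Characters 𝒟 using (θ₀)
 open LinearAlgebra 𝒟
 open SymmetricSums 𝒟 using (form; form-cong; form-+M; apply-+M)
 open GeneralLinear 𝒟 using (⨁-2; ∑GL)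
 open Blocks m public

 pattern 0F = fz
 pattern 1F = fs fz

 -- A section of `part`. Entries are computed at `ι p`, by cases on the three blocks, instead of at
 -- indices that have to be split.
 ι : Part → Fin d
 ι(p1 k) = k ↑ˡ (m ∔ 2)
 ι(p2 k) = m ↑ʳ (k ↑ˡ 2)
 ι(p3 k) = m ↑ʳ (m ↑ʳ k)

 part-ι : ∀ p → part(ι p) ≡ p
 part-ι(p1 k) rewrite FinP.splitAt-↑ˡ m k(m ∔ 2) = refl
 part-ι(p2 k) rewrite FinP.splitAt-↑ʳ m(m ∔ 2)(k ↑ˡ 2) | FinP.splitAt-↑ˡ m k 2 = refl
 part-ι(p3 k) rewrite FinP.splitAt-↑ʳ m(m ∔ 2)(m ↑ʳ k) | FinP.splitAt-↑ʳ m 2 k = refl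

 ι-elim : (P : Fin d → Set) → (∀ p → P(ι p)) → ∀ x → P x
 ι-elim P f = split-elim m P(f ∘ p1)(split-elim m(λ y → P(m ↑ʳ y))(f ∘ p2)(f ∘ p3))

 ι-part : ∀ x → ι(part x) ≡ x
 ι-part = ι-elim(λ x → ι(part x) ≡ x)(λ p → cong ι(part-ι p))

 ι≋ : {M N : Mat d d} → (∀ p q → M(ι p)(ι q) ≡ N(ι p)(ι q)) → M ≋ N
 ι≋ {M} {N} e = ι-elim(λ x → ∀ y → M x y ≡ N x y)(λ p → ι-elim(λ y → M(ι p) y ≡ N(ι p) y)(e p))

 ⨁ₚ : (Part → Fq) → Fq
 ⨁ₚ f = ⨁(f ∘ p1) ⊕ (⨁(f ∘ p2) ⊕ ⨁(f ∘ p3))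

 ⨁-ι : ∀ f → ⨁ f ≡ ⨁ₚ(f ∘ ι)
 ⨁-ι f = ⨁-split m f ∙ cong(⨁(λ k → f(ι(p1 k))) ⊕_)(⨁-split m _)

 ⨁ₚ-cong : ∀ {f g} → (∀ p → f p ≡ g p) → ⨁ₚ f ≡ ⨁ₚ g
 ⨁ₚ-cong e = cong₂ _⊕_ (⨁-cong λ k → e(p1 k))(cong₂ _⊕_ (⨁-cong λ k → e(p2 k))(⨁-cong λ k → e(p3 k)))

 only1 : ∀ {f} → (∀ k → f(p2 k) ≡ 0#) → (∀ k → f(p3 k) ≡ 0#) → ⨁ₚ f ≡ ⨁(f ∘ p1)
 only1 {f} e e' = cong(⨁(f ∘ p1) ⊕_)(cong₂ _⊕_ (⨁-zero e)(⨁-zero e') ∙ ⊕-idˡ 0#) ∙ ⊕-idʳ _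
 only2 : ∀ {f} → (∀ k → f(p1 k) ≡ 0#) → (∀ k → f(p3 k) ≡ 0#) → ⨁ₚ f ≡ ⨁(f ∘ p2)
 only2 {f} e e' = cong₂ _⊕_ (⨁-zero e)(cong(⨁(f ∘ p2) ⊕_)(⨁-zero e') ∙ ⊕-idʳ _) ∙ ⊕-idˡ _
 only3 : ∀ {f} → (∀ k → f(p1 k) ≡ 0#) → (∀ k → f(p2 k) ≡ 0#) → ⨁ₚ f ≡ ⨁(f ∘ p3)
 only3 {f} e e' = cong₂ _⊕_ (⨁-zero e)(cong(_⊕ ⨁(f ∘ p3))(⨁-zero e') ∙ ⊕-idˡ _) ∙ ⊕-idˡ _

 0⊙ : ∀ {x y} → x ≡ 0# → x ⊙ y ≡ 0#
 0⊙ {y = y} refl = ⊙-0ˡ y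
 ⊙0 : ∀ {x y} → y ≡ 0# → x ⊙ y ≡ 0#
 ⊙0 {x} refl = ⊙-0ʳ x

 -- The pairing of the coordinates in the polar form of θ⁻, which is the sum of x_r y_(τ r). In the
 -- last block x² and κy² disappear by polarisation and only the mixed term is left.
 τ : Part → Part
 τ(p1 k) = p2 k
 τ(p2 k) = p1 k
 τ(p3 0F) = p3 1F
 τ(p3 1F) = p3 0F

 ττ : ∀ p → τ(τ p) ≡ p
 ττ(p1 k) = refl
 ττ(p2 k) = refl
 ττ(p3 0F) = refl
 ττ(p3 1F) = refl

 τᶠ : Fin d → Fin d
 τᶠ x = ι(τ(part x))

 τᶠ-ι : ∀ p → τᶠ(ι p) ≡ ι(τ p)
 τᶠ-ι p = cong(ι ∘ τ)(part-ι p)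

 τᶠτᶠ : ∀ x → τᶠ(τᶠ x) ≡ x
 τᶠτᶠ x = τᶠ-ι(τ(part x)) ∙ cong ι(ττ(part x)) ∙ ι-part x

 θ : Vecᶠ d → Fq
 θ x = ⨁(λ k → x(ι(p1 k)) ⊙ x(ι(p2 k))) ⊕ θ₀(x(ι(p3 0F)))(x(ι(p3 1F)))

 θ-cong : ∀ {x y} → (∀ i → x i ≡ y i) → θ x ≡ θ y
 θ-cong e = cong₂ _⊕_ (⨁-cong λ k → cong₂ _⊙_ (e(ι(p1 k)))(e(ι(p2 k))))(cong₂ θ₀(e(ι(p3 0F)))(e(ι(p3 1F))))

 θ₀-⊕ : ∀ x y x' y' → θ₀(x ⊕ x')(y ⊕ y') ≡ θ₀ x y ⊕ θ₀ x' y' ⊕ (x ⊙ y' ⊕ y ⊙ x')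
 θ₀-⊕ x y x' y' = solve 5(λ k x y x' y' → (x :+ x') :* (x :+ x') :+ (x :+ x') :* (y :+ y') :+ k :* (y :+ y') :* (y :+ y')
  := (x :* x :+ x :* y :+ k :* y :* y) :+ (x' :* x' :+ x' :* y' :+ k :* y' :* y') :+ (x :* y' :+ y :* x')) refl κ x y x' y'

 β : Vecᶠ d → Vecᶠ d → Fq
 β x y = ⨁(λ r → x r ⊙ y(τᶠ r))

 θ-polar : ∀ x y → θ(λ i → x i ⊕ y i) ≡ θ x ⊕ θ y ⊕ β x y
 θ-polar x y = begin
  _ ≡⟨ cong₂ _⊕_ (⨁-cong(λ k → solve 4(λ a b c d → (a :+ b) :* (c :+ d) := (a :* c :+ b :* d) :+ (a :* d :+ c :* b)) refl(x₁ k)(y₁ k)(x₂ k)(y₂ k)) ∙ ⨁-⊕ _ _ ∙ cong₂ _⊕_ (⨁-⊕ _ _)(⨁-⊕ _ _))(θ₀-⊕ _ _ _ _) ⟩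
  (dot x₁ x₂ ⊕ dot y₁ y₂) ⊕ (dot x₁ y₂ ⊕ dot x₂ y₁) ⊕ (θ₀(x₃ 0F)(x₃ 1F) ⊕ θ₀(y₃ 0F)(y₃ 1F) ⊕ (x₃ 0F ⊙ y₃ 1F ⊕ x₃ 1F ⊙ y₃ 0F)) ≡⟨ solve 7(λ a b c d e f g → (a :+ b) :+ (c :+ d) :+ (e :+ f :+ g) := (a :+ e) :+ (b :+ f) :+ (c :+ (d :+ g))) refl _ _ _ _ _ _ _ ⟩
  θ x ⊕ θ y ⊕ (dot x₁ y₂ ⊕ (dot x₂ y₁ ⊕ (x₃ 0F ⊙ y₃ 1F ⊕ x₃ 1F ⊙ y₃ 0F))) ≡⟨ cong(θ x ⊕ θ y ⊕_)(sym(⨁-ι _ ∙ ⨁ₚ-cong(λ p → cong(λ z → x(ι p) ⊙ y z)(τᶠ-ι p)) ∙ cong(λ z → dot x₁ y₂ ⊕ (dot x₂ y₁ ⊕ z))(⨁-2 _))) ⟩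
  _ ∎
  where
  x₁ = λ k → x(ι(p1 k)) ; x₂ = λ k → x(ι(p2 k)) ; x₃ = λ k → x(ι(p3 k))
  y₁ = λ k → y(ι(p1 k)) ; y₂ = λ k → y(ι(p2 k)) ; y₃ = λ k → y(ι(p3 k))

 Isometry : Mat d d → Set
 Isometry g = ∀ x → θ(apply g x) ≡ θ x

 -- Membership in Q without parameters: an isometry with three zero blocks whose last block has the
 -- shape of SO⁻(2,q). The two conditions on that block separate Q from its coset by ρ. Closure
 -- under products and inverses can be read off entrywise, which is hard on the parametrised
 -- products.
 record InQ (g : Mat d d) : Set where
  field
   z21 : ∀ i j → g(ι(p2 i))(ι(p1 j)) ≡ 0#
   z31 : ∀ i j → g(ι(p3 i))(ι(p1 j)) ≡ 0#
   z23 : ∀ i j → g(ι(p2 i))(ι(p3 j)) ≡ 0#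
   so01 : g(ι(p3 0F))(ι(p3 1F)) ≡ κ ⊙ g(ι(p3 1F))(ι(p3 0F))
   so11 : g(ι(p3 1F))(ι(p3 1F)) ≡ g(ι(p3 0F))(ι(p3 0F)) ⊕ g(ι(p3 1F))(ι(p3 0F))
   isometry : Isometry g
 open InQ public

 InQ-cong : ∀ {g k} → g ≋ k → InQ g → InQ k
 InQ-cong e q = record
  { z21 = λ i j → sym(e _ _) ∙ z21 q i j ; z31 = λ i j → sym(e _ _) ∙ z31 q i j ; z23 = λ i j → sym(e _ _) ∙ z23 q i j
  ; so01 = sym(e _ _) ∙ so01 q ∙ cong(κ ⊙_)(e _ _) ; so11 = sym(e _ _) ∙ so11 q ∙ cong₂ _⊕_ (e _ _)(e _ _)
  ; isometry = λ x → θ-cong(λ i → dot-cong(λ j → sym(e i j)) λ _ → refl) ∙ isometry q x }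

 InQ? : ∀ g → Dec(InQ g)
 InQ? g = map′(λ (a , b , c , d , e , f) → record { z21 = a ; z31 = b ; z23 = c ; so01 = d ; so11 = e ; isometry = f })
  (λ q → z21 q , z31 q , z23 q , so01 q , so11 q , isometry q)
  ((FinP.all? λ i → FinP.all? λ j → _ ≟ 0#) ×-dec(FinP.all? λ i → FinP.all? λ j → _ ≟ 0#) ×-dec(FinP.all? λ i → FinP.all? λ j → _ ≟ 0#) ×-dec(_ ≟ _) ×-dec(_ ≟ _)
   ×-dec FS.∀?(𝕍 d) {λ x → θ(apply g x) ≡ θ x} (λ e h → θ-cong(λ i → dot-cong {u = g i} (λ _ → refl) λ j → sym(e j)) ∙ h ∙ θ-cong e) λ x → θ(apply g x) ≟ θ x)

 Isometry-⊛ : ∀ {g k} → Isometry g → Isometry k → Isometry(g ⊛ k)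
 Isometry-⊛ {g} {k} ig ik x = θ-cong(apply-⊛ g k x) ∙ ig(apply k x) ∙ ik x

 ⊛-ι : ∀ (g k : Mat d d) p q → (g ⊛ k)(ι p)(ι q) ≡ ⨁ₚ(λ r → g(ι p)(ι r) ⊙ k(ι r)(ι q))
 ⊛-ι g k p q = ⨁-ι _

 InQ-⊛ : ∀ {g k} → InQ g → InQ k → InQ(g ⊛ k)
 InQ-⊛ {g} {k} a b = record
  { z21 = λ i j → ⊛-ι g k(p2 i)(p1 j) ∙ only1 {pr(p2 i)(p1 j)} (λ l → ⊙0(z21 b l j))(λ l → ⊙0(z31 b l j)) ∙ ⨁-zero(λ l → 0⊙(z21 a i l))
  ; z31 = λ i j → ⊛-ι g k(p3 i)(p1 j) ∙ only1 {pr(p3 i)(p1 j)} (λ l → ⊙0(z21 b l j))(λ l → ⊙0(z31 b l j)) ∙ ⨁-zero(λ l → 0⊙(z31 a i l))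
  ; z23 = λ i j → ⊛-ι g k(p2 i)(p3 j) ∙ only2 {pr(p2 i)(p3 j)} (λ l → 0⊙(z21 a i l))(λ l → 0⊙(z23 a i l)) ∙ ⨁-zero(λ l → ⊙0(z23 b l j))
  ; so01 = e33 0F 1F ∙ cong₂ _⊕_ (cong(g₃ 0F 0F ⊙_)(so01 b))(cong₂ _⊙_ (so01 a)(so11 b)) ∙
    solve 5(λ κ x y u v → x :* (κ :* v) :+ κ :* y :* (u :+ v) := κ :* (y :* u :+ (x :+ y) :* v)) refl κ(g₃ 0F 0F)(g₃ 1F 0F)(k₃ 0F 0F)(k₃ 1F 0F) ∙ cong(κ ⊙_)(sym e10)
  ; so11 = e33 1F 1F ∙ cong₂ _⊕_ (cong(g₃ 1F 0F ⊙_)(so01 b))(cong₂ _⊙_ (so11 a)(so11 b)) ∙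
    solve 5(λ κ x y u v → y :* (κ :* v) :+ (x :+ y) :* (u :+ v) := (x :* u :+ κ :* y :* v) :+ (y :* u :+ (x :+ y) :* v)) refl κ(g₃ 0F 0F)(g₃ 1F 0F)(k₃ 0F 0F)(k₃ 1F 0F) ∙ sym(cong₂ _⊕_ e00 e10)
  ; isometry = Isometry-⊛ {g} {k} (isometry a)(isometry b) }
  where
  pr = λ p q r → g(ι p)(ι r) ⊙ k(ι r)(ι q)
  g₃ = λ i j → g(ι(p3 i))(ι(p3 j))
  k₃ = λ i j → k(ι(p3 i))(ι(p3 j))
  e33 : ∀ i j → (g ⊛ k)(ι(p3 i))(ι(p3 j)) ≡ g₃ i 0F ⊙ k₃ 0F j ⊕ g₃ i 1F ⊙ k₃ 1F j
  e33 i j = ⊛-ι g k(p3 i)(p3 j) ∙ only3 {pr(p3 i)(p3 j)} (λ l → 0⊙(z31 a i l))(λ l → ⊙0(z23 b l j)) ∙ ⨁-2 _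
  e00 = e33 0F 0F ∙ cong(λ z → g₃ 0F 0F ⊙ k₃ 0F 0F ⊕ z ⊙ k₃ 1F 0F)(so01 a)
  e10 = e33 1F 0F ∙ cong(λ z → g₃ 1F 0F ⊙ k₃ 0F 0F ⊕ z ⊙ k₃ 1F 0F)(so11 a)

 -- The adjoint for the polar form. On isometries it is the inverse, and its entries are a
 -- permutation of those of g, so the zero blocks remain visible.
 _† : Mat d d → Mat d d
 (g †) x y = g(τᶠ y)(τᶠ x)

 †-ι : ∀ g p q → (g †)(ι p)(ι q) ≡ g(ι(τ q))(ι(τ p))
 †-ι g p q = cong₂ g(τᶠ-ι q)(τᶠ-ι p)

 β-invariant : ∀ {g} → Isometry g → ∀ x y → β(apply g x)(apply g y) ≡ β x y
 β-invariant {g} i x y = recover(apply g x)(apply g y) ∙ cong₂ _⊕_ (cong₂ _⊕_ (θ-cong(λ j → sym(apply-⊕ g x y j)) ∙ i _)(i x))(i y) ∙ sym(recover x y)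
  where
  recover : ∀ x y → β x y ≡ θ(λ i → x i ⊕ y i) ⊕ θ x ⊕ θ y
  recover x y = solve 3(λ a b c → c := (a :+ b :+ c) :+ a :+ b) refl(θ x)(θ y)(β x y) ∙ cong(λ z → z ⊕ θ x ⊕ θ y)(sym(θ-polar x y))

 apply-unit : ∀ {a b} (M : Mat a b) j i → apply M(idM j) i ≡ M i j
 apply-unit M j i = dot-comm(M i)(idM j) ∙ dot-idˡ j(M i)

 †-inverseˡ : ∀ {g} → Isometry g → (g †) ⊛ g ≋ idM
 †-inverseˡ {g} i p q = begin
  _ ≡⟨ ⨁-cong(λ r → ⊙-comm _ _ ∙ sym(cong₂ _⊙_ (apply-unit g q r)(apply-unit g(τᶠ p)(τᶠ r)))) ⟩
  β(apply g(idM q))(apply g(idM(τᶠ p))) ≡⟨ β-invariant {g} i(idM q)(idM(τᶠ p)) ⟩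
  β(idM q)(idM(τᶠ p)) ≡⟨ dot-idˡ q(λ r → idM(τᶠ p)(τᶠ r)) ⟩
  idM(τᶠ p)(τᶠ q) ≡⟨ same(p Fin.≟ q) ⟩
  _ ∎
  where
  same : Dec(p ≡ q) → idM(τᶠ p)(τᶠ q) ≡ idM p q
  same(yes refl) = idM-diag(τᶠ p) ∙ sym(idM-diag p)
  same(no ne) = idM-off(λ e → ne(sym(τᶠτᶠ p) ∙ cong τᶠ e ∙ τᶠτᶠ q)) ∙ sym(idM-off ne)

 †-inverseʳ : ∀ {g} → Isometry g → g ⊛ (g †) ≋ idM
 †-inverseʳ {g} i = left⇒right {M = g} (†-inverseˡ {g} i)

 InQ-† : ∀ {g} → InQ g → InQ(g †)
 InQ-† {g} a = record
  { z21 = λ i j → †-ι g(p2 i)(p1 j) ∙ z21 a j i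
  ; z31 = λ { 0F j → †-ι g(p3 0F)(p1 j) ∙ z23 a j 1F ; 1F j → †-ι g(p3 1F)(p1 j) ∙ z23 a j 0F }
  ; z23 = λ { i 0F → †-ι g(p2 i)(p3 0F) ∙ z31 a 1F i ; i 1F → †-ι g(p2 i)(p3 1F) ∙ z31 a 0F i }
  ; so01 = †-ι g(p3 0F)(p3 1F) ∙ so01 a ∙ cong(κ ⊙_)(sym(†-ι g(p3 1F)(p3 0F)))
  ; so11 = †-ι g(p3 1F)(p3 1F) ∙ sym(⊕-cancel _ (g(ι(p3 1F))(ι(p3 0F)))) ∙ sym(cong₂ _⊕_ (†-ι g(p3 0F)(p3 0F) ∙ so11 a)(†-ι g(p3 1F)(p3 0F)))
  ; isometry = λ x → sym(isometry a(apply(g †) x)) ∙ θ-cong(λ j → sym(apply-⊛ g(g †) x j) ∙ dot-cong(†-inverseʳ {g} (isometry a) j)(λ _ → refl) ∙ dot-idˡ j x) }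

 module Nine (M11 M12 : Mat m m)(M13 : Mat m 2)(M21 M22 : Mat m m)(M23 : Mat m 2)(M31 M32 : Mat 2 m)(M33 : Mat 2 2) where
  blk : Part → Part → Fq
  blk(p1 i)(p1 j) = M11 i j
  blk(p1 i)(p2 j) = M12 i j
  blk(p1 i)(p3 j) = M13 i j
  blk(p2 i)(p1 j) = M21 i j
  blk(p2 i)(p2 j) = M22 i j
  blk(p2 i)(p3 j) = M23 i j
  blk(p3 i)(p1 j) = M31 i j
  blk(p3 i)(p2 j) = M32 i j
  blk(p3 i)(p3 j) = M33 i j

  block-part : ∀ x y → block M11 M12 M13 M21 M22 M23 M31 M32 M33 x y ≡ blk(part x)(part y)
  block-part x y with part x | part y
  ... | p1 i | p1 j = refl
  ... | p1 i | p2 j = refl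
  ... | p1 i | p3 j = refl
  ... | p2 i | p1 j = refl
  ... | p2 i | p2 j = refl
  ... | p2 i | p3 j = refl
  ... | p3 i | p1 j = refl
  ... | p3 i | p2 j = refl
  ... | p3 i | p3 j = refl

  block-ι : ∀ p q → block M11 M12 M13 M21 M22 M23 M31 M32 M33(ι p)(ι q) ≡ blk p q
  block-ι p q = block-part(ι p)(ι q) ∙ cong₂ blk(part-ι p)(part-ι q)

 so : Fq → Fq → Mat 2 2
 so d₁ d₂ = mat2 d₁(κ ⊙ d₂) d₂(d₁ ⊕ d₂)

 -- The product of the two factors multiplied out. The entry ᵗh ᵗi η i has become ᵗh η, because i
 -- preserves the polar form η.
 QB : Mat m m → Mat m m → Mat 2 2 → Mat m m → Mat 2 m → Part → Part → Fq
 QB A A' i B h = Nine.blk A(A ⊛ B)(A ⊛ (ᵗ h ⊛ η)) zeroM(ᵗ A') zeroM zeroM(i ⊛ h) i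

 QE : Mat m m → Mat m m → Mat 2 2 → Mat m m → Mat 2 m → Mat d d
 QE A A' i B h x y = QB A A' i B h(part x)(part y)

 QE-ι : ∀ A A' i B h p q → QE A A' i B h(ι p)(ι q) ≡ QB A A' i B h p q
 QE-ι A A' i B h p q = cong₂(QB A A' i B h)(part-ι p)(part-ι q)

 ⊛₂ : ∀ {a b} (M : Mat a 2)(P : Mat 2 b) i j → (M ⊛ P) i j ≡ M i 0F ⊙ P 0F j ⊕ M i 1F ⊙ P 1F j
 ⊛₂ M P i j = ⨁-2 _

 so-η : ∀ {d₁ d₂} → θ₀ d₁ d₂ ≡ 1# → ᵗ(so d₁ d₂) ⊛ (η ⊛ so d₁ d₂) ≋ η
 so-η {x} {y} e i j = ⊛₂(ᵗ(so x y))(η ⊛ so x y) i j ∙ cong₂(λ u v → so x y 0F i ⊙ u ⊕ so x y 1F i ⊙ v)(⊛₂ η(so x y) 0F j)(⊛₂ η(so x y) 1F j) ∙ entry i j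
  where
  entry : ∀ i j → so x y 0F i ⊙ (0# ⊙ so x y 0F j ⊕ 1# ⊙ so x y 1F j) ⊕ so x y 1F i ⊙ (1# ⊙ so x y 0F j ⊕ 0# ⊙ so x y 1F j) ≡ η i j
  entry 0F 0F = solve 2(λ x y → x :* (con false :* x :+ con true :* y) :+ y :* (con true :* x :+ con false :* y) := con false) refl x y
  entry 0F 1F = solve 3(λ k x y → x :* (con false :* (k :* y) :+ con true :* (x :+ y)) :+ y :* (con true :* (k :* y) :+ con false :* (x :+ y)) := x :* x :+ x :* y :+ k :* y :* y) refl κ x y ∙ e
  entry 1F 0F = solve 3(λ k x y → k :* y :* (con false :* x :+ con true :* y) :+ (x :+ y) :* (con true :* x :+ con false :* y) := x :* x :+ x :* y :+ k :* y :* y) refl κ x y ∙ e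
  entry 1F 1F = solve 3(λ k x y → k :* y :* (con false :* (k :* y) :+ con true :* (x :+ y)) :+ (x :+ y) :* (con true :* (k :* y) :+ con false :* (x :+ y)) := con false) refl κ x y

 so-inverse : ∀ {d₁ d₂} → θ₀ d₁ d₂ ≡ 1# → so d₁ d₂ ⊛ so(d₁ ⊕ d₂) d₂ ≋ idM
 so-inverse {x} {y} e i j = ⊛₂(so x y)(so(x ⊕ y) y) i j ∙ entry i j
  where
  entry : ∀ i j → so x y i 0F ⊙ so(x ⊕ y) y 0F j ⊕ so x y i 1F ⊙ so(x ⊕ y) y 1F j ≡ idM i j
  entry 0F 0F = solve 3(λ k x y → x :* (x :+ y) :+ k :* y :* y := x :* x :+ x :* y :+ k :* y :* y) refl κ x y ∙ e
  entry 0F 1F = solve 3(λ k x y → x :* (k :* y) :+ k :* y :* (x :+ y :+ y) := con false) refl κ x y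
  entry 1F 0F = solve 2(λ x y → y :* (x :+ y) :+ (x :+ y) :* y := con false) refl x y
  entry 1F 1F = solve 3(λ k x y → y :* (k :* y) :+ (x :+ y) :* (x :+ y :+ y) := x :* x :+ x :* y :+ k :* y :* y) refl κ x y ∙ e

 so-inverseˡ : ∀ {d₁ d₂} → θ₀ d₁ d₂ ≡ 1# → so(d₁ ⊕ d₂) d₂ ⊛ so d₁ d₂ ≋ idM
 so-inverseˡ {d₁} {d₂} e = left⇒right {M = so(d₁ ⊕ d₂) d₂} (so-inverse e)

 Qelem≋QE : ∀ A A' {d₁ d₂} B h → θ₀ d₁ d₂ ≡ 1# → Qelem A A'(so d₁ d₂) B h ≋ QE A A'(so d₁ d₂) B h
 Qelem≋QE A A' {d₁} {d₂} B h e x y = ⊗≋⊛ M N x y ∙ ι≋ {M ⊛ N} {QE A A' i B h} (λ p q → ⊛-ι M N p q ∙ ⨁ₚ-cong(λ r → cong₂ _⊙_ (L.block-ι p r)(R.block-ι r q)) ∙ entry p q ∙ sym(QE-ι A A' i B h p q)) x y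
  where
  i = so d₁ d₂
  H = ᵗ h ⊗ (ᵗ i ⊗ (η ⊗ i))
  module L = Nine A zeroM zeroM zeroM(ᵗ A') zeroM zeroM zeroM i
  module R = Nine idM B H zeroM idM zeroM zeroM h idM
  M = block A zeroM zeroM zeroM(ᵗ A') zeroM zeroM zeroM i
  N = block idM B H zeroM idM zeroM zeroM h idM
  H≋ : H ≋ ᵗ h ⊛ η
  H≋ k l = ⊗≋⊛ (ᵗ h)(ᵗ i ⊗ (η ⊗ i)) k l ∙ ⊛-congˡ(ᵗ h)(λ a b → ⊗≋⊛ (ᵗ i)(η ⊗ i) a b ∙ ⊛-congˡ(ᵗ i)(⊗≋⊛ η i) a b ∙ so-η e a b) k l
  entry : ∀ p q → ⨁ₚ(λ r → L.blk p r ⊙ R.blk r q) ≡ QB A A' i B h p q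
  entry(p1 a)(p1 b) = only1 {λ r → L.blk(p1 a) r ⊙ R.blk r(p1 b)} (λ _ → ⊙-0ˡ _)(λ _ → ⊙-0ˡ _) ∙ ⊛-identityʳ A a b
  entry(p1 a)(p2 b) = only1 {λ r → L.blk(p1 a) r ⊙ R.blk r(p2 b)} (λ _ → ⊙-0ˡ _)(λ _ → ⊙-0ˡ _)
  entry(p1 a)(p3 b) = only1 {λ r → L.blk(p1 a) r ⊙ R.blk r(p3 b)} (λ _ → ⊙-0ˡ _)(λ _ → ⊙-0ˡ _) ∙ ⊛-congˡ A H≋ a b
  entry(p2 a)(p1 b) = only2 {λ r → L.blk(p2 a) r ⊙ R.blk r(p1 b)} (λ _ → ⊙-0ˡ _)(λ _ → ⊙-0ˡ _) ∙ ⨁-zero(λ _ → ⊙-0ʳ _)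
  entry(p2 a)(p2 b) = only2 {λ r → L.blk(p2 a) r ⊙ R.blk r(p2 b)} (λ _ → ⊙-0ˡ _)(λ _ → ⊙-0ˡ _) ∙ ⊛-identityʳ(ᵗ A') a b
  entry(p2 a)(p3 b) = only2 {λ r → L.blk(p2 a) r ⊙ R.blk r(p3 b)} (λ _ → ⊙-0ˡ _)(λ _ → ⊙-0ˡ _) ∙ ⨁-zero(λ _ → ⊙-0ʳ _)
  entry(p3 a)(p1 b) = only3 {λ r → L.blk(p3 a) r ⊙ R.blk r(p1 b)} (λ _ → ⊙-0ˡ _)(λ _ → ⊙-0ˡ _) ∙ ⨁-zero(λ _ → ⊙-0ʳ _)
  entry(p3 a)(p2 b) = only3 {λ r → L.blk(p3 a) r ⊙ R.blk r(p2 b)} (λ _ → ⊙-0ˡ _)(λ _ → ⊙-0ˡ _)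
  entry(p3 a)(p3 b) = only3 {λ r → L.blk(p3 a) r ⊙ R.blk r(p3 b)} (λ _ → ⊙-0ˡ _)(λ _ → ⊙-0ˡ _) ∙ ⊛-identityʳ i a b

 triple : Vecᶠ m → Vecᶠ m → Vecᶠ 2 → Part → Fq
 triple u v w(p1 k) = u k
 triple u v w(p2 k) = v k
 triple u v w(p3 k) = w k

 act : (Part → Part → Fq) → (Part → Fq) → Part → Fq
 act B x p = ⨁ₚ(λ r → B p r ⊙ x r)

 apply-ι : ∀ g x p → apply g x(ι p) ≡ act(λ p q → g(ι p)(ι q))(x ∘ ι) p
 apply-ι g x p = ⨁-ι _

 θₚ : (Part → Fq) → Fq
 θₚ x = dot(x ∘ p1)(x ∘ p2) ⊕ θ₀(x(p3 0F))(x(p3 1F))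

 θₚ-cong : ∀ {x y} → (∀ p → x p ≡ y p) → θₚ x ≡ θₚ y
 θₚ-cong e = cong₂ _⊕_ (dot-cong(e ∘ p1)(e ∘ p2))(cong₂ θ₀(e(p3 0F))(e(p3 1F)))

 isometry-ι : ∀ {g} → Isometry g → ∀ x → θₚ(act(λ p q → g(ι p)(ι q)) x) ≡ θₚ x
 isometry-ι {g} i x = θₚ-cong(λ p → sym(apply-ι g x' p ∙ ⨁ₚ-cong λ r → cong(g(ι p)(ι r) ⊙_)(cong x(part-ι r)))) ∙ i x' ∙ θₚ-cong(λ p → cong x(part-ι p))
  where x' = x ∘ part

 δ₀ : Vecᶠ 2 → Fq
 δ₀ w = θ₀(w 0F)(w 1F)

 β₀ : Vecᶠ 2 → Vecᶠ 2 → Fq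
 β₀ w w' = w 0F ⊙ w' 1F ⊕ w 1F ⊙ w' 0F

 form-δ : ∀ w → form δ w w ≡ δ₀ w
 form-δ w = ⨁-2 _ ∙ cong₂(λ u v → w 0F ⊙ u ⊕ w 1F ⊙ v)(⨁-2 _)(⨁-2 _) ∙
  solve 3(λ k x y → x :* (con true :* x :+ con true :* y) :+ y :* (con false :* x :+ k :* y) := x :* x :+ x :* y :+ k :* y :* y) refl κ(w 0F)(w 1F)

 apply-ᵗ-form : ∀ (h : Mat 2 m) v → form(ᵗ h ⊛ (δ ⊛ h)) v v ≡ δ₀(apply h v)
 apply-ᵗ-form h v = dot-cong(λ _ → refl)(λ k → apply-⊛(ᵗ h)(δ ⊛ h) v k ∙ dot-cong(λ _ → refl)(apply-⊛ δ h v)) ∙ dot-apply-ᵗ(ᵗ h) v(apply δ(apply h v)) ∙ form-δ(apply h v)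

 alternating⇒form : ∀ {n} {M : Mat n n} → Alternating M → ∀ v → form M v v ≡ 0#
 alternating⇒form {zero} _ v = ⨁-[] _
 alternating⇒form {suc n} {M} (dg , sy) v = begin
  _ ≡⟨ ⨁-suc _ ∙ cong₂(λ x y → v fz ⊙ x ⊕ y)(⨁-suc _ ∙ cong(_⊕ dot(λ j → M fz(fs j)) v')(0⊙(dg fz)) ∙ ⊕-idˡ _)
   (⨁-cong(λ i → cong(v(fs i) ⊙_)(⨁-suc _ ∙ cong(λ z → z ⊙ v fz ⊕ dot(λ j → M(fs i)(fs j)) v')(sy(fs i) fz)) ∙ ⊙-distribˡ _ _ _) ∙ ⨁-⊕ _ _) ⟩
  v fz ⊙ dot(λ j → M fz(fs j)) v' ⊕ (⨁(λ i → v' i ⊙ (M fz(fs i) ⊙ v fz)) ⊕ form(λ i j → M(fs i)(fs j)) v' v') ≡⟨ cong₂(λ x y → v fz ⊙ dot(λ j → M fz(fs j)) v' ⊕ (x ⊕ y))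
   (⨁-cong(λ i → solve 3(λ a b c → a :* (b :* c) := c :* (b :* a)) refl(v' i)(M fz(fs i))(v fz)) ∙ ⨁-⊙ˡ(v fz) _)(alternating⇒form((λ i → dg(fs i)) , λ i j → sy(fs i)(fs j)) v') ⟩
  v fz ⊙ dot(λ j → M fz(fs j)) v' ⊕ (v fz ⊙ dot(λ j → M fz(fs j)) v' ⊕ 0#) ≡⟨ solve 1(λ x → x :+ (x :+ con false) := con false) refl _ ⟩
  _ ∎
  where v' = v ∘ fs

 form-unit : ∀ {n} (M : Mat n n) i j → form M(idM i)(idM j) ≡ M i j
 form-unit M i j = dot-idˡ i _ ∙ apply-unit M j i

 -- Unit vectors give the zero diagonal, and sums of two unit vectors give symmetry by polarisation,
 -- there being no signs.
 form⇒alternating : ∀ {n} {M : Mat n n} → (∀ v → form M v v ≡ 0#) → Alternating M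
 form⇒alternating {M = M} f = dg , λ i j → ⊕≡0⇒≡(cong₂ _⊕_ (sym(form-unit M i j))(sym(form-unit M j i)) ∙ solve 4(λ a b c d → b :+ c := (a :+ b :+ (c :+ d)) :+ (a :+ d)) refl(fo i i)(fo i j)(fo j i)(fo j j) ∙
   cong₂ _⊕_ (sym(expand(idM i)(idM j)) ∙ f _)(cong₂ _⊕_ (f(idM i))(f(idM j))) ∙ solve 0(con false :+ (con false :+ con false) := con false) refl)
  where
  fo = λ i j → form M(idM i)(idM j)
  dg = λ i → sym(form-unit M i i) ∙ f(idM i)
  expand : ∀ x y → form M(λ k → x k ⊕ y k)(λ k → x k ⊕ y k) ≡ form M x x ⊕ form M x y ⊕ (form M y x ⊕ form M y y)
  expand x y = dot-⊕ˡ x y _ ∙ cong₂ _⊕_ (dot-cong(λ _ → refl)(apply-⊕ M x y) ∙ dot-⊕ʳ x _ _)(dot-cong(λ _ → refl)(apply-⊕ M x y) ∙ dot-⊕ʳ y _ _)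

 form-ᵗ : ∀ (B : Mat m m) v → form(ᵗ B) v v ≡ dot(apply B v) v
 form-ᵗ B v = dot-apply-ᵗ(ᵗ B) v v

 so-isometry : ∀ {d₁ d₂} → θ₀ d₁ d₂ ≡ 1# → ∀ w → δ₀(apply(so d₁ d₂) w) ≡ δ₀ w
 so-isometry {x} {y} e w = cong₂ θ₀(⨁-2 _)(⨁-2 _) ∙ solve 5(λ k x y u v → (x :* u :+ k :* y :* v) :* (x :* u :+ k :* y :* v) :+ (x :* u :+ k :* y :* v) :* (y :* u :+ (x :+ y) :* v) :+ k :* (y :* u :+ (x :+ y) :* v) :* (y :* u :+ (x :+ y) :* v)
  := (x :* x :+ x :* y :+ k :* y :* y) :* (u :* u :+ u :* v :+ k :* v :* v)) refl κ x y(w 0F)(w 1F) ∙ cong(_⊙ δ₀ w) e ∙ ⊙-idˡ _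

 Cond : Mat m m → Mat m m → Fq → Fq → Mat m m → Mat 2 m → Set
 Cond A A' d₁ d₂ B h = (A ⊛ A' ≋ idM × A' ⊛ A ≋ idM) × θ₀ d₁ d₂ ≡ 1# × Alternating(ᵗ B +M (ᵗ h ⊛ (δ ⊛ h)))

 alt-form : ∀ (B : Mat m m)(h : Mat 2 m) v → form(ᵗ B +M (ᵗ h ⊛ (δ ⊛ h))) v v ≡ dot(apply B v) v ⊕ δ₀(apply h v)
 alt-form B h v = form-+M(ᵗ B) _ v v ∙ cong₂ _⊕_ (form-ᵗ B v)(apply-ᵗ-form h v)

 -- After A and i are removed, the change of θ is (Bv)·v + δ₀(hv) plus mixed terms that cancel. The
 -- first two are the value at v of the form of ᵗB + ᵗh δ h, which is zero because that matrix is
 -- alternating.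
 QE∈Q : ∀ {A A' d₁ d₂ B h} → Cond A A' d₁ d₂ B h → InQ(QE A A'(so d₁ d₂) B h)
 QE∈Q {A} {A'} {d₁} {d₂} {B} {h} ((_ , A'A) , norm , alt) = record
  { z21 = λ i j → E(p2 i)(p1 j) ; z31 = λ i j → E(p3 i)(p1 j) ; z23 = λ i j → E(p2 i)(p3 j)
  ; so01 = E(p3 0F)(p3 1F) ∙ cong(κ ⊙_)(sym(E(p3 1F)(p3 0F))) ; so11 = E(p3 1F)(p3 1F) ∙ sym(cong₂ _⊕_ (E(p3 0F)(p3 0F))(E(p3 1F)(p3 0F)))
  ; isometry = iso }
  where
  i = so d₁ d₂
  E = QE-ι A A' i B h
  iso : Isometry(QE A A' i B h)
  iso x = begin
   _ ≡⟨ θₚ-cong(λ p → apply-ι(QE A A' i B h) x p ∙ ⨁ₚ-cong(λ r → cong(_⊙ x(ι r))(E p r)) ∙ comp p) ⟩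
   dot(apply A u')(apply(ᵗ A') v) ⊕ δ₀(apply i w') ≡⟨ cong₂ _⊕_ (dot-comm _ _ ∙ dot-apply-ᵗ A(apply(ᵗ A') v) u' ∙ dot-comm _ u' ∙ dot-cong(λ _ → refl) λ k → sym(apply-⊛(ᵗ A)(ᵗ A') v k) ∙ dot-cong(λ l → dot-comm _ _ ∙ A'A l k ∙ idM-sym l k)(λ _ → refl) ∙ dot-idˡ k v)(so-isometry norm w') ⟩
   dot u' v ⊕ δ₀ w' ≡⟨ cong₂ _⊕_ (dot-⊕ˡ u _ v ∙ cong(dot u v ⊕_)(dot-⊕ˡ(apply B v) _ v ∙ cong(dot(apply B v) v ⊕_)(dot-cong(apply-⊛(ᵗ h) η w)(λ _ → refl) ∙ dot-comm _ v ∙ dot-apply-ᵗ(ᵗ h) v(apply η w) ∙ ⨁-2 _ ∙ cong₂(λ x y → apply h v 0F ⊙ x ⊕ apply h v 1F ⊙ y)(⨁-2 _)(⨁-2 _))))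
     (θ₀-⊕(apply h v 0F)(apply h v 1F)(w 0F)(w 1F)) ⟩
   dot u v ⊕ (dot(apply B v) v ⊕ (apply h v 0F ⊙ (0# ⊙ w 0F ⊕ 1# ⊙ w 1F) ⊕ apply h v 1F ⊙ (1# ⊙ w 0F ⊕ 0# ⊙ w 1F))) ⊕ (δ₀(apply h v) ⊕ δ₀ w ⊕ β₀(apply h v) w) ≡⟨ solve 8(λ a b x y r s e f → a :+ (b :+ (x :* (con false :* r :+ con true :* s) :+ y :* (con true :* r :+ con false :* s))) :+ (e :+ f :+ (x :* s :+ y :* r)) := (a :+ f) :+ (b :+ e)) refl(dot u v)(dot(apply B v) v)(apply h v 0F)(apply h v 1F)(w 0F)(w 1F)(δ₀(apply h v))(δ₀ w) ⟩
   (dot u v ⊕ δ₀ w) ⊕ (dot(apply B v) v ⊕ δ₀(apply h v)) ≡⟨ cong((dot u v ⊕ δ₀ w) ⊕_)(sym(alt-form B h v) ∙ alternating⇒form alt v) ∙ ⊕-idʳ _ ⟩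
   _ ∎
   where
   u = λ k → x(ι(p1 k)) ; v = λ k → x(ι(p2 k)) ; w = λ k → x(ι(p3 k))
   u' = λ k → u k ⊕ (apply B v k ⊕ apply(ᵗ h ⊛ η) w k)
   w' = λ k → apply h v k ⊕ w k
   comp : ∀ p → act(QB A A' i B h)(x ∘ ι) p ≡ triple(apply A u')(apply(ᵗ A') v)(apply i w') p
   comp(p1 k) = cong₂(λ y z → dot(A k) u ⊕ (y ⊕ z))(apply-⊛ A B v k)(apply-⊛ A(ᵗ h ⊛ η) w k) ∙ sym(apply-⊕ A u _ k ∙ cong(dot(A k) u ⊕_)(apply-⊕ A _ _ k))
   comp(p2 k) = only2 {λ r → QB A A' i B h(p2 k) r ⊙ x(ι r)} (λ _ → ⊙-0ˡ _)(λ _ → ⊙-0ˡ _)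
   comp(p3 k) = cong₂(λ y z → y ⊕ (z ⊕ dot(i k) w))(⨁-zero λ _ → ⊙-0ˡ _)(apply-⊛ i h v k) ∙ ⊕-idˡ _ ∙ sym(apply-⊕ i(apply h v) w k)

 -- The parameters are read off the blocks: A = g₁₁, its inverse is the transpose of g₂₂, h = i⁻¹
 -- g₃₂ and B = A⁻¹ g₁₂. Evaluating the isometry condition on vectors supported in one or two blocks
 -- yields all the required relations.
 module ExtractQ {g : Mat d d} (a : InQ g) where
  ĝ : Part → Part → Fq
  ĝ p q = g(ι p)(ι q)
  g11 = λ i j → ĝ(p1 i)(p1 j) ; g12 = λ i j → ĝ(p1 i)(p2 j) ; g13 = λ i j → ĝ(p1 i)(p3 j)
  g22 = λ i j → ĝ(p2 i)(p2 j) ; g32 = λ i j → ĝ(p3 i)(p2 j) ; g33 = λ i j → ĝ(p3 i)(p3 j)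
  d₁ d₂ : Fq
  d₁ = ĝ(p3 0F)(p3 0F)
  d₂ = ĝ(p3 1F)(p3 0F)
  h : Mat 2 m
  h = so(d₁ ⊕ d₂) d₂ ⊛ g32
  B : Mat m m
  B = ᵗ g22 ⊛ g12

  g33≋so : g33 ≋ so d₁ d₂
  g33≋so 0F 0F = refl
  g33≋so 0F 1F = so01 a
  g33≋so 1F 0F = refl
  g33≋so 1F 1F = so11 a

  iso : ∀ u v w → dot(λ k → apply g11 u k ⊕ (apply g12 v k ⊕ apply g13 w k))(apply g22 v) ⊕ δ₀(λ k → apply g32 v k ⊕ apply g33 w k) ≡ dot u v ⊕ δ₀ w
  iso u v w = θₚ-cong {triple(λ k → apply g11 u k ⊕ (apply g12 v k ⊕ apply g13 w k))(apply g22 v)(λ k → apply g32 v k ⊕ apply g33 w k)} {act ĝ(triple u v w)} (λ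
   { (p1 k) → refl
   ; (p2 k) → sym(only2 {λ r → ĝ(p2 k) r ⊙ triple u v w r} (λ l → 0⊙(z21 a k l)) λ l → 0⊙(z23 a k l))
   ; (p3 k) → sym(cong(_⊕ (apply g32 v k ⊕ apply g33 w k))(⨁-zero λ l → 0⊙(z31 a k l)) ∙ ⊕-idˡ _) }) ∙
   isometry-ι {g} (isometry a)(triple u v w)

  private
   0v : ∀ {n} → Vecᶠ n
   0v _ = 0#
   app0 : ∀ {x y} (M : Mat x y) k → apply M 0v k ≡ 0#
   app0 M k = dot-zeroʳ(M k)(λ _ → refl)
   δ₀-0 : δ₀ 0v ≡ 0#
   δ₀-0 = solve 1(λ k → con false :* con false :+ con false :* con false :+ k :* con false :* con false := con false) refl κ
   δ₀-cong : ∀ {w w' : Vecᶠ 2} → (∀ k → w k ≡ w' k) → δ₀ w ≡ δ₀ w'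
   δ₀-cong e = cong₂ θ₀(e 0F)(e 1F)

  iso-v : ∀ v → dot(apply g12 v)(apply g22 v) ⊕ δ₀(apply g32 v) ≡ 0#
  iso-v v = sym(cong₂ _⊕_ (dot-cong(λ k → cong₂(λ x y → x ⊕ (apply g12 v k ⊕ y))(app0 g11 k)(app0 g13 k) ∙ ⊕-idˡ _ ∙ ⊕-idʳ _) λ _ → refl)(δ₀-cong λ k → cong(apply g32 v k ⊕_)(app0 g33 k) ∙ ⊕-idʳ _)) ∙
   iso 0v v 0v ∙ cong₂ _⊕_ (dot-comm _ v ∙ dot-zeroʳ v λ _ → refl) δ₀-0 ∙ ⊕-idˡ 0#

  iso-uv : ∀ u v → dot(apply g11 u)(apply g22 v) ≡ dot u v
  iso-uv u v = begin
   _ ≡⟨ sym(⊕-idʳ _) ∙ cong(dot(apply g11 u)(apply g22 v) ⊕_)(sym(iso-v v)) ⟩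
   dot(apply g11 u)(apply g22 v) ⊕ (dot(apply g12 v)(apply g22 v) ⊕ δ₀(apply g32 v)) ≡⟨ sym(⊕-assoc _ _ _) ∙ cong(_⊕ δ₀(apply g32 v))(sym(dot-⊕ˡ(apply g11 u)(apply g12 v)(apply g22 v))) ⟩
   dot(λ k → apply g11 u k ⊕ apply g12 v k)(apply g22 v) ⊕ δ₀(apply g32 v) ≡⟨ sym(cong₂ _⊕_ (dot-cong(λ k → cong(apply g11 u k ⊕_)(cong(apply g12 v k ⊕_)(app0 g13 k) ∙ ⊕-idʳ _)) λ _ → refl)(δ₀-cong λ k → cong(apply g32 v k ⊕_)(app0 g33 k) ∙ ⊕-idʳ _)) ⟩
   _ ≡⟨ iso u v 0v ⟩
   dot u v ⊕ δ₀ 0v ≡⟨ cong(dot u v ⊕_) δ₀-0 ∙ ⊕-idʳ _ ⟩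
   _ ∎

  A'A : ᵗ g22 ⊛ g11 ≋ idM
  A'A i j = dot-comm _ _ ∙ dot-cong(λ k → sym(apply-unit g11 j k))(λ k → sym(apply-unit g22 i k)) ∙ iso-uv(idM j)(idM i) ∙ dot-idˡ j(idM i) ∙ refl

  AA' : g11 ⊛ ᵗ g22 ≋ idM
  AA' = left⇒right {M = g11} A'A

  iso-w : ∀ w → δ₀(apply g33 w) ≡ δ₀ w
  iso-w w = sym(cong₂ _⊕_ (dot-zeroʳ _ (app0 g22))(δ₀-cong λ k → cong(_⊕ apply g33 w k)(app0 g32 k) ∙ ⊕-idˡ _) ∙ ⊕-idˡ _) ∙
   iso 0v 0v w ∙ cong(_⊕ δ₀ w)(dot-zeroʳ _ λ _ → refl) ∙ ⊕-idˡ _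

  norm : θ₀ d₁ d₂ ≡ 1#
  norm = sym(cong₂ θ₀(apply-unit g33 0F 0F)(apply-unit g33 0F 1F)) ∙ iso-w(idM 0F) ∙ solve 1(λ k → con true :* con true :+ con true :* con false :+ k :* con false :* con false := con true) refl κ

  g32≋ : so d₁ d₂ ⊛ h ≋ g32
  g32≋ i j = sym(⊛-assoc(so d₁ d₂) _ g32 i j) ∙ ⊛-congʳ g32(so-inverse norm) i j ∙ ⊛-identityˡ g32 i j

  g12≋ : g11 ⊛ B ≋ g12
  g12≋ i j = sym(⊛-assoc g11 _ g12 i j) ∙ ⊛-congʳ g12 AA' i j ∙ ⊛-identityˡ g12 i j

  altᴮ : Alternating(ᵗ B +M (ᵗ h ⊛ (δ ⊛ h)))
  altᴮ = form⇒alternating(λ v → alt-form B h v ∙ cong₂ _⊕_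
   (dot-cong(apply-⊛(ᵗ g22) g12 v)(λ _ → refl) ∙ sym(dot-apply-ᵗ g22(apply g12 v) v))
   (sym(so-isometry norm(apply h v)) ∙ δ₀-cong λ k → sym(apply-⊛(so d₁ d₂) h v k) ∙ dot-cong(g32≋ k) λ _ → refl) ∙ iso-v v)

  -- The remaining component of the isometry condition is the mixed one, which determines g13.
  iso-vw : ∀ v w → dot(apply g13 w)(apply g22 v) ≡ β₀(apply h v) w
  iso-vw v w = ⊕≡0⇒≡(begin
   _ ≡⟨ solve 5(λ c b e f t → c :+ t := (c :+ b :+ (e :+ f :+ t)) :+ (b :+ e) :+ f) refl c b(δ₀(apply h v))(δ₀ w)(β₀(apply h v) w) ⟩
   (c ⊕ b ⊕ (δ₀(apply h v) ⊕ δ₀ w ⊕ β₀(apply h v) w)) ⊕ (b ⊕ δ₀(apply h v)) ⊕ δ₀ w ≡⟨ cong₂(λ x y → x ⊕ y ⊕ δ₀ w) big small ⟩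
   δ₀ w ⊕ 0# ⊕ δ₀ w ≡⟨ solve 1(λ x → x :+ con false :+ x := con false) refl(δ₀ w) ⟩
   _ ∎)
   where
   c = dot(apply g13 w)(apply g22 v)
   b = dot(apply g12 v)(apply g22 v)
   g32v : ∀ k → apply g32 v k ≡ apply(so d₁ d₂)(apply h v) k
   g32v k = dot-cong(λ j → sym(g32≋ k j))(λ _ → refl) ∙ apply-⊛(so d₁ d₂) h v k
   small : b ⊕ δ₀(apply h v) ≡ 0#
   small = cong(b ⊕_)(sym(so-isometry norm(apply h v)) ∙ δ₀-cong λ k → sym(g32v k)) ∙ iso-v v
   big : c ⊕ b ⊕ (δ₀(apply h v) ⊕ δ₀ w ⊕ β₀(apply h v) w) ≡ δ₀ w
   big = cong₂ _⊕_ (⊕-comm c b ∙ sym(dot-⊕ˡ(apply g12 v)(apply g13 w)(apply g22 v)) ∙ dot-cong(λ k → sym(cong(_⊕ (apply g12 v k ⊕ apply g13 w k))(app0 g11 k) ∙ ⊕-idˡ _)) λ _ → refl)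
     (sym(θ₀-⊕ _ _ _ _) ∙ sym(so-isometry norm λ k → apply h v k ⊕ w k) ∙ δ₀-cong λ k → apply-⊕(so d₁ d₂)(apply h v) w k ∙ cong₂ _⊕_ (sym(g32v k))(dot-cong(λ j → sym(g33≋so k j)) λ _ → refl)) ∙
    iso 0v v w ∙ cong(_⊕ δ₀ w)(dot-comm _ v ∙ dot-zeroʳ v λ _ → refl) ∙ ⊕-idˡ _

  g13≋ : g11 ⊛ (ᵗ h ⊛ η) ≋ g13
  g13≋ i j = ⊛-congˡ g11(λ k l → entry k l ∙ sym(dot-comm _ _ ∙ dot-cong(λ x → sym(apply-unit g13 l x))(λ x → sym(apply-unit g22 k x)) ∙ iso-vw(idM k)(idM l))) i j ∙
   sym(⊛-assoc g11(ᵗ g22) g13 i j) ∙ ⊛-congʳ g13 AA' i j ∙ ⊛-identityˡ g13 i j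
   where
   entry : ∀ k l → (ᵗ h ⊛ η) k l ≡ β₀(apply h(idM k))(idM l)
   entry k l = ⊛₂(ᵗ h) η k l ∙ lemma l ∙ cong₂(λ x y → x ⊙ idM l 1F ⊕ y ⊙ idM l 0F)(sym(apply-unit h k 0F))(sym(apply-unit h k 1F))
    where
    lemma : ∀ l → h 0F k ⊙ η 0F l ⊕ h 1F k ⊙ η 1F l ≡ h 0F k ⊙ idM l 1F ⊕ h 1F k ⊙ idM l 0F
    lemma 0F = refl
    lemma 1F = refl

 Params : FS
 Params = (𝕄 m m ×ᶠ 𝕄 m m) ×ᶠ ((𝔽ˢ ×ᶠ 𝔽ˢ) ×ᶠ (𝕄 m m ×ᶠ 𝕄 2 m))

 cond? : ∀ A A' d₁ d₂ B h → Dec(Cond A A' d₁ d₂ B h)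
 cond? A A' d₁ d₂ B h = InvPair? A A' ×-dec((θ₀ d₁ d₂ ≟ 1#) ×-dec alt?(ᵗ B +M (ᵗ h ⊛ (δ ⊛ h))))

 alt-cong : ∀ {B B' : Mat m m} {h h' : Mat 2 m} → B ≋ B' → h ≋ h' → Alternating(ᵗ B +M (ᵗ h ⊛ (δ ⊛ h))) → Alternating(ᵗ B' +M (ᵗ h' ⊛ (δ ⊛ h')))
 alt-cong {B} {B'} {h} {h'} e e' = Alternating-cong(λ i j → cong₂ _⊕_ (e j i)(⊛-cong {M = ᵗ h} {ᵗ h'} {δ ⊛ h} {δ ⊛ h'} (λ k l → e' l k)(⊛-congˡ δ e') i j))

 QB-cong : ∀ {A A₁ A' A₁' i B B₁ h h₁} → A ≋ A₁ → A' ≋ A₁' → B ≋ B₁ → h ≋ h₁ → ∀ p q → QB A A' i B h p q ≡ QB A₁ A₁' i B₁ h₁ p q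
 QB-cong eA eA' eB eh(p1 x)(p1 y) = eA x y
 QB-cong {A} {B = B} eA eA' eB eh(p1 x)(p2 y) = ⊛-cong {M = A} {P = B} eA eB x y
 QB-cong {A} {A₁} {h = h} {h₁} eA eA' eB eh(p1 x)(p3 y) = ⊛-cong {M = A} {A₁} eA(⊛-congʳ {M = ᵗ h} {ᵗ h₁} η λ k l → eh l k) x y
 QB-cong eA eA' eB eh(p2 x)(p1 y) = refl
 QB-cong eA eA' eB eh(p2 x)(p2 y) = eA' y x
 QB-cong eA eA' eB eh(p2 x)(p3 y) = refl
 QB-cong eA eA' eB eh(p3 x)(p1 y) = refl
 QB-cong {i = i} eA eA' eB eh(p3 x)(p2 y) = ⊛-congˡ i eh x y
 QB-cong eA eA' eB eh(p3 x)(p3 y) = refl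

 recover : ∀ {g} (a : InQ g) → let open ExtractQ a in g ≋ QE g11(ᵗ g22)(so d₁ d₂) B h
 recover {g} a = ι≋ {g} (λ p q → sym(QE-ι g11(ᵗ g22)(so d₁ d₂) B h p q ∙ go p q))
  where
  open ExtractQ a
  go : ∀ p q → QB g11(ᵗ g22)(so d₁ d₂) B h p q ≡ g(ι p)(ι q)
  go(p1 x)(p1 y) = refl
  go(p1 x)(p2 y) = g12≋ x y
  go(p1 x)(p3 y) = g13≋ x y
  go(p2 x)(p1 y) = sym(z21 a x y)
  go(p2 x)(p2 y) = refl
  go(p2 x)(p3 y) = sym(z23 a x y)
  go(p3 x)(p1 y) = sym(z31 a x y)
  go(p3 x)(p2 y) = g32≋ x y
  go(p3 x)(p3 y) = sym(g33≋so x y)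

 ∑Q-params : {F : Mat d d → ℤ} → FS.Cong(𝕄 d d) F →
  ∑(enum Params)(λ ((A , A') , ((d₁ , d₂) , (B , h))) → χ(cond? A A' d₁ d₂ B h) * F(QE A A'(so d₁ d₂) B h)) ≡ ∑(Mats d d)(λ g → χ(InQ? g) * F g)
 ∑Q-params {F} Fc = ∑-bij Params(𝕄 d d)(λ ((A , A') , ((d₁ , d₂) , (B , h))) → cond? A A' d₁ d₂ B h) InQ? to from
  (λ { {((A , A') , ((d₁ , d₂) , (B , h)))} c@((AA' , A'A) , norm , alt) e →
   let E = λ p q → e(ι p)(ι q) ∙ QE-ι A A'(so d₁ d₂) B h p q
   in InQ-cong(λ x y → sym(e x y))(QE∈Q c) ,
    (((λ i j → sym(E(p1 i)(p1 j))) , λ i j → sym(E(p2 j)(p2 i))) , ((sym(E(p3 0F)(p3 0F)) , sym(E(p3 1F)(p3 0F))) ,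
     ((λ i j → sym(⊛-cong {M = _} {A'} {_} {A ⊛ B} (λ k l → E(p2 l)(p2 k))(λ k l → E(p1 k)(p2 l)) i j ∙ sym(⊛-assoc A' A B i j) ∙ ⊛-congʳ B A'A i j ∙ ⊛-identityˡ B i j)) ,
      λ i j → sym(⊛-cong {M = _} {so(d₁ ⊕ d₂) d₂} {_} {so d₁ d₂ ⊛ h} (λ k l → cong₂(λ x y → so(x ⊕ y) y k l)(E(p3 0F)(p3 0F))(E(p3 1F)(p3 0F)))(λ k l → E(p3 k)(p2 l)) i j ∙
       sym(⊛-assoc(so(d₁ ⊕ d₂) d₂)(so d₁ d₂) h i j) ∙ ⊛-congʳ h(so-inverseˡ norm) i j ∙ ⊛-identityˡ h i j)))) ,
    Fc(λ x y → sym(e x y)) })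
  (λ { {((A , A') , ((d₁ , d₂) , (B , h)))} {g} a((eA , eA') , ((refl , refl) , (eB , eh))) → let module X = ExtractQ a in
   (((λ i j → ⊛-cong {M = A} {P = A'} eA eA' i j ∙ X.AA' i j) , λ i j → ⊛-cong {M = A'} {P = A} eA' eA i j ∙ X.A'A i j) , X.norm , alt-cong {X.B} {B} {X.h} {h} (λ i j → sym(eB i j))(λ i j → sym(eh i j)) X.altᴮ) ,
   λ x y → recover a x y ∙ sym(QB-cong {i = so X.d₁ X.d₂} eA eA' eB eh(part x)(part y)) })
  where
  to : El Params → Mat d d
  to ((A , A') , ((d₁ , d₂) , (B , h))) = QE A A'(so d₁ d₂) B h
  from : Mat d d → El Params
  from g = ((λ i j → g(ι(p1 i))(ι(p1 j))) , λ i j → g(ι(p2 j))(ι(p2 i))) , ((x , y) , ((ᵗ(λ i j → g(ι(p2 i))(ι(p2 j))) ⊛ λ i j → g(ι(p1 i))(ι(p2 j))) , (so(x ⊕ y) y ⊛ λ i j → g(ι(p3 i))(ι(p2 j)))))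
   where
   x = g(ι(p3 0F))(ι(p3 0F))
   y = g(ι(p3 1F))(ι(p3 0F))

 ∑Q-nested : {F : Mat d d → ℤ} → FS.Cong(𝕄 d d) F → ∑ Qlist F ≡
  ∑GL m(λ A A' → ∑ Fs λ d₁ → ∑ Fs λ d₂ → χ(θ₀ d₁ d₂ ≟ 1#) * ∑(Mats m m) λ B → ∑(Mats 2 m) λ h → χ(alt?(ᵗ B +M (ᵗ h ⊛ (δ ⊛ h)))) * F(QE A A'(so d₁ d₂) B h))
 ∑Q-nested {F} Fc = ∑-concatMap _ GLpairs F ∙ ∑-filterᵇ _ (cartesianProduct(Mats m m)(Mats m m)) _ ∙ ∑-cartesianProduct(Mats m m)(Mats m m) _ ∙
  ∑-cong(Mats m m)(λ A → ∑-cong(Mats m m) λ A' → cong₂ _*_ (χ-⇔(T? _)(InvPair? A A')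
    (λ t → let (t₁ , t₂) = Equivalence.to T-∧ t in (λ i j → sym(⊗≋⊛ A A' i j) ∙ eqM⁺ {M = A ⊗ A'} t₁ i j) , λ i j → sym(⊗≋⊛ A' A i j) ∙ eqM⁺ {M = A' ⊗ A} t₂ i j)
    λ (e₁ , e₂) → Equivalence.from T-∧(eqM⁻ {M = A ⊗ A'} (λ i j → ⊗≋⊛ A A' i j ∙ e₁ i j) , eqM⁻ {M = A' ⊗ A} λ i j → ⊗≋⊛ A' A i j ∙ e₂ i j))
   (∑-concatMap _ SOminus F ∙ ∑-map _ (filterᵇ _ (cartesianProduct Fs Fs)) _ ∙ ∑-filterᵇ _ (cartesianProduct Fs Fs) _ ∙ ∑-cartesianProduct Fs Fs _ ∙
    ∑-cong Fs λ d₁ → ∑-cong Fs λ d₂ → χ-match(T? _)(θ₀ d₁ d₂ ≟ 1#)(λ t → let norm = ==⇒≡ t in norm ,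
     ∑-concatMap _ (Mats m m) F ∙ ∑-cong(Mats m m) λ B → ∑-map _ (filterᵇ _ (Mats 2 m)) F ∙ ∑-filterᵇ _ (Mats 2 m) _ ∙ ∑-cong(Mats 2 m) λ h → cong₂ _*_
      (χ-⇔(T? _)(alt?(ᵗ B +M (ᵗ h ⊛ (δ ⊛ h))))(alt⁺ B h)(alt⁻ B h))(Fc(Qelem≋QE A A' B h norm))) ≡⇒==))
  where
  alt≋ : ∀ B h → ᵗ B +M (ᵗ h ⊗ (δ ⊗ h)) ≋ ᵗ B +M (ᵗ h ⊛ (δ ⊛ h))
  alt≋ B h i j = cong(B j i ⊕_)(⊗≋⊛ (ᵗ h)(δ ⊗ h) i j ∙ ⊛-congˡ(ᵗ h)(⊗≋⊛ δ h) i j)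
  alt⁺ : ∀ B h → T(Setup.alternating 𝔽 r κ(ᵗ B +M (ᵗ h ⊗ (δ ⊗ h)))) → Alternating(ᵗ B +M (ᵗ h ⊛ (δ ⊛ h)))
  alt⁺ B h t = Alternating-cong(alt≋ B h)((λ i → ==⇒≡ (proj₁(Equivalence.to T-∧(T-all⁺ _ t i)))) , λ i j → ==⇒≡ (T-all⁺ _ (proj₂(Equivalence.to T-∧(T-all⁺ _ t i))) j))
  alt⁻ : ∀ B h → Alternating(ᵗ B +M (ᵗ h ⊛ (δ ⊛ h))) → T(Setup.alternating 𝔽 r κ(ᵗ B +M (ᵗ h ⊗ (δ ⊗ h))))
  alt⁻ B h a = let (dg , sy) = Alternating-cong(λ i j → sym(alt≋ B h i j)) a in T-all⁻ _ (λ i → Equivalence.from T-∧(≡⇒== (dg i) , T-all⁻ _ λ j → ≡⇒== (sy i j)))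

 -- The parameters are unique, so `Qlist` meets every element of Q exactly once. From here on sums
 -- over Q are sums over all matrices, weighted by the predicate `InQ`.
 ∑Q : {F : Mat d d → ℤ} → FS.Cong(𝕄 d d) F → ∑ Qlist F ≡ ∑(Mats d d)(λ g → χ(InQ? g) * F g)
 ∑Q {F} Fc = ∑Q-nested Fc ∙ sym flatten ∙ ∑Q-params Fc
  where
  pull : ∀ a b c z → a * b * c * z ≡ a * (b * (c * z))
  pull = ring
  flatten : ∑(enum Params)(λ ((A , A') , ((d₁ , d₂) , (B , h))) → χ(cond? A A' d₁ d₂ B h) * F(QE A A'(so d₁ d₂) B h)) ≡ _
  flatten = ∑-cartesianProduct(cartesianProduct(Mats m m)(Mats m m)) _ _ ∙ ∑-cartesianProduct(Mats m m)(Mats m m) _ ∙ ∑-cong(Mats m m)(λ A → ∑-cong(Mats m m) λ A' →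
   ∑-cartesianProduct(cartesianProduct Fs Fs) _ _ ∙ ∑-cartesianProduct Fs Fs _ ∙ ∑-cong Fs(λ d₁ → ∑-cong Fs(λ d₂ →
    ∑-cartesianProduct(Mats m m)(Mats 2 m) _ ∙ ∑-cong(Mats m m)(λ B → ∑-cong(Mats 2 m)(λ h →
     cong(_* F(QE A A'(so d₁ d₂) B h))(χ-×(InvPair? A A')((θ₀ d₁ d₂ ≟ 1#) ×-dec alt?(ᵗ B +M (ᵗ h ⊛ (δ ⊛ h)))) ∙ cong(χ(InvPair? A A') *_)(χ-×(θ₀ d₁ d₂ ≟ 1#)(alt?(ᵗ B +M (ᵗ h ⊛ (δ ⊛ h))))) ∙ sym(Z.*-assoc(χ(InvPair? A A'))(χ(θ₀ d₁ d₂ ≟ 1#))(χ(alt?(ᵗ B +M (ᵗ h ⊛ (δ ⊛ h))))))) ∙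
      pull(χ(InvPair? A A'))(χ(θ₀ d₁ d₂ ≟ 1#))(χ(alt?(ᵗ B +M (ᵗ h ⊛ (δ ⊛ h)))))(F(QE A A'(so d₁ d₂) B h))) ∙
     ∑-*ˡ(Mats 2 m)(χ(InvPair? A A')) _ ∙ cong(χ(InvPair? A A') *_)(∑-*ˡ(Mats 2 m)(χ(θ₀ d₁ d₂ ≟ 1#)) _)) ∙
     ∑-*ˡ(Mats m m)(χ(InvPair? A A')) _ ∙ cong(χ(InvPair? A A') *_)(∑-*ˡ(Mats m m)(χ(θ₀ d₁ d₂ ≟ 1#)) _)) ∙
    ∑-*ˡ Fs(χ(InvPair? A A')) _) ∙ ∑-*ˡ Fs(χ(InvPair? A A')) _)

-- Double cosets: fibres of the multiplication map and traces

module Cosets (𝒟 : FieldData)(m s : ℕ) where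
 open FieldArithmetic 𝒟
 open Characters 𝒟 using (θ₀)
 open LinearAlgebra 𝒟
 open GeneralLinear 𝒟 using (⨁-2)
 open QGroup 𝒟 m

 ≋-sym : ∀ {a b} {M P : Mat a b} → M ≋ P → P ≋ M
 ≋-sym e i j = sym(e i j)

 ≋-trans : ∀ {a b} {M P R : Mat a b} → M ≋ P → P ≋ R → M ≋ R
 ≋-trans e e' i j = e i j ∙ e' i j

 cancelˡ : ∀ {n k} {L M : Mat n n} (X : Mat n k) → L ⊛ M ≋ idM → L ⊛ (M ⊛ X) ≋ X
 cancelˡ {L = L} {M} X e i j = sym(⊛-assoc L M X i j) ∙ ⊛-congʳ X e i j ∙ ⊛-identityˡ X i j

 ⊛-cancelˡ : ∀ {n k} {L M : Mat n n} {X Y : Mat n k} → L ⊛ M ≋ idM → M ⊛ X ≋ M ⊛ Y → X ≋ Y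
 ⊛-cancelˡ {L = L} {M} {X} {Y} e h i j = sym(cancelˡ {L = L} {M} X e i j) ∙ ⊛-congˡ L h i j ∙ cancelˡ {L = L} {M} Y e i j

 ∑ᴽ : (Mat d d → ℤ) → ℤ
 ∑ᴽ F = ∑(Mats d d)(λ g → χ(InQ? g) * F g)

 ∑ᴽ-cong : ∀ {F G} → (∀ g → InQ g → F g ≡ G g) → ∑ᴽ F ≡ ∑ᴽ G
 ∑ᴽ-cong e = ∑-cong(Mats d d)(λ g → χ-guard(InQ? g)(e g))

 ∑ᴽ-*ʳ : ∀ c F → ∑ᴽ(λ g → F g * c) ≡ ∑ᴽ F * c
 ∑ᴽ-*ʳ c F = ∑-cong(Mats d d)(λ g → sym(Z.*-assoc(χ(InQ? g))(F g) c)) ∙ ∑-*ʳ(Mats d d) c _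

 module _ {F : Mat d d → ℤ} (Fc : FS.Cong(𝕄 d d) F) where
  ∑ᴽ-left : ∀ {k} → InQ k → ∑ᴽ(λ g → F(k ⊛ g)) ≡ ∑ᴽ F
  ∑ᴽ-left {k} a = ∑-bij(𝕄 d d)(𝕄 d d) InQ? InQ?(k ⊛_)((k †) ⊛_)
   (λ {g} b e → InQ-cong(≋-sym e)(InQ-⊛ a b) , (λ i j → sym(cancelˡ {L = k †} {k} g(†-inverseˡ {k} (isometry a)) i j) ∙ ⊛-congˡ(k †)(≋-sym e) i j) , Fc(≋-sym e))
   (λ {y = g} b e → InQ-cong(≋-sym e)(InQ-⊛(InQ-† a) b) , λ i j → sym(cancelˡ {L = k} {k †} g(†-inverseʳ {k} (isometry a)) i j) ∙ ⊛-congˡ k(≋-sym e) i j)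

  ∑ᴽ-† : ∑ᴽ(λ g → F(g †)) ≡ ∑ᴽ F
  ∑ᴽ-† = ∑-bij(𝕄 d d)(𝕄 d d) InQ? InQ? _† _†
   (λ {g} b e → InQ-cong(≋-sym e)(InQ-† b) , (λ i j → sym(cong₂ g(τᶠτᶠ i)(τᶠτᶠ j)) ∙ sym(e(τᶠ j)(τᶠ i))) , Fc(≋-sym e))
   (λ {y = g} b e → InQ-cong(≋-sym e)(InQ-† b) , λ i j → sym(cong₂ g(τᶠτᶠ i)(τᶠτᶠ j)) ∙ sym(e(τᶠ j)(τᶠ i)))

 π̂ : Part → Part
 π̂(p1 k) = if toℕ k ℕ.<ᵇ s then p2 k else p1 k
 π̂(p2 k) = if toℕ k ℕ.<ᵇ s then p1 k else p2 k
 π̂(p3 k) = p3 k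

 π̂π̂ : ∀ p → π̂(π̂ p) ≡ p
 π̂π̂(p1 k) with toℕ k ℕ.<ᵇ s in eq
 ... | true rewrite eq = refl
 ... | false rewrite eq = refl
 π̂π̂(p2 k) with toℕ k ℕ.<ᵇ s in eq
 ... | true rewrite eq = refl
 ... | false rewrite eq = refl
 π̂π̂(p3 k) = refl

 π : Fin d → Fin d
 π = σperm s

 π-part : ∀ x → π x ≡ ι(π̂(part x))
 π-part x with part x in eq
 ... | p1 k with toℕ k ℕ.<ᵇ s
 ...   | true = refl
 ...   | false = sym(ι-part x) ∙ cong ι eq
 π-part x | p2 k with toℕ k ℕ.<ᵇ s
 ...   | true = refl
 ...   | false = sym(ι-part x) ∙ cong ι eq
 π-part x | p3 k = sym(ι-part x) ∙ cong ι eq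

 π-ι : ∀ p → π(ι p) ≡ ι(π̂ p)
 π-ι p = π-part(ι p) ∙ cong(ι ∘ π̂)(part-ι p)

 ππ : ∀ x → π(π x) ≡ x
 ππ x = cong π(π-part x) ∙ π-ι(π̂(part x)) ∙ cong ι(π̂π̂(part x)) ∙ ι-part x

 σs : Mat d d
 σs = σ s

 σ⊛ : ∀ (M : Mat d d) x y → (σs ⊛ M) x y ≡ M(π x) y
 σ⊛ M x y = dot-idˡ(π x)(λ k → M k y)

 ⊛σ : ∀ (M : Mat d d) x y → (M ⊛ σs) x y ≡ M x(π y)
 ⊛σ M x y = dot-cong {u = M x} (λ _ → refl)(λ k → swap k y) ∙ dot-idʳ(M x)(π y)
  where
  swap : ∀ k y → idM(π k) y ≡ idM k(π y)
  swap k y with π k Fin.≟ y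
  ... | yes refl = sym(cong(idM k)(ππ k) ∙ idM-diag k)
  ... | no ne = sym(idM-off λ e → ne(cong π e ∙ ππ y))

 σσ : σs ⊛ σs ≋ idM
 σσ x y = σ⊛ σs x y ∙ cong(λ z → idM z y)(ππ x)

 conj : Mat d d → Mat d d
 conj w = σs ⊛ (w ⊛ σs)

 conj-ι : ∀ w p q → conj w(ι p)(ι q) ≡ w(ι(π̂ p))(ι(π̂ q))
 conj-ι w p q = σ⊛(w ⊛ σs)(ι p)(ι q) ∙ ⊛σ w _ _ ∙ cong₂ w(π-ι p)(π-ι q)

 σ-isometry : Isometry σs
 σ-isometry x = cong₂ _⊕_ (⨁-cong λ k → go k)(cong₂ θ₀(at(p3 0F))(at(p3 1F)))
  where
  at : ∀ p → apply σs x(ι p) ≡ x(ι(π̂ p))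
  at p = dot-idˡ(π(ι p)) x ∙ cong x(π-ι p)
  go : ∀ k → apply σs x(ι(p1 k)) ⊙ apply σs x(ι(p2 k)) ≡ x(ι(p1 k)) ⊙ x(ι(p2 k))
  go k = cong₂ _⊙_ (at(p1 k))(at(p2 k)) ∙ swap(toℕ k ℕ.<ᵇ s)
   where
   swap : ∀ b → x(ι(if b then p2 k else p1 k)) ⊙ x(ι(if b then p1 k else p2 k)) ≡ x(ι(p1 k)) ⊙ x(ι(p2 k))
   swap true = ⊙-comm _ _
   swap false = refl

 -- The order of Q ∩ σQσ, since w lies in it exactly when w and σwσ are in Q.
 c : ℤ
 c = ∑ᴽ(λ w → χ(InQ?(conj w)))

 -- Applied with `pre` equal to the identity and to ρ. Being an involution that normalises Q, it can
 -- be carried past an element of Q under the trace.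
 module Coset (pre : Mat d d)(pre² : pre ⊛ pre ≋ idM)(normal : ∀ {y} → InQ y → InQ(pre ⊛ (y ⊛ pre))) where
  D : Mat d d → Mat d d → Mat d d
  D x y = pre ⊛ (x ⊛ (σs ⊛ y))

  D-cong : ∀ {x x' y y'} → x ≋ x' → y ≋ y' → D x y ≋ D x' y'
  D-cong {x} {x'} {y} {y'} e e' = ⊛-congˡ pre(⊛-cong {M = x} {x'} e(⊛-congˡ σs e'))

  ⊗≋D : ∀ x y → pre ⊗ (x ⊗ (σ s ⊗ y)) ≋ D x y
  ⊗≋D x y i j = ⊗≋⊛ pre(x ⊗ (σ s ⊗ y)) i j ∙ ⊛-congˡ pre(λ k l → ⊗≋⊛ x(σ s ⊗ y) k l ∙ ⊛-congˡ x(⊗≋⊛ (σ s) y) k l) i j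

  solve-y : ∀ {x₀ y₀ w y} → InQ x₀ → InQ w → D x₀ y₀ ≋ D(x₀ ⊛ (w †)) y → y ≋ conj w ⊛ y₀
  solve-y {x₀} {y₀} {w} {y} a b e = ≋-sym(≋-trans(⊛-assoc σs(w ⊛ σs) y₀)(≋-trans(⊛-congˡ σs(≋-trans(⊛-assoc w σs y₀)(≋-trans(⊛-congˡ w step₂)(cancelˡ {L = w} {w †} (σs ⊛ y)(†-inverseʳ {w} (isometry b))))))(cancelˡ {L = σs} {σs} y σσ)))
   where
   step₁ : x₀ ⊛ (σs ⊛ y₀) ≋ x₀ ⊛ ((w †) ⊛ (σs ⊛ y))
   step₁ = ≋-trans(⊛-cancelˡ {L = pre} {pre} pre² e)(⊛-assoc x₀(w †)(σs ⊛ y))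
   step₂ : σs ⊛ y₀ ≋ (w †) ⊛ (σs ⊛ y)
   step₂ = ⊛-cancelˡ {L = x₀ †} {x₀} (†-inverseˡ {x₀} (isometry a)) step₁

  unsolve-y : ∀ {x₀ y₀ w y} → InQ w → y ≋ conj w ⊛ y₀ → D x₀ y₀ ≋ D(x₀ ⊛ (w †)) y
  unsolve-y {x₀} {y₀} {w} {y} b e = ⊛-congˡ pre(≋-sym(≋-trans(⊛-assoc x₀(w †)(σs ⊛ y))(⊛-congˡ x₀(≋-trans(⊛-congˡ(w †)(≋-trans(⊛-congˡ σs e)
   (≋-trans(⊛-congˡ σs(⊛-assoc σs(w ⊛ σs) y₀))(≋-trans(cancelˡ {L = σs} {σs} ((w ⊛ σs) ⊛ y₀) σσ)(⊛-assoc w σs y₀)))))(cancelˡ {L = w †} {w} (σs ⊛ y₀)(†-inverseˡ {w} (isometry b)))))))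

  _≈?ᴹ_ = FS._≈?_ (𝕄 d d)

  -- All x are written as x₀ w⁻¹ with w in Q. The equation for the product then forces y = σwσ y₀,
  -- which lies in Q exactly when σwσ does. So the fibre is indexed by Q ∩ σQσ.
  multiplicity : ∀ {x₀ y₀ M} → InQ x₀ → InQ y₀ → M ≋ D x₀ y₀ → ∑ᴽ(λ x → ∑ᴽ λ y → χ(M ≈?ᴹ D x y)) ≡ c
  multiplicity {x₀} {y₀} {M} a b e = begin
   _ ≡⟨ sym(∑ᴽ-left R-cong a) ⟩
   ∑ᴽ(λ w → R(x₀ ⊛ w)) ≡⟨ sym(∑ᴽ-† λ e → R-cong(⊛-congˡ x₀ e)) ⟩
   ∑ᴽ(λ w → R(x₀ ⊛ (w †))) ≡⟨ ∑ᴽ-cong(λ w wQ → ∑-cong(Mats d d)(λ y → cong(χ(InQ? y) *_)(χ-⇔(M ≈?ᴹ D(x₀ ⊛ (w †)) y)(y ≈?ᴹ(conj w ⊛ y₀))(λ e' → solve-y a wQ(≋-trans(≋-sym e) e')) λ e' → ≋-trans e(unsolve-y {x₀} wQ e')) ∙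
     Z.*-comm(χ(InQ? y)) _) ∙ ∑-sift(𝕄 d d)(conj w ⊛ y₀) {λ y → χ(InQ? y)} (λ {x} {y} e' → χ-⇔(InQ? x)(InQ? y)(InQ-cong e')(InQ-cong(≋-sym e'))) ∙
     χ-⇔(InQ?(conj w ⊛ y₀))(InQ?(conj w))(λ q → InQ-cong(≋-trans(⊛-assoc(conj w) y₀(y₀ †))(≋-trans(⊛-congˡ(conj w)(†-inverseʳ {y₀} (isometry b)))(⊛-identityʳ(conj w))))(InQ-⊛ q(InQ-† b))) λ q → InQ-⊛ q b) ⟩
   c ∎
   where
   R : Mat d d → ℤ
   R x = ∑ᴽ(λ y → χ(M ≈?ᴹ D x y))
   R-cong : FS.Cong(𝕄 d d) R
   R-cong {x} {x'} e = ∑ᴽ-cong(λ y _ → χ-⇔(M ≈?ᴹ D x y)(M ≈?ᴹ D x' y)(λ h → ≋-trans h(D-cong {x} {x'} {y} e λ _ _ → refl)) λ h → ≋-trans h(D-cong {x'} {x} {y} (≋-sym e) λ _ _ → refl))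

  -- The list is known only through its sums, so membership is tested by summing the indicator of x:
  -- outside Q the sum is zero.
  Qlist⊆Q : ∀ {x} → x ∈ Qlist → InQ x
  Qlist⊆Q {x} i with InQ? x
  ... | yes q = q
  ... | no ¬q = ⊥-elim(All.lookup(∑χ≡0⇒none(_≈?ᴹ x) Qlist(∑Q {λ y → χ(y ≈?ᴹ x)} (λ {y} {z} e → χ-⇔(y ≈?ᴹ x)(z ≈?ᴹ x)(≋-trans(≋-sym e))(≋-trans e)) ∙
   ∑-cong(Mats d d)(λ y → Z.*-comm(χ(InQ? y)) _ ∙ χ-guard(y ≈?ᴹ x) {y = 0ℤ} (λ e → χ-no(InQ? y) λ q → ¬q(InQ-cong e q)) ∙ Z.*-zeroʳ(χ(y ≈?ᴹ x))) ∙ ∑-zero(Mats d d))) i λ _ _ → refl)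

  inDC⁻ : ∀ {M} → T(inDC pre s M) → ∃[ x ] ∃[ y ] InQ x × InQ y × M ≋ D x y
  inDC⁻ {M} t = let (x , i , t₁) = find(any⁻ _ Qlist t) ; (y , j , t₂) = find(any⁻ _ Qlist t₁) in
   x , y , Qlist⊆Q i , Qlist⊆Q j , ≋-trans(eqM⁺ {M = M} t₂)(⊗≋D x y)

  inDC⁺ : ∀ {M x y} → x ∈ Qlist → y ∈ Qlist → M ≋ D x y → T(inDC pre s M)
  inDC⁺ {M} {x} {y} i j e = any⁺ _ (Any.map(λ { refl → any⁺ _ (Any.map(λ { refl → eqM⁻ {M = M} (≋-trans e(≋-sym(⊗≋D x y))) }) j) }) i)

  double-∑ : (F : Mat d d → Mat d d → ℤ) → (∀ {x x' y y'} → x ≋ x' → y ≋ y' → F x y ≡ F x' y') → ∑ Qlist(λ x → ∑ Qlist λ y → F x y) ≡ ∑ᴽ(λ x → ∑ᴽ λ y → F x y)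
  double-∑ F Fc = ∑Q(λ e → ∑-cong Qlist λ y → Fc {y = y} e λ _ _ → refl) ∙ ∑ᴽ-cong(λ x _ → ∑Q λ e → Fc {x} (λ _ _ → refl) e)

  fibre : ∀ M → ∑ Qlist(λ x → ∑ Qlist λ y → χ(M ≈?ᴹ D x y)) ≡ c * χ(T?(inDC pre s M))
  fibre M = go(T?(inDC pre s M))
   where
   go : (t : Dec(T(inDC pre s M))) → ∑ Qlist(λ x → ∑ Qlist λ y → χ(M ≈?ᴹ D x y)) ≡ c * χ t
   go(yes t) = let (x , y , a , b , e) = inDC⁻ t in double-∑ _ (λ {x} {x'} {y} {y'} e₁ e₂ → χ-⇔(M ≈?ᴹ D x y)(M ≈?ᴹ D x' y')(λ h → ≋-trans h(D-cong {x} {x'} {y} e₁ e₂)) λ h → ≋-trans h(D-cong {x'} {x} {y'} (≋-sym e₁)(≋-sym e₂))) ∙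
    multiplicity a b e ∙ sym(Z.*-identityʳ c)
   go(no ¬t) = ∑-cong∈ Qlist(λ x i → ∑-cong∈ Qlist(λ y j → χ-no(M ≈?ᴹ D x y) λ e → ¬t(inDC⁺ i j e)) ∙ ∑-zero Qlist) ∙ ∑-zero Qlist ∙ sym(Z.*-zeroʳ c)

  ∑-coset : {f : Mat d d → ℤ} → FS.Cong(𝕄 d d) f → c * ∑(filterᵇ(inDC pre s)(Mats d d)) f ≡ ∑ᴽ(λ x → ∑ᴽ λ y → f(D x y))
  ∑-coset {f} fc = begin
   _ ≡⟨ cong(c *_)(∑-filterᵇ(inDC pre s)(Mats d d) f) ∙ sym(∑-*ˡ(Mats d d) c _) ⟩
   ∑(Mats d d)(λ M → c * (χ(T?(inDC pre s M)) * f M)) ≡⟨ ∑-cong(Mats d d)(λ M → sym(Z.*-assoc c(χ(T?(inDC pre s M)))(f M)) ∙ cong(_* f M)(sym(fibre M)) ∙ sym(∑-*ʳ Qlist(f M) _) ∙ ∑-cong Qlist λ x → sym(∑-*ʳ Qlist(f M) _)) ⟩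
   ∑(Mats d d)(λ M → ∑ Qlist λ x → ∑ Qlist λ y → χ(M ≈?ᴹ D x y) * f M) ≡⟨ ∑-swap(Mats d d) Qlist _ ∙ ∑-cong Qlist(λ x → ∑-swap(Mats d d) Qlist _) ⟩
   ∑ Qlist(λ x → ∑ Qlist λ y → ∑(Mats d d) λ M → χ(M ≈?ᴹ D x y) * f M) ≡⟨ ∑-cong Qlist(λ x → ∑-cong Qlist λ y → ∑-sift(𝕄 d d)(D x y) fc) ⟩
   ∑ Qlist(λ x → ∑ Qlist λ y → f(D x y)) ≡⟨ double-∑(λ x y → f(D x y))(λ {x} {x'} {y} e e' → fc(D-cong {x} {x'} {y} e e')) ⟩
   _ ∎

  -- By cyclicity the trace of the product is that of σ pre (pre y pre) x, and pre y pre in Q is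
  -- absorbed into x. Nothing then depends on y, whence the factor |Q|. The constant φ = 1 gives the
  -- size of the coset, φ = λ(a ·) its character sum.
  ∑-coset-trace : (φ : Fq → ℤ) → c * ∑(filterᵇ(inDC pre s)(Mats d d))(λ g → φ(Tr g)) ≡ ∑ᴽ(λ _ → 1ℤ) * ∑ᴽ(λ w → φ(Trᵃ(σs ⊛ (pre ⊛ w))))
  ∑-coset-trace φ = begin
   _ ≡⟨ cong(c *_)(∑-cong(filterᵇ(inDC pre s)(Mats d d)) λ g → cong φ(Tr≡Trᵃ g)) ⟩
   c * ∑(filterᵇ(inDC pre s)(Mats d d))(λ g → φ(Trᵃ g)) ≡⟨ ∑-coset(λ e → cong φ(Trᵃ-cong e)) ⟩
   ∑ᴽ(λ x → ∑ᴽ λ y → φ(Trᵃ(D x y))) ≡⟨ ∑-cong(Mats d d)(λ x → sym(∑-*ˡ(Mats d d)(χ(InQ? x)) _)) ∙ ∑-swap(Mats d d)(Mats d d) _ ∙ ∑-cong(Mats d d)(λ y → ∑-cong(Mats d d)(λ x → *-swapˡ(χ(InQ? x))(χ(InQ? y)) _) ∙ ∑-*ˡ(Mats d d)(χ(InQ? y)) _) ⟩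
   ∑ᴽ(λ y → ∑ᴽ λ x → φ(Trᵃ(D x y))) ≡⟨ ∑ᴽ-cong(λ y yQ → ∑ᴽ-cong(λ x _ → cong φ(cyclic x y)) ∙ ∑ᴽ-left {λ w → φ(Trᵃ(σs ⊛ (pre ⊛ w)))} (λ e → cong φ(Trᵃ-cong(⊛-congˡ σs(⊛-congˡ pre e))))(normal yQ) ∙ sym(Z.*-identityˡ(∑ᴽ λ w → φ(Trᵃ(σs ⊛ (pre ⊛ w)))))) ⟩
   ∑ᴽ(λ y → 1ℤ * ∑ᴽ λ w → φ(Trᵃ(σs ⊛ (pre ⊛ w)))) ≡⟨ ∑ᴽ-*ʳ _ (λ _ → 1ℤ) ⟩
   _ ∎
   where
   cyclic : ∀ x y → Trᵃ(D x y) ≡ Trᵃ(σs ⊛ (pre ⊛ ((pre ⊛ (y ⊛ pre)) ⊛ x)))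
   cyclic x y = begin
    _ ≡⟨ Trᵃ-cong(≋-sym(⊛-assoc pre x(σs ⊛ y))) ⟩
    Trᵃ((pre ⊛ x) ⊛ (σs ⊛ y)) ≡⟨ Trᵃ-comm(pre ⊛ x)(σs ⊛ y) ∙ Trᵃ-cong(⊛-assoc σs y(pre ⊛ x)) ⟩
    Trᵃ(σs ⊛ (y ⊛ (pre ⊛ x))) ≡⟨ Trᵃ-cong(⊛-congˡ σs(≋-sym(≋-trans(⊛-congˡ pre(⊛-assoc pre(y ⊛ pre) x))(≋-trans(cancelˡ {L = pre} {pre} ((y ⊛ pre) ⊛ x) pre²)(⊛-assoc y pre x))))) ⟩
    _ ∎

 module Id = Coset idM(⊛-identityˡ idM)(λ {y} q → InQ-cong(≋-sym(≋-trans(⊛-identityˡ(y ⊛ idM))(⊛-identityʳ y))) q)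

 ρ₀ : Mat 2 2
 ρ₀ = mat2 1# 1# 0# 1#

 private
  module ρB = Nine idM zeroM zeroM zeroM idM zeroM zeroM zeroM ρ₀

 ρ⊛₁ : ∀ (M : Mat d d) k y → (ρ ⊛ M)(ι(p1 k)) y ≡ M(ι(p1 k)) y
 ρ⊛₁ M k y = ⨁-ι _ ∙ ⨁ₚ-cong(λ r → cong(_⊙ M(ι r) y)(ρB.block-ι(p1 k) r)) ∙ only1 {λ r → ρB.blk(p1 k) r ⊙ M(ι r) y} (λ _ → ⊙-0ˡ _)(λ _ → ⊙-0ˡ _) ∙ dot-idˡ k(λ l → M(ι(p1 l)) y)

 ρ⊛₂ : ∀ (M : Mat d d) k y → (ρ ⊛ M)(ι(p2 k)) y ≡ M(ι(p2 k)) y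
 ρ⊛₂ M k y = ⨁-ι _ ∙ ⨁ₚ-cong(λ r → cong(_⊙ M(ι r) y)(ρB.block-ι(p2 k) r)) ∙ only2 {λ r → ρB.blk(p2 k) r ⊙ M(ι r) y} (λ _ → ⊙-0ˡ _)(λ _ → ⊙-0ˡ _) ∙ dot-idˡ k(λ l → M(ι(p2 l)) y)

 ρ⊛₃ : ∀ (M : Mat d d) k y → (ρ ⊛ M)(ι(p3 k)) y ≡ ρ₀ k 0F ⊙ M(ι(p3 0F)) y ⊕ ρ₀ k 1F ⊙ M(ι(p3 1F)) y
 ρ⊛₃ M k y = ⨁-ι _ ∙ ⨁ₚ-cong(λ r → cong(_⊙ M(ι r) y)(ρB.block-ι(p3 k) r)) ∙ only3 {λ r → ρB.blk(p3 k) r ⊙ M(ι r) y} (λ _ → ⊙-0ˡ _)(λ _ → ⊙-0ˡ _) ∙ ⨁-2 _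

 ⊛ρ₁ : ∀ (M : Mat d d) x k → (M ⊛ ρ) x(ι(p1 k)) ≡ M x(ι(p1 k))
 ⊛ρ₁ M x k = ⨁-ι _ ∙ ⨁ₚ-cong(λ r → cong(M x(ι r) ⊙_)(ρB.block-ι r(p1 k))) ∙ only1 {λ r → M x(ι r) ⊙ ρB.blk r(p1 k)} (λ _ → ⊙-0ʳ _)(λ _ → ⊙-0ʳ _) ∙ dot-idʳ(λ l → M x(ι(p1 l))) k

 ⊛ρ₃ : ∀ (M : Mat d d) x k → (M ⊛ ρ) x(ι(p3 k)) ≡ M x(ι(p3 0F)) ⊙ ρ₀ 0F k ⊕ M x(ι(p3 1F)) ⊙ ρ₀ 1F k
 ⊛ρ₃ M x k = ⨁-ι _ ∙ ⨁ₚ-cong(λ r → cong(M x(ι r) ⊙_)(ρB.block-ι r(p3 k))) ∙ only3 {λ r → M x(ι r) ⊙ ρB.blk r(p3 k)} (λ _ → ⊙-0ʳ _)(λ _ → ⊙-0ʳ _) ∙ ⨁-2 _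

 private
  1⊕0 : ∀ x y → 1# ⊙ x ⊕ 1# ⊙ y ≡ x ⊕ y
  1⊕0 = solve 2(λ x y → con true :* x :+ con true :* y := x :+ y) refl
  0⊕1 : ∀ x y → 0# ⊙ x ⊕ 1# ⊙ y ≡ y
  0⊕1 = solve 2(λ x y → con false :* x :+ con true :* y := y) refl

 ρ² : ρ ⊛ ρ ≋ idM
 ρ² = ι-elim(λ x → ∀ y → (ρ ⊛ ρ) x y ≡ idM x y)(λ p y → row p y ∙ refl)
  where
  row : ∀ p y → (ρ ⊛ ρ)(ι p) y ≡ idM(ι p) y
  rowρ : ∀ p y → ρ(ι p) y ≡ (ρ ⊛ idM)(ι p) y
  rowρ p y = sym(⊛-identityʳ ρ(ι p) y)
  row(p1 k) y = ρ⊛₁ ρ k y ∙ rowρ(p1 k) y ∙ ρ⊛₁ idM k y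
  row(p2 k) y = ρ⊛₂ ρ k y ∙ rowρ(p2 k) y ∙ ρ⊛₂ idM k y
  row(p3 0F) y = ρ⊛₃ ρ 0F y ∙ 1⊕0 _ _ ∙ cong₂ _⊕_ (rowρ(p3 0F) y ∙ ρ⊛₃ idM 0F y ∙ 1⊕0 _ _)(rowρ(p3 1F) y ∙ ρ⊛₃ idM 1F y ∙ 0⊕1 _ _) ∙ ⊕-cancel _ _
  row(p3 1F) y = ρ⊛₃ ρ 1F y ∙ 0⊕1 _ _ ∙ rowρ(p3 1F) y ∙ ρ⊛₃ idM 1F y ∙ 0⊕1 _ _

 ρ-isometry : Isometry ρ
 ρ-isometry x = cong₂ _⊕_ (⨁-cong λ k → cong₂ _⊙_ (at₁ k)(at₂ k))(cong₂ θ₀(at₃ 0F ∙ 1⊕0 _ _)(at₃ 1F ∙ 0⊕1 _ _) ∙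
   solve 3(λ k x y → (x :+ y) :* (x :+ y) :+ (x :+ y) :* y :+ k :* y :* y := x :* x :+ x :* y :+ k :* y :* y) refl κ(x(ι(p3 0F)))(x(ι(p3 1F))))
  where
  X : Mat d d
  X i _ = x i
  at₁ : ∀ k → apply ρ x(ι(p1 k)) ≡ x(ι(p1 k))
  at₁ k = ρ⊛₁ X k(ι(p1 k))
  at₂ : ∀ k → apply ρ x(ι(p2 k)) ≡ x(ι(p2 k))
  at₂ k = ρ⊛₂ X k(ι(p2 k))
  at₃ : ∀ k → apply ρ x(ι(p3 k)) ≡ ρ₀ k 0F ⊙ x(ι(p3 0F)) ⊕ ρ₀ k 1F ⊙ x(ι(p3 1F))
  at₃ k = ρ⊛₃ X k(ι(p3 k))

 ρ-normal : ∀ {y} → InQ y → InQ(ρ ⊛ (y ⊛ ρ))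
 ρ-normal {y} q = record
  { z21 = λ i j → ρ⊛₂(y ⊛ ρ) i _ ∙ ⊛ρ₁ y _ j ∙ z21 q i j
  ; z31 = λ i j → ρ⊛₃(y ⊛ ρ) i _ ∙ cong₂ _⊕_ (⊙0(⊛ρ₁ y _ j ∙ z31 q 0F j))(⊙0(⊛ρ₁ y _ j ∙ z31 q 1F j)) ∙ ⊕-idˡ 0#
  ; z23 = λ i j → ρ⊛₂(y ⊛ ρ) i _ ∙ ⊛ρ₃ y _ j ∙ cong₂ _⊕_ (0⊙(z23 q i 0F))(0⊙(z23 q i 1F)) ∙ ⊕-idˡ 0#
  ; so01 = e 0F 1F ∙ cong₂(λ u v → 1# ⊙ (u₀ ⊙ 1# ⊕ u ⊙ 1#) ⊕ 1# ⊙ (u₁ ⊙ 1# ⊕ v ⊙ 1#))(so01 q)(so11 q) ∙ solve 3(λ k x y → con true :* (x :* con true :+ k :* y :* con true) :+ con true :* (y :* con true :+ (x :+ y) :* con true) := k :* (con false :* (x :* con true :+ k :* y :* con false) :+ con true :* (y :* con true :+ (x :+ y) :* con false))) refl κ u₀ u₁ ∙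
    cong(κ ⊙_)(sym(e 1F 0F ∙ cong₂(λ u v → 0# ⊙ (u₀ ⊙ 1# ⊕ u ⊙ 0#) ⊕ 1# ⊙ (u₁ ⊙ 1# ⊕ v ⊙ 0#))(so01 q)(so11 q)))
  ; so11 = e 1F 1F ∙ cong₂(λ u v → 0# ⊙ (u₀ ⊙ 1# ⊕ u ⊙ 1#) ⊕ 1# ⊙ (u₁ ⊙ 1# ⊕ v ⊙ 1#))(so01 q)(so11 q) ∙ solve 3(λ k x y → con false :* (x :* con true :+ k :* y :* con true) :+ con true :* (y :* con true :+ (x :+ y) :* con true)
     := (con true :* (x :* con true :+ k :* y :* con false) :+ con true :* (y :* con true :+ (x :+ y) :* con false)) :+ (con false :* (x :* con true :+ k :* y :* con false) :+ con true :* (y :* con true :+ (x :+ y) :* con false))) refl κ u₀ u₁ ∙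
    sym(cong₂ _⊕_ (e 0F 0F)(e 1F 0F) ∙ cong₂(λ u v → (1# ⊙ (u₀ ⊙ 1# ⊕ u ⊙ 0#) ⊕ 1# ⊙ (u₁ ⊙ 1# ⊕ v ⊙ 0#)) ⊕ (0# ⊙ (u₀ ⊙ 1# ⊕ u ⊙ 0#) ⊕ 1# ⊙ (u₁ ⊙ 1# ⊕ v ⊙ 0#)))(so01 q)(so11 q))
  ; isometry = Isometry-⊛ {ρ} {y ⊛ ρ} ρ-isometry(Isometry-⊛ {y} {ρ} (isometry q) ρ-isometry) }
  where
  u₀ = y(ι(p3 0F))(ι(p3 0F))
  u₁ = y(ι(p3 1F))(ι(p3 0F))
  e : ∀ i j → (ρ ⊛ (y ⊛ ρ))(ι(p3 i))(ι(p3 j)) ≡ ρ₀ i 0F ⊙ (y(ι(p3 0F))(ι(p3 0F)) ⊙ ρ₀ 0F j ⊕ y(ι(p3 0F))(ι(p3 1F)) ⊙ ρ₀ 1F j) ⊕ ρ₀ i 1F ⊙ (y(ι(p3 1F))(ι(p3 0F)) ⊙ ρ₀ 0F j ⊕ y(ι(p3 1F))(ι(p3 1F)) ⊙ ρ₀ 1F j)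
  e i j = ρ⊛₃(y ⊛ ρ) i _ ∙ cong₂(λ u v → ρ₀ i 0F ⊙ u ⊕ ρ₀ i 1F ⊙ v)(⊛ρ₃ y _ j)(⊛ρ₃ y _ j)

 module Rho = Coset ρ ρ² ρ-normal

 -- The contribution of the first 2m coordinates. For k < s the permutation moves the off-diagonal
 -- entry (AB)_kk and a zero onto the diagonal, and for the other k the entries of A and of its
 -- inverse stay there.
 Tσ : Mat m m → Mat m m → Mat m m → Fq
 Tσ A A' B = ⨁(λ k → if toℕ k ℕ.<ᵇ s then (A ⊛ B) k k else A k k ⊕ A' k k)

 module _ (A A' : Mat m m)(d₁ d₂ : Fq)(B : Mat m m)(h : Mat 2 m) where
  private
   g = QE A A'(so d₁ d₂) B h
   E = QE-ι A A'(so d₁ d₂) B h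

  trace-formula : ∀ pre (t₃ : Fq) → (∀ k y → (pre ⊛ g)(ι(p1 k)) y ≡ g(ι(p1 k)) y) → (∀ k y → (pre ⊛ g)(ι(p2 k)) y ≡ g(ι(p2 k)) y) →
   (pre ⊛ g)(ι(p3 0F))(ι(p3 0F)) ⊕ (pre ⊛ g)(ι(p3 1F))(ι(p3 1F)) ≡ t₃ → Trᵃ(σs ⊛ (pre ⊛ g)) ≡ t₃ ⊕ Tσ A A' B
  trace-formula pre t₃ e₁ e₂ e₃ = begin
   _ ≡⟨ ⨁-ι _ ∙ ⨁ₚ-cong(λ p → σ⊛(pre ⊛ g)(ι p)(ι p) ∙ cong(λ z → (pre ⊛ g) z(ι p))(π-ι p)) ⟩
   ⨁ₚ(λ p → (pre ⊛ g)(ι(π̂ p))(ι p)) ≡⟨ cong₂(λ u v → u ⊕ (v ⊕ ⨁ λ k → (pre ⊛ g)(ι(p3 k))(ι(p3 k))))(⨁-cong first)(⨁-cong second) ⟩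
   ⨁(λ k → if toℕ k ℕ.<ᵇ s then 0# else A k k) ⊕ (⨁(λ k → if toℕ k ℕ.<ᵇ s then (A ⊛ B) k k else A' k k) ⊕ ⨁ λ k → (pre ⊛ g)(ι(p3 k))(ι(p3 k))) ≡⟨ cong(λ z → _ ⊕ (_ ⊕ z))(⨁-2 _ ∙ e₃) ⟩
   ⨁(λ k → if toℕ k ℕ.<ᵇ s then 0# else A k k) ⊕ (⨁(λ k → if toℕ k ℕ.<ᵇ s then (A ⊛ B) k k else A' k k) ⊕ t₃) ≡⟨ sym(⊕-assoc _ _ t₃) ∙ ⊕-comm _ t₃ ∙ cong(t₃ ⊕_)(sym(⨁-⊕ _ _) ∙ ⨁-cong λ k → merge(toℕ k ℕ.<ᵇ s)(A k k)(A' k k)((A ⊛ B) k k)) ⟩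
   _ ∎
   where
   merge : ∀ b x y z → (if b then 0# else x) ⊕ (if b then z else y) ≡ (if b then z else x ⊕ y)
   merge true x y z = ⊕-idˡ z
   merge false x y z = refl
   first : ∀ k → (pre ⊛ g)(ι(π̂(p1 k)))(ι(p1 k)) ≡ (if toℕ k ℕ.<ᵇ s then 0# else A k k)
   first k with toℕ k ℕ.<ᵇ s
   ... | true = e₂ k _ ∙ E(p2 k)(p1 k)
   ... | false = e₁ k _ ∙ E(p1 k)(p1 k)
   second : ∀ k → (pre ⊛ g)(ι(π̂(p2 k)))(ι(p2 k)) ≡ (if toℕ k ℕ.<ᵇ s then (A ⊛ B) k k else A' k k)
   second k with toℕ k ℕ.<ᵇ s
   ... | true = e₁ k _ ∙ E(p1 k)(p2 k)
   ... | false = e₂ k _ ∙ E(p2 k)(p2 k)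

  trace-id : Trᵃ(σs ⊛ (idM ⊛ g)) ≡ 1# ⊙ d₂ ⊕ Tσ A A' B
  trace-id = trace-formula idM(1# ⊙ d₂)(λ k y → ⊛-identityˡ g _ y)(λ k y → ⊛-identityˡ g _ y)
   (cong₂ _⊕_ (⊛-identityˡ g _ _ ∙ E(p3 0F)(p3 0F))(⊛-identityˡ g _ _ ∙ E(p3 1F)(p3 1F)) ∙ solve 2(λ x y → x :+ (x :+ y) := con true :* y) refl d₁ d₂)

  -- The last block contributes d₁ + (d₁ + d₂) = d₂ without ρ, whereas multiplication by ρ makes the
  -- two diagonal entries equal and their sum zero. The coefficients 1 and 0 of d₂ are written out
  -- so that one formula covers both cases.
  trace-ρ : Trᵃ(σs ⊛ (ρ ⊛ g)) ≡ 0# ⊙ d₂ ⊕ Tσ A A' B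
  trace-ρ = trace-formula ρ(0# ⊙ d₂)(ρ⊛₁ g)(ρ⊛₂ g)
   (cong₂ _⊕_ (ρ⊛₃ g 0F _ ∙ cong₂(λ u v → 1# ⊙ u ⊕ 1# ⊙ v)(E(p3 0F)(p3 0F))(E(p3 1F)(p3 0F)))(ρ⊛₃ g 1F _ ∙ cong₂(λ u v → 0# ⊙ u ⊕ 1# ⊙ v)(E(p3 0F)(p3 1F))(E(p3 1F)(p3 1F))) ∙
    solve 3(λ k x y → (con true :* x :+ con true :* y) :+ (con false :* (k :* y) :+ con true :* (x :+ y)) := con false :* y) refl κ d₁ d₂)

-- The character sum over Q and the conditions for σwσ to lie in Q

module CosetSums (𝒟 : FieldData)(s t : ℕ) where
 open FieldArithmetic 𝒟
 open Characters 𝒟 using (θ₀)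
 open LinearAlgebra 𝒟
 open SymmetricSums 𝒟
 open GeneralLinear 𝒟
 open Blocked s t
 private
  m = s ∔ t
 open QGroup 𝒟(s ∔ t)
 open Cosets 𝒟(s ∔ t) s using (≋-sym; cancelˡ; ∑ᴽ; π̂; σs; conj; conj-ι; σ-isometry; c; Tσ)

 <ᵇ-↑ˡ : ∀ i → (toℕ(i ↑ˡ t) ℕ.<ᵇ s) ≡ true
 <ᵇ-↑ˡ i = Equivalence.to T-≡(N.<⇒<ᵇ(subst(_< s)(sym(FinP.toℕ-↑ˡ i t))(FinP.toℕ<n i)))

 <ᵇ-↑ʳ : (j : Fin t) → (toℕ(s ↑ʳ j) ℕ.<ᵇ s) ≡ false
 <ᵇ-↑ʳ j with toℕ(s ↑ʳ j) ℕ.<ᵇ s in eq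
 ... | false = refl
 ... | true = ⊥-elim(N.m+n≮m s(toℕ j)(subst(_< s)(FinP.toℕ-↑ʳ s j)(N.<ᵇ⇒<(toℕ(s ↑ʳ j)) s(Equivalence.from T-≡ eq))))

 ∑ᴽ-nested : {F : Mat d d → ℤ} → FS.Cong(𝕄 d d) F → ∑ᴽ F ≡
  ∑GL m(λ A A' → ∑ Fs λ d₁ → ∑ Fs λ d₂ → χ(θ₀ d₁ d₂ ≟ 1#) * ∑(Mats m m) λ B → ∑(Mats 2 m) λ h → χ(alt?(ᵗ B +M (ᵗ h ⊛ (δ ⊛ h)))) * F(QE A A'(so d₁ d₂) B h))
 ∑ᴽ-nested Fc = sym(∑Q Fc) ∙ ∑Q-nested Fc

 ∑GL-cong : ∀ {n} {f g : Mat n n → Mat n n → ℤ} → (∀ A A' → A ⊛ A' ≋ idM → f A A' ≡ g A A') → ∑GL n f ≡ ∑GL n g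
 ∑GL-cong {n} e = ∑-cong(Mats n n)(λ A → ∑-cong(Mats n n) λ A' → χ-guard(InvPair? A A') λ (p , _) → e A A' p)

 ∑GL-*ˡ : ∀ n k f → ∑GL n(λ A A' → k * f A A') ≡ k * ∑GL n f
 ∑GL-*ˡ n k f = ∑-cong(Mats n n)(λ A → ∑-cong(Mats n n)(λ A' → *-swapˡ(χ(InvPair? A A')) k(f A A')) ∙ ∑-*ˡ(Mats n n) k _) ∙ ∑-*ˡ(Mats n n) k _

 N : Mat 2 m → Mat m m
 N h = ᵗ h ⊛ (δ ⊛ h)

 N-entry : ∀ h i j → N h i j ≡ h 0F i ⊙ h 0F j ⊕ h 0F i ⊙ h 1F j ⊕ κ ⊙ (h 1F i ⊙ h 1F j)
 N-entry h i j = ⊛₂(ᵗ h)(δ ⊛ h) i j ∙ cong₂(λ u v → h 0F i ⊙ u ⊕ h 1F i ⊙ v)(⊛₂ δ h 0F j)(⊛₂ δ h 1F j) ∙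
  solve 5(λ k x y x' y' → x :* (con true :* x' :+ con true :* y') :+ y :* (con false :* x' :+ k :* y') := x :* x' :+ x :* y' :+ k :* (y :* y')) refl κ(h 0F i)(h 1F i)(h 0F j)(h 1F j)

 -- For fixed h the condition on B says that Z = ᵗB + ᵗh δ h is alternating, so ᵗB = Z + ᵗh δ h with
 -- Z free.
 ∑-alternating-shift : ∀ h {f : Mat m m → ℤ} → FS.Cong(𝕄 m m) f → ∑(Mats m m)(λ B → χ(alt?(ᵗ B +M N h)) * f(ᵗ B)) ≡ ∑(Mats m m)(λ Z → χ(alt? Z) * f(Z +M N h))
 ∑-alternating-shift h {f} fc = ∑-bij(𝕄 m m)(𝕄 m m)(λ B → alt?(ᵗ B +M N h)) alt?(λ B → ᵗ B +M N h)(λ Z → ᵗ(Z +M N h))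
  (λ {B} {Z} a e → Alternating-cong(≋-sym e) a , (λ i j → sym(⊕-cancel(B i j)(N h j i)) ∙ cong(_⊕ N h j i)(sym(e j i))) , fc λ i j → sym(⊕-cancel(B j i)(N h i j)) ∙ cong(_⊕ N h i j)(sym(e i j)))
  (λ {B} {Z} a e → Alternating-cong(λ i j → sym(⊕-cancel(Z i j)(N h i j)) ∙ cong(_⊕ N h i j)(sym(e j i))) a , λ i j → sym(⊕-cancel(Z i j)(N h i j)) ∙ cong(_⊕ N h i j)(sym(e j i)))

 ∑-restrict : {f : Vecᶠ s → ℤ} → FS.Cong(𝕍 s) f → ∑(enum(𝕍 m))(λ x → f λ i → x(i ↑ˡ t)) ≡ Q ^ t * ∑(enum(𝕍 s)) f
 ∑-restrict {f} fc = ∑-split 𝔽ˢ s t(λ e → fc λ i → e(i ↑ˡ t)) ∙ ∑-cong(enum(𝕍 s))(λ u → ∑-cong(enum(𝕍 t))(λ v → fc(lookup-++ˡ u v)) ∙ ∑𝕍-const t(f u)) ∙ ∑-*ˡ(enum(𝕍 s))(Q ^ t) f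

 ∑-2rows : {f : Mat 2 m → ℤ} → FS.Cong(𝕄 2 m) f → ∑(Mats 2 m) f ≡ ∑(enum(𝕍 m))(λ x → ∑(enum(𝕍 m)) λ y → f(x ∷ᶠ y ∷ᶠ λ ()))
 ∑-2rows {f} fc = ∑-Π-suc(𝕍 m) 1 fc ∙ ∑-cong(enum(𝕍 m))(λ x → ∑-Π-suc(𝕍 m) 0 {λ R → f(x ∷ᶠ R)} (λ e → fc λ { fz j → refl ; (fs i) → e i }) ∙
  ∑-cong(enum(𝕍 m)) λ y → Z.+-identityʳ(f(x ∷ᶠ (y ∷ᶠ _))) ∙ fc λ { fz j → refl ; (fs fz) j → refl ; (fs(fs())) })

 module TraceSum (a : Fq)(a≢0 : a ≢ 0#) where
  open GaussSum a a≢0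

  -- The first s rows of A, scaled by a. With them a times the sum of (AB)_kk over k < s is the
  -- pairing with ᵗB.
  Cᴬ : Mat m m → Mat m m
  Cᴬ A i j = if toℕ i ℕ.<ᵇ s then a ⊙ A i j else 0#

  Cᴬˡ : ∀ A i j → Cᴬ A(i ↑ˡ t) j ≡ a ⊙ A(i ↑ˡ t) j
  Cᴬˡ A i j = cong(λ b → if b then a ⊙ A(i ↑ˡ t) j else 0#)(<ᵇ-↑ˡ i)
  Cᴬʳ : ∀ A i j → Cᴬ A(s ↑ʳ i) j ≡ 0#
  Cᴬʳ A i j = cong(λ b → if b then a ⊙ A(s ↑ʳ i) j else 0#)(<ᵇ-↑ʳ i)

  tail-trace : Mat m m → Mat m m → Fq
  tail-trace A A' = a ⊙ (Trᵃ(b₂₂ A) ⊕ Trᵃ(b₂₂ A'))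

  Tσ-split : ∀ A A' B → a ⊙ Tσ A A' B ≡ ⟪ Cᴬ A , ᵗ B ⟫ ⊕ tail-trace A A'
  Tσ-split A A' B = begin
   _ ≡⟨ cong(a ⊙_)(⨁-split s _ ∙ cong₂ _⊕_ (⨁-cong λ i → cong(λ b → if b then (A ⊛ B)(i ↑ˡ t)(i ↑ˡ t) else A(i ↑ˡ t)(i ↑ˡ t) ⊕ A'(i ↑ˡ t)(i ↑ˡ t))(<ᵇ-↑ˡ i))(⨁-cong(λ j → cong(λ b → if b then (A ⊛ B)(s ↑ʳ j)(s ↑ʳ j) else A(s ↑ʳ j)(s ↑ʳ j) ⊕ A'(s ↑ʳ j)(s ↑ʳ j))(<ᵇ-↑ʳ j)) ∙ ⨁-⊕ _ _)) ⟩
   a ⊙ (⨁(λ i → (A ⊛ B)(i ↑ˡ t)(i ↑ˡ t)) ⊕ (Trᵃ(b₂₂ A) ⊕ Trᵃ(b₂₂ A'))) ≡⟨ ⊙-distribˡ a _ _ ⟩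
   a ⊙ ⨁(λ i → (A ⊛ B)(i ↑ˡ t)(i ↑ˡ t)) ⊕ tail-trace A A' ≡⟨ cong(_⊕ tail-trace A A')(sym(⨁-⊙ˡ a _) ∙ sym(⨁-split s _ ∙ cong₂ _⊕_ (⨁-cong λ i → dot-cong(Cᴬˡ A i)(λ _ → refl) ∙ dot-⊙ˡ a(A(i ↑ˡ t))(ᵗ B(i ↑ˡ t)))(⨁-zero λ j → dot-comm _ _ ∙ dot-zeroʳ _ (Cᴬʳ A j)) ∙ ⊕-idʳ _)) ⟩
   _ ∎

  symmetric⇒ : ∀ A → Symmetric(Cᴬ A) → b₁₂ A ≋ zeroM × Symmetric(b₁₁ A)
  symmetric⇒ A h = (λ i j → ⊙-nonzeroʳ a≢0(sym(Cᴬˡ A i _) ∙ h _ _ ∙ Cᴬʳ A j _)) , λ i j → ⊙-cancelˡ a≢0(sym(Cᴬˡ A i _) ∙ h _ _ ∙ Cᴬˡ A j _)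

  symmetric⇐ : ∀ A → b₁₂ A ≋ zeroM → Symmetric(b₁₁ A) → Symmetric(Cᴬ A)
  symmetric⇐ A z h = split-elim s(λ i → ∀ j → Cᴬ A i j ≡ Cᴬ A j i)
   (λ i → split-elim s _ (λ j → Cᴬˡ A i _ ∙ cong(a ⊙_)(h i j) ∙ sym(Cᴬˡ A j _)) λ j → Cᴬˡ A i _ ∙ ⊙0(z i j) ∙ sym(Cᴬʳ A j _))
   (λ i → split-elim s _ (λ j → Cᴬʳ A i _ ∙ sym(Cᴬˡ A j _ ∙ ⊙0(z j i))) λ j → Cᴬʳ A i _ ∙ sym(Cᴬʳ A j _))

  pair-N : ∀ A → b₁₂ A ≋ zeroM → ∀ x y → ⟪ Cᴬ A , N(x ∷ᶠ y ∷ᶠ λ ()) ⟫ ≡ a ⊙ Φ(b₁₁ A)(λ i → x(i ↑ˡ t))(λ i → y(i ↑ˡ t))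
  pair-N A z x y = begin
   _ ≡⟨ ⨁-split s _ ∙ cong₂ _⊕_ (⨁-cong λ i → dot-cong(Cᴬˡ A i)(λ _ → refl) ∙ dot-⊙ˡ a(A(i ↑ˡ t)) _)(⨁-zero λ j → dot-comm _ _ ∙ dot-zeroʳ _ (Cᴬʳ A j)) ∙ ⊕-idʳ _ ∙ ⨁-⊙ˡ a _ ⟩
   a ⊙ ⨁(λ i → dot(A(i ↑ˡ t))(N h(i ↑ˡ t))) ≡⟨ cong(a ⊙_)(⨁-cong row ∙ ⨁-⊕ _ _ ∙ cong₂ _⊕_ (⨁-⊕ _ _)(⨁-⊙ˡ κ _)) ⟩
   _ ∎
   where
   h : Mat 2 m
   h = x ∷ᶠ y ∷ᶠ (λ ())
   x' = λ i → x(i ↑ˡ t)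
   y' = λ i → y(i ↑ˡ t)
   row : ∀ i → dot(A(i ↑ˡ t))(N h(i ↑ˡ t)) ≡ x' i ⊙ apply(b₁₁ A) x' i ⊕ x' i ⊙ apply(b₁₁ A) y' i ⊕ κ ⊙ (y' i ⊙ apply(b₁₁ A) y' i)
   row i = begin
    _ ≡⟨ ⨁-split s _ ∙ cong₂ _⊕_ (dot-cong(λ _ → refl) λ j → N-entry h(i ↑ˡ t)(j ↑ˡ t))(dot-comm _ _ ∙ dot-zeroʳ _ (z i)) ∙ ⊕-idʳ _ ⟩
    dot(b₁₁ A i)(λ j → x' i ⊙ x' j ⊕ x' i ⊙ y' j ⊕ κ ⊙ (y' i ⊙ y' j)) ≡⟨ dot-⊕ʳ(b₁₁ A i) _ _ ∙ cong₂ _⊕_ (dot-⊕ʳ(b₁₁ A i) _ _ ∙ cong₂ _⊕_ (dot-⊙ʳ(x' i)(b₁₁ A i) x')(dot-⊙ʳ(x' i)(b₁₁ A i) y'))(dot-⊙ʳ κ(b₁₁ A i) _ ∙ cong(κ ⊙_)(dot-⊙ʳ(y' i)(b₁₁ A i) y')) ⟩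
    _ ∎

  -- The alternating part of B forces Cᴬ to be symmetric: the block b₁₂ of A vanishes and b₁₁ is
  -- symmetric. The shift by ᵗh δ h then leaves a quadratic exponential sum in h. It involves only
  -- the first s columns, so each of the two rows has t free entries.
  inner-∑ : ∀ A → ∑(Mats m m)(λ B → ∑(Mats 2 m) λ h → χ(alt?(ᵗ B +M N h)) * λ' ⟪ Cᴬ A , ᵗ B ⟫) ≡ Q ^ tri m * (Q ^ t * Q ^ t) * (χ(zero₁₂? A) * (χ(symmetric?(b₁₁ A)) * W(b₁₁ A)))
  inner-∑ A = begin
   _ ≡⟨ ∑-swap(Mats m m)(Mats 2 m) _ ∙ ∑-cong(Mats 2 m)(λ h → ∑-alternating-shift h {λ Z → λ' ⟪ Cᴬ A , Z ⟫} (λ e → cong λ'(⟪⟫-cong(λ _ _ → refl) e)) ∙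
     ∑-cong(Mats m m)(λ Z → cong(χ(alt? Z) *_)(cong λ'(⨁-cong(λ i → dot-⊕ʳ(Cᴬ A i)(Z i)(N h i)) ∙ ⨁-⊕ _ _) ∙ λ-⊕ _ _) ∙ sym(Z.*-assoc(χ(alt? Z)) _ _)) ∙ ∑-*ʳ(Mats m m)(λ' ⟪ Cᴬ A , N h ⟫) _ ∙ cong(_* λ' ⟪ Cᴬ A , N h ⟫)(∑-alternating(Cᴬ A))) ⟩
   ∑(Mats 2 m)(λ h → Q ^ tri m * χ(symmetric?(Cᴬ A)) * λ' ⟪ Cᴬ A , N h ⟫) ≡⟨ ∑-*ˡ(Mats 2 m)(Q ^ tri m * χ(symmetric?(Cᴬ A))) _ ∙ Z.*-assoc(Q ^ tri m) _ _ ⟩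
   Q ^ tri m * (χ(symmetric?(Cᴬ A)) * ∑(Mats 2 m) λ h → λ' ⟪ Cᴬ A , N h ⟫) ≡⟨ cong(Q ^ tri m *_)(χ-match(symmetric?(Cᴬ A))(zero₁₂? A ×-dec symmetric?(b₁₁ A))(λ h → let zs = symmetric⇒ A h in zs , hsum(proj₁ zs)) λ (z , h) → symmetric⇐ A z h) ⟩
   Q ^ tri m * (χ(zero₁₂? A ×-dec symmetric?(b₁₁ A)) * (Q ^ t * (Q ^ t * W(b₁₁ A)))) ≡⟨ cong(λ z → Q ^ tri m * (z * (Q ^ t * (Q ^ t * W(b₁₁ A)))))(χ-×(zero₁₂? A)(symmetric?(b₁₁ A))) ⟩
   Q ^ tri m * (χ(zero₁₂? A) * χ(symmetric?(b₁₁ A)) * (Q ^ t * (Q ^ t * W(b₁₁ A)))) ≡⟨ arrange(Q ^ tri m)(χ(zero₁₂? A))(χ(symmetric?(b₁₁ A)))(Q ^ t)(W(b₁₁ A)) ⟩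
   _ ∎
   where
   arrange : ∀ p z y u w → p * (z * y * (u * (u * w))) ≡ p * (u * u) * (z * (y * w))
   arrange = ring
   hsum : b₁₂ A ≋ zeroM → ∑(Mats 2 m)(λ h → λ' ⟪ Cᴬ A , N h ⟫) ≡ Q ^ t * (Q ^ t * W(b₁₁ A))
   hsum z = begin
    _ ≡⟨ ∑-2rows(λ {h} {h'} e → cong λ'(⟪⟫-cong(λ _ _ → refl)(⊛-cong {M = ᵗ h} {ᵗ h'} (λ i j → e j i)(⊛-congˡ δ e)))) ⟩
    ∑(enum(𝕍 m))(λ x → ∑(enum(𝕍 m)) λ y → λ' ⟪ Cᴬ A , N(x ∷ᶠ y ∷ᶠ λ ()) ⟫) ≡⟨ ∑-cong(enum(𝕍 m))(λ x → ∑-cong(enum(𝕍 m))(λ y → cong λ'(pair-N A z x y)) ∙ ∑-restrict {λ y → λ'(a ⊙ Φ S(λ i → x(i ↑ˡ t)) y)} λ e → cong(λ z → λ'(a ⊙ z))(Φ-cong {S = S} {S} (λ _ _ → refl)(λ _ → refl) e)) ⟩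
    ∑(enum(𝕍 m))(λ x → Q ^ t * ∑(enum(𝕍 s)) λ y → λ'(a ⊙ Φ S(λ i → x(i ↑ˡ t)) y)) ≡⟨ ∑-*ˡ(enum(𝕍 m))(Q ^ t) _ ∙ cong(Q ^ t *_)(∑-restrict {λ x → ∑(enum(𝕍 s))(λ y → λ'(a ⊙ Φ S x y))} λ e → ∑-cong(enum(𝕍 s)) λ y → cong(λ z → λ'(a ⊙ z))(Φ-cong {S = S} {S} (λ _ _ → refl) e λ _ → refl)) ⟩
    _ ∎
    where S = b₁₁ A

  SO-sum : Fq → ℤ
  SO-sum ε = ∑ Fs(λ d₁ → ∑ Fs λ d₂ → χ(θ₀ d₁ d₂ ≟ 1#) * λ'(a ⊙ (ε ⊙ d₂)))

  -- The variables separate: the block of SO⁻(2,q), then B and h for fixed A, and finally A, which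
  -- is block triangular with a symmetric leading block. That block carries the Gauss sum, the last
  -- one the Kloosterman sum over GL_t.
  ∑ᴽ-trace : ∀ ε (tr' : Mat d d → Fq) → (∀ {g k} → g ≋ k → tr' g ≡ tr' k) → (∀ A A' d₁ d₂ B h → tr'(QE A A'(so d₁ d₂) B h) ≡ ε ⊙ d₂ ⊕ Tσ A A' B) →
   ∑ᴽ(λ w → λ'(a ⊙ tr' w)) ≡ SO-sum ε * (Q ^ tri m * (Q ^ t * Q ^ t) * ((Q ^ s) ^ t * (G s * KGL a t)))
  ∑ᴽ-trace ε tr' trc formula = begin
   _ ≡⟨ ∑ᴽ-nested(λ e → cong(λ z → λ'(a ⊙ z))(trc e)) ⟩
   ∑GL m(λ A A' → ∑ Fs λ d₁ → ∑ Fs λ d₂ → χ(θ₀ d₁ d₂ ≟ 1#) * ∑(Mats m m) λ B → ∑(Mats 2 m) λ h → χ(alt?(ᵗ B +M N h)) * λ'(a ⊙ tr'(QE A A'(so d₁ d₂) B h))) ≡⟨ ∑GL-cong {m} (λ A A' _ → factor A A') ⟩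
   ∑GL m(λ A A' → P * (χ(zero₁₂? A) * (g(b₁₁ A) * h(b₂₂ A)(b₂₂ A')))) ≡⟨ ∑GL-*ˡ m P(λ A A' → χ(zero₁₂? A) * (g(b₁₁ A) * h(b₂₂ A)(b₂₂ A'))) ⟩
   P * ∑GL m(λ A A' → χ(zero₁₂? A) * (g(b₁₁ A) * h(b₂₂ A)(b₂₂ A'))) ≡⟨ cong(P *_)(∑-lower g h(λ {S} {S'} e → cong₂ _*_ (χ-⇔(symmetric? S)(symmetric? S')(Symmetric-cong e)(Symmetric-cong(≋-sym e)))(W-cong {S = S} {S'} e)) λ e e' → cong₂(λ u v → λ'(a ⊙ (u ⊕ v)))(Trᵃ-cong e)(Trᵃ-cong e')) ⟩
   P * ((Q ^ s) ^ t * (∑(Mats s s)(λ S → χ(nonsing? S) * g S) * KGL a t)) ≡⟨ cong(λ z → P * ((Q ^ s) ^ t * (z * KGL a t)))(∑-cong(Mats s s) λ S → *-swapˡ(χ(nonsing? S))(χ(symmetric? S))(W S)) ∙ Z.*-assoc(SO-sum ε) _ _ ⟩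
   _ ∎
   where
   P = SO-sum ε * (Q ^ tri m * (Q ^ t * Q ^ t))
   g : Mat s s → ℤ
   g S = χ(symmetric? S) * W S
   h : Mat t t → Mat t t → ℤ
   h U U' = λ'(a ⊙ (Trᵃ U ⊕ Trᵃ U'))
   arrange : ∀ x p z y u → x * (p * (z * y) * u) ≡ x * p * (z * (y * u))
   arrange = ring
   factor : ∀ A A' → ∑ Fs(λ d₁ → ∑ Fs λ d₂ → χ(θ₀ d₁ d₂ ≟ 1#) * ∑(Mats m m) λ B → ∑(Mats 2 m) λ h → χ(alt?(ᵗ B +M N h)) * λ'(a ⊙ tr'(QE A A'(so d₁ d₂) B h))) ≡ P * (χ(zero₁₂? A) * (g(b₁₁ A) * h(b₂₂ A)(b₂₂ A')))
   factor A A' = ∑-cong Fs(λ d₁ → ∑-cong Fs(λ d₂ → cong(χ(θ₀ d₁ d₂ ≟ 1#) *_)(∑-cong(Mats m m)(λ B → ∑-cong(Mats 2 m)(λ h → term d₁ d₂ B h) ∙ ∑-*ˡ(Mats 2 m)(λ'(a ⊙ (ε ⊙ d₂))) _) ∙ ∑-*ˡ(Mats m m)(λ'(a ⊙ (ε ⊙ d₂))) _) ∙ sym(Z.*-assoc(χ(θ₀ d₁ d₂ ≟ 1#)) _ _)) ∙ ∑-*ʳ Fs J _) ∙ ∑-*ʳ Fs J _ ∙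
     cong(SO-sum ε *_)(∑-cong(Mats m m)(λ B → ∑-*ʳ(Mats 2 m)(λ'(tail-trace A A')) _) ∙ ∑-*ʳ(Mats m m)(λ'(tail-trace A A')) _ ∙ cong(_* λ'(tail-trace A A'))(inner-∑ A)) ∙
      arrange(SO-sum ε)(Q ^ tri m * (Q ^ t * Q ^ t))(χ(zero₁₂? A))(g(b₁₁ A))(λ'(tail-trace A A'))
    where
    J = ∑(Mats m m)(λ B → ∑(Mats 2 m) λ h → χ(alt?(ᵗ B +M N h)) * λ' ⟪ Cᴬ A , ᵗ B ⟫ * λ'(tail-trace A A'))
    term : ∀ d₁ d₂ B h → χ(alt?(ᵗ B +M N h)) * λ'(a ⊙ tr'(QE A A'(so d₁ d₂) B h)) ≡ λ'(a ⊙ (ε ⊙ d₂)) * (χ(alt?(ᵗ B +M N h)) * λ' ⟪ Cᴬ A , ᵗ B ⟫ * λ'(tail-trace A A'))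
    term d₁ d₂ B h = cong(χ(alt?(ᵗ B +M N h)) *_)(cong λ'(cong(a ⊙_)(formula A A' d₁ d₂ B h) ∙ ⊙-distribˡ a _ _ ∙ cong(a ⊙ (ε ⊙ d₂) ⊕_)(Tσ-split A A' B)) ∙ λ-⊕ _ _ ∙ cong(λ'(a ⊙ (ε ⊙ d₂)) *_)(λ-⊕ _ _)) ∙
     *-swapˡ(χ(alt?(ᵗ B +M N h)))(λ'(a ⊙ (ε ⊙ d₂))) _ ∙ cong(λ'(a ⊙ (ε ⊙ d₂)) *_)(sym(Z.*-assoc(χ(alt?(ᵗ B +M N h))) _ _))

 module _ {A A' : Mat m m} {d₁ d₂ : Fq} {B : Mat m m} {h : Mat 2 m} where
  private
   g = QE A A'(so d₁ d₂) B h
   E : ∀ p q → conj g(ι p)(ι q) ≡ QB A A'(so d₁ d₂) B h(π̂ p)(π̂ q)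
   E p q = conj-ι g p q ∙ QE-ι A A'(so d₁ d₂) B h(π̂ p)(π̂ q)
   π1ˡ : ∀ i → π̂(p1(i ↑ˡ t)) ≡ p2(i ↑ˡ t)
   π1ˡ i = cong(λ b → if b then p2(i ↑ˡ t) else p1(i ↑ˡ t))(<ᵇ-↑ˡ i)
   π1ʳ : ∀ i → π̂(p1(s ↑ʳ i)) ≡ p1(s ↑ʳ i)
   π1ʳ i = cong(λ b → if b then p2(s ↑ʳ i) else p1(s ↑ʳ i))(<ᵇ-↑ʳ i)
   π2ˡ : ∀ i → π̂(p2(i ↑ˡ t)) ≡ p1(i ↑ˡ t)
   π2ˡ i = cong(λ b → if b then p1(i ↑ˡ t) else p2(i ↑ˡ t))(<ᵇ-↑ˡ i)
   π2ʳ : ∀ i → π̂(p2(s ↑ʳ i)) ≡ p2(s ↑ʳ i)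
   π2ʳ i = cong(λ b → if b then p1(s ↑ʳ i) else p2(s ↑ʳ i))(<ᵇ-↑ʳ i)
   E' : ∀ p q {p' q'} → π̂ p ≡ p' → π̂ q ≡ q' → conj g(ι p)(ι q) ≡ QB A A'(so d₁ d₂) B h p' q'
   E' p q refl refl = E p q

  -- Conjugation by σ moves b₁₂ of A, the first s columns of ih and the leading block of AB into
  -- positions where elements of Q vanish. Then i and the leading block of A are cancelled.
  conj∈Q⇒ : Cond A A' d₁ d₂ B h → InQ(conj g) → b₁₂ A ≋ zeroM × (∀ k i → h k(i ↑ˡ t) ≡ 0#) × b₁₁ B ≋ zeroM
  conj∈Q⇒((AA' , _) , norm , _) q = z , hz , λ i j → sym(cancelˡ {L = b₁₁ A'} {b₁₁ A} (b₁₁ B)(left⇒right SS') i j) ∙ dot-zeroʳ(b₁₁ A' i)(λ k →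
    sym(block-⊛ A B(k ↑ˡ t)(j ↑ˡ t) ∙ cong((b₁₁ A ⊛ b₁₁ B) k j ⊕_)(dot-comm _ _ ∙ dot-zeroʳ _ (z k)) ∙ ⊕-idʳ _) ∙ sym(E'(p2(k ↑ˡ t))(p1(j ↑ˡ t))(π2ˡ k)(π1ˡ j)) ∙ z21 q(k ↑ˡ t)(j ↑ˡ t))
   where
   z : b₁₂ A ≋ zeroM
   z i j = sym(E'(p2(i ↑ˡ t))(p1(s ↑ʳ j))(π2ˡ i)(π1ʳ j)) ∙ z21 q(i ↑ˡ t)(s ↑ʳ j)
   open Extract {A} {A'} AA' z
   hz : ∀ k i → h k(i ↑ˡ t) ≡ 0#
   hz k i = sym(cancelˡ {L = so(d₁ ⊕ d₂) d₂} {so d₁ d₂} h(so-inverseˡ norm) k(i ↑ˡ t)) ∙ dot-zeroʳ(so(d₁ ⊕ d₂) d₂ k)(λ l → sym(E'(p3 l)(p1(i ↑ˡ t)) refl(π1ˡ i)) ∙ z31 q l(i ↑ˡ t))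

  conj∈Q⇐ : Cond A A' d₁ d₂ B h → b₁₂ A ≋ zeroM → (∀ k i → h k(i ↑ˡ t) ≡ 0#) → b₁₁ B ≋ zeroM → InQ(conj g)
  conj∈Q⇐ c@((AA' , _) , norm , _) z hz Bz = record
   { z21 = split-elim s _ (λ i → split-elim s _
      (λ j → E'(p2(i ↑ˡ t))(p1(j ↑ˡ t))(π2ˡ i)(π1ˡ j) ∙ block-⊛ A B _ _ ∙ cong₂ _⊕_ (dot-zeroʳ _ λ k → Bz k j)(dot-comm _ _ ∙ dot-zeroʳ _ (z i)) ∙ ⊕-idˡ 0#)
      λ j → E'(p2(i ↑ˡ t))(p1(s ↑ʳ j))(π2ˡ i)(π1ʳ j) ∙ z i j)
     (λ i → split-elim s _ (λ j → E'(p2(s ↑ʳ i))(p1(j ↑ˡ t))(π2ʳ i)(π1ˡ j) ∙ z' j i) λ j → E'(p2(s ↑ʳ i))(p1(s ↑ʳ j))(π2ʳ i)(π1ʳ j))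
   ; z31 = λ k → split-elim s _ (λ j → E'(p3 k)(p1(j ↑ˡ t)) refl(π1ˡ j) ∙ dot-zeroʳ _ λ l → hz l j)(λ j → E'(p3 k)(p1(s ↑ʳ j)) refl(π1ʳ j))
   ; z23 = λ i k → split-elim s(λ i → conj g(ι(p2 i))(ι(p3 k)) ≡ 0#)(λ i → E'(p2(i ↑ˡ t))(p3 k)(π2ˡ i) refl ∙ ⨁-split s _ ∙ cong₂ _⊕_
     (⨁-zero λ l → ⊙0(dot-comm _ _ ∙ dot-zeroʳ _ λ n → hz n l))(⨁-zero λ l → 0⊙(z i l)) ∙ ⊕-idˡ 0#)(λ i → E'(p2(s ↑ʳ i))(p3 k)(π2ʳ i) refl) i
   ; so01 = E(p3 0F)(p3 1F) ∙ cong(κ ⊙_)(sym(E(p3 1F)(p3 0F)))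
   ; so11 = E(p3 1F)(p3 1F) ∙ sym(cong₂ _⊕_ (E(p3 0F)(p3 0F))(E(p3 1F)(p3 0F)))
   ; isometry = Isometry-⊛ {σs} {g ⊛ σs} σ-isometry(Isometry-⊛ {g} {σs} (isometry(QE∈Q c)) σ-isometry) }
   where open Extract {A} {A'} AA' z

 hz? : (h : Mat 2 m) → Dec(∀ k i → h k(i ↑ˡ t) ≡ 0#)
 hz? h = FinP.all? λ k → FinP.all? λ i → h k(i ↑ˡ t) ≟ 0#

 Bz? : (B : Mat m m) → Dec(b₁₁ B ≋ zeroM)
 Bz? B = FS._≈?_ (𝕄 s s)(b₁₁ B) zeroM

 ∑-prefix-zero : ∑(enum(𝕍 m))(λ x → χ(≈0? λ i → x(i ↑ˡ t))) ≡ Q ^ t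
 ∑-prefix-zero = ∑-restrict {λ u → χ(≈0? u)} (λ {u} {v} e → χ-⇔(≈0? u)(≈0? v)(λ z i → sym(e i) ∙ z i) λ z i → e i ∙ z i) ∙ cong(Q ^ t *_)(FS.∑-δ(𝕍 s) λ _ → 0#) ∙ Z.*-identityʳ _

 ∑-hz : ∑(Mats 2 m)(λ h → χ(hz? h)) ≡ Q ^ t * Q ^ t
 ∑-hz = ∑-2rows(λ {h} {h'} e → χ-⇔(hz? h)(hz? h')(λ z k i → sym(e k _) ∙ z k i) λ z k i → e k _ ∙ z k i) ∙ ∑-cong(enum(𝕍 m))(λ x → ∑-cong(enum(𝕍 m)) λ y →
   χ-⇔(hz?(x ∷ᶠ y ∷ᶠ λ ()))(≈0?(λ i → x(i ↑ˡ t)) ×-dec ≈0? λ i → y(i ↑ˡ t))(λ z → z 0F , z 1F)(λ { (p , q) 0F → p ; (p , q) 1F → q }) ∙ χ-×(≈0? λ i → x(i ↑ˡ t))(≈0? λ i → y(i ↑ˡ t))) ∙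
  ∑-*(enum(𝕍 m))(enum(𝕍 m)) _ _ ∙ cong₂ _*_ ∑-prefix-zero ∑-prefix-zero

-- The order of Q ∩ σQσ

module StabiliserOrder (𝒟 : FieldData) where
 open FieldArithmetic 𝒟
 open LinearAlgebra 𝒟
 open SymmetricSums 𝒟 using (gl)
 open GeneralLinear 𝒟 using (∑GL; module Blocked)

 Bz : ∀ s t → Mat(s ∔ t)(s ∔ t) → Set
 Bz s t M = Blocked.b₁₁ s t M ≋ zeroM

 Bz?' : ∀ s t M → Dec(Bz s t M)
 Bz?' s t M = FS._≈?_ (𝕄 s s)(Blocked.b₁₁ s t M) zeroM

 -- Each of the first s rows keeps t free entries, and the last block is any alternating matrix of
 -- size t. The base case is the character sum over alternating matrices with the zero coefficient
 -- matrix.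
 ∑-alternating-Bz : ∀ s t → ∑(Mats(s ∔ t)(s ∔ t))(λ Z → χ(alt? Z) * χ(Bz?' s t Z)) ≡ (Q ^ t) ^ s * Q ^ tri t
 ∑-alternating-Bz zero t = ∑-cong(Mats t t)(λ Z → cong(χ(alt? Z) *_)(sym(λ0≡1 {Z}))) ∙ ∑-alternating {t} zeroM ∙ cong(Q ^ tri t *_)(χ-yes(symmetric? {t} zeroM) λ _ _ → refl) ∙ Z.*-comm(Q ^ tri t) 1ℤ
  where
  λ0≡1 : ∀ {Z : Mat t t} → λ' ⟪ zeroM , Z ⟫ ≡ 1ℤ
  λ0≡1 {Z} = cong λ'(⨁-zero λ i → dot-comm zeroᵛ(Z i) ∙ dot-zeroʳ(Z i) λ _ → refl) ∙ λ-0
   where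
   zeroᵛ : Vecᶠ t
   zeroᵛ _ = 0#
 ∑-alternating-Bz(suc s) t = begin
  _ ≡⟨ ∑-border-alternating(λ {M} {P} e → χ-⇔(Bz?'(suc s) t M)(Bz?'(suc s) t P)(λ z i j → sym(e _ _) ∙ z i j) λ z i j → e _ _ ∙ z i j) ⟩
  ∑(enum(𝕍 m))(λ u → ∑(Mats m m) λ Z → χ(alt? Z) * χ(Bz?'(suc s) t(border 0# u u Z))) ≡⟨ ∑-cong(enum(𝕍 m))(λ u → ∑-cong(Mats m m) λ Z → cong(χ(alt? Z) *_)(χ-⇔(Bz?'(suc s) t(border 0# u u Z))(≈0?(λ i → u(i ↑ˡ t)) ×-dec Bz?' s t Z)(λ z → (λ i → z fz(fs i)) , λ i j → z(fs i)(fs j))(λ { (p , q) fz fz → refl ; (p , q) fz(fs j) → p j ; (p , q)(fs i) fz → p i ; (p , q)(fs i)(fs j) → q i j }) ∙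
   χ-×(≈0? λ i → u(i ↑ˡ t))(Bz?' s t Z)) ∙ *-swapˡ(χ(alt? Z))(χ(≈0? λ i → u(i ↑ˡ t))) _) ⟩
  ∑(enum(𝕍 m))(λ u → ∑(Mats m m) λ Z → χ(≈0? λ i → u(i ↑ˡ t)) * (χ(alt? Z) * χ(Bz?' s t Z))) ≡⟨ ∑-*(enum(𝕍 m))(Mats m m) _ _ ∙ cong₂ _*_ (CosetSums.∑-prefix-zero 𝒟 s t)(∑-alternating-Bz s t) ⟩
  Q ^ t * ((Q ^ t) ^ s * Q ^ tri t) ≡⟨ sym(Z.*-assoc(Q ^ t) _ _) ⟩
  _ ∎
  where m = s ∔ t

 module _ (s t : ℕ) where
  private
   m = s ∔ t
  open Characters 𝒟 using (K-0; θ₀; ∑SO)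
  open Blocked s t using (b₁₁; zero₁₂?; ∑-lower)
  open QGroup 𝒟 m using (InQ-cong; InQ?; so; QE)
  open Cosets 𝒟 m s using (≋-sym; σs; conj; c)
  open CosetSums 𝒟 s t using (∑ᴽ-nested; ∑GL-cong; ∑GL-*ˡ; N; ∑-alternating-shift; conj∈Q⇒; conj∈Q⇐; hz?; Bz?; ∑-hz)

  -- The factors count, in this order, SO⁻(2,q), the free columns of h, the alternating matrices
  -- with vanishing leading block, and the block triangular invertible matrices A.
  stabiliser : c ≡ (Q + 1ℤ) * ((Q ^ t * Q ^ t) * ((Q ^ t) ^ s * Q ^ tri t)) * ((Q ^ s) ^ t * (gl s * gl t))
  stabiliser = begin
   c ≡⟨ ∑ᴽ-nested(λ {M} {P} e → χ-⇔(InQ?(conj M))(InQ?(conj P))(InQ-cong(⊛-congˡ σs(⊛-congʳ σs e)))(InQ-cong(⊛-congˡ σs(⊛-congʳ σs(≋-sym e))))) ⟩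
   ∑GL m(λ A A' → ∑ Fs λ d₁ → ∑ Fs λ d₂ → χ(θ₀ d₁ d₂ ≟ 1#) * ∑(Mats m m) λ B → ∑(Mats 2 m) λ h → χ(alt?(ᵗ B +M N h)) * χ(InQ?(conj(QE A A'(so d₁ d₂) B h)))) ≡⟨ ∑GL-cong {m} factor ⟩
   ∑GL m(λ A A' → P * (χ(zero₁₂? A) * (1ℤ * 1ℤ))) ≡⟨ ∑GL-*ˡ m P(λ A A' → χ(zero₁₂? A) * (1ℤ * 1ℤ)) ∙ cong(P *_)(∑-lower(λ _ → 1ℤ)(λ _ _ → 1ℤ)(λ _ → refl)(λ _ _ → refl) ∙
     cong((Q ^ s) ^ t *_)(cong₂ _*_ (∑-cong(Mats s s) λ S → Z.*-identityʳ _)(∑GL-forget {t} {λ _ → 1ℤ} (λ _ → refl) ∙ ∑-cong(Mats t t) λ S → Z.*-identityʳ _))) ⟩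
   _ ∎
   where
   P = (Q + 1ℤ) * ((Q ^ t * Q ^ t) * ((Q ^ t) ^ s * Q ^ tri t))
   so-count : ∑ Fs(λ d₁ → ∑ Fs λ d₂ → χ(θ₀ d₁ d₂ ≟ 1#)) ≡ Q + 1ℤ
   so-count = ∑-cong Fs(λ x → ∑-cong Fs λ y → sym(cong(χ(θ₀ x y ≟ 1#) *_)(cong λ'(⊙-0ˡ y) ∙ λ-0) ∙ Z.*-identityʳ _)) ∙ ∑SO 0# ∙ cong₂(λ u v → Q * u - v)(χ-yes(0# ≟ 0#) refl) K-0 ∙ cong(_+ 1ℤ)(Z.*-identityʳ Q)
   bh-count : ∑(Mats m m)(λ B → ∑(Mats 2 m) λ h → χ(alt?(ᵗ B +M N h)) * (χ(hz? h) * χ(Bz? B))) ≡ (Q ^ t * Q ^ t) * ((Q ^ t) ^ s * Q ^ tri t)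
   bh-count = ∑-swap(Mats m m)(Mats 2 m) _ ∙ ∑-cong(Mats 2 m)(λ h → ∑-cong(Mats m m)(λ B → *-swapˡ(χ(alt?(ᵗ B +M N h)))(χ(hz? h)) _) ∙ ∑-*ˡ(Mats m m)(χ(hz? h)) _ ∙ χ-guard(hz? h) λ z → shifted h z) ∙
     ∑-*ʳ(Mats 2 m)((Q ^ t) ^ s * Q ^ tri t) _ ∙ cong(_* ((Q ^ t) ^ s * Q ^ tri t)) ∑-hz
    where
    shifted : ∀ h → (∀ k i → h k(i ↑ˡ t) ≡ 0#) → ∑(Mats m m)(λ B → χ(alt?(ᵗ B +M N h)) * χ(Bz? B)) ≡ (Q ^ t) ^ s * Q ^ tri t
    shifted h z = ∑-cong(Mats m m)(λ B → cong(χ(alt?(ᵗ B +M N h)) *_)(χ-⇔(Bz? B)(Bz?' s t(ᵗ B))(λ e i j → e j i) λ e i j → e j i)) ∙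
     ∑-alternating-shift h {λ Z → χ(Bz?' s t Z)} (λ {M} {P} e → χ-⇔(Bz?' s t M)(Bz?' s t P)(λ z i j → sym(e _ _) ∙ z i j) λ z i j → e _ _ ∙ z i j) ∙
     ∑-cong(Mats m m)(λ Z → cong(χ(alt? Z) *_)(χ-⇔(Bz?' s t(Z +M N h))(Bz?' s t Z)(λ e i j → sym(cong(Z _ _ ⊕_)(N0 i j) ∙ ⊕-idʳ _) ∙ e i j) λ e i j → cong(Z _ _ ⊕_)(N0 i j) ∙ ⊕-idʳ _ ∙ e i j)) ∙ ∑-alternating-Bz s t
     where
     N0 : ∀ i j → N h(i ↑ˡ t)(j ↑ˡ t) ≡ 0#
     N0 i j = dot-zeroʳ(λ k → h k(i ↑ˡ t))(λ k → dot-zeroʳ(δ k) λ l → z l j)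
   factor : ∀ A A' → A ⊛ A' ≋ idM → ∑ Fs(λ d₁ → ∑ Fs λ d₂ → χ(θ₀ d₁ d₂ ≟ 1#) * ∑(Mats m m) λ B → ∑(Mats 2 m) λ h → χ(alt?(ᵗ B +M N h)) * χ(InQ?(conj(QE A A'(so d₁ d₂) B h)))) ≡ P * (χ(zero₁₂? A) * (1ℤ * 1ℤ))
   factor A A' AA' = ∑-cong Fs(λ d₁ → ∑-cong Fs(λ d₂ → χ-guard(θ₀ d₁ d₂ ≟ 1#) λ norm → ∑-cong(Mats m m)(λ B → ∑-cong(Mats 2 m)(λ h → χ-guard(alt?(ᵗ B +M N h)) λ alt → let cd = (AA' , left⇒right AA') , norm , alt in
      χ-⇔(InQ? _)(zero₁₂? A ×-dec(hz? h ×-dec Bz? B))(conj∈Q⇒ cd)(λ (x , y , z) → conj∈Q⇐ cd x y z) ∙ χ-×(zero₁₂? A)(hz? h ×-dec Bz? B) ∙ cong(χ(zero₁₂? A) *_)(χ-×(hz? h)(Bz? B))) ∙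
     ∑-cong(Mats 2 m)(λ h → *-swapˡ(χ(alt?(ᵗ B +M N h)))(χ(zero₁₂? A)) _) ∙ ∑-*ˡ(Mats 2 m)(χ(zero₁₂? A)) _) ∙ ∑-*ˡ(Mats m m)(χ(zero₁₂? A)) _ ∙ cong(χ(zero₁₂? A) *_) bh-count) ∙ ∑-*ʳ Fs U _) ∙
    ∑-*ʳ Fs U _ ∙ cong(_* U) so-count ∙ arrange(Q + 1ℤ)(χ(zero₁₂? A))((Q ^ t * Q ^ t) * ((Q ^ t) ^ s * Q ^ tri t))
    where
    U = χ(zero₁₂? A) * ((Q ^ t * Q ^ t) * ((Q ^ t) ^ s * Q ^ tri t))
    arrange : ∀ x z y → x * (z * y) ≡ x * y * (z * (1ℤ * 1ℤ))
    arrange = ring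

-- Finite differences, Stirling numbers and binomial coefficients

open import Data.Nat.Combinatorics using (_C_; nCk+nC[k+1]≡[n+1]C[k+1]; k>n⇒nCk≡0; nCn≡1)

∑-upTo-last : ∀ n (f : ℕ → ℤ) → ∑(upTo(suc n)) f ≡ ∑(upTo n) f + f n
∑-upTo-last n f = cong(λ l → ∑ l f)(sym(ListP.upTo-∷ʳ n)) ∙ ∑-++(upTo n)(n ∷ []) f ∙ cong(ℤ._+_ (∑(upTo n) f))(Z.+-identityʳ(f n))

-- Abstract for the same reason as ⨁.
abstract
 Σ< : ℕ → (ℕ → ℤ) → ℤ
 Σ< n f = ∑(upTo n) f

 Σ<≡ : ∀ n f → ∑(upTo n) f ≡ Σ< n f
 Σ<≡ n f = refl

 Σ<-first : ∀ n f → Σ<(suc n) f ≡ f 0 + Σ< n(f ∘ suc)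
 Σ<-first n f = cong(λ l → f 0 + sumℤ l)(ListP.map-applyUpTo suc f n ∙ sym(ListP.map-applyUpTo id(f ∘ suc) n))

 Σ<-last : ∀ n f → Σ<(suc n) f ≡ Σ< n f + f n
 Σ<-last n f = ∑-upTo-last n f

 Σ<-cong : ∀ n {f g : ℕ → ℤ} → (∀ k → f k ≡ g k) → Σ< n f ≡ Σ< n g
 Σ<-cong n = ∑-cong(upTo n)

 Σ<-+ : ∀ n f g → Σ< n(λ k → f k + g k) ≡ Σ< n f + Σ< n g
 Σ<-+ n = ∑-+(upTo n)

 Σ<-*ˡ : ∀ n c f → Σ< n(λ k → c * f k) ≡ c * Σ< n f
 Σ<-*ˡ n = ∑-*ˡ(upTo n)

 Σ<-neg : ∀ n f → Σ< n(λ k → - f k) ≡ - Σ< n f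
 Σ<-neg n = ∑-neg(upTo n)

 Σ<-zero : ∀ n → Σ< n(λ _ → 0ℤ) ≡ 0ℤ
 Σ<-zero n = ∑-zero(upTo n)

 Σ<-swap : ∀ m n (f : ℕ → ℕ → ℤ) → Σ< m(λ x → Σ< n(f x)) ≡ Σ< n(λ y → Σ< m λ x → f x y)
 Σ<-swap m n = ∑-swap(upTo m)(upTo n)

 ∑Σ<-swap : (xs : List 𝑋)(n : ℕ)(f : 𝑋 → ℕ → ℤ) → ∑ xs(λ x → Σ< n(f x)) ≡ Σ< n(λ y → ∑ xs λ x → f x y)
 ∑Σ<-swap xs n = ∑-swap xs(upTo n)

 Σ<-[] : ∀ f → Σ< 0 f ≡ 0ℤ
 Σ<-[] f = refl

Σ<-1 : ∀ f → Σ< 1 f ≡ f 0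
Σ<-1 f = Σ<-first 0 f ∙ cong(ℤ._+_ (f 0))(Σ<-[] _) ∙ Z.+-identityʳ(f 0)

Σ<-cong< : ∀ n {f g : ℕ → ℤ} → (∀ k → k < n → f k ≡ g k) → Σ< n f ≡ Σ< n g
Σ<-cong< zero {f} {g} e = Σ<-[] f ∙ sym(Σ<-[] g)
Σ<-cong<(suc n) {f} {g} e = Σ<-last n f ∙ cong₂ _+_ (Σ<-cong< n λ k l → e k(N.m<n⇒m<1+n l))(e n N.≤-refl) ∙ sym(Σ<-last n g)

Σ<-extend : ∀ {m} n {f : ℕ → ℤ} → m ≤ n → (∀ k → m ≤ k → k < n → f k ≡ 0ℤ) → Σ< n f ≡ Σ< m f
Σ<-extend zero z≤n z = refl
Σ<-extend {m} (suc n) {f} le z with N.m≤n⇒m<n∨m≡n le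
... | inj₂ refl = refl
... | inj₁(s≤s l) = Σ<-last n f ∙ cong₂ _+_ (Σ<-extend n l λ k a b → z k a(N.m<n⇒m<1+n b))(z n l N.≤-refl) ∙ Z.+-identityʳ(Σ< m f)

pos-C-suc : ∀ n k → pos(suc n C suc k) ≡ pos(n C k) + pos(n C suc k)
pos-C-suc n k = cong pos(sym(nCk+nC[k+1]≡[n+1]C[k+1] n k))

pascal-sum : ∀ h (w : ℕ → ℤ) → Σ<(suc(suc h))(λ l → pos(suc h C l) * w l) ≡ Σ<(suc h)(λ l → pos(h C l) * w l) + Σ<(suc h)(λ l → pos(h C l) * w(suc l))
pascal-sum h w = begin
 _ ≡⟨ Σ<-first(suc h) _ ⟩
 1ℤ * w 0 + Σ<(suc h)(λ i → pos(suc h C suc i) * w(suc i)) ≡⟨ cong(ℤ._+_ (1ℤ * w 0))(Σ<-cong(suc h)(λ i → cong(_* w(suc i))(pos-C-suc h i) ∙ Z.*-distribʳ-+(w(suc i))(pos(h C i))(pos(h C suc i))) ∙ Σ<-+(suc h) _ _) ⟩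
 1ℤ * w 0 + (A + Σ<(suc h) λ i → pos(h C suc i) * w(suc i)) ≡⟨ cong(λ z → 1ℤ * w 0 + (A + z))(Σ<-last h _ ∙ cong(λ z → B + pos z * w(suc h))(k>n⇒nCk≡0(N.n<1+n h)) ∙ cong(ℤ._+_ B)(Z.*-zeroˡ(w(suc h)))) ⟩
 1ℤ * w 0 + (A + (B + 0ℤ)) ≡⟨ arrange(1ℤ * w 0) A B ⟩
 1ℤ * w 0 + B + A ≡⟨ cong(_+ A)(sym(Σ<-first h _)) ⟩
 _ ∎
 where
 A = Σ<(suc h)(λ l → pos(h C l) * w(suc l))
 B = Σ< h(λ i → pos(h C suc i) * w(suc i))
 arrange : ∀ a b c → a + (b + (c + 0ℤ)) ≡ a + c + b
 arrange = ring

binomial : ∀ h x y → (x + y) ^ h ≡ Σ<(suc h)(λ l → pos(h C l) * (x ^ l * y ^ (h ∸ l)))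
binomial zero x y = sym(Σ<-1 _)
binomial(suc h) x y = sym(pascal-sum h _ ∙ cong₂ _+_
  (Σ<-cong<(suc h) {g = λ l → y * (pos(h C l) * (x ^ l * y ^ (h ∸ l)))} (λ l lt → cong(λ z → pos(h C l) * (x ^ l * y ^ z))(N.+-∸-assoc 1(N.≤-pred lt)) ∙ arr(pos(h C l))(x ^ l) y(y ^ (h ∸ l))) ∙ Σ<-*ˡ(suc h) y _)
  (Σ<-cong(suc h)(λ l → arr'(pos(h C l)) x(x ^ l)(y ^ (h ∸ l))) ∙ Σ<-*ˡ(suc h) x _) ∙
 sym(Z.*-distribʳ-+ E y x) ∙ cong₂ _*_ (Z.+-comm y x)(sym(binomial h x y)))
 where
 E = Σ<(suc h)(λ l → pos(h C l) * (x ^ l * y ^ (h ∸ l)))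
 arr : ∀ c u y v → c * (u * (y * v)) ≡ y * (c * (u * v))
 arr = ring
 arr' : ∀ c x u v → c * (x * u * v) ≡ x * (c * (u * v))
 arr' = ring

Δ : ℕ → (ℕ → ℤ) → ℕ → ℤ
Δ zero f x = f x
Δ(suc t) f x = Δ t f(suc x) - Δ t f x

Δ-sum : ∀ t f x → Σ<(suc t)(λ j → pos(t C j) * (-1ℤ ^ (t ∸ j) * f(x ∔ j))) ≡ Δ t f x
Δ-sum zero f x = Σ<-1 _ ∙ one(f(x ∔ 0)) ∙ cong f(N.+-identityʳ x)
 where
 one : ∀ z → 1ℤ * (1ℤ * z) ≡ z
 one = ring
Δ-sum(suc t) f x = pascal-sum t _ ∙ Z.+-comm(Σ<(suc t) λ j → pos(t C j) * (-1ℤ ^ (suc t ∸ j) * f(x ∔ j))) _ ∙ cong₂ _+_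
 (Σ<-cong(suc t)(λ j → cong(λ z → pos(t C j) * (-1ℤ ^ (t ∸ j) * f z))(N.+-suc x j)) ∙ Δ-sum t f(suc x))
 (Σ<-cong<(suc t) {g = λ j → - (pos(t C j) * (-1ℤ ^ (t ∸ j) * f(x ∔ j)))} (λ j l → cong(λ z → pos(t C j) * (-1ℤ ^ z * f(x ∔ j)))(N.+-∸-assoc 1(N.≤-pred l)) ∙ neg(pos(t C j))(-1ℤ ^ (t ∸ j))(f(x ∔ j))) ∙ Σ<-neg(suc t) _ ∙ cong -_ (Δ-sum t f x))
 where
 neg : ∀ a b c → a * (-1ℤ * b * c) ≡ - (a * (b * c))
 neg = ring

Δ-leibniz : ∀ t f x → Δ(suc t)(λ x → pos x * f x) x ≡ pos x * Δ(suc t) f x + pos(suc t) * Δ t f(suc x)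
Δ-leibniz zero f x = base(pos x)(f x)(f(suc x))
 where
 base : ∀ x u v → (1ℤ + x) * v - x * u ≡ x * (v - u) + 1ℤ * v
 base = ring
Δ-leibniz(suc t) f x = cong₂ _-_ (Δ-leibniz t f(suc x))(Δ-leibniz t f x) ∙ step(pos x)(pos t)(Δ t f(suc x))(Δ t f x)(Δ t f(suc(suc x)))
 where
 step : ∀ x t u v w → ((1ℤ + x) * (w - u) + (1ℤ + t) * w) - (x * (u - v) + (1ℤ + t) * u) ≡ x * ((w - u) - (u - v)) + (1ℤ + (1ℤ + t)) * (w - u)
 step = ring

Δ-cong : ∀ t {f g} → (∀ x → f x ≡ g x) → ∀ x → Δ t f x ≡ Δ t g x
Δ-cong zero e x = e x
Δ-cong(suc t) e x = cong₂ _-_ (Δ-cong t e(suc x))(Δ-cong t e x)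

Δ-const : ∀ t x → Δ(suc t)(λ _ → 1ℤ) x ≡ 0ℤ
Δ-const zero x = refl
Δ-const(suc t) x = cong₂ _-_ (Δ-const t(suc x))(Δ-const t x)

-- The number of surjections from a set of h elements onto one of t elements, that is t! S(h,t). The
-- recursion avoids division.
surjections : ℕ → ℕ → ℕ
surjections zero zero = 1
surjections zero(suc t) = 0
surjections(suc h) zero = 0
surjections(suc h)(suc t) = suc t · (surjections h(suc t) ∔ surjections h t)

Δ-power : ∀ h t → Δ t(λ x → pos(x ** h)) 0 ≡ pos(surjections h t)
Δ-power zero zero = refl
Δ-power zero(suc t) = Δ-const t 0
Δ-power(suc h) zero = refl
Δ-power(suc h)(suc t) = begin
 _ ≡⟨ Δ-cong(suc t)(λ x → Z.pos-* x(x ** h)) 0 ∙ Δ-leibniz t(λ x → pos(x ** h)) 0 ⟩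
 0ℤ * Δ(suc t)(λ x → pos(x ** h)) 0 + pos(suc t) * Δ t(λ x → pos(x ** h)) 1 ≡⟨ rearrange(pos(suc t))(Δ t(λ x → pos(x ** h)) 1)(Δ t(λ x → pos(x ** h)) 0) ⟩
 pos(suc t) * (Δ(suc t)(λ x → pos(x ** h)) 0 + Δ t(λ x → pos(x ** h)) 0) ≡⟨ cong(pos(suc t) *_)(cong₂ _+_ (Δ-power h(suc t))(Δ-power h t)) ⟩
 pos(suc t) * pos(surjections h(suc t) ∔ surjections h t) ≡⟨ sym(Z.pos-*(suc t) _) ⟩
 _ ∎
 where
 rearrange : ∀ t u v → 0ℤ * (u - v) + t * u ≡ t * (u - v + v)
 rearrange = ring

!∣surjections : ∀ h t → t ! ∣ surjections h t
!∣surjections zero zero = divides 1 refl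
!∣surjections zero(suc t) = divides 0 refl
!∣surjections(suc h) zero = divides 0 refl
!∣surjections(suc h)(suc t) = *-monoʳ-∣(suc t)(∣m∣n⇒∣m+n(∣-trans(n∣m*n(suc t))(!∣surjections h(suc t)))(!∣surjections h t))

divℤ-exact : ∀ d n → d ∣ n → .{{ℕ.NonZero d}} → pos d * divℤ(pos n) d ≡ pos n
divℤ-exact(suc k) n d∣n = cong(pos(suc k) *_)(div-pos-is-/ℕ(pos n)(suc k)) ∙ sym(Z.pos-*(suc k)(n ℕ./ suc k)) ∙ cong pos(m*[n/m]≡n d∣n)

-- The alternating sum in `stirling2` is the t-th difference of x^h at 0, which obeys the recursion
-- of the surjection numbers by the product rule. Since t! divides these numbers, the integer
-- division is exact.
!*stirling2 : ∀ h t → pos(t !) * stirling2 h t ≡ pos(surjections h t)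
!*stirling2 h t = cong(λ z → pos(t !) * divℤ z(t !))(Σ<≡(suc t) _ ∙ Σ<-cong(suc t)(λ j → arr(-1ℤ ^ (t ∸ j))(pos(t C j))(pos(j ** h))) ∙ Δ-sum t(λ x → pos(x ** h)) 0 ∙ Δ-power h t) ∙
 divℤ-exact(t !)(surjections h t)(!∣surjections h t) {{N._!≢0 t}}
 where
 arr : ∀ a b c → a * b * c ≡ b * (a * c)
 arr = ring

surjections-small : ∀ h t → h < t → surjections h t ≡ 0
surjections-small zero(suc t) _ = refl
surjections-small(suc h)(suc t)(s≤s l) = cong(suc t ·_)(cong₂ _∔_ (surjections-small h(suc t)(N.m<n⇒m<1+n l))(surjections-small h t l)) ∙ N.*-zeroʳ(suc t)

C-absorb : ∀ c t → pos c * pos(c C t) ≡ pos t * pos(c C t) + pos(suc t) * pos(c C suc t)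
C-absorb zero zero = refl
C-absorb zero(suc t) = sym(cong₂(λ x y → pos(suc t) * pos x + pos(suc(suc t)) * pos y)(k>n⇒nCk≡0 {0} {suc t} (s≤s z≤n))(k>n⇒nCk≡0 {0} {suc(suc t)} (s≤s z≤n)) ∙ zeros(pos(suc t))(pos(suc(suc t))))
 where
 zeros : ∀ a b → a * 0ℤ + b * 0ℤ ≡ 0ℤ
 zeros = ring
C-absorb(suc c) zero = lemma(pos c)(pos(c C 1))(C-absorb c 0) ∙ cong(λ z → 0ℤ + 1ℤ * z)(sym(pos-C-suc c 0))
 where
 lemma : ∀ c x → c * 1ℤ ≡ 0ℤ * 1ℤ + 1ℤ * x → (1ℤ + c) * 1ℤ ≡ 0ℤ + 1ℤ * (1ℤ + x)
 lemma c x e = l1 c ∙ cong(ℤ._+_ 1ℤ) e ∙ l2 x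
  where
  l1 : ∀ c → (1ℤ + c) * 1ℤ ≡ 1ℤ + c * 1ℤ
  l1 = ring
  l2 : ∀ x → 1ℤ + (0ℤ * 1ℤ + 1ℤ * x) ≡ 0ℤ + 1ℤ * (1ℤ + x)
  l2 = ring
C-absorb(suc c)(suc t) = cong(pos(suc c) *_)(pos-C-suc c t) ∙ l1(pos c) x y ∙ cong₂(λ u v → u + v + (x + y))(C-absorb c t)(C-absorb c(suc t)) ∙ l2(pos t) x y z ∙
  sym(cong₂(λ u v → pos(suc t) * u + pos(suc(suc t)) * v)(pos-C-suc c t)(pos-C-suc c(suc t)))
 where
 x = pos(c C t)
 y = pos(c C suc t)
 z = pos(c C suc(suc t))
 l1 : ∀ c x y → (1ℤ + c) * (x + y) ≡ c * x + c * y + (x + y)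
 l1 = ring
 l2 : ∀ t x y z → t * x + (1ℤ + t) * y + ((1ℤ + t) * y + (1ℤ + (1ℤ + t)) * z) + (x + y) ≡ (1ℤ + t) * (x + y) + (1ℤ + (1ℤ + t)) * (y + z)
 l2 = ring

-- Maps from h points to c points, sorted by the size t of their image. The induction multiplies by
-- c and absorbs it into the binomial coefficients. The upper limit M ≥ h leaves room for the shift
-- of t.
power-as-binomials : ∀ c h M → h ≤ M → pos(c ** h) ≡ Σ<(suc M)(λ t → pos(surjections h t) * pos(c C t))
power-as-binomials c zero M _ = sym(Σ<-first M _ ∙ cong(ℤ._+_ (1ℤ * 1ℤ))(Σ<-cong M(λ t → Z.*-zeroˡ(pos(c C suc t))) ∙ Σ<-zero M) ∙ refl)
power-as-binomials c(suc h) M h<M = begin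
 _ ≡⟨ Z.pos-* c(c ** h) ∙ cong(pos c *_)(power-as-binomials c h M(N.<⇒≤ h<M)) ∙ sym(Σ<-*ˡ(suc M)(pos c) _) ⟩
 Σ<(suc M)(λ t → pos c * (y t * b t)) ≡⟨ Σ<-cong(suc M)(λ t → *-swapˡ(pos c)(y t)(b t) ∙ cong(y t *_)(C-absorb c t) ∙ l(y t)(pos t)(b t)(pos(suc t))(b(suc t))) ∙ Σ<-+(suc M) _ _ ⟩
 Σ<(suc M)(λ t → pos t * y t * b t) + Σ<(suc M)(λ t → pos(suc t) * y t * b(suc t)) ≡⟨ cong₂ _+_ {y = S₁} {v = S₂} (Σ<-first M _ ∙ cong(_+ S₁)(z(y 0)(b 0)) ∙ Z.+-identityˡ S₁)
  (Σ<-last M _ ∙ cong(λ u → S₂ + pos(suc M) * u * b(suc M))(cong pos(surjections-small h M h<M)) ∙ z' S₂(pos(suc M))(b(suc M))) ⟩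
 S₁ + S₂ ≡⟨ sym(Σ<-+ M _ _) ∙ Σ<-cong M(λ t → l'(pos(suc t))(y(suc t))(y t)(b(suc t)) ∙ cong(_* b(suc t))(sym(Z.pos-*(suc t)(surjections h(suc t) ∔ surjections h t)))) ⟩
 Σ< M(λ t → pos(surjections(suc h)(suc t)) * b(suc t)) ≡⟨ sym(Σ<-first M _ ∙ cong(_+ Σ< M λ t → pos(surjections(suc h)(suc t)) * b(suc t))(Z.*-zeroˡ(b 0)) ∙ Z.+-identityˡ _) ⟩
 _ ∎
 where
 y = λ t → pos(surjections h t)
 b = λ t → pos(c C t)
 S₁ = Σ< M(λ t → pos(suc t) * y(suc t) * b(suc t))
 S₂ = Σ< M(λ t → pos(suc t) * y t * b(suc t))
 l : ∀ y t b s d → y * (t * b + s * d) ≡ t * y * b + s * y * d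
 l = ring
 l' : ∀ s u v d → s * u * d + s * v * d ≡ s * (u + v) * d
 l' = ring
 z : ∀ u v → 0ℤ * u * v ≡ 0ℤ
 z = ring
 z' : ∀ a u v → a + u * 0ℤ * v ≡ a
 z' = ring

-- γ u N t is the binomial coefficient (u choose N − t), read as 0 for t > N.
γ : ℕ → ℕ → ℕ → ℕ
γ u N zero = u C N
γ u zero(suc t) = 0
γ u(suc N)(suc t) = γ u N t

γ-pascal : ∀ u N t → pos(γ(suc u) N t) ≡ pos(γ u N(suc t)) + pos(γ u N t)
γ-pascal u zero zero = refl
γ-pascal u zero(suc t) = refl
γ-pascal u(suc N) zero = pos-C-suc u N
γ-pascal u(suc N)(suc t) = γ-pascal u N t

γ-zero : ∀ u N t → u ∔ t < N → γ u N t ≡ 0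
γ-zero u N zero l = k>n⇒nCk≡0(subst(_< N)(N.+-identityʳ u) l)
γ-zero u zero(suc t) _ = refl
γ-zero u(suc N)(suc t)(s≤s l) = γ-zero u N t(subst(_≤ N)(N.+-suc u t) l)

γ-binℤ : ∀ N j t → j ≤ N → binℤ(pos N - pos j)(pos N - pos t) ≡ pos(γ(N ∸ j) N t)
γ-binℤ N j t le = cong₂ binℤ(Z.[+m]-[+n]≡m⊖n N j ∙ Z.⊖-≥ le)(Z.[+m]-[+n]≡m⊖n N t) ∙ go(N ∸ j) N t
 where
 go : ∀ u N t → binℤ(pos u)(N ℤ.⊖ t) ≡ pos(γ u N t)
 go u N zero = refl
 go u zero(suc t) = refl
 go u(suc N)(suc t) = cong(binℤ(pos u))(Z.[1+m]⊖[1+n]≡m⊖n N t) ∙ go u N t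

^-* : ∀ x y n → (x * y) ^ n ≡ x ^ n * y ^ n
^-* x y zero = refl
^-* x y(suc n) = cong(x * y *_)(^-* x y n) ∙ i x y(x ^ n)(y ^ n)
 where
 i : ∀ a b c d → a * b * (c * d) ≡ a * c * (b * d)
 i = ring
pos-^ : ∀ a n → pos(a ** n) ≡ pos a ^ n
pos-^ a zero = refl
pos-^ a(suc n) = Z.pos-* a(a ** n) ∙ cong(pos a *_)(pos-^ a n)

-- The code as a dual and the Pless power moments

module Code (𝒟 : FieldData) {𝐴 : Set} (f : 𝐴 → FiniteField.Carrier(FieldData.𝔽 𝒟)) where
 open FieldArithmetic 𝒟
 open Characters 𝒟 using (∑λ-⊙)

 ΣL : List 𝐴 → Fq
 ΣL S = sumF(map f S)

 abstract
  -- A sum over all words of a function of their weight and their syndrome. It is abstract, so that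
  -- only its recursion along the list is used.
  Sub : List 𝐴 → (ℕ → Fq → ℤ) → ℤ
  Sub L g = ∑(subseqs L)(λ S → g(length S)(ΣL S))

  Sub≡ : ∀ L g → ∑(subseqs L)(λ S → g(length S)(ΣL S)) ≡ Sub L g
  Sub≡ L g = refl

  Sub-[] : ∀ g → Sub [] g ≡ g 0 0#
  Sub-[] g = Z.+-identityʳ(g 0 0#)

  Sub-∷ : ∀ x L g → Sub(x ∷ L) g ≡ Sub L g + Sub L(λ k σ → g(suc k)(f x ⊕ σ))
  Sub-∷ x L g = ∑-++(subseqs L)(map(x ∷_)(subseqs L)) _ ∙ cong(ℤ._+_ (Sub L g))(∑-map(x ∷_)(subseqs L) _)

  Sub-+ : ∀ L g h → Sub L(λ k σ → g k σ + h k σ) ≡ Sub L g + Sub L h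
  Sub-+ L g h = ∑-+(subseqs L) _ _

  Sub-*ˡ : ∀ L c g → Sub L(λ k σ → c * g k σ) ≡ c * Sub L g
  Sub-*ˡ L c g = ∑-*ˡ(subseqs L) c _

  Sub-zero : ∀ L → Sub L(λ _ _ → 0ℤ) ≡ 0ℤ
  Sub-zero L = ∑-zero(subseqs L)

  ∑Sub-swap : (xs : List 𝑋)(L : List 𝐴)(g : 𝑋 → ℕ → Fq → ℤ) → ∑ xs(λ x → Sub L(g x)) ≡ Sub L(λ k σ → ∑ xs λ x → g x k σ)
  ∑Sub-swap xs L g = ∑-swap xs(subseqs L) _

  SubΣ<-swap : ∀ L n (g : ℕ → ℕ → Fq → ℤ) → Sub L(λ k σ → Σ< n λ j → g j k σ) ≡ Σ< n(λ j → Sub L(g j))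
  SubΣ<-swap L n g = ∑Σ<-swap(subseqs L) n _

 Sub-cong : ∀ L {g h : ℕ → Fq → ℤ} → (∀ k σ → k ≤ length L → g k σ ≡ h k σ) → Sub L g ≡ Sub L h
 Sub-cong [] {g} {h} e = Sub-[] g ∙ e 0 0# z≤n ∙ sym(Sub-[] h)
 Sub-cong(x ∷ L) {g} {h} e = Sub-∷ x L g ∙ cong₂ _+_ (Sub-cong L λ k σ l → e k σ(N.m≤n⇒m≤1+n l))(Sub-cong L λ k σ l → e(suc k)(f x ⊕ σ)(s≤s l)) ∙ sym(Sub-∷ x L h)

 module _ (a : Fq) where
  -- The weight of the word of the dual trace code that belongs to a.
  wt : List 𝐴 → ℕ
  wt [] = 0
  wt(x ∷ L) = if tr(a ⊙ f x) == 0# then wt L else suc(wt L)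

  ∑λ≡N-2wt : ∀ L → ∑ L(λ x → λ'(a ⊙ f x)) ≡ pos(length L) - pos 2 * pos(wt L)
  ∑λ≡N-2wt [] = refl
  ∑λ≡N-2wt(x ∷ L) with tr(a ⊙ f x) == 0#
  ... | true = cong(ℤ._+_ 1ℤ)(∑λ≡N-2wt L) ∙ l(pos(length L))(pos(wt L))
   where
   l : ∀ n w → 1ℤ + (n - pos 2 * w) ≡ 1ℤ + n - pos 2 * w
   l = ring
  ... | false = cong(ℤ._+_ -1ℤ)(∑λ≡N-2wt L) ∙ l(pos(length L))(pos(wt L))
   where
   l : ∀ n w → -1ℤ + (n - pos 2 * w) ≡ 1ℤ + n - pos 2 * (1ℤ + w)
   l = ring

  pless-term : ℕ → ℕ → ℕ → Fq → ℤ
  pless-term N t k σ = λ'(a ⊙ σ) * (-1ℤ ^ k * pos(γ(N ∸ k) N t))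

  -- Comparing coefficients of y^t in (1 + y)^N P(−y/(1+y)) = (1 + 2y)^wt, where P(T) = (1 − T)^wt (1 + T)^(N − wt).
  pless : ∀ L t → Sub L(pless-term(length L) t) ≡ pos(2 ** t) * pos(wt L C t)
  pless [] t = Sub-[](pless-term 0 t) ∙ cong(λ z → z * (1ℤ * pos(γ 0 0 t)))(cong λ'(⊙-0ʳ a) ∙ λ-0) ∙ base t
   where
   base : ∀ t → 1ℤ * (1ℤ * pos(γ 0 0 t)) ≡ pos(2 ** t) * pos(0 C t)
   base zero = refl
   base(suc t) = sym(cong(λ z → pos(2 ** suc t) * pos z)(k>n⇒nCk≡0 {0} {suc t} (s≤s z≤n)) ∙ Z.*-zeroʳ(pos(2 ** suc t)))
  pless(x ∷ L) zero = Sub-∷ x L _ ∙ cong₂ _+_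
    (Sub-cong L(λ k σ l → cong(λ z → λ'(a ⊙ σ) * (-1ℤ ^ k * z))(cong(λ z → pos(z C suc N))(N.+-∸-assoc 1 l) ∙ pos-C-suc(N ∸ k) N ∙ cong(λ z → pos((N ∸ k) C N) + pos z)(k>n⇒nCk≡0(s≤s(N.m∸n≤m N k))) ∙ Z.+-identityʳ _)) ∙ pless L zero)
    (Sub-cong L {h = λ _ _ → 0ℤ} (λ k σ l → cong(λ z → λ'(a ⊙ (f x ⊕ σ)) * (-1ℤ ^ suc k * pos z))(k>n⇒nCk≡0(s≤s(N.m∸n≤m N k))) ∙ zz(λ'(a ⊙ (f x ⊕ σ)))(-1ℤ ^ suc k)) ∙ Sub-zero L) ∙ refl
   where
   N = length L
   zz : ∀ u v → u * (v * 0ℤ) ≡ 0ℤ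
   zz = ring
  pless(x ∷ L)(suc t) = begin
   _ ≡⟨ Sub-∷ x L _ ⟩
   Sub L(pless-term(suc N)(suc t)) + Sub L(λ k σ → pless-term(suc N)(suc t)(suc k)(f x ⊕ σ)) ≡⟨ cong₂ _+_
    (Sub-cong L(λ k σ l → cong(λ z → λ'(a ⊙ σ) * (-1ℤ ^ k * z))(cong(λ z → pos(γ z N t))(N.+-∸-assoc 1 l) ∙ γ-pascal(N ∸ k) N t) ∙ l₁(λ'(a ⊙ σ))(-1ℤ ^ k)(pos(γ(N ∸ k) N(suc t)))(pos(γ(N ∸ k) N t))) ∙ Sub-+ L _ _)
    (Sub-cong L(λ k σ _ → cong(_* (-1ℤ ^ suc k * pos(γ(N ∸ k) N t)))(cong λ'(⊙-distribˡ a(f x) σ) ∙ λ-⊕ _ _) ∙ l₂(λ'(a ⊙ f x))(λ'(a ⊙ σ))(-1ℤ ^ k)(pos(γ(N ∸ k) N t))) ∙ Sub-*ˡ L(- λ'(a ⊙ f x)) _) ⟩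
   Sub L(pless-term N(suc t)) + Sub L(pless-term N t) + - λ'(a ⊙ f x) * Sub L(pless-term N t) ≡⟨ cong₂(λ u v → u + v + - λ'(a ⊙ f x) * v)(pless L(suc t))(pless L t) ⟩
   pos(2 ** suc t) * pos(wt L C suc t) + pos(2 ** t) * pos(wt L C t) + - λ'(a ⊙ f x) * (pos(2 ** t) * pos(wt L C t)) ≡⟨ finish ⟩
   _ ∎
   where
   N = length L
   l₁ : ∀ u v x y → u * (v * (x + y)) ≡ u * (v * x) + u * (v * y)
   l₁ = ring
   l₂ : ∀ p u v x → p * u * (-1ℤ * v * x) ≡ - p * (u * (v * x))
   l₂ = ring
   f₁ : ∀ p x y → p + x * y + - 1ℤ * (x * y) ≡ p
   f₁ = ring
   f₂ : ∀ p x y → pos 2 * p * x + p * y + - -1ℤ * (p * y) ≡ pos 2 * p * (y + x)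
   f₂ = ring
   finish : pos(2 ** suc t) * pos(wt L C suc t) + pos(2 ** t) * pos(wt L C t) + - λ'(a ⊙ f x) * (pos(2 ** t) * pos(wt L C t)) ≡ pos(2 ** suc t) * pos(wt(x ∷ L) C suc t)
   finish with tr(a ⊙ f x) == 0#
   ... | true = f₁(pos(2 ** suc t) * pos(wt L C suc t))(pos(2 ** t))(pos(wt L C t))
   ... | false = cong(λ z → z * pos(wt L C suc t) + pos(2 ** t) * pos(wt L C t) + - -1ℤ * (pos(2 ** t) * pos(wt L C t)))(Z.pos-* 2(2 ** t)) ∙
    f₂(pos(2 ** t))(pos(wt L C suc t))(pos(wt L C t)) ∙ cong₂ _*_ (sym(Z.pos-* 2(2 ** t)))(sym(pos-C-suc(wt L) t))

 Cwt : List 𝐴 → ℕ → ℕ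
 Cwt L j = count(λ S → (length S ==ℕ j) ∧ (sumF(map f S) == 0#))(subseqs L)

 pos-count : {𝐵 : Set} (p : 𝐵 → Bool)(xs : List 𝐵) → pos(count p xs) ≡ ∑ xs(λ x → χ(T?(p x)))
 pos-count p xs = sym(∑-length(filterᵇ p xs)) ∙ ∑-filterᵇ p xs _ ∙ ∑-cong xs(λ x → Z.*-identityʳ _)

 pos-Cwt : ∀ L j → pos(Cwt L j) ≡ Sub L(λ k σ → χ(k ℕ.≟ j) * χ(σ ≟ 0#))
 pos-Cwt L j = pos-count _ (subseqs L) ∙ ∑-cong(subseqs L)(λ S → χ-⇔(T? _)((length S ℕ.≟ j) ×-dec(ΣL S ≟ 0#))
  (λ t → let (u , v) = Equivalence.to T-∧ t in toWitness u , ==⇒≡ v)(λ (u , v) → Equivalence.from T-∧(fromWitness u , ≡⇒== v)) ∙ χ-×(length S ℕ.≟ j)(ΣL S ≟ 0#)) ∙ Sub≡ L _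

 Sub-by-length : ∀ L (g : ℕ → ℤ) → Sub L(λ k σ → χ(σ ≟ 0#) * g k) ≡ Σ<(suc(length L))(λ j → pos(Cwt L j) * g j)
 Sub-by-length L g = begin
  _ ≡⟨ Sub-cong L(λ k σ l → cong(χ(σ ≟ 0#) *_)(sym(pick k(suc(length L))(s≤s l))) ∙ sym(Σ<-*ˡ(suc(length L))(χ(σ ≟ 0#)) _) ∙ Σ<-cong(suc(length L)) λ j → arr(χ(σ ≟ 0#))(χ(k ℕ.≟ j))(g j)) ⟩
  Sub L(λ k σ → Σ<(suc(length L)) λ j → χ(k ℕ.≟ j) * χ(σ ≟ 0#) * g j) ≡⟨ SubΣ<-swap L(suc(length L))(λ j k σ → χ(k ℕ.≟ j) * χ(σ ≟ 0#) * g j) ∙ Σ<-cong(suc(length L))(λ j → Sub-cong L(λ k σ _ → Z.*-comm _ (g j)) ∙ Sub-*ˡ L(g j) _ ∙ cong(g j *_)(sym(pos-Cwt L j)) ∙ Z.*-comm(g j) _) ⟩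
  _ ∎
  where
  arr : ∀ s k g → s * (k * g) ≡ k * s * g
  arr = ring
  pick : ∀ k n → k < n → Σ< n(λ j → χ(k ℕ.≟ j) * g j) ≡ g k
  pick k(suc n) l with N.m≤n⇒m<n∨m≡n l
  ... | inj₂ refl = Σ<-last n _ ∙ cong₂ _+_ (Σ<-cong< n {g = λ _ → 0ℤ} (λ j j<n → cong(_* g j)(χ-no(n ℕ.≟ j)(N.<⇒≢ j<n ∘ sym))) ∙ Σ<-zero n)(cong(_* g n)(χ-yes(n ℕ.≟ n) refl)) ∙ Z.+-identityˡ _ ∙ Z.*-identityˡ(g n)
  ... | inj₁(s≤s l') = Σ<-last n _ ∙ cong₂ _+_ (pick k n l')(cong(_* g n)(χ-no(k ℕ.≟ n)(N.<⇒≢ l'))) ∙ Z.+-identityʳ _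

 -- N - S(a) is twice the weight belonging to a. Its power is expanded in binomial coefficients,
 -- each of these is a signed character sum over all words, and summation over a keeps the words
 -- with syndrome zero, the codewords.
 pless-moment : ∀ L h → let N = length L in ∑ Fs(λ a → (pos N - ∑ L λ x → λ'(a ⊙ f x)) ^ h) ≡
  Q * sumRangeℤ 0(N ⊓ h)(λ j → (-1ℤ ^ j) * pos(Cwt L j) * sumRangeℤ j h λ t → pos(t !) * stirling2 h t * pos(2 ** (h ∸ t)) * binℤ(pos N - pos j)(pos N - pos t))
 pless-moment L h = begin
  _ ≡⟨ ∑-cong Fs(λ a → expand a) ⟩
  ∑ Fs(λ a → Σ<(suc h) λ t → w t * Sub L(pless-term a N t)) ≡⟨ ∑Σ<-swap Fs(suc h) _ ∙ Σ<-cong(suc h)(λ t → ∑-*ˡ Fs(w t) _ ∙ cong(w t *_)(orth t)) ⟩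
  Σ<(suc h)(λ t → w t * (Q * Σ<(suc N) λ j → pos(Cwt L j) * (-1ℤ ^ j * pos(γ(N ∸ j) N t)))) ≡⟨ Σ<-cong(suc h)(λ t → *-swapˡ(w t) Q _ ∙ cong(Q *_)(sym(Σ<-*ˡ(suc N)(w t) _))) ∙ Σ<-*ˡ(suc h) Q _ ∙ cong(Q *_)(Σ<-swap(suc h)(suc N) _) ⟩
  Q * Σ<(suc N)(λ j → Σ<(suc h) λ t → w t * (pos(Cwt L j) * (-1ℤ ^ j * pos(γ(N ∸ j) N t)))) ≡⟨ cong(Q *_)(Σ<-cong<(suc N)(λ j l → inner j(N.≤-pred l)) ∙ Σ<-extend(suc N)(s≤s(N.m⊓n≤m N h))(λ j a b → beyond j a(N.≤-pred b)) ∙ sym(Σ<≡(suc(N ⊓ h)) _)) ⟩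
  _ ∎
  where
  N = length L
  w : ℕ → ℤ
  w t = pos(surjections h t) * pos(2 ** (h ∸ t))
  Rt : ℕ → ℕ → ℤ
  Rt j t = pos(t !) * stirling2 h t * pos(2 ** (h ∸ t)) * binℤ(pos N - pos j)(pos N - pos t)
  R : ℕ → ℤ
  R j = sumRangeℤ j h(Rt j)
  expand : ∀ a → (pos N - ∑ L λ x → λ'(a ⊙ f x)) ^ h ≡ Σ<(suc h)(λ t → w t * Sub L(pless-term a N t))
  expand a = begin
   _ ≡⟨ cong(_^ h)(cong(λ z → pos N - z)(∑λ≡N-2wt a L) ∙ c(pos N)(pos(wt a L))) ⟩
   (pos 2 * pos(wt a L)) ^ h ≡⟨ ^-* (pos 2)(pos(wt a L)) h ∙ cong₂ _*_ (sym(pos-^ 2 h))(sym(pos-^(wt a L) h) ∙ power-as-binomials(wt a L) h h N.≤-refl) ⟩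
   pos(2 ** h) * Σ<(suc h)(λ t → pos(surjections h t) * pos(wt a L C t)) ≡⟨ sym(Σ<-*ˡ(suc h)(pos(2 ** h)) _) ∙ Σ<-cong<(suc h)(λ t l → cong(_* (pos(surjections h t) * pos(wt a L C t)))(cong(λ z → pos(2 ** z))(sym(N.m∸n+n≡m(N.≤-pred l))) ∙ cong pos(N.^-distribˡ-+-* 2(h ∸ t) t) ∙ Z.pos-*(2 ** (h ∸ t))(2 ** t)) ∙
    c'(pos(2 ** (h ∸ t)))(pos(2 ** t))(pos(surjections h t))(pos(wt a L C t)) ∙ cong(w t *_)(sym(pless a L t))) ⟩
   _ ∎
   where
   c : ∀ n w → n - (n - pos 2 * w) ≡ pos 2 * w
   c = ring
   c' : ∀ u v s b → u * v * (s * b) ≡ s * u * (v * b)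
   c' = ring
  orth : ∀ t → ∑ Fs(λ a → Sub L(pless-term a N t)) ≡ Q * Σ<(suc N)(λ j → pos(Cwt L j) * (-1ℤ ^ j * pos(γ(N ∸ j) N t)))
  orth t = ∑Sub-swap Fs L(λ a → pless-term a N t) ∙ Sub-cong L(λ k σ _ → ∑-*ʳ Fs(-1ℤ ^ k * pos(γ(N ∸ k) N t)) _ ∙
   cong(_* (-1ℤ ^ k * pos(γ(N ∸ k) N t)))(∑-cong Fs(λ a → cong λ'(⊙-comm a σ)) ∙ ∑λ-⊙ σ) ∙ Z.*-assoc Q _ _) ∙
   Sub-*ˡ L Q _ ∙ cong(Q *_)(Sub-by-length L λ j → -1ℤ ^ j * pos(γ(N ∸ j) N t))
  small : ∀ {j t} → j ≤ N → t < j → γ(N ∸ j) N t ≡ 0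
  small {j} {t} le lt = γ-zero(N ∸ j) N t(N.<-≤-trans(N.+-monoʳ-<(N ∸ j) lt)(N.≤-reflexive(N.m∸n+n≡m le)))
  zz : ∀ a b c → a * (b * (c * 0ℤ)) ≡ 0ℤ
  zz = ring
  z₂ : ∀ a b → a * b * 0ℤ ≡ 0ℤ
  z₂ = ring
  -- For j > h the range of the inner sum is empty, its length `suc h ∸ j` being truncated to zero.
  -- This accounts for the upper limit min(N, h).
  beyond : ∀ j → suc(N ⊓ h) ≤ j → j ≤ N → (-1ℤ ^ j) * pos(Cwt L j) * R j ≡ 0ℤ
  beyond j l le = cong((-1ℤ ^ j) * pos(Cwt L j) *_)(cong(λ n → ∑(upTo n) λ k → Rt j(j ∔ k))(N.m≤n⇒m∸n≡0 h<j)) ∙ z₂(-1ℤ ^ j)(pos(Cwt L j))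
   where
   h<j : suc h ≤ j
   h<j with N.⊓-sel N h
   ... | inj₁ e = ⊥-elim(N.<⇒≱(subst(_< j) e l) le)
   ... | inj₂ e = subst(_< j) e l
  inner : ∀ j → j ≤ N → Σ<(suc h)(λ t → w t * (pos(Cwt L j) * (-1ℤ ^ j * pos(γ(N ∸ j) N t)))) ≡ (-1ℤ ^ j) * pos(Cwt L j) * R j
  inner j le = drop j(suc h)(λ t lt → cong(λ z → w t * (pos(Cwt L j) * (-1ℤ ^ j * pos z)))(small le lt) ∙ zz(w t)(pos(Cwt L j))(-1ℤ ^ j)) ∙
   Σ<-cong(suc h ∸ j)(λ k → arr(pos(surjections h(j ∔ k)))(pos(2 ** (h ∸ (j ∔ k))))(pos(Cwt L j))(-1ℤ ^ j)(pos(γ(N ∸ j) N(j ∔ k))) ∙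
    cong₂(λ u v → (-1ℤ ^ j) * pos(Cwt L j) * (u * pos(2 ** (h ∸ (j ∔ k))) * v))(sym(!*stirling2 h(j ∔ k)))(sym(γ-binℤ N j(j ∔ k) le))) ∙ Σ<-*ˡ(suc h ∸ j)((-1ℤ ^ j) * pos(Cwt L j)) _ ∙ cong((-1ℤ ^ j) * pos(Cwt L j) *_)(sym(Σ<≡(suc h ∸ j) _))
   where
   arr : ∀ s p c e g → s * p * (c * (e * g)) ≡ e * c * (s * p * g)
   arr = ring
   drop : ∀ j n {F : ℕ → ℤ} → (∀ t → t < j → F t ≡ 0ℤ) → Σ< n F ≡ Σ<(n ∸ j)(λ k → F(j ∔ k))
   drop zero n z = refl
   drop(suc j) zero z = Σ<-[] _ ∙ sym(Σ<-[] _)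
   drop(suc j)(suc n) {F} z = Σ<-first n F ∙ cong₂ _+_ (z 0(s≤s z≤n))(drop j n λ t l → z(suc t)(s≤s l)) ∙ Z.+-identityˡ _

-- Counting words by the multiplicities of their traces

module Families (𝒟 : FieldData) {𝐴 : Set} (f : 𝐴 → FiniteField.Carrier(FieldData.𝔽 𝒟)) where
 open FieldArithmetic 𝒟
 open Characters 𝒟 using (∑λ-⊙)
 open Code 𝒟 f using (Sub; Sub-[]; Sub-∷)

 -- The sum over families ν with values at most j, weighted by the product of the binomials (n x
 -- choose ν x), of a function of the total and of the weighted sum of the elements.
 Fam : List Fq → ℕ → (Fq → ℕ) → (ℕ → Fq → ℤ) → ℤ
 Fam [] j n g = g 0 0#
 Fam(x ∷ E) j n g = Σ<(suc j)(λ v → pos(n x C v) * Fam E j n λ k σ → g(v ∔ k)((v ·F x) ⊕ σ))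

 Fam-cong : ∀ E j {n n' g g'} → (∀ x → x ∈ E → n x ≡ n' x) → (∀ k σ → g k σ ≡ g' k σ) → Fam E j n g ≡ Fam E j n' g'
 Fam-cong [] j e h = h 0 0#
 Fam-cong(x ∷ E) j e h = Σ<-cong(suc j)(λ v → cong₂(λ a b → pos(a C v) * b)(e x(here refl))(Fam-cong E j(λ y i → e y(there i)) λ k σ → h _ _))

 Fam-zero : ∀ E j n {g} → (∀ k σ → g k σ ≡ 0ℤ) → Fam E j n g ≡ 0ℤ
 Fam-zero [] j n h = h 0 0#
 Fam-zero(x ∷ E) j n h = Σ<-cong(suc j)(λ v → cong(pos(n x C v) *_)(Fam-zero E j n λ k σ → h _ _) ∙ Z.*-zeroʳ(pos(n x C v))) ∙ Σ<-zero(suc j)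

 Fam-empty : ∀ E j g → Fam E j(λ _ → 0) g ≡ g 0 0#
 Fam-empty [] j g = refl
 Fam-empty(x ∷ E) j g = Σ<-first j _ ∙ cong₂ _+_ (Z.*-identityˡ _ ∙ Fam-empty E j _ ∙ cong(g 0)(⊕-idˡ 0#))(Σ<-cong j(λ v → Z.*-zeroˡ(Fam E j(λ _ → 0) λ k σ → g(suc v ∔ k)((suc v ·F x) ⊕ σ))) ∙ Σ<-zero j) ∙ Z.+-identityʳ _

 bump : Fq → (Fq → ℕ) → Fq → ℕ
 bump y n β = if y == β then suc(n β) else n β

 bump-≡ : ∀ y n → bump y n y ≡ suc(n y)
 bump-≡ y n with y ≟ y
 ... | yes _ = refl
 ... | no ne = ⊥-elim(ne refl)

 bump-≢ : ∀ {y β} n → y ≢ β → bump y n β ≡ n β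
 bump-≢ {y} {β} n ne with y ≟ β
 ... | yes e = ⊥-elim(ne e)
 ... | no _ = refl

 -- Pascal's rule at the coordinate y. The shifted half also contains a family with ν_y = j + 1,
 -- which is harmless because g vanishes beyond j.
 Fam-bump : ∀ E j n y {g} → Unique E → y ∈ E → (∀ k σ → j < k → g k σ ≡ 0ℤ) → Fam E j(bump y n) g ≡ Fam E j n g + Fam E j n(λ k σ → g(suc k)(y ⊕ σ))
 Fam-bump(x ∷ E) j n .x {g} (ne ∷ u)(here refl) h = begin
  _ ≡⟨ Σ<-cong(suc j)(λ v → cong₂(λ a b → pos(a C v) * b)(bump-≡ x n)(Fam-cong E j(λ z i → bump-≢ n(All.lookup ne i)) λ _ _ → refl)) ⟩
  Σ<(suc j)(λ v → pos(suc(n x) C v) * F v) ≡⟨ Σ<-first j _ ∙ cong(ℤ._+_ (1ℤ * F 0))(Σ<-cong j(λ v → cong(_* F(suc v))(pos-C-suc(n x) v) ∙ Z.*-distribʳ-+(F(suc v))(pos(n x C v))(pos(n x C suc v))) ∙ Σ<-+ j _ _) ∙ arr(1ℤ * F 0) X Y ⟩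
  1ℤ * F 0 + Y + X ≡⟨ cong₂ _+_ (sym(Σ<-first j _))(sym(Σ<-last j _ ∙ cong(λ z → X + pos(n x C j) * z)(Fam-zero E j n λ k σ → h _ _ (s≤s(N.m≤m+n j k))) ∙ z₀ X(pos(n x C j)))) ⟩
  Fam(x ∷ E) j n g + Σ<(suc j)(λ v → pos(n x C v) * F(suc v)) ≡⟨ cong(ℤ._+_ (Fam(x ∷ E) j n g))(Σ<-cong(suc j) λ v → cong(pos(n x C v) *_)(Fam-cong E j(λ _ _ → refl) λ k σ → cong(g _)(⊕-assoc x(v ·F x) σ))) ⟩
  _ ∎
  where
  F : ℕ → ℤ
  F v = Fam E j n(λ k σ → g(v ∔ k)((v ·F x) ⊕ σ))
  X = Σ< j(λ v → pos(n x C v) * F(suc v))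
  Y = Σ< j(λ v → pos(n x C suc v) * F(suc v))
  arr : ∀ a x y → a + (x + y) ≡ a + y + x
  arr = ring
  z₀ : ∀ a x → a + x * 0ℤ ≡ a
  z₀ = ring
 Fam-bump(x ∷ E) j n y {g} (ne ∷ u)(there i) h = begin
  _ ≡⟨ Σ<-cong(suc j)(λ v → cong₂(λ a b → pos(a C v) * b)(bump-≢ n λ e → All.lookup ne i(sym e))(Fam-bump E j n y u i λ k σ l → h _ _ (N.<-≤-trans l(N.m≤n+m k v))) ∙ Z.*-distribˡ-+(pos(n x C v)) _ _) ⟩
  Σ<(suc j)(λ v → pos(n x C v) * F v + pos(n x C v) * Fam E j n λ k σ → g(v ∔ suc k)((v ·F x) ⊕ (y ⊕ σ))) ≡⟨ Σ<-+(suc j) _ _ ⟩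
  Fam(x ∷ E) j n g + Σ<(suc j)(λ v → pos(n x C v) * Fam E j n λ k σ → g(v ∔ suc k)((v ·F x) ⊕ (y ⊕ σ))) ≡⟨ cong(ℤ._+_ (Fam(x ∷ E) j n g))(Σ<-cong(suc j) λ v → cong(pos(n x C v) *_)(Fam-cong E j(λ _ _ → refl) λ k σ → cong₂ g(N.+-suc v k)
   (sym(⊕-assoc _ y σ) ∙ cong(_⊕ σ)(⊕-comm _ y) ∙ ⊕-assoc y _ σ))) ⟩
  _ ∎
  where
  F : ℕ → ℤ
  F v = Fam E j n(λ k σ → g(v ∔ k)((v ·F x) ⊕ σ))

 mult : List 𝐴 → Fq → ℕ
 mult [] β = 0
 mult(x ∷ L) = bump(f x)(mult L)

 -- A word chooses, for every β, some of the positions whose trace is β. The proof adds one position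
 -- at a time.
 Sub≡Fam : ∀ L j {g} → (∀ k σ → j < k → g k σ ≡ 0ℤ) → Sub L g ≡ Fam Fs j(mult L) g
 Sub≡Fam [] j h = Sub-[] _ ∙ sym(Fam-empty Fs j _)
 Sub≡Fam(x ∷ L) j {g} h = Sub-∷ x L g ∙ cong₂ _+_ (Sub≡Fam L j h)(Sub≡Fam L j λ k σ l → h _ _ (N.m<n⇒m<1+n l)) ∙ sym(Fam-bump Fs j(mult L)(f x) elements-unique(elements-complete(f x)) h)

 -- Fourier inversion: the indicator of trace β is written as a character sum, and the sums are
 -- interchanged.
 q*mult : ∀ L β → Q * pos(mult L β) ≡ ∑ Fs(λ a → λ'(a ⊙ β) * ∑ L λ x → λ'(a ⊙ f x))
 q*mult L β = begin
  _ ≡⟨ cong(Q *_)(counted L) ⟩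
  Q * ∑ L(λ x → χ(β ⊕ f x ≟ 0#)) ≡⟨ sym(∑-*ˡ L Q _) ⟩
  ∑ L(λ x → Q * χ(β ⊕ f x ≟ 0#)) ≡⟨ ∑-cong L(λ x → sym(∑λ-⊙(β ⊕ f x)) ∙ ∑-cong Fs λ a → cong λ'(⊙-comm _ a ∙ ⊙-distribˡ a β(f x)) ∙ λ-⊕(a ⊙ β)(a ⊙ f x)) ⟩
  ∑ L(λ x → ∑ Fs λ a → λ'(a ⊙ β) * λ'(a ⊙ f x)) ≡⟨ ∑-swap L Fs _ ∙ ∑-cong Fs(λ a → ∑-*ˡ L(λ'(a ⊙ β)) _) ⟩
  _ ∎
  where
  counted : ∀ L → pos(mult L β) ≡ ∑ L(λ x → χ(β ⊕ f x ≟ 0#))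
  counted [] = refl
  counted(x ∷ L) with f x ≟ β
  ... | yes e = cong₂ _+_ (sym(χ-yes(β ⊕ f x ≟ 0#)(≡⇒⊕≡0(sym e))))(counted L)
  ... | no ne = counted L ∙ sym(cong(_+ ∑ L λ x → χ(β ⊕ f x ≟ 0#))(χ-no(β ⊕ f x ≟ 0#) λ e → ne(sym(⊕≡0⇒≡ e))) ∙ Z.+-identityˡ _)

 ∏ν : (Fq → ℕ) → List(Fq × ℕ) → ℕ
 ∏ν n [] = 1
 ∏ν n((x , v) ∷ ν) = (n x C v) · ∏ν n ν

 term : (Fq → ℕ) → (ℕ → Fq → ℤ) → List(Fq × ℕ) → ℤ
 term n g ν = pos(∏ν n ν) * g(sumℕ(map proj₂ ν))(sumF(map(λ p → proj₂ p ·F proj₁ p) ν))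

 Fam≡ : ∀ E j n (g : ℕ → Fq → ℤ) → Fam E j n g ≡ ∑(assignments E j)(term n g)
 Fam≡ [] j n g = sym(Z.+-identityʳ _ ∙ Z.*-identityˡ(g 0 0#))
 Fam≡(x ∷ E) j n g = Σ<-cong(suc j)(λ v → cong(pos(n x C v) *_)(Fam≡ E j n _) ∙ sym(∑-*ˡ(assignments E j)(pos(n x C v)) _) ∙ ∑-cong(assignments E j)(λ ν →
  sym(Z.*-assoc(pos(n x C v))(pos(∏ν n ν)) _) ∙ cong(_* g(v ∔ sumℕ(map proj₂ ν))((v ·F x) ⊕ sumF(map(λ p → proj₂ p ·F proj₁ p) ν)))(sym(Z.pos-*(n x C v)(∏ν n ν)))) ∙ sym(∑-map((x , v) ∷_)(assignments E j)(term n g))) ∙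
  sym(Σ<≡(suc j) λ v → ∑(map((x , v) ∷_)(assignments E j))(term n g)) ∙ sym(∑-concatMap(λ v → map((x , v) ∷_)(assignments E j))(upTo(suc j))(term n g))

 assignments-keys : ∀ (E : List Fq) j {ν} → ν ∈ assignments E j → map proj₁ ν ≡ E
 assignments-keys [] j(here refl) = refl
 assignments-keys(x ∷ E) j i = let (v , w , _ , j' , e) = unpack i in cong(map proj₁) e ∙ cong(x ∷_)(assignments-keys E j j')
  where
  unpack : ∀ {ν} → ν ∈ assignments(x ∷ E) j → ∃[ v ] ∃[ w ] ⊤ × w ∈ assignments E j × ν ≡ (x , v) ∷ w
  unpack i with find(∈-concatMap⁻(λ v → map((x , v) ∷_)(assignments E j)) {xs = upTo(suc j)} i)
  ... | v , _ , i' with ∈-map⁻((x , v) ∷_) i'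
  ...   | w , iw , e = v , w , tt , iw , e

prodℕ-cong : (xs : List 𝑋) {F G : 𝑋 → ℕ} → (∀ x → x ∈ xs → F x ≡ G x) → prodℕ(map F xs) ≡ prodℕ(map G xs)
prodℕ-cong [] e = refl
prodℕ-cong(x ∷ xs) e = cong₂ _·_ (e x(here refl))(prodℕ-cong xs λ y i → e y(there i))

prodℕ-* : (xs : List 𝑋)(F G : 𝑋 → ℕ) → prodℕ(map F xs) · prodℕ(map G xs) ≡ prodℕ(map(λ x → F x · G x) xs)
prodℕ-* [] F G = refl
prodℕ-*(x ∷ xs) F G = N.[m*n]*[o*p]≡[m*o]*[n*p](F x) _ (G x) _ ∙ cong(F x · G x ·_)(prodℕ-* xs F G)

prodℕ-1 : (xs : List 𝑋) → prodℕ(map(λ _ → 1) xs) ≡ 1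
prodℕ-1 [] = refl
prodℕ-1(x ∷ xs) = N.*-identityˡ _ ∙ prodℕ-1 xs

prodℕ-swap : (xs : List 𝑋)(ys : List 𝑌)(F : 𝑋 → 𝑌 → ℕ) → prodℕ(map(λ x → prodℕ(map(F x) ys)) xs) ≡ prodℕ(map(λ y → prodℕ(map(λ x → F x y) xs)) ys)
prodℕ-swap [] ys F = sym(prodℕ-1 ys)
prodℕ-swap(x ∷ xs) ys F = cong(prodℕ(map(F x) ys) ·_)(prodℕ-swap xs ys F) ∙ prodℕ-* ys(F x) _

prodℕ-filterᵇ : (p : 𝑋 → Bool)(F : 𝑋 → ℕ)(xs : List 𝑋) → prodℕ(map F(filterᵇ p xs)) ≡ prodℕ(map(λ x → if p x then F x else 1) xs)
prodℕ-filterᵇ p F [] = refl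
prodℕ-filterᵇ p F(x ∷ xs) with p x
... | true = cong(F x ·_)(prodℕ-filterᵇ p F xs)
... | false = prodℕ-filterᵇ p F xs ∙ sym(N.*-identityˡ _)

prodℕ-pick : (_≟_ : DecidableEquality 𝑋)(xs : List 𝑋) {x : 𝑋} (F : 𝑋 → ℕ) → Unique xs → x ∈ xs → prodℕ(map(λ y → if ⌊ x ≟ y ⌋ then F y else 1) xs) ≡ F x
prodℕ-pick _≟_ (x ∷ xs) {.x} F(ne ∷ u)(here refl) = cong₂ _·_ (at x)(prodℕ-cong xs(λ y i → other y(All.lookup ne i)) ∙ prodℕ-1 xs) ∙ N.*-identityʳ _
 where
 at : ∀ y → (if ⌊ y ≟ y ⌋ then F y else 1) ≡ F y
 at y with y ≟ y
 ... | yes _ = refl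
 ... | no ne = ⊥-elim(ne refl)
 other : ∀ y → x ≢ y → (if ⌊ x ≟ y ⌋ then F y else 1) ≡ 1
 other y ne with x ≟ y
 ... | yes e = ⊥-elim(ne e)
 ... | no _ = refl
prodℕ-pick _≟_ (y ∷ xs) {x} F(ne ∷ u)(there i) = cong₂ _·_ (other λ e → All.lookup ne i(sym e))(prodℕ-pick _≟_ xs F u i) ∙ N.*-identityˡ _
 where
 other : x ≢ y → (if ⌊ x ≟ y ⌋ then F y else 1) ≡ 1
 other ne with x ≟ y
 ... | yes e = ⊥-elim(ne e)
 ... | no _ = refl

toℚ-+ : ∀ x y → toℚ(x + y) ≡ toℚ x ℚ.+ toℚ y
toℚ-+ x y = ℚP.toℚᵘ-injective(ℚᵘP.≃-trans(ℚP.toℚᵘ-fromℚᵘ(ℚᵘ.mkℚᵘ(x + y) 0))(ℚᵘP.≃-trans(ℚᵘ.*≡*(l x y))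
 (ℚᵘP.≃-trans(ℚᵘP.+-cong(ℚᵘP.≃-sym(ℚP.toℚᵘ-fromℚᵘ(ℚᵘ.mkℚᵘ x 0)))(ℚᵘP.≃-sym(ℚP.toℚᵘ-fromℚᵘ(ℚᵘ.mkℚᵘ y 0))))(ℚᵘP.≃-sym(ℚP.toℚᵘ-homo-+(toℚ x)(toℚ y))))))
 where
 l : ∀ x y → (x + y) * 1ℤ ≡ (x * 1ℤ + y * 1ℤ) * 1ℤ
 l = ring

divℚ-cancel : ∀ d x .{{_ : ℕ.NonZero d}} → divℚ(pos d * x) d ≡ toℚ x
divℚ-cancel(suc k) x = ℚP.fromℚᵘ-cong {ℚᵘ.mkℚᵘ(pos(suc k) * x) k} {ℚᵘ.mkℚᵘ x 0} (ℚᵘ.*≡*(Z.*-identityʳ _ ∙ Z.*-comm(pos(suc k)) x))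

divℤ-cancel : ∀ d n .{{_ : ℕ.NonZero d}} → divℤ(pos d * pos n) d ≡ pos n
divℤ-cancel d@(suc k) n = cong(ℤ._/ pos d)(sym(Z.pos-* d n)) ∙ div-pos-is-/ℕ(pos(d · n)) d ∙ cong pos(cong(ℕ._/ d)(N.*-comm d n) ∙ m*n/n≡m n d)

d*c%d≡0 : ∀ d c .{{_ : ℕ.NonZero d}} → (pos d * c) ℤ.%ℕ d ≡ 0
d*c%d≡0 d c = go ℤ.∣ c - k ∣ refl
 where
 k = (pos d * c) ℤ./ℕ d
 l : ∀ d c r k → d * c ≡ r + k * d → r ≡ d * (c - k)
 l d c r k e = sym(u r(k * d)) ∙ cong(_- k * d)(sym e) ∙ v d c k
  where
  u : ∀ r m → r + m - m ≡ r
  u = ring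
  v : ∀ d c k → d * c - k * d ≡ d * (c - k)
  v = ring
 r≡ : (pos d * c) ℤ.%ℕ d ≡ d · ℤ.∣ c - k ∣
 r≡ = cong ℤ.∣_∣ (l(pos d) c(pos((pos d * c) ℤ.%ℕ d)) k(a≡a%ℕn+[a/ℕn]*n(pos d * c) d)) ∙ Z.abs-*(pos d)(c - k)
 go : ∀ y → ℤ.∣ c - k ∣ ≡ y → (pos d * c) ℤ.%ℕ d ≡ 0
 go zero e = r≡ ∙ cong(d ·_) e ∙ N.*-zeroʳ d
 go(suc y) e = ⊥-elim(N.<⇒≱(n%ℕd<d(pos d * c) d)(subst(d ≤_)(sym(r≡ ∙ cong(d ·_) e))(N.m≤m*n d(suc y))))

-- Recursions and weight distributions from the values S(a)

module Parts (𝒟 : FieldData)(ε : Sign)(i : Idx)(m : ℕ) where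
 open FieldArithmetic 𝒟
 open Characters 𝒟
 open Pieces ε i m
 open Code 𝒟(Tr {d}) using (pos-Cwt; pless-moment)
 open Families 𝒟(Tr {d})

 S : Fq → ℤ
 S a = ∑(DC i)(λ g → λ'(a ⊙ Tr g))

 S-0 : S 0# ≡ pos N
 S-0 = ∑-cong(DC i)(λ g → cong λ'(⊙-0ˡ(Tr g)) ∙ λ-0) ∙ ∑-length(DC i)

 -- When N - S(a) = A(c + sK'(a)), the moment identity is A^h times a binomial expansion in the
 -- moments of K'. The top term is the left side of the recursion. The cases differ only in s, c and
 -- K'.
 moments : (s c : ℤ)(K' : Fq → ℤ) → .{{ℕ.NonZero A}} → (∀ a → a ≢ 0# → pos N - S a ≡ pos A * (c + s * K' a)) →
  ∀ h → 1 ≤ h → toℚ(s ^ h * ∑ F* λ a → K' a ^ h) ≡ toℚ(recSum s c(λ l → ∑ F* λ a → K' a ^ l) h) ℚ.+ Σh h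
 moments s c K' ⦃ nzA ⦄ hyp(suc h') _ = begin
  _ ≡⟨ cong toℚ(l X R) ∙ toℚ-+ R(X - R) ⟩
  toℚ R ℚ.+ toℚ(X - R) ≡⟨ cong(toℚ R ℚ.+_)(sym(cong(λ z → divℚ z(A ** h)) total ∙ divℚ-cancel(A ** h)(X - R) ⦃ N.m^n≢0 A h ⦄)) ⟩
  _ ∎
  where
  h = suc h'
  M : ℕ → ℤ
  M l = ∑ F*(λ a → K' a ^ l)
  X = s ^ h * M h
  Y = ∑(upTo h)(λ l → s ^ l * pos(h C l) * c ^ (h ∸ l) * M l)
  R = recSum s c M h
  l : ∀ X R → X ≡ R + (X - R)
  l = ring
  one : h C h ≡ 1
  one = nCn≡1 h
  arr : ∀ b sl k cl → b * (sl * k * cl) ≡ sl * b * cl * k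
  arr = ring
  fin : ∀ y x → y + x * 1ℤ * 1ℤ ≡ x - - y
  fin = ring
  expansion : ∑ F*(λ a → (s * K' a + c) ^ h) ≡ X - R
  expansion = begin
   _ ≡⟨ ∑-cong F*(λ a → binomial h(s * K' a) c ∙ Σ<-cong(suc h) λ l → cong(λ z → pos(h C l) * (z * c ^ (h ∸ l)))(^-* s(K' a) l) ∙ arr(pos(h C l))(s ^ l)(K' a ^ l)(c ^ (h ∸ l))) ⟩
   ∑ F*(λ a → Σ<(suc h) λ l → s ^ l * pos(h C l) * c ^ (h ∸ l) * K' a ^ l) ≡⟨ ∑Σ<-swap F*(suc h) _ ∙ Σ<-cong(suc h)(λ l → ∑-*ˡ F*(s ^ l * pos(h C l) * c ^ (h ∸ l)) _) ⟩
   Σ<(suc h)(λ l → s ^ l * pos(h C l) * c ^ (h ∸ l) * M l) ≡⟨ Σ<-last h _ ∙ cong₂ _+_ (sym(Σ<≡ h _))(cong₂(λ u v → s ^ h * pos u * c ^ v * M h) one(N.n∸n≡0 h) ∙ swap(s ^ h)(M h)) ⟩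
   Y + X * 1ℤ * 1ℤ ≡⟨ fin Y X ⟩
   _ ∎
   where
   swap : ∀ x y → x * 1ℤ * 1ℤ * y ≡ x * y * 1ℤ * 1ℤ
   swap = ring
  total : pos q * sumRangeℤ 0(N ⊓ h)(λ j → (-1ℤ ^ j) * pos(Cw i j) * sumRangeℤ j h λ t → pos(t !) * stirling2 h t * pos(2 ** (h ∸ t)) * binℤ(pos N - pos j)(pos N - pos t)) ≡ pos(A ** h) * (X - R)
  total = begin
   _ ≡⟨ sym(pless-moment(DC i) h) ⟩
   ∑ Fs(λ a → (pos N - S a) ^ h) ≡⟨ ∑-split₀(λ a → (pos N - S a) ^ h) ⟩
   -- The term a = 0 vanishes because S(0) = N and h ≥ 1.
   (pos N - S 0#) ^ h + ∑ F*(λ a → (pos N - S a) ^ h) ≡⟨ cong₂ _+_ (cong(λ z → (pos N - z) ^ h) S-0 ∙ cong(_^ h)(Z.+-inverseʳ(pos N)))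
    (∑-nz-cong λ a na → cong(_^ h)(hyp a na ∙ cong(pos A *_)(Z.+-comm c(s * K' a))) ∙ ^-* (pos A)(s * K' a + c) h ∙ cong(_* (s * K' a + c) ^ h)(sym(pos-^ A h))) ⟩
   0ℤ + ∑ F*(λ a → pos(A ** h) * (s * K' a + c) ^ h) ≡⟨ Z.+-identityˡ _ ∙ ∑-*ˡ F*(pos(A ** h)) _ ∙ cong(pos(A ** h) *_) expansion ⟩
   _ ∎

 n : Fq → ℕ
 n = mult(DC i)

 -- The integer division in `top` is exact, with quotient the number of coset elements of trace β,
 -- since q times that number is the dividend.
 top-exact : ∀ c β → Q * pos(n β) ≡ pos A * (pos B + e * c) → top c ≡ pos(n β)
 top-exact c β eq = cong(λ z → divℤ z q)(sym eq) ∙ divℤ-cancel q(n β)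

 binT-exact : ∀ {c β k} → Q * pos(n β) ≡ pos A * (pos B + e * c) → binT(top c) k ≡ n β C k
 binT-exact {c} {β} {k} eq = cong(λ z → binT z k)(top-exact c β eq)

 ν-lookup : ∀ ν → Unique(map proj₁ ν) → ∏ν n ν ≡ prodℕ(map(λ β → n β C ν⟨ ν ⟩ β)(map proj₁ ν))
 ν-lookup [] u = refl
 ν-lookup((x , v) ∷ ν)(ne ∷ u) = cong₂ _·_ (cong(n x C_)(sym here-v))(ν-lookup ν u ∙ prodℕ-cong(map proj₁ ν) λ β j → cong(n β C_)(sym(there-v(All.lookup ne j))))
  where
  here-v : ν⟨(x , v) ∷ ν ⟩ x ≡ v
  here-v with x ≟ x
  ... | yes _ = refl
  ... | no ne = ⊥-elim(ne refl)
  there-v : ∀ {β} → x ≢ β → ν⟨(x , v) ∷ ν ⟩ β ≡ ν⟨ ν ⟩ β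
  there-v {β} ne with x ≟ β
  ... | yes e = ⊥-elim(ne e)
  ... | no _ = refl

 weights : (P : List(Fq × ℕ) → ℕ) → (∀ ν → P ν ≡ prodℕ(map(λ β → n β C ν⟨ ν ⟩ β) Fs)) → ∀ j → Cw i j ≡ sumℕ(map P(families j))
 weights P hyp j = Z.+-injective(begin
  _ ≡⟨ pos-Cwt(DC i) j ∙ Sub≡Fam(DC i) j(λ k σ l → cong(_* χ(σ ≟ 0#))(χ-no(k ℕ.≟ j) λ e → N.<⇒≢ l(sym e)) ∙ Z.*-zeroˡ(χ(σ ≟ 0#))) ∙ Fam≡ Fs j n g ⟩
  ∑(assignments Fs j)(term n g) ≡⟨ ∑-cong∈(assignments Fs j)(λ ν iν → Z.*-comm(pos(∏ν n ν)) _ ∙ cong₂ _*_ (sym(χ-×(sumℕ(map proj₂ ν) ℕ.≟ j)(total ν ≟ 0#)) ∙ χ-⇔((sumℕ(map proj₂ ν) ℕ.≟ j) ×-dec(total ν ≟ 0#))(T?(ok ν))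
   (λ (u , v) → Equivalence.from T-∧(fromWitness u , ≡⇒== v)) λ t → let (u , v) = Equivalence.to T-∧ t in toWitness u , ==⇒≡ v)
   (cong pos(ν-lookup ν(subst Unique(sym(assignments-keys Fs j iν)) elements-unique) ∙ cong(λ E → prodℕ(map(λ β → n β C ν⟨ ν ⟩ β) E))(assignments-keys Fs j iν) ∙ sym(hyp ν)))) ⟩
  ∑(assignments Fs j)(λ ν → χ(T?(ok ν)) * pos(P ν)) ≡⟨ sym(∑-filterᵇ ok(assignments Fs j) λ ν → pos(P ν)) ⟩
  ∑(families j)(λ ν → pos(P ν)) ≡⟨ sum-pos(families j) ⟩
  _ ∎)
  where
  total : List(Fq × ℕ) → Fq
  total ν = sumF(map(λ p → proj₂ p ·F proj₁ p) ν)
  ok : List(Fq × ℕ) → Bool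
  ok ν = (sumℕ(map proj₂ ν) ==ℕ j) ∧ (total ν == 0#)
  g : ℕ → Fq → ℤ
  g k σ = χ(k ℕ.≟ j) * χ(σ ≟ 0#)
  sum-pos : ∀ νs → ∑ νs(λ ν → pos(P ν)) ≡ pos(sumℕ(map P νs))
  sum-pos [] = refl
  sum-pos(ν ∷ νs) = cong(ℤ._+_ (pos(P ν)))(sum-pos νs)

 prodℕ-nonzeros : (F : Fq → ℕ) → prodℕ(map F F*) ≡ prodℕ(map(λ β → if not(β == 0#) then F β else 1) Fs)
 prodℕ-nonzeros F = prodℕ-filterᵇ(λ x → not(x == 0#)) F Fs

 prodℕ-0# : (F : Fq → ℕ) → F 0# ≡ prodℕ(map(λ β → if 0# == β then F β else 1) Fs)
 prodℕ-0# F = sym(prodℕ-pick _≟_ Fs F elements-unique(elements-complete 0#))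

 module _ (N≡AB : N ≡ A · B) where
  posN : pos N ≡ pos A * pos B
  posN = cong pos N≡AB ∙ Z.pos-* A B

  ∑λS : ∀ β → Q * pos(n β) ≡ pos N + ∑ F*(λ a → λ'(a ⊙ β) * S a)
  ∑λS β = q*mult(DC i) β ∙ ∑-split₀ _ ∙ cong(_+ ∑ F* λ a → λ'(a ⊙ β) * S a)(cong₂ _*_ (cong λ'(⊙-0ˡ β) ∙ λ-0) S-0 ∙ Z.*-identityˡ(pos N))

  ∑nzλ : (k : ℤ)(H : Fq → ℤ)(β : Fq) → ∑ F*(λ a → λ'(a ⊙ β) * (k * H a)) ≡ k * (∑ Fs(λ a → λ'(a ⊙ β) * H a) - H 0#)
  ∑nzλ k H β = ∑-cong F*(λ a → *-swapˡ(λ'(a ⊙ β)) k(H a)) ∙ ∑-*ˡ F* k _ ∙ cong(k *_)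
   (l(H 0#) _ ∙ cong(_- H 0#)(sym(∑-split₀ _ ∙ cong(_+ ∑ F* λ a → λ'(a ⊙ β) * H a)(cong(_* H 0#)(cong λ'(⊙-0ˡ β) ∙ λ-0) ∙ Z.*-identityˡ(H 0#)))))
   where
   l : ∀ x y → y ≡ x + y - x
   l = ring

  module _ (S≡ : ∀ a → a ≢ 0# → S a ≡ e * pos A * K a) where
   -- S(a) is a multiple of K only for a ≠ 0. Extending the sum to a = 0 costs K(0) = -1, the origin
   -- of the + 1 in the three binomials.
   frequency : ∀ β x → ∑ F*(λ α → λ' α * χ(β ≟ α ⁻¹)) ≡ x → Q * pos(n β) ≡ pos A * (pos B + e * (Q * x + 1ℤ))
   frequency β x eq = ∑λS β ∙ cong₂ _+_ posN(∑-nz-cong(λ a na → cong(λ'(a ⊙ β) *_)(S≡ a na)) ∙ ∑nzλ(e * pos A) K β ∙ cong₂(λ u v → e * pos A * (u - v))(∑λK β ∙ cong(Q *_) eq) K-0) ∙ l(pos A)(pos B) e(Q * x)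
    where
    l : ∀ A B e x → A * B + e * A * (x - -1ℤ) ≡ A * (B + e * (x + 1ℤ))
    l = ring

   partA : .{{ℕ.NonZero A}} → PartA
   partA = moments(- e)(pos B) K(λ a na → cong₂ _-_ posN(S≡ a na) ∙ l(pos A)(pos B) e(K a)) , λ j _ → weights _ (λ ν → product λ β → ν⟨ ν ⟩ β) j
    where
    l : ∀ A B e k → A * B - e * A * k ≡ A * (B + - e * k)
    l = ring
    f₀ : Q * pos(n 0#) ≡ pos A * (pos B + e * 1ℤ)
    f₀ = frequency 0# 0ℤ(detect-inverse₀ λ') ∙ cong(λ z → pos A * (pos B + e * (z + 1ℤ)))(Z.*-zeroʳ Q)
    f₁ : ∀ {β} → β ≢ 0# → tr(β ⁻¹) ≡ 0# → Q * pos(n β) ≡ pos A * (pos B + e * (Q + 1ℤ))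
    f₁ {β} nβ t = frequency β 1ℤ(detect-inverse nβ λ' ∙ λ-1 t) ∙ cong(λ z → pos A * (pos B + e * (z + 1ℤ)))(Z.*-identityʳ Q)
    f₂ : ∀ {β} → β ≢ 0# → tr(β ⁻¹) ≡ 1# → Q * pos(n β) ≡ pos A * (pos B + e * (- Q + 1ℤ))
    f₂ {β} nβ t = frequency β -1ℤ(detect-inverse nβ λ' ∙ λ--1 t) ∙ cong(λ z → pos A * (pos B + e * (z + 1ℤ)))(Z.*-comm Q -1ℤ ∙ Z.-1*i≡-i Q)
    -- Exactly one of the three conditions holds for each β, so the three restricted products merge
    -- into a single product over the whole field.
    select : ∀ β (x₀ x₁ x₂ x : ℕ) → (β ≡ 0# → x₀ ≡ x) → (β ≢ 0# → tr(β ⁻¹) ≡ 0# → x₁ ≡ x) → (β ≢ 0# → tr(β ⁻¹) ≡ 1# → x₂ ≡ x) →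
     (if 0# == β then x₀ else 1) · (if not(β == 0#) then (if tr(β ⁻¹) == 0# then x₁ else 1) else 1) · (if not(β == 0#) then (if tr(β ⁻¹) == 1# then x₂ else 1) else 1) ≡ x
    select β x₀ x₁ x₂ x h₀ h₁ h₂ with 0# ≟ β | β ≟ 0# | tr(β ⁻¹) ≟ 0# | tr(β ⁻¹) ≟ 1#
    ... | yes z | no nz | _ | _ = ⊥-elim(nz(sym z))
    ... | no nz | yes z | _ | _ = ⊥-elim(nz(sym z))
    ... | yes z | yes z' | _ | _ = N.*-identityʳ _ ∙ N.*-identityʳ _ ∙ h₀ z'
    ... | no _ | no nz | yes t | yes t' = ⊥-elim(0≢1(sym t ∙ t'))
    ... | no _ | no nz | yes t | no _ = N.*-identityʳ _ ∙ N.*-identityˡ _ ∙ h₁ nz t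
    ... | no _ | no nz | no _ | yes t = N.*-identityˡ _ ∙ h₂ nz t
    ... | no _ | no nz | no t | no t' with tr-01(β ⁻¹)
    ...   | inj₁ t″ = ⊥-elim(t t″)
    ...   | inj₂ t″ = ⊥-elim(t' t″)
    product : ∀ (w : Fq → ℕ) → binT(top 1ℤ)(w 0#) · prodℕ(map(λ β → binT(top(Q + 1ℤ))(w β))(filterᵇ(λ β → tr(β ⁻¹) == 0#) F*))
     · prodℕ(map(λ β → binT(top(- Q + 1ℤ))(w β))(filterᵇ(λ β → tr(β ⁻¹) == 1#) F*)) ≡ prodℕ(map(λ β → n β C w β) Fs)
    product w = cong₂ _·_ (cong₂ _·_ (prodℕ-0# _)(restrict(λ β → tr(β ⁻¹) == 0#) _) ∙ prodℕ-* Fs _ _)(restrict(λ β → tr(β ⁻¹) == 1#) _) ∙ prodℕ-* Fs _ _ ∙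
     prodℕ-cong Fs(λ β _ → select β(binT(top 1ℤ)(w β))(binT(top(Q + 1ℤ))(w β))(binT(top(- Q + 1ℤ))(w β))(n β C w β)(λ { refl → binT-exact f₀ })(λ nβ t → binT-exact(f₁ nβ t)) λ nβ t → binT-exact(f₂ nβ t))
     where
     restrict : ∀ p (F : Fq → ℕ) → prodℕ(map F(filterᵇ p F*)) ≡ prodℕ(map(λ β → if not(β == 0#) then (if p β then F β else 1) else 1) Fs)
     restrict p F = prodℕ-filterᵇ p F F* ∙ prodℕ-nonzeros _

  module _ (u : ℤ)(S≡ : ∀ a → a ≢ 0# → S a ≡ - (e * pos A) * (u + K₂ a)) where
   moments-K₂ : .{{ℕ.NonZero A}} → ∀ h → 1 ≤ h → toℚ(e ^ h * MK₂ h) ≡ toℚ(recSum e(pos B + e * u) MK₂ h) ℚ.+ Σh h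
   moments-K₂ = moments e(pos B + e * u) K₂(λ a na → cong₂ _-_ posN(S≡ a na) ∙ l(pos A)(pos B) e u(K₂ a))
    where
    l : ∀ A B e u k → A * B - - (e * A) * (u + k) ≡ A * (B + e * u + e * k)
    l = ring

   -- The identity K² = q + K₂ moves the centre of the expansion by eq and leaves Σ_h unchanged.
   moments-K² : .{{ℕ.NonZero A}} → ∀ c → pos B + e * u ≡ c + e * Q → ∀ h → 1 ≤ h → toℚ(e ^ h * MK(2 · h)) ≡ toℚ(recSum e c(λ l → MK(2 · l)) h) ℚ.+ Σh h
   moments-K² c eq h h≥1 = cong(λ z → toℚ(e ^ h * z))(squares h) ∙ moments e c(λ a → K a * K a)(λ a na → cong₂ _-_ posN(S≡ a na) ∙
     l(pos A)(pos B) e u(K₂ a) ∙ cong(pos A *_)(cong(_+ e * K₂ a) eq ∙ l' c e Q(K₂ a) ∙ cong(λ z → c + e * z)(sym(K²≡q+K₂ na)))) h h≥1 ∙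
     cong(λ z → toℚ(- z) ℚ.+ Σh h)(∑-cong(upTo(suc(h ∸ 1))) λ l → cong(e ^ l * pos(h C l) * c ^ (h ∸ l) *_)(sym(squares l)))
    where
    l : ∀ A B e u k → A * B - - (e * A) * (u + k) ≡ A * (B + e * u + e * k)
    l = ring
    l' : ∀ c e q k → c + e * q + e * k ≡ c + e * (q + k)
    l' = ring
    squares : ∀ l → MK(2 · l) ≡ ∑ F*(λ a → (K a * K a) ^ l)
    squares l = ∑-cong F*(λ a → sym(Z.^-*-assoc(K a) 2 l) ∙ cong(_^ l)(cong(K a *_)(Z.*-identityʳ(K a))))

   -- The constant u contributes only at β = 0, by orthogonality. The correction u + 1 is the value
   -- of u + K₂ at a = 0.
   frequency₂ : ∀ β x y → u * (Q * χ(β ≟ 0#)) ≡ x → ∑ Fs(λ a → λ'(a ⊙ β) * K₂ a) ≡ y → Q * pos(n β) ≡ pos A * (pos B + e * (u + 1ℤ - x - y))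
   frequency₂ β x y ex ey = ∑λS β ∙ cong₂ _+_ posN(∑-nz-cong(λ a na → cong(λ'(a ⊙ β) *_)(S≡ a na)) ∙ ∑nzλ(- (e * pos A))(λ a → u + K₂ a) β ∙ cong₂(λ v w → - (e * pos A) * (v - (u + w)))
    (∑-cong Fs(λ a → Z.*-distribˡ-+(λ'(a ⊙ β)) u(K₂ a) ∙ cong(_+ λ'(a ⊙ β) * K₂ a)(Z.*-comm(λ'(a ⊙ β)) u)) ∙ ∑-+ Fs _ _ ∙
     cong₂ _+_ (∑-*ˡ Fs u _ ∙ cong(u *_)(∑-cong Fs(λ a → cong λ'(⊙-comm a β)) ∙ ∑λ-⊙ β) ∙ ex) ey) K₂-0) ∙ l(pos A)(pos B) e u x y
    where
    l : ∀ A B e u x y → A * B + - (e * A) * (x + y - (u + 1ℤ)) ≡ A * (B + e * (u + 1ℤ - x - y))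
    l = ring

   f₀ : Q * pos(n 0#) ≡ pos A * (pos B + e * (u + 1ℤ - u * Q))
   f₀ = frequency₂ 0#(u * Q) 0ℤ(cong(λ z → u * (Q * z))(χ-yes(0# ≟ 0#) refl) ∙ cong(u *_)(Z.*-identityʳ Q)) ∑λK₂-0 ∙ cong(λ z → pos A * (pos B + e * z))(Z.+-identityʳ(u + 1ℤ - u * Q))

   f₁ : ∀ {β} → β ≢ 0# → Q * pos(n β) ≡ pos A * (pos B + e * (u + 1ℤ - Q * K(β ⁻¹)))
   f₁ {β} nβ = frequency₂ β 0ℤ(Q * K(β ⁻¹))(cong(λ z → u * (Q * z))(χ-no(β ≟ 0#) nβ) ∙ cong(u *_)(Z.*-zeroʳ Q) ∙ Z.*-zeroʳ u)(∑λK₂-≢0 nβ) ∙ cong(λ z → pos A * (pos B + e * (z - Q * K(β ⁻¹))))(Z.+-identityʳ(u + 1ℤ))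

   module _ (r≥2 : 2 ≤ r) where
    admissible? = λ τ → T?(⌊ τ * τ ℤ.<? pos(4 · q) ⌋ ∧ (((τ + 1ℤ) ℤ.% pos 4) ==ℕ 0))

    -- The Hasse bound and the congruence modulo 4 are the two tests defining `taus`. The crude
    -- bound |K| ≤ 2q places K in the range from which the list is filtered.
    K∈taus : ∀ {b} → b ≢ 0# → K b ∈ taus
    K∈taus {b} nb = ∈-filter⁺ admissible?(subst(_∈ map(λ k → pos k - pos(2 · q))(upTo(suc(4 · q))))(sym(proj₂ shifted))(∈-map⁺(λ k → pos k - pos(2 · q))(∈-upTo⁺(s≤s(proj₁(proj₂(shift(K b) small)))))))
     (Equivalence.from(T-∧ {⌊ K b * K b ℤ.<? pos(4 · q) ⌋} {((K b + 1ℤ) ℤ.% pos 4) ==ℕ 0})(fromWitness {a? = K b * K b ℤ.<? pos(4 · q)} K²<4q , fromWitness {a? = (K b + 1ℤ) ℤ.% pos 4 ℕ.≟ 0} mod4))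
     where
     K²<4q : K b * K b ℤ.< pos(4 · q)
     K²<4q = WeilBound.weil 𝒟 b nb r≥2
     small : ℤ.∣ K b ∣ ≤ 2 · q
     small = N.≮⇒≥(λ big → N.<⇒≱(Z.drop‿+<+(subst(ℤ._< pos(4 · q))(square(K b)) K²<4q))(N.≤-trans(N.≤-trans(N.m≤m*n(4 · q) q)(N.≤-reflexive(N.*-assoc 4 q q ∙ sym(N.[m*n]*[o*p]≡[m*o]*[n*p] 2 q 2 q))))(N.*-mono-≤(N.<⇒≤ big)(N.<⇒≤ big))))
      where
      square : ∀ k → k * k ≡ pos(ℤ.∣ k ∣ · ℤ.∣ k ∣)
      square(pos a) = sym(Z.pos-* a a)
      square -[1+ a ] = refl
     shift : ∀ τ → ℤ.∣ τ ∣ ≤ 2 · q → ∃[ k ] k ≤ 4 · q × τ ≡ pos k - pos(2 · q)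
     shift(pos a) le = a ∔ 2 · q , subst(a ∔ 2 · q ≤_)(sym(N.*-distribʳ-+ q 2 2))(N.+-monoˡ-≤(2 · q) le) , cancel(pos a)(pos(2 · q))
      where
      cancel : ∀ x y → x ≡ x + y - y
      cancel = ring
     shift -[1+ a ] le = 2 · q ∸ suc a , N.≤-trans(N.m∸n≤m(2 · q)(suc a))(N.*-monoˡ-≤ q {2} {4} (s≤s(s≤s z≤n))) ,
      cancel(pos(2 · q ∸ suc a))(pos(suc a)) ∙ cong(λ z → pos(2 · q ∸ suc a) - pos z)(N.m∸n+n≡m le)
      where
      cancel : ∀ x y → - y ≡ x - (x + y)
      cancel = ring
     shifted : ∃[ k ] K b ≡ pos k - pos(2 · q)
     shifted = proj₁(shift(K b) small) , proj₂(proj₂(shift(K b) small))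
     -- K + 1 = q - 2 Z₁ with 4 | q and Z₁ even.
     mod4 : (K b + 1ℤ) ℤ.% pos 4 ≡ 0
     mod4 = cong(ℤ._%ℕ 4)(cong(_+ 1ℤ)(K≡q-1-2Z₁ b ∙ cong₂(λ x y → x - 1ℤ - pos 2 * y) q≡4c(proj₂(Z₁-even nb))) ∙ l(pos(2 ** (r ∸ 2)))(proj₁(Z₁-even nb))) ∙ d*c%d≡0 4(pos(2 ** (r ∸ 2)) - proj₁(Z₁-even nb))
      where
      q≡4c : Q ≡ pos 4 * pos(2 ** (r ∸ 2))
      q≡4c = cong pos(size≡ ∙ cong(2 **_)(sym(N.m+[n∸m]≡n r≥2)) ∙ N.^-distribˡ-+-* 2 2(r ∸ 2)) ∙ Z.pos-* 4(2 ** (r ∸ 2))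
      l : ∀ c z → pos 4 * c - 1ℤ - pos 2 * (pos 2 * z) + 1ℤ ≡ pos 4 * (c - z)
      l = ring

    taus-unique : Unique taus
    taus-unique = UniqueP.filter⁺ admissible?(UniqueP.map⁺ {f = λ k → pos k - pos(2 · q)} (λ {x} {y} e → Z.+-injective(+-cancelˡ M(Z.+-comm M(pos x) ∙ e ∙ Z.+-comm(pos y) M)))(UniqueP.upTo⁺(suc(4 · q))))
     where
     M = - pos(2 · q)

    -- Each β ≠ 0 occurs for exactly one τ of the list, namely K(1/β). The products over τ and over
    -- β can therefore be interchanged and the product over τ collapses.
    weightsBC : ∀ j → Cw i j ≡ weightBC(u + 1ℤ - u * Q)(λ τ → u + 1ℤ - Q * τ) j
    weightsBC = weights _ (λ ν → product λ β → ν⟨ ν ⟩ β)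
     where
     c₁ : ℤ → ℤ
     c₁ τ = u + 1ℤ - Q * τ
     at : ∀ β (x₀ x : ℕ)(F : ℤ → ℕ) → (β ≡ 0# → x₀ ≡ x) → (β ≢ 0# → F(K(β ⁻¹)) ≡ x) →
      (if 0# == β then x₀ else 1) · prodℕ(map(λ τ → if not(β == 0#) then (if K(β ⁻¹) ==ℤ τ then F τ else 1) else 1) taus) ≡ x
     at β x₀ x F h₀ h₁ with 0# ≟ β | β ≟ 0#
     ... | yes z | no nz = ⊥-elim(nz(sym z))
     ... | no nz | yes z = ⊥-elim(nz(sym z))
     ... | yes z | yes z' = cong₂ _·_ (h₀ z')(prodℕ-1 taus) ∙ N.*-identityʳ x
     ... | no _ | no nz = N.*-identityˡ _ ∙ prodℕ-pick ℤ._≟_ taus F taus-unique(K∈taus(⁻¹-≢0 nz)) ∙ h₁ nz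
     product : ∀ (w : Fq → ℕ) → binT(top(u + 1ℤ - u * Q))(w 0#) · prodℕ(map(λ τ → prodℕ(map(λ β → binT(top(c₁ τ))(w β))(filterᵇ(λ β → K(β ⁻¹) ==ℤ τ) F*))) taus) ≡ prodℕ(map(λ β → n β C w β) Fs)
     product w = cong₂ _·_ (prodℕ-0# λ β → binT(top(u + 1ℤ - u * Q))(w β))(prodℕ-cong taus(λ τ _ → prodℕ-filterᵇ(λ β → K(β ⁻¹) ==ℤ τ) _ F* ∙ prodℕ-nonzeros _) ∙ prodℕ-swap taus Fs _) ∙
      prodℕ-* Fs _ _ ∙ prodℕ-cong Fs(λ β _ → at β(binT(top(u + 1ℤ - u * Q))(w β))(n β C w β)(λ τ → binT(top(c₁ τ))(w β))(λ { refl → binT-exact f₀ }) λ nβ → binT-exact(f₁ nβ))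

-- Exponents and products of the factors q^j - 1

tri-+ : ∀ s t → tri(s ∔ t) ≡ tri s ∔ tri t ∔ s · t
tri-+ zero t = sym(N.+-identityʳ(tri t))
tri-+(suc s) t = cong(s ∔ t ∔_)(tri-+ s t) ∙ l s t(tri s)(tri t)(s · t)
 where
 l : ∀ s t x y z → s ∔ t ∔ (x ∔ y ∔ z) ≡ s ∔ x ∔ y ∔ (t ∔ z)
 l = ringℕ

square-tri : ∀ k → k · k ≡ 2 · tri k ∔ k
square-tri zero = refl
square-tri(suc k) = l k(k · k) ∙ cong(λ z → suc(k ∔ k ∔ z))(square-tri k) ∙ l' k(tri k)
 where
 l : ∀ k z → suc(k ∔ k · suc k) ≡ suc(k ∔ k ∔ k · k)
 l = ringℕ
 l' : ∀ k x → suc(k ∔ k ∔ (2 · x ∔ k)) ≡ 2 · (k ∔ x) ∔ suc k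
 l' = ringℕ

tri-double : ∀ k → tri(2 · k) ≡ 4 · tri k ∔ k
tri-double k = tri-+ k(k ∔ 0) ∙ cong(λ z → tri k ∔ tri z ∔ k · z)(N.+-identityʳ k) ∙ cong(tri k ∔ tri k ∔_)(square-tri k) ∙ l(tri k) k
 where
 l : ∀ x k → x ∔ x ∔ (2 · x ∔ k) ≡ 4 · x ∔ k
 l = ringℕ

suc-^∸1 : ∀ q n .{{_ : ℕ.NonZero q}} → suc(q ** n ∸ 1) ≡ q ** n
suc-^∸1 q n = N.m+[n∸m]≡n(N.m^n>0 q n)

^∸1-∣ : ∀ q a b .{{_ : ℕ.NonZero q}} → q ** a ∸ 1 ∣ q ** (a · b) ∸ 1
^∸1-∣ q a zero = subst(λ z → q ** a ∸ 1 ∣ q ** z ∸ 1)(sym(N.*-zeroʳ a))(divides 0 refl)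
^∸1-∣ q a(suc b) = subst(x ∣_)(sym(cong(λ z → q ** z ∸ 1)(N.*-suc a b) ∙ cong(_∸ 1)(N.^-distribˡ-+-* q a(a · b)) ∙ cong₂(λ u v → u · v ∸ 1)(sym(suc-^∸1 q a))(sym(suc-^∸1 q(a · b)))))
 (∣m∣n⇒∣m+n(^∸1-∣ q a b)(m∣m*n(suc(q ** (a · b) ∸ 1))))
 where x = q ** a ∸ 1

-- `p n` is the q-factorial without its denominators. P₁ and P₂ collect its factors with odd and
-- with even exponents, the products that appear in A and in B.
module QFactorials (q : ℕ) .{{_ : ℕ.NonZero q}} where
 p P₁ P₂ : ℕ → ℕ
 p n = prodFrom1 n(λ j → q ** j ∸ 1)
 P₁ n = prodFrom1 n(λ j → q ** (2 · j ∸ 1) ∸ 1)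
 P₂ n = prodFrom1 n(λ j → q ** (2 · j) ∸ 1)

 private
  x∸ : ℕ → ℕ
  x∸ n = q ** n ∸ 1

 P₁-suc : ∀ k → P₁(suc k) ≡ P₁ k · x∸(suc(2 · k))
 P₁-suc k = cong(λ z → P₁ k · x∸ z)(N.+-suc k(k ∔ 0))

 p-double : ∀ k → p(2 · k) ≡ P₁ k · P₂ k
 p-double zero = refl
 p-double(suc k) = cong p(N.*-suc 2 k) ∙ cong₂(λ u v → u · x∸(suc(2 · k)) · x∸ v)(p-double k)(sym(N.*-suc 2 k)) ∙ l(P₁ k)(P₂ k)(x∸(suc(2 · k)))(x∸(2 · suc k)) ∙ cong(_· P₂(suc k))(sym(P₁-suc k))
  where
  l : ∀ a b x y → a · b · x · y ≡ a · x · (b · y)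
  l = ringℕ

 p-double+1 : ∀ k → p(suc(2 · k)) ≡ P₁(suc k) · P₂ k
 p-double+1 k = cong(_· x∸(suc(2 · k)))(p-double k) ∙ l(P₁ k)(P₂ k)(x∸(suc(2 · k))) ∙ cong(_· P₂ k)(sym(P₁-suc k))
  where
  l : ∀ a b x → a · b · x ≡ a · x · b
  l = ringℕ

 p>0 : 2 ≤ q → ∀ n → 0 < p n
 p>0 q≥2 zero = s≤s z≤n
 p>0 q≥2(suc n) = N.*-mono-<(p>0 q≥2 n)(N.≤-pred(N.≤-trans(N.≤-trans q≥2(N.m≤m*n q(q ** n) {{N.m^n≢0 q n}}))(N.≤-reflexive(sym(suc-^∸1 q(suc n))))))

 divℕ-exact : ∀ {x d} → .{{ℕ.NonZero d}} → d ∣ x → divℕ x d · d ≡ x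
 divℕ-exact {x} {suc d} d∣x = m/n*n≡m d∣x

 module _ (q≥2 : 2 ≤ q) where
  private
   nz : ∀ n → ℕ.NonZero(p n)
   nz n = ℕ.>-nonZero(p>0 q≥2 n)

  gauss-0 : ∀ s → 1 · (p s · p 0) ≡ p(s ∔ 0)
  gauss-0 s = l(p s) ∙ cong p(sym(N.+-identityʳ s))
   where
   l : ∀ a → 1 · (a · 1) ≡ a
   l = ringℕ

  gauss-1 : ∀ s → gauss q(s ∔ 1) 1 · (p s · p 1) ≡ p(s ∔ 1)
  gauss-1 s = l(gauss q(s ∔ 1) 1)(p s)(p 1) ∙ cong(p s ·_)(divℕ-exact {x = 1 · x∸(s ∔ 1)} {{nz 1}} (subst₂ _∣_ (sym(N.*-identityˡ(x∸ 1)))(cong x∸(N.*-identityˡ(s ∔ 1)) ∙ sym(N.*-identityˡ(x∸(s ∔ 1))))(^∸1-∣ q 1(s ∔ 1))) ∙ N.*-identityˡ _ ∙ cong x∸(N.+-comm s 1)) ∙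
    cong p(N.+-comm 1 s)
   where
   l : ∀ g a b → g · (a · b) ≡ a · (g · b)
   l = ringℕ

  -- `gauss` is a truncated quotient, so divisibility has to be supplied. It is a hypothesis because
  -- the parity of s decides which of the two factors of the numerator is divisible by q² - 1.
  gauss-2 : ∀ s → x∸ 2 · x∸ 1 ∣ x∸(suc(suc s)) · x∸(suc s) → gauss q(s ∔ 2) 2 · (p s · p 2) ≡ p(s ∔ 2)
  gauss-2 s dv = l(gauss q(s ∔ 2) 2)(p s)(x∸ 1)(x∸ 2) ∙ cong(p s ·_)(divℕ-exact {x = top} {d = 1 · x∸ 2 · x∸ 1} {{subst ℕ.NonZero(l₂(x∸ 1)(x∸ 2))(nz 2)}} (subst₂ _∣_ (cong(_· x∸ 1)(sym(N.*-identityˡ(x∸ 2))))(sym top≡) dv) ∙ top≡) ∙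
   l₃(p s)(x∸(suc s))(x∸(suc(suc s))) ∙ cong p(N.+-comm 2 s)
   where
   top = 1 · x∸(s ∔ 2) · x∸(s ∔ 2 ∸ 1)
   top≡ : top ≡ x∸(suc(suc s)) · x∸(suc s)
   top≡ = cong₂ _·_ (N.*-identityˡ _ ∙ cong x∸(N.+-comm s 2))(cong(λ z → x∸(z ∸ 1))(N.+-comm s 2))
   l : ∀ g a x y → g · (a · (1 · x · y)) ≡ a · (g · (1 · y · x))
   l = ringℕ
   l₂ : ∀ x y → 1 · x · y ≡ 1 · y · x
   l₂ = ringℕ
   l₃ : ∀ a x y → a · (y · x) ≡ a · x · y
   l₃ = ringℕ

-- The order of Q and the passage from Q to the double coset

module Evaluation (𝒟 : FieldData)(s t : ℕ) where
 open FieldArithmetic 𝒟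
 open Characters 𝒟 using (q-nonZero; K-0; θ₀; ∑SO)
 open LinearAlgebra 𝒟 using (_⊛_; Trᵃ; ⊛-congˡ; Trᵃ-cong)
 open SymmetricSums 𝒟 using (gl; gl-0; gl-suc; module GaussSum)
 open GeneralLinear 𝒟 using (KGL)
 private
  m = s ∔ t
 open QGroup 𝒟 m using (InQ-cong; InQ?; d; part; p1; p2; p3; σperm; ρ)
 open Cosets 𝒟 m s using (∑ᴽ; ∑ᴽ-cong; σs; c; trace-id; trace-ρ)
 open Cosets 𝒟 m 0 using (σ⊛; ⊛σ) renaming (conj to conj₀; c to c₀; σs to σs₀)
 open CosetSums 𝒟 s t using (module TraceSum)
 open StabiliserOrder 𝒟 using (stabiliser)

 open QFactorials q

 q≥2 : 2 ≤ q
 q≥2 = subst(2 ≤_)(sym q≡2*2^)(N.*-monoʳ-≤ 2(N.m^n>0 2(ℕ.pred r)))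

 pos-x∸ : ∀ n → pos(q ** n ∸ 1) ≡ Q ^ n - 1ℤ
 pos-x∸ n = l(pos(q ** n ∸ 1)) ∙ cong(_- 1ℤ)(cong pos(suc-^∸1 q n) ∙ pos-^ q n)
  where
  l : ∀ x → x ≡ 1ℤ + x - 1ℤ
  l = ring

 gl≡ : ∀ n → gl n ≡ Q ^ tri n * pos(p n)
 gl≡ zero = gl-0
 gl≡(suc n) = gl-suc n ∙ cong₂(λ u v → u * (Q ^ n * v))(sym(pos-x∸(suc n)))(gl≡ n) ∙ l(pos(q ** suc n ∸ 1))(Q ^ n)(Q ^ tri n)(pos(p n)) ∙
   cong₂ _*_ (sym(Z.^-distribˡ-+-* Q n(tri n)))(sym(Z.pos-*(p n)(q ** suc n ∸ 1)))
  where
  l : ∀ x a b y → x * (a * (b * y)) ≡ a * b * (y * x)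
  l = ring

 Ω : ℕ
 Ω = (q ∔ 1) · q ** (2 · m ∔ 2 · tri m) · p m

 2* : ∀ n → Q ^ (2 · n) ≡ Q ^ n * Q ^ n
 2* n = cong(λ z → Q ^ (n ∔ z))(N.+-identityʳ n) ∙ Z.^-distribˡ-+-* Q n n

 pos-Ω : pos Ω ≡ (Q + 1ℤ) * (Q ^ m * Q ^ m * (Q ^ tri m * Q ^ tri m)) * pos(p m)
 pos-Ω = Z.pos-*((q ∔ 1) · q ** (2 · m ∔ 2 · tri m))(p m) ∙ cong(_* pos(p m))(Z.pos-*(q ∔ 1)(q ** (2 · m ∔ 2 · tri m)) ∙ cong((Q + 1ℤ) *_)(pos-^ q(2 · m ∔ 2 · tri m) ∙ Z.^-distribˡ-+-* Q(2 · m)(2 · tri m) ∙ cong₂ _*_ (2* m)(2*(tri m))))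

 -- The stabiliser formula for s = 0: then σ is the identity and Q ∩ σQσ is Q.
 order : ∑ᴽ(λ _ → 1ℤ) ≡ pos Ω
 order = begin
  _ ≡⟨ ∑ᴽ-cong(λ w wQ → sym(χ-yes(InQ?(conj₀ w))(InQ-cong(λ x y → sym(σ⊛(w ⊛ σs₀) x y ∙ ⊛σ w _ y ∙ cong₂ w(σ₀ x)(σ₀ y))) wQ))) ⟩
  c₀ ≡⟨ stabiliser 0 m ⟩
  (Q + 1ℤ) * ((Q ^ m * Q ^ m) * (1ℤ * Q ^ tri m)) * (1ℤ ^ m * (gl 0 * gl m)) ≡⟨ cong((Q + 1ℤ) * ((Q ^ m * Q ^ m) * (1ℤ * Q ^ tri m)) *_)(cong₂ _*_ (Z.^-zeroˡ m)(cong₂ _*_ gl-0(gl≡ m))) ⟩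
  (Q + 1ℤ) * ((Q ^ m * Q ^ m) * (1ℤ * Q ^ tri m)) * (1ℤ * (1ℤ * (Q ^ tri m * pos(p m)))) ≡⟨ l(Q + 1ℤ)(Q ^ m * Q ^ m)(Q ^ tri m)(pos(p m)) ∙ sym pos-Ω ⟩
  _ ∎
  where
  σ₀ : ∀ x → σperm 0 x ≡ x
  σ₀ x with part x
  ... | p1 _ = refl
  ... | p2 _ = refl
  ... | p3 _ = refl
  l : ∀ k v T y → k * (v * (1ℤ * T)) * (1ℤ * (1ℤ * (T * y))) ≡ k * (v * (T * T)) * y
  l = ring

 Ω≢0 : ℕ.NonZero Ω
 Ω≢0 = ℕ.>-nonZero(N.*-mono-<(N.*-mono-<(N.m≤n+m 1 q)(N.m^n>0 q(2 · m ∔ 2 · tri m)))(p>0 q≥2 m))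

 -- W is the part of the character sum that does not depend on a. From cA = |Q| W and W B = |Q|
 -- follows c A B = |Q|², which also shows that c and A are nonzero. Cancelling c gives the size and
 -- the character values.
 module Formula (A B g W : ℕ)(g-eq : g · (p s · p t) ≡ p m)(A-eq : A ≡ q ** (2 · s ∔ tri s) · (g · W))(B-eq : W · B ≡ Ω) where
  c*A : c * pos A ≡ pos Ω * pos W
  c*A = begin
   _ ≡⟨ cong₂ _*_ (stabiliser s t ∙ cong₂(λ u v → (Q + 1ℤ) * (U * U * (u * Tt)) * (y * v))(Z.^-*-assoc Q t s ∙ cong(Q ^_)(N.*-comm t s) ∙ sym(Z.^-*-assoc Q s t))(cong₂ _*_ (gl≡ s)(gl≡ t)))
    (cong pos A-eq ∙ Z.pos-*(q ** (2 · s ∔ tri s))(g · W) ∙ cong₂ _*_ (pos-^ q(2 · s ∔ tri s) ∙ Z.^-distribˡ-+-* Q(2 · s)(tri s) ∙ cong(_* Ts)(2* s))(Z.pos-* g W)) ⟩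
   (Q + 1ℤ) * (U * U * (y * Tt)) * (y * (Ts * pos(p s) * (Tt * pos(p t)))) * (V * V * Ts * (pos g * pos W)) ≡⟨ l(Q + 1ℤ) U V y Ts Tt(pos(p s))(pos(p t))(pos g)(pos W) ⟩
   (Q + 1ℤ) * (V * U * (V * U) * (Ts * Tt * y * (Ts * Tt * y))) * (pos g * (pos(p s) * pos(p t))) * pos W ≡⟨ cong(_* pos W)(cong₂ _*_ (cong((Q + 1ℤ) *_)(cong₂ _*_ (cong₂ _*_ (sym VU)(sym VU))(cong₂ _*_ (sym TT)(sym TT))))
    (cong(pos g *_)(sym(Z.pos-*(p s)(p t))) ∙ sym(Z.pos-* g(p s · p t)) ∙ cong pos g-eq) ∙ sym pos-Ω) ⟩
   _ ∎
   where
   U = Q ^ t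
   V = Q ^ s
   y = (Q ^ s) ^ t
   Ts = Q ^ tri s
   Tt = Q ^ tri t
   VU : Q ^ m ≡ V * U
   VU = Z.^-distribˡ-+-* Q s t
   TT : Q ^ tri m ≡ Ts * Tt * y
   TT = cong(Q ^_)(tri-+ s t) ∙ Z.^-distribˡ-+-* Q(tri s ∔ tri t)(s · t) ∙ cong₂ _*_ (Z.^-distribˡ-+-* Q(tri s)(tri t))(sym(Z.^-*-assoc Q s t))
   l : ∀ k U V y S T ps pt g W → k * (U * U * (y * T)) * (y * (S * ps * (T * pt))) * (V * V * S * (g * W)) ≡ k * (V * U * (V * U) * (S * T * y * (S * T * y))) * (g * (ps * pt)) * W
   l = ring

  cAB : c * (pos A * pos B) ≡ pos Ω * pos Ω
  cAB = sym(Z.*-assoc c(pos A)(pos B)) ∙ cong(_* pos B) c*A ∙ Z.*-assoc(pos Ω)(pos W)(pos B) ∙ cong(pos Ω *_)(sym(Z.pos-* W B) ∙ cong pos B-eq)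

  Ω²≢0 : pos Ω * pos Ω ≢ 0ℤ
  Ω²≢0 e = ℕ.≢-nonZero⁻¹(Ω · Ω) {{N.m*n≢0 Ω Ω {{Ω≢0}} {{Ω≢0}}}} (Z.+-injective(Z.pos-* Ω Ω ∙ e))

  A≢0 : ℕ.NonZero A
  A≢0 = ℕ.≢-nonZero(λ e → Ω²≢0(sym cAB ∙ cong(λ z → c * (pos z * pos B)) e ∙ cong(c *_)(Z.*-zeroˡ(pos B)) ∙ Z.*-zeroʳ c))

  c-cancel : ∀ {x y} → c * x ≡ c * y → x ≡ y
  c-cancel {x} {y} = Z.*-cancelˡ-≡ c x y {{ℤ.≢-nonZero(λ e → Ω²≢0(sym cAB ∙ cong(_* (pos A * pos B)) {x = c} e ∙ Z.*-zeroˡ(pos A * pos B)))}}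

  module _ (L : List(Mat d d))(tr' : Mat d d → Fq)(coset : ∀ (φ : Fq → ℤ) → c * ∑ L(λ g → φ(Tr g)) ≡ ∑ᴽ(λ _ → 1ℤ) * ∑ᴽ λ w → φ(tr' w)) where
   size-formula : length L ≡ A · B
   size-formula = Z.+-injective(sym(∑-length L) ∙ c-cancel(coset(λ _ → 1ℤ) ∙ cong₂ _*_ order order ∙ sym cAB) ∙ sym(Z.pos-* A B))

   character-formula : ∀ a V → ∑ᴽ(λ w → λ'(a ⊙ tr' w)) ≡ pos W * V → ∑ L(λ g → λ'(a ⊙ Tr g)) ≡ pos A * V
   character-formula a V e = c-cancel(coset(λ z → λ'(a ⊙ z)) ∙ cong₂ _*_ order e ∙ sym(Z.*-assoc(pos Ω)(pos W) V) ∙ cong(_* V)(sym c*A) ∙ Z.*-assoc c(pos A) V)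

 module _ (a : Fq)(a≢0 : a ≢ 0#) where
  open GaussSum a a≢0 using (G)
  open TraceSum a a≢0 using (∑ᴽ-trace)

  private
   Y = Q ^ tri m * (Q ^ t * Q ^ t) * ((Q ^ s) ^ t * (G s * KGL a t))

  ∑ᴽ-trace-id : ∑ᴽ(λ w → λ'(a ⊙ Trᵃ(σs ⊛ (idM ⊛ w)))) ≡ - K a * Y
  ∑ᴽ-trace-id = ∑ᴽ-trace 1# _ (λ e → Trᵃ-cong(⊛-congˡ σs(⊛-congˡ idM e))) trace-id ∙ cong(_* Y)
   (∑-cong Fs(λ x → ∑-cong Fs λ y → cong(λ z → χ(θ₀ x y ≟ 1#) * λ'(a ⊙ z))(⊙-idˡ y)) ∙ ∑SO a ∙ cong(λ z → Q * z - K a)(χ-no(a ≟ 0#) a≢0) ∙ cong(_- K a)(Z.*-zeroʳ Q) ∙ Z.+-identityˡ(- K a))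

  ∑ᴽ-trace-ρ : ∑ᴽ(λ w → λ'(a ⊙ Trᵃ(σs ⊛ (ρ ⊛ w)))) ≡ (Q + 1ℤ) * Y
  ∑ᴽ-trace-ρ = ∑ᴽ-trace 0# _ (λ e → Trᵃ-cong(⊛-congˡ σs(⊛-congˡ ρ e))) trace-ρ ∙ cong(_* Y)
   (∑-cong Fs(λ x → ∑-cong Fs λ y → cong(λ z → χ(θ₀ x y ≟ 1#) * λ' z)(cong(a ⊙_)(⊙-0ˡ y) ∙ ⊙-0ʳ a ∙ sym(⊙-0ˡ y))) ∙ ∑SO 0# ∙ cong₂(λ u v → Q * u - v)(χ-yes(0# ≟ 0#) refl) K-0 ∙ cong(_- -1ℤ)(Z.*-identityʳ Q))

-- Closed form of the Gauss sum and matching of the constants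

γ₀ : ℕ → ℕ
γ₀ k = 2 · tri k ∔ 4 · k

module GaussClosed (𝒟 : FieldData)(a : FiniteField.Carrier(FieldData.𝔽 𝒟))(a≢0 : a ≢ FiniteField.0#(FieldData.𝔽 𝒟)) where
 open FieldArithmetic 𝒟
 open Characters 𝒟 using (q-nonZero)
 open QFactorials q
 open SymmetricSums 𝒟 using (module GaussSum)
 open GaussSum a a≢0 using (G; G-0; G-1; G-suc-suc)

 pos-P₁-suc : ∀ k → pos(P₁(suc k)) ≡ pos(P₁ k) * (Q ^ suc(2 · k) - 1ℤ)
 pos-P₁-suc k = cong pos(P₁-suc k) ∙ Z.pos-*(P₁ k)(q ** suc(2 · k) ∸ 1) ∙ cong(pos(P₁ k) *_)(Evaluation.pos-x∸ 𝒟 0 0(suc(2 · k)))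

 γ₀-suc : ∀ k → Q ^ γ₀(suc k) ≡ Q ^ γ₀ k * (Q ^ suc(2 · k) * (Q * (Q * (Q * 1ℤ))))
 γ₀-suc k = cong(Q ^_)(l(tri k) k) ∙ Z.^-distribˡ-+-* Q(γ₀ k) _ ∙ cong(Q ^ γ₀ k *_)(Z.^-distribˡ-+-* Q(suc(2 · k)) 3)
  where
  l : ∀ x k → 2 · (k ∔ x) ∔ 4 · suc k ≡ 2 · x ∔ 4 · k ∔ (suc(2 · k) ∔ 3)
  l = ringℕ

 -- The recursion reaches back to both parities, so the two closed forms are proved together. The
 -- sign is that of (-1)^size.
 G-double : ∀ k → G(2 · k) ≡ 1ℤ * (Q ^ γ₀ k * pos(P₁ k))
 G-double+1 : ∀ k → G(suc(2 · k)) ≡ -1ℤ * (Q ^ suc(γ₀ k) * pos(P₁(suc k)))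

 G-double zero = G-0
 G-double(suc k) = begin
  _ ≡⟨ cong G(N.*-suc 2 k) ∙ G-suc-suc(2 · k) ∙ cong₂(λ u v → (X - 1ℤ) * (X * (Q * Q * u)) + (Q - 1ℤ) * (X * (- Q * v)))(G-double k)(G-double+1 k ∙ cong(λ z → -1ℤ * (Q ^ suc(γ₀ k) * z))(pos-P₁-suc k)) ⟩
  _ ≡⟨ l Q X(Q ^ γ₀ k)(pos(P₁ k)) ⟩
  1ℤ * (Q ^ γ₀ k * (X * (Q * (Q * (Q * 1ℤ)))) * (pos(P₁ k) * (X - 1ℤ))) ≡⟨ sym(cong₂(λ u v → 1ℤ * (u * v))(γ₀-suc k)(pos-P₁-suc k)) ⟩
  _ ∎
  where
  X = Q ^ suc(2 · k)
  l : ∀ q X E P → (X - 1ℤ) * (X * (q * q * (1ℤ * (E * P)))) + (q - 1ℤ) * (X * (- q * (-1ℤ * (q * E * (P * (X - 1ℤ)))))) ≡ 1ℤ * (E * (X * (q * (q * (q * 1ℤ)))) * (P * (X - 1ℤ)))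
  l = ring

 G-double+1 zero = G-1 ∙ l Q ∙ cong(λ z → -1ℤ * (Q * 1ℤ * z))(sym(pos-P₁-suc 0))
  where
  l : ∀ q → - (q * (q - 1ℤ)) ≡ -1ℤ * (q * 1ℤ * (1ℤ * (q * 1ℤ - 1ℤ)))
  l = ring
 G-double+1(suc k) = begin
  _ ≡⟨ cong(G ∘ suc)(N.*-suc 2 k) ∙ G-suc-suc(suc(2 · k)) ∙ cong₂(λ u v → (Q * X - 1ℤ) * (Q * X * (Q * Q * u)) + (Q - 1ℤ) * (Q * X * (- Q * v)))(G-double+1 k)(cong G(sym(N.*-suc 2 k)) ∙ G-double(suc k) ∙ cong(λ z → 1ℤ * (z * pos(P₁(suc k))))(γ₀-suc k)) ⟩
  _ ≡⟨ l Q X(Q ^ γ₀ k)(pos(P₁(suc k))) ⟩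
  -1ℤ * (Q * (Q ^ γ₀ k * (X * (Q * (Q * (Q * 1ℤ))))) * (pos(P₁(suc k)) * (Q * (Q * X) - 1ℤ))) ≡⟨ sym(cong₂(λ u v → -1ℤ * (Q * u * v))(γ₀-suc k)(pos-P₁-suc(suc k) ∙ cong(λ z → pos(P₁(suc k)) * (Q ^ suc z - 1ℤ))(N.*-suc 2 k))) ⟩
  _ ∎
  where
  X = Q ^ suc(2 · k)
  l : ∀ q X E P → (q * X - 1ℤ) * (q * X * (q * q * (-1ℤ * (q * E * P)))) + (q - 1ℤ) * (q * X * (- q * (1ℤ * (E * (X * (q * (q * (q * 1ℤ)))) * P)))) ≡ -1ℤ * (q * (E * (X * (q * (q * (q * 1ℤ))))) * (P * (q * (q * X) - 1ℤ)))
  l = ring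

-- With n = 2k + c and k² = 2 tri k + k the exponents become linear in `tri k` and k. The truncated
-- subtractions and the division by 4 are then exact.
quotient-A : ∀ {n} c k v w (a : ℕ → ℕ → ℕ) → n ≡ 2 · k ∔ c → (∀ x k → 5 · (8 · x ∔ (4 ∔ 4 · c) · k ∔ c · c) ≡ v · (2 · k ∔ c) ∔ (w ∔ a x k · 4)) →
 (5 · n · n ∸ v · n ∸ w) ℕ./ 4 ≡ a(tri k) k
quotient-A c k v w a refl h = cong(ℕ._/ 4)(cong(λ z → z ∸ v · (2 · k ∔ c) ∸ w)(l c k ∙ cong(λ z → 5 · (4 · z ∔ 4 · c · k ∔ c · c))(square-tri k) ∙ l' c k(tri k) ∙ h(tri k) k) ∙
  cong(_∸ w)(N.m+n∸m≡n(v · (2 · k ∔ c)) _) ∙ N.m+n∸m≡n w _) ∙ m*n/n≡m(a(tri k) k) 4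
 where
 l : ∀ c k → 5 · (2 · k ∔ c) · (2 · k ∔ c) ≡ 5 · (4 · (k · k) ∔ 4 · c · k ∔ c · c)
 l = ringℕ
 l' : ∀ c k x → 5 · (4 · (2 · x ∔ k) ∔ 4 · c · k ∔ c · c) ≡ 5 · (8 · x ∔ (4 ∔ 4 · c) · k ∔ c · c)
 l' = ringℕ

quotient-B : ∀ {x} k → x ≡ 2 · k → (x · x) ℕ./ 4 ≡ 2 · tri k ∔ k
quotient-B k refl = cong(ℕ._/ 4)(l k) ∙ m*n/n≡m(k · k) 4 ∙ square-tri k
 where
 l : ∀ k → 2 · k · (2 · k) ≡ k · k · 4
 l = ringℕ

half : ∀ {x} k → x ≡ 2 · k → x ℕ./ 2 ≡ k
half k refl = cong(ℕ._/ 2)(N.*-comm 2 k) ∙ m*n/n≡m k 2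

module Assembly (𝒟 : FieldData)(s t : ℕ)(σ₁ : ℤ)(P γ' x : ℕ)(tri-s : tri s ≡ x)
  (G-eq : ∀ a (a≢0 : a ≢ FiniteField.0#(FieldData.𝔽 𝒟)) → SymmetricSums.GaussSum.G 𝒟 a a≢0 s ≡ σ₁ * (pos(FiniteField.size(FieldData.𝔽 𝒟)) ^ γ' * pos P)) where
 open FieldArithmetic 𝒟
 open Characters 𝒟 using (q-nonZero)
 open GeneralLinear 𝒟 using (KGL)
 open QFactorials q
 open Evaluation 𝒟 s t using (Ω; module Formula; ∑ᴽ-trace-id; ∑ᴽ-trace-ρ)
 private
  m = s ∔ t
  𝑇 = Q ^ tri m
  E = Q ^ γ'
 open Blocks m using (d; inDC; ρ)
 open Cosets 𝒟 m s using (module Id; module Rho; σs)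
 open LinearAlgebra 𝒟 using (_⊛_; Trᵃ)

 tri-m : tri m ≡ x ∔ tri t ∔ s · t
 tri-m = tri-+ s t ∙ cong(λ z → z ∔ tri t ∔ s · t) tri-s

 -- The equation ω ω' = q + 1 records where the factor |SO⁻(2,q)| of |Q| goes. With ρ it occurs in
 -- the character sum and belongs to A, without ρ it stays in B. The number f is the power of q
 -- produced by the blocks of size t, and R completes P to the product of all factors of `p m`.
 module Numbers (f A B ω ω' g R a b : ℕ)(ωω' : ω · ω' ≡ q ∔ 1)(g-eq : g · (p s · p t) ≡ p m)
   (A-eq : A ≡ ω · q ** a · (g · P))(B-eq : B ≡ ω' · q ** b · R)(PR : P · R ≡ p m)
   (a-eq : a ≡ 2 · s ∔ x ∔ (x ∔ tri t ∔ s · t ∔ (f ∔ γ')))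
   (b-eq : x ∔ tri t ∔ s · t ∔ (f ∔ γ') ∔ b ≡ 2 · m ∔ 2 · (x ∔ tri t ∔ s · t)) where
  w = tri m ∔ (f ∔ γ')
  W = ω · q ** w · P

  A-eq' : A ≡ q ** (2 · s ∔ tri s) · (g · W)
  A-eq' = A-eq ∙ cong(λ z → ω · z · (g · P))(cong(q **_)(a-eq ∙ cong₂(λ u v → 2 · s ∔ u ∔ (v ∔ (f ∔ γ')))(sym tri-s)(sym tri-m)) ∙ N.^-distribˡ-+-* q(2 · s ∔ tri s) w) ∙ l ω(q ** (2 · s ∔ tri s))(q ** w) g P
   where
   l : ∀ o u v g P → o · (u · v) · (g · P) ≡ u · (g · (o · v · P))
   l = ringℕ

  B-eq' : W · B ≡ Ω
  B-eq' = cong(W ·_) B-eq ∙ l ω ω'(q ** w)(q ** b) P R ∙ cong₂ _·_ (cong₂ _·_ ωω'(sym(N.^-distribˡ-+-* q w b) ∙ cong(q **_)(cong(λ z → z ∔ (f ∔ γ') ∔ b) tri-m ∙ b-eq ∙ cong(λ z → 2 · m ∔ 2 · z)(sym tri-m)))) PR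
   where
   l : ∀ o o' u v P R → o · u · P · (o' · v · R) ≡ o · o' · (u · v) · (P · R)
   l = ringℕ

  open Formula A B g W g-eq A-eq' B-eq'

  pos-W : pos W ≡ pos ω * (𝑇 * (Q ^ f * E)) * pos P
  pos-W = Z.pos-*(ω · q ** w) P ∙ cong(_* pos P)(Z.pos-* ω(q ** w) ∙ cong(pos ω *_)(pos-^ q w ∙ Z.^-distribˡ-+-* Q(tri m)(f ∔ γ') ∙ cong(𝑇 *_)(Z.^-distribˡ-+-* Q f γ')))

  private
   dc : Mat d d → List(Mat d d)
   dc pre = filterᵇ(inDC pre s)(Mats d d)
   tr₁ : Mat d d → Mat d d → Fq
   tr₁ pre w = Trᵃ(σs ⊛ (pre ⊛ w))
   Z : Fq → ℤ
   Z a = Q ^ t * Q ^ t * ((Q ^ s) ^ t * (σ₁ * KGL a t))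

  W*V : ∀ {a} (a≢0 : a ≢ 0#) k V → k * Z a ≡ pos ω * Q ^ f * V → k * (𝑇 * (Q ^ t * Q ^ t) * ((Q ^ s) ^ t * (SymmetricSums.GaussSum.G 𝒟 a a≢0 s * KGL a t))) ≡ pos W * V
  W*V {a} a≢0 k V e = begin
   _ ≡⟨ cong(λ z → k * (𝑇 * (Q ^ t * Q ^ t) * ((Q ^ s) ^ t * (z * KGL a t))))(G-eq a a≢0) ⟩
   k * (𝑇 * (Q ^ t * Q ^ t) * ((Q ^ s) ^ t * (σ₁ * (E * pos P) * KGL a t))) ≡⟨ l k 𝑇(Q ^ t)((Q ^ s) ^ t) σ₁ E(pos P)(KGL a t) ⟩
   𝑇 * E * pos P * (k * Z a) ≡⟨ cong(𝑇 * E * pos P *_) e ∙ l'(pos ω) 𝑇(Q ^ f) E(pos P) V ⟩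
   pos ω * (𝑇 * (Q ^ f * E)) * pos P * V ≡⟨ cong(_* V)(sym pos-W) ⟩
   _ ∎
   where
   l : ∀ k 𝑇 u y s E P X → k * (𝑇 * (u * u) * (y * (s * (E * P) * X))) ≡ 𝑇 * E * P * (k * (u * u * (y * (s * X))))
   l = ring
   l' : ∀ o 𝑇 F E P V → 𝑇 * E * P * (o * F * V) ≡ o * (𝑇 * (F * E)) * P * V
   l' = ring

  result-id : ∀ {s'} → s' ≡ s → (V : Fq → ℤ) → (∀ a → a ≢ 0# → - K a * Z a ≡ pos ω * Q ^ f * V a) → let L = filterᵇ(inDC idM s')(Mats d d) in
   length L ≡ A · B × ℕ.NonZero A × (∀ a → a ≢ 0# → ∑ L(λ g → λ'(a ⊙ Tr g)) ≡ pos A * V a)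
  result-id refl V e = size-formula(dc idM)(tr₁ idM) Id.∑-coset-trace , A≢0 , λ a a≢0 → character-formula(dc idM)(tr₁ idM) Id.∑-coset-trace a(V a)(∑ᴽ-trace-id a a≢0 ∙ W*V a≢0(- K a)(V a)(e a a≢0))

  result-ρ : ∀ {s'} → s' ≡ s → (V : Fq → ℤ) → (∀ a → a ≢ 0# → (Q + 1ℤ) * Z a ≡ pos ω * Q ^ f * V a) → let L = filterᵇ(inDC ρ s')(Mats d d) in
   length L ≡ A · B × ℕ.NonZero A × (∀ a → a ≢ 0# → ∑ L(λ g → λ'(a ⊙ Tr g)) ≡ pos A * V a)
  result-ρ refl V e = size-formula(dc ρ)(tr₁ ρ) Rho.∑-coset-trace , A≢0 , λ a a≢0 → character-formula(dc ρ)(tr₁ ρ) Rho.∑-coset-trace a(V a)(∑ᴽ-trace-ρ a a≢0 ∙ W*V a≢0(Q + 1ℤ)(V a)(e a a≢0))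

-- The eight families of double cosets

module Cases (𝒟 : FieldData) where
 open FieldArithmetic 𝒟
 open Characters 𝒟 using (q-nonZero; K²≡q+K₂)
 open QFactorials q
 open GeneralLinear 𝒟 using (KGL; KGL-0; KGL-1; KGL-2)

 -- The quotient S(a)/A. In the cases 2 and 4 it is written with K₂, after K² = q + K₂.
 value : Sign → Idx → Fq → ℤ
 value ε i1 a = sgn ε * K a
 value ε i2 a = - sgn ε * (Q + K₂ a)
 value ε i3 a = sgn ε * K a
 value ε i4 a = - sgn ε * (Q * Q + K₂ a)

 Result : Sign → Idx → ℕ → Set
 Result ε i m = let open Pieces ε i m in (N ≡ A · B) × ℕ.NonZero A × (∀ a → a ≢ 0# → ∑(DC i)(λ g → λ'(a ⊙ Tr g)) ≡ pos A * value ε i a)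

 private
  x∸ : ℕ → ℕ
  x∸ n = q ** n ∸ 1

  q≥2 : 2 ≤ q
  q≥2 = Evaluation.q≥2 𝒟 0 0

  +1 : ∀ n → n ∔ 1 ≡ suc n
  +1 n = N.+-comm n 1

 module Even k t = Assembly 𝒟(2 · k) t 1ℤ(P₁ k)(γ₀ k)(4 · tri k ∔ k)(tri-double k)(λ a a≢0 → GaussClosed.G-double 𝒟 a a≢0 k)
 module Odd k t = Assembly 𝒟(suc(2 · k)) t -1ℤ(P₁(suc k))(suc(γ₀ k))(2 · k ∔ (4 · tri k ∔ k))(cong(2 · k ∔_)(tri-double k))(λ a a≢0 → GaussClosed.G-double+1 𝒟 a a≢0 k)

 eval-1 : ∀ σ a → - K a * (1ℤ * 1ℤ * (1ℤ * (σ * KGL a 0))) ≡ 1ℤ * 1ℤ * (- σ * K a)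
 eval-1 σ a = cong(λ z → - K a * (1ℤ * 1ℤ * (1ℤ * (σ * z))))(KGL-0 a) ∙ l σ(K a)
  where
  l : ∀ σ k → - k * (1ℤ * 1ℤ * (1ℤ * (σ * 1ℤ))) ≡ 1ℤ * 1ℤ * (- σ * k)
  l = ring

 eval-2 : ∀ σ {a} → a ≢ 0# → ∀ v → - K a * (Q * 1ℤ * (Q * 1ℤ) * (v * 1ℤ * (σ * KGL a 1))) ≡ 1ℤ * (Q * (Q * v)) * (- σ * (Q + K₂ a))
 eval-2 σ {a} na v = cong(λ z → - K a * (Q * 1ℤ * (Q * 1ℤ) * (v * 1ℤ * (σ * z))))(KGL-1 na) ∙ l σ(K a) Q v ∙ cong(λ z → 1ℤ * (Q * (Q * v)) * (- σ * z))(K²≡q+K₂ na)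
  where
  l : ∀ σ k q v → - k * (q * 1ℤ * (q * 1ℤ) * (v * 1ℤ * (σ * k))) ≡ 1ℤ * (q * (q * v)) * (- σ * (k * k))
  l = ring

 eval-3 : ∀ σ {a} → a ≢ 0# → ∀ v → (Q + 1ℤ) * (Q * 1ℤ * (Q * 1ℤ) * (v * 1ℤ * (σ * KGL a 1))) ≡ (Q + 1ℤ) * (Q * (Q * v)) * (σ * K a)
 eval-3 σ {a} na v = cong(λ z → (Q + 1ℤ) * (Q * 1ℤ * (Q * 1ℤ) * (v * 1ℤ * (σ * z))))(KGL-1 na) ∙ l σ(K a) Q v
  where
  l : ∀ σ k q v → (q + 1ℤ) * (q * 1ℤ * (q * 1ℤ) * (v * 1ℤ * (σ * k))) ≡ (q + 1ℤ) * (q * (q * v)) * (σ * k)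
  l = ring

 -- The sum over GL₂ is q(K² + q² - q) = q(K₂ + q²). Its factor q joins q^(2t) and q^(st) with t =
 -- 2, which makes the exponent 5 + 2s.
 eval-4 : ∀ σ {a} → a ≢ 0# → ∀ s → (Q + 1ℤ) * (Q * (Q * 1ℤ) * (Q * (Q * 1ℤ)) * (Q ^ s * (Q ^ s * 1ℤ) * (σ * KGL a 2))) ≡ (Q + 1ℤ) * Q ^ (5 ∔ (s ∔ s)) * (σ * (Q * Q + K₂ a))
 eval-4 σ {a} na s = cong(λ z → (Q + 1ℤ) * (Q * (Q * 1ℤ) * (Q * (Q * 1ℤ)) * (v * (v * 1ℤ) * (σ * z))))(KGL-2 {a} na ∙ cong(λ z → Q * z + Q * Q * (Q - 1ℤ))(K²≡q+K₂ na)) ∙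
   l σ(K₂ a) Q v ∙ cong(λ z → (Q + 1ℤ) * (Q * (Q * (Q * (Q * (Q * z))))) * (σ * (Q * Q + K₂ a)))(sym(Z.^-distribˡ-+-* Q s s))
  where
  v = Q ^ s
  l : ∀ σ k q v → (q + 1ℤ) * (q * (q * 1ℤ) * (q * (q * 1ℤ)) * (v * (v * 1ℤ) * (σ * (q * (q + k) + q * q * (q - 1ℤ))))) ≡ (q + 1ℤ) * (q * (q * (q * (q * (q * (v * v)))))) * (σ * (q * q + k))
  l = ring

 private
  2k+2 : ∀ k → suc(2 · k) ∔ 1 ≡ 2 · suc k
  2k+2 = ringℕ

  2k+2' : ∀ k → 2 · k ∔ 2 ≡ 2 · suc k
  2k+2' = ringℕ

  PR-odd : ∀ k → P₁ k · (x∸(2 · k ∔ 1) · P₂ k) ≡ p(2 · k ∔ 1)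
  PR-odd k = l(P₁ k)(x∸(2 · k ∔ 1))(P₂ k) ∙ cong₂(λ u v → u · x∸ v)(sym(p-double k))(+1(2 · k)) ∙ cong p(sym(+1(2 · k)))
   where
   l : ∀ P x R → P · (x · R) ≡ P · R · x
   l = ringℕ

  dv₂ : ∀ k j → x∸ 2 · x∸ 1 ∣ x∸(suc(suc(2 · k))) · x∸ j
  dv₂ k j = *-pres-∣(subst(λ z → x∸ 2 ∣ x∸ z)(N.*-suc 2 k)(^∸1-∣ q 2(suc k)))(subst(λ z → x∸ 1 ∣ x∸ z)(N.*-identityˡ j)(^∸1-∣ q 1 j))

 -- n = 2k + 2, s = n - 1 odd and t = 0. The sign of the Gauss sum cancels that of -K.
 module Plus₁ (k : ℕ) where
  private
   n = suc(suc(2 · k) ∔ 0)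
   la : ∀ x k → 10 · x ∔ 14 · k ∔ 3 ≡ 2 · (suc(2 · k)) ∔ (2 · k ∔ (4 · x ∔ k)) ∔ ((2 · k ∔ (4 · x ∔ k)) ∔ 0 ∔ (suc(2 · k)) · 0 ∔ (0 ∔ (suc(2 · x ∔ 4 · k))))
   la = ringℕ
   lb : ∀ x k → (2 · k ∔ (4 · x ∔ k)) ∔ 0 ∔ (suc(2 · k)) · 0 ∔ (0 ∔ (suc(2 · x ∔ 4 · k))) ∔ (2 · (k ∔ x) ∔ suc k) ≡ 2 · (suc(2 · k) ∔ 0) ∔ 2 · ((2 · k ∔ (4 · x ∔ k)) ∔ 0 ∔ (suc(2 · k)) · 0)
   lb = ringℕ
   ln : ∀ k → suc(suc(2 · k) ∔ 0) ≡ 2 · k ∔ 2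
   ln = ringℕ
   lq : ∀ x k → 5 · (8 · x ∔ (4 ∔ 4 · 2) · k ∔ 2 · 2) ≡ 2 · (2 · k ∔ 2) ∔ (4 ∔ (10 · x ∔ 14 · k ∔ 3) · 4)
   lq = ringℕ
   a-eq = quotient-A 2 k 2 4(λ x k → 10 · x ∔ 14 · k ∔ 3)(ln k) lq ∙ la(tri k) k
   a = (5 · n · n ∸ 2 · n ∸ 4) ℕ./ 4
   h : (2 · k ∔ 0) ℕ./ 2 ≡ k
   h = half k(N.+-identityʳ(2 · k))
   lA : ∀ u v P → u · v · P ≡ 1 · u · (1 · (P · v))
   lA = ringℕ
  open Constants n q using (Aᶜ; Bᶜ)
  open Odd.Numbers k 0 0(Aᶜ plus i1)(Bᶜ plus i1) 1(q ∔ 1) 1(P₂ k) a((n · n) ℕ./ 4)(N.*-identityˡ(q ∔ 1))(gauss-0 q≥2(suc(2 · k)))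
   (cong(λ z → q ** a · x∸(suc(2 · k ∔ 0)) · P₁ z) h ∙ lA(q ** a)(x∸(suc(2 · k ∔ 0)))(P₁ k) ∙ cong(λ z → 1 · q ** a · (1 · z))(cong(λ z → P₁ k · x∸(suc z))(N.+-identityʳ(2 · k)) ∙ sym(P₁-suc k)))
   (cong(λ z → (q ∔ 1) · q ** ((n · n) ℕ./ 4) · P₂ z) h)(sym(p-double+1 k) ∙ cong p(sym(N.+-identityʳ(suc(2 · k)))))
   a-eq(cong(λ z → (2 · k ∔ (4 · tri k ∔ k)) ∔ 0 ∔ (suc(2 · k)) · 0 ∔ (0 ∔ (suc(2 · tri k ∔ 4 · k))) ∔ z)(quotient-B(suc k)(ln k ∙ sym(N.*-suc 2 k ∙ N.+-comm 2(2 · k)))) ∙ lb(tri k) k) using (result-id)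

  result : Result plus i1(suc(2 · k) ∔ 0)
  result = result-id(N.+-identityʳ(suc(2 · k)))(value plus i1)(λ a _ → eval-1 -1ℤ a)

 module Minus₁ (k : ℕ) where
  private
   n = suc(2 · k ∔ 0)
   la : ∀ x k → 10 · x ∔ 10 · k ≡ 2 · (2 · k) ∔ (4 · x ∔ k) ∔ ((4 · x ∔ k) ∔ 0 ∔ (2 · k) · 0 ∔ (0 ∔ (2 · x ∔ 4 · k)))
   la = ringℕ
   lb : ∀ x k → (4 · x ∔ k) ∔ 0 ∔ (2 · k) · 0 ∔ (0 ∔ (2 · x ∔ 4 · k)) ∔ (2 · x ∔ k) ≡ 2 · (2 · k ∔ 0) ∔ 2 · ((4 · x ∔ k) ∔ 0 ∔ (2 · k) · 0)
   lb = ringℕ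
   ln : ∀ k → suc(2 · k ∔ 0) ≡ 2 · k ∔ 1
   ln = ringℕ
   h : (2 · k ∔ 0) ℕ./ 2 ≡ k
   h = half k(N.+-identityʳ(2 · k))
   lq : ∀ k z → suc(2 · k) · suc(2 · k) ≡ suc(4 · (k · k) ∔ 4 · k)
   lq = ringℕ
   lq' : ∀ x k → 5 · (4 · (2 · x ∔ k) ∔ 4 · k) ≡ (10 · x ∔ 10 · k) · 4
   lq' = ringℕ
   lA : ∀ u P → u · P ≡ 1 · u · (1 · P)
   lA = ringℕ
   a = (5 · (n · n ∸ 1)) ℕ./ 4
   a-eq = cong(ℕ._/ 4)(cong(λ z → 5 · (z ∸ 1))(cong(λ z → suc z · suc z)(N.+-identityʳ(2 · k)) ∙ lq k 0) ∙ cong(λ z → 5 · (4 · z ∔ 4 · k))(square-tri k) ∙ lq'(tri k) k) ∙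
    m*n/n≡m(10 · tri k ∔ 10 · k) 4 ∙ la(tri k) k
  open Constants n q using (Aᶜ; Bᶜ)
  open Even.Numbers k 0 0(Aᶜ minus i1)(Bᶜ minus i1) 1(q ∔ 1) 1(P₂ k) a(((n ∸ 1) · (n ∸ 1)) ℕ./ 4)(N.*-identityˡ(q ∔ 1))(gauss-0 q≥2(2 · k))
   (cong(λ z → q ** a · P₁ z) h ∙ lA(q ** a)(P₁ k))
   (cong(λ z → (q ∔ 1) · q ** (((n ∸ 1) · (n ∸ 1)) ℕ./ 4) · P₂ z) h)(sym(p-double k) ∙ cong p(sym(N.+-identityʳ(2 · k))))
   a-eq(cong(λ z → (4 · tri k ∔ k) ∔ 0 ∔ (2 · k) · 0 ∔ (0 ∔ (2 · tri k ∔ 4 · k)) ∔ z)(quotient-B k(N.+-identityʳ(2 · k))) ∙ lb(tri k) k) using (result-id)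

  result : Result minus i1(2 · k ∔ 0)
  result = result-id(N.+-identityʳ(2 · k))(value minus i1)(λ a _ → eval-1 1ℤ a)

 -- n = 2k + 2, s = n - 2 even and t = 1. The two cases share the Gauss and Kloosterman factors, and
 -- differ in whether SO⁻(2,q) gives -K or q + 1.
 module Plus₂₃ (k : ℕ) where
  private
   n = suc(2 · k ∔ 1)
   la : ∀ x k → 10 · x ∔ 14 · k ∔ 2 ≡ 2 · (2 · k) ∔ (4 · x ∔ k) ∔ ((4 · x ∔ k) ∔ 0 ∔ (2 · k) · 1 ∔ (2 ∔ (2 · k) ∔ (2 · x ∔ 4 · k)))
   la = ringℕ
   lb : ∀ x k → (4 · x ∔ k) ∔ 0 ∔ (2 · k) · 1 ∔ (2 ∔ (2 · k) ∔ (2 · x ∔ 4 · k)) ∔ (2 · x ∔ k) ≡ 2 · (2 · k ∔ 1) ∔ 2 · ((4 · x ∔ k) ∔ 0 ∔ (2 · k) · 1)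
   lb = ringℕ
   ln : ∀ k → suc(2 · k ∔ 1) ≡ 2 · k ∔ 2
   ln = ringℕ
   lq : ∀ x k → 5 · (8 · x ∔ (4 ∔ 4 · 2) · k ∔ 2 · 2) ≡ 2 · (2 · k ∔ 2) ∔ (8 ∔ (10 · x ∔ 14 · k ∔ 2) · 4)
   lq = ringℕ
   a-eq = quotient-A 2 k 2 8(λ x k → 10 · x ∔ 14 · k ∔ 2)(ln k) lq ∙ la(tri k) k
   a = (5 · n · n ∸ 2 · n ∸ 8) ℕ./ 4
   h : (2 · k ∔ 1 ∸ 1) ℕ./ 2 ≡ k
   h = half k(N.m+n∸n≡m(2 · k) 1)
   lA : ∀ u g P → u · g · P ≡ 1 · u · (g · P)
   lA = ringℕ
   lA' : ∀ o u g P → o · u · g · P ≡ o · u · (g · P)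
   lA' = ringℕ
   lB : ∀ u x P → u · x · P ≡ 1 · u · (x · P)
   lB = ringℕ
   g = gauss q(2 · k ∔ 1) 1
   b = ((2 · k ∔ 1 ∸ 1) · (2 · k ∔ 1 ∸ 1)) ℕ./ 4
   b-eq = (cong(λ z → (4 · tri k ∔ k) ∔ 0 ∔ (2 · k) · 1 ∔ (2 ∔ (2 · k) ∔ (2 · tri k ∔ 4 · k)) ∔ z)(quotient-B k(N.m+n∸n≡m(2 · k) 1)) ∙ lb(tri k) k)
   PR : P₁ k · (x∸(2 · k ∔ 1) · P₂ k) ≡ p(2 · k ∔ 1)
   PR = PR-odd k
  open Constants n q using (Aᶜ; Bᶜ)
  open Even.Numbers k 1(2 ∔ (2 · k))(Aᶜ plus i2)(Bᶜ plus i2) 1(q ∔ 1) g((x∸(2 · k ∔ 1) · P₂ k)) a b(N.*-identityˡ(q ∔ 1))(gauss-1 q≥2(2 · k))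
   (cong(λ z → q ** a · g · P₁ z) h ∙ lA(q ** a) g(P₁ k))(cong(λ z → (q ∔ 1) · q ** b · x∸(2 · k ∔ 1) · P₂ z) h ∙ N.*-assoc((q ∔ 1) · q ** b) _ _) PR a-eq b-eq using (result-id)
  open Even.Numbers k 1(2 ∔ (2 · k))(Aᶜ plus i3)(Bᶜ plus i3)(q ∔ 1) 1 g((x∸(2 · k ∔ 1) · P₂ k)) a b(N.*-identityʳ(q ∔ 1))(gauss-1 q≥2(2 · k))
   (cong(λ z → (q ∔ 1) · q ** a · g · P₁ z) h ∙ lA'(q ∔ 1)(q ** a) g(P₁ k))(cong(λ z → q ** b · x∸(2 · k ∔ 1) · P₂ z) h ∙ lB(q ** b) _ _) PR a-eq b-eq using (result-ρ)

  result₂ : Result plus i2(2 · k ∔ 1)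
  result₂ = result-id(N.m+n∸n≡m(2 · k) 1)(value plus i2)(λ a na → eval-2 1ℤ na(Q ^ (2 · k)))

  result₃ : Result plus i3(2 · k ∔ 1)
  result₃ = result-ρ(N.m+n∸n≡m(2 · k) 1)(value plus i3)(λ a na → eval-3 1ℤ na(Q ^ (2 · k)))

 module Minus₂₃ (k : ℕ) where
  private
   n = suc(suc(2 · k) ∔ 1)
   la : ∀ x k → 10 · x ∔ 18 · k ∔ 7 ≡ 2 · (suc(2 · k)) ∔ (2 · k ∔ (4 · x ∔ k)) ∔ ((2 · k ∔ (4 · x ∔ k)) ∔ 0 ∔ (suc(2 · k)) · 1 ∔ (2 ∔ (suc(2 · k)) ∔ (suc(2 · x ∔ 4 · k))))
   la = ringℕ
   lb : ∀ x k → (2 · k ∔ (4 · x ∔ k)) ∔ 0 ∔ (suc(2 · k)) · 1 ∔ (2 ∔ (suc(2 · k)) ∔ (suc(2 · x ∔ 4 · k))) ∔ (2 · (k ∔ x) ∔ suc k) ≡ 2 · (suc(2 · k) ∔ 1) ∔ 2 · ((2 · k ∔ (4 · x ∔ k)) ∔ 0 ∔ (suc(2 · k)) · 1)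
   lb = ringℕ
   ln : ∀ k → suc(suc(2 · k) ∔ 1) ≡ 2 · k ∔ 3
   ln = ringℕ
   lq : ∀ x k → 5 · (8 · x ∔ (4 ∔ 4 · 3) · k ∔ 3 · 3) ≡ 4 · (2 · k ∔ 3) ∔ (5 ∔ (10 · x ∔ 18 · k ∔ 7) · 4)
   lq = ringℕ
   a-eq = quotient-A 3 k 4 5(λ x k → 10 · x ∔ 18 · k ∔ 7)(ln k) lq ∙ la(tri k) k
   a = (5 · n · n ∸ 4 · n ∸ 5) ℕ./ 4
   h : (suc(2 · k) ∔ 1) ℕ./ 2 ≡ suc k
   h = half(suc k)(2k+2 k)
   lA : ∀ u g P → u · g · P ≡ 1 · u · (g · P)
   lA = ringℕ
   lA' : ∀ o u g P → o · u · g · P ≡ o · u · (g · P)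
   lA' = ringℕ
   g = gauss q(suc(2 · k) ∔ 1) 1
   b = ((suc(2 · k) ∔ 1) · (suc(2 · k) ∔ 1)) ℕ./ 4
   b-eq = (cong(λ z → (2 · k ∔ (4 · tri k ∔ k)) ∔ 0 ∔ (suc(2 · k)) · 1 ∔ (2 ∔ (suc(2 · k)) ∔ (suc(2 · tri k ∔ 4 · k))) ∔ z)(quotient-B(suc k)(2k+2 k)) ∙ lb(tri k) k)
   PR : P₁(suc k) · P₂(suc k) ≡ p(suc(2 · k) ∔ 1)
   PR = sym(p-double(suc k)) ∙ cong p(sym(2k+2 k))
  open Constants n q using (Aᶜ; Bᶜ)
  open Odd.Numbers k 1(2 ∔ (suc(2 · k)))(Aᶜ minus i2)(Bᶜ minus i2) 1(q ∔ 1) g(P₂(suc k)) a b(N.*-identityˡ(q ∔ 1))(gauss-1 q≥2(suc(2 · k)))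
   (cong(λ z → q ** a · g · P₁ z) h ∙ lA(q ** a) g(P₁(suc k)))(cong(λ z → (q ∔ 1) · q ** b · P₂ z) h) PR a-eq b-eq using (result-id)
  open Odd.Numbers k 1(2 ∔ (suc(2 · k)))(Aᶜ minus i3)(Bᶜ minus i3)(q ∔ 1) 1 g(P₂(suc k)) a b(N.*-identityʳ(q ∔ 1))(gauss-1 q≥2(suc(2 · k)))
   (cong(λ z → (q ∔ 1) · q ** a · g · P₁ z) h ∙ lA'(q ∔ 1)(q ** a) g(P₁(suc k)))(cong(λ z → q ** b · P₂ z) h ∙ cong(_· P₂(suc k))(sym(N.*-identityˡ(q ** b)))) PR a-eq b-eq using (result-ρ)

  result₂ : Result minus i2(suc(2 · k) ∔ 1)
  result₂ = result-id(N.m+n∸n≡m(suc(2 · k)) 1)(value minus i2)(λ a na → eval-2 -1ℤ na(Q ^ (suc(2 · k))))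

  result₃ : Result minus i3(suc(2 · k) ∔ 1)
  result₃ = result-ρ(N.m+n∸n≡m(suc(2 · k)) 1)(value minus i3)(λ a na → eval-3 -1ℤ na(Q ^ (suc(2 · k))))

 -- n = 2k + 4, s = n - 3 odd and t = 2.
 module Plus₄ (k : ℕ) where
  private
   n = suc(suc(2 · k) ∔ 2)
   la : ∀ x k → 10 · x ∔ 22 · k ∔ 13 ≡ 2 · (suc(2 · k)) ∔ (2 · k ∔ (4 · x ∔ k)) ∔ ((2 · k ∔ (4 · x ∔ k)) ∔ 1 ∔ (suc(2 · k)) · 2 ∔ (5 ∔ ((suc(2 · k)) ∔ (suc(2 · k))) ∔ (suc(2 · x ∔ 4 · k))))
   la = ringℕ
   lb : ∀ x k → (2 · k ∔ (4 · x ∔ k)) ∔ 1 ∔ (suc(2 · k)) · 2 ∔ (5 ∔ ((suc(2 · k)) ∔ (suc(2 · k))) ∔ (suc(2 · x ∔ 4 · k))) ∔ (2 · (k ∔ x) ∔ suc k) ≡ 2 · (suc(2 · k) ∔ 2) ∔ 2 · ((2 · k ∔ (4 · x ∔ k)) ∔ 1 ∔ (suc(2 · k)) · 2)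
   lb = ringℕ
   ln : ∀ k → suc(suc(2 · k) ∔ 2) ≡ 2 · k ∔ 4
   ln = ringℕ
   lq : ∀ x k → 5 · (8 · x ∔ (4 ∔ 4 · 4) · k ∔ 4 · 4) ≡ 6 · (2 · k ∔ 4) ∔ (4 ∔ (10 · x ∔ 22 · k ∔ 13) · 4)
   lq = ringℕ
   a-eq = quotient-A 4 k 6 4(λ x k → 10 · x ∔ 22 · k ∔ 13)(ln k) lq ∙ la(tri k) k
   a = (5 · n · n ∸ 6 · n ∸ 4) ℕ./ 4
   h : (2 · k ∔ 2) ℕ./ 2 ≡ suc k
   h = half(suc k)(2k+2' k)
   lA : ∀ o u g P → o · u · g · P ≡ o · u · (g · P)
   lA = ringℕ
   lB : ∀ u x P → u · x · P ≡ 1 · u · (x · P)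
   lB = ringℕ
   g = gauss q(suc(2 · k) ∔ 2) 2
   b = ((2 · k ∔ 2) · (2 · k ∔ 2)) ℕ./ 4
  open Constants n q using (Aᶜ; Bᶜ)
  open Odd.Numbers k 2(5 ∔ ((suc(2 · k)) ∔ (suc(2 · k))))(Aᶜ plus i4)(Bᶜ plus i4)(q ∔ 1) 1 g(x∸(suc(2 · k ∔ 2)) · P₂(suc k)) a b(N.*-identityʳ(q ∔ 1))(gauss-2 q≥2(suc(2 · k))(subst(x∸ 2 · x∸ 1 ∣_)(N.*-comm(x∸(suc(suc(2 · k)))) _)(dv₂ k(suc(suc(suc(2 · k)))))))
   (cong(λ z → (q ∔ 1) · q ** a · g · P₁ z) h ∙ lA(q ∔ 1)(q ** a) g(P₁(suc k)))(cong(λ z → q ** b · x∸(suc(2 · k ∔ 2)) · P₂ z) h ∙ lB(q ** b) _ _)(cong(λ z → P₁(suc k) · (x∸ z · P₂(suc k)))(cong suc(2k+2' k) ∙ sym(+1(2 · suc k))) ∙ PR-odd(suc k) ∙ cong p(+1(2 · suc k) ∙ cong suc(sym(2k+2' k)))) a-eq(cong(λ z → (2 · k ∔ (4 · tri k ∔ k)) ∔ 1 ∔ (suc(2 · k)) · 2 ∔ (5 ∔ ((suc(2 · k)) ∔ (suc(2 · k))) ∔ (suc(2 · tri k ∔ 4 · k))) ∔ z)(quotient-B(suc k)(2k+2' k)) ∙ lb(tri k) k) using (result-ρ)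

  result : Result plus i4(suc(2 · k) ∔ 2)
  result = result-ρ(N.m+n∸n≡m(suc(2 · k)) 2)(value plus i4)(λ a na → eval-4 -1ℤ na(suc(2 · k)))

 module Minus₄ (k : ℕ) where
  private
   n = suc(2 · k ∔ 2)
   la : ∀ x k → 10 · x ∔ 18 · k ∔ 6 ≡ 2 · (2 · k) ∔ (4 · x ∔ k) ∔ ((4 · x ∔ k) ∔ 1 ∔ (2 · k) · 2 ∔ (5 ∔ ((2 · k) ∔ (2 · k)) ∔ (2 · x ∔ 4 · k)))
   la = ringℕ
   lb : ∀ x k → (4 · x ∔ k) ∔ 1 ∔ (2 · k) · 2 ∔ (5 ∔ ((2 · k) ∔ (2 · k)) ∔ (2 · x ∔ 4 · k)) ∔ (2 · x ∔ k) ≡ 2 · (2 · k ∔ 2) ∔ 2 · ((4 · x ∔ k) ∔ 1 ∔ (2 · k) · 2)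
   lb = ringℕ
   ln : ∀ k → suc(2 · k ∔ 2) ≡ 2 · k ∔ 3
   ln = ringℕ
   lq : ∀ x k → 5 · (8 · x ∔ (4 ∔ 4 · 3) · k ∔ 3 · 3) ≡ 4 · (2 · k ∔ 3) ∔ (9 ∔ (10 · x ∔ 18 · k ∔ 6) · 4)
   lq = ringℕ
   a-eq = quotient-A 3 k 4 9(λ x k → 10 · x ∔ 18 · k ∔ 6)(ln k) lq ∙ la(tri k) k
   a = (5 · n · n ∸ 4 · n ∸ 9) ℕ./ 4
   h : (2 · k ∔ 2 ∸ 2) ℕ./ 2 ≡ k
   h = half k(N.m+n∸n≡m(2 · k) 2)
   lA : ∀ o u g P → o · u · g · P ≡ o · u · (g · P)
   lA = ringℕ
   lB : ∀ u x y P → u · x · y · P ≡ 1 · u · (x · y · P)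
   lB = ringℕ
   lP : ∀ P R x y → P · (x · y · R) ≡ P · R · x · y
   lP = ringℕ
   g = gauss q(2 · k ∔ 2) 2
   b = ((2 · k ∔ 2 ∸ 2) · (2 · k ∔ 2 ∸ 2)) ℕ./ 4
  open Constants n q using (Aᶜ; Bᶜ)
  open Even.Numbers k 2(5 ∔ ((2 · k) ∔ (2 · k)))(Aᶜ minus i4)(Bᶜ minus i4)(q ∔ 1) 1 g(x∸(2 · k ∔ 2 ∸ 1) · x∸(2 · k ∔ 2) · P₂ k) a b(N.*-identityʳ(q ∔ 1))(gauss-2 q≥2(2 · k)(dv₂ k(suc(2 · k))))
   (cong(λ z → (q ∔ 1) · q ** a · g · P₁ z) h ∙ lA(q ∔ 1)(q ** a) g(P₁ k))(cong(λ z → q ** b · x∸(2 · k ∔ 2 ∸ 1) · x∸(2 · k ∔ 2) · P₂ z) h ∙ lB(q ** b) _ _ _)(lP(P₁ k)(P₂ k) _ _ ∙ cong₂(λ u v → u · x∸(v ∸ 1) · x∸ v)(sym(p-double k))(N.+-comm(2 · k) 2) ∙ cong p(N.+-comm 2(2 · k))) a-eq(cong(λ z → (4 · tri k ∔ k) ∔ 1 ∔ (2 · k) · 2 ∔ (5 ∔ ((2 · k) ∔ (2 · k)) ∔ (2 · tri k ∔ 4 · k)) ∔ z)(quotient-B k(N.m+n∸n≡m(2 · k) 2)) ∙ lb(tri k) k) using (result-ρ)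

  result : Result minus i4(2 · k ∔ 2)
  result = result-ρ(N.m+n∸n≡m(2 · k) 2)(value minus i4)(λ a na → eval-4 1ℤ na(2 · k))

-- Assembling the theorem

module Conclusion (𝒟 : FieldData) where
 open FieldArithmetic 𝒟
 open Cases 𝒟

 Goal : Sign → Idx → ℕ → Set
 Goal ε i m = let open Pieces ε i m in (N ≡ A · B) × (CondA ε i(suc m) q → PartA) × (CondB ε i(suc m) q → PartB) × (CondC ε i(suc m) q → PartC)

 -- Every case module is numbered so that k = 0 is its smallest n. The parity witness is shifted to
 -- fit, and the values below the admissible n are refuted.
 results : ∀ ε i m → Valid ε i(suc m) → Result ε i m
 results plus i1 m((suc k , e) , _) = subst(Result plus i1)(l k ∙ N.suc-injective(sym e))(Plus₁.result k)
  where
  l : ∀ k → suc(2 · k) ∔ 0 ≡ k ∔ (suc k ∔ 0)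
  l = ringℕ
 results plus i2 m((suc k , e) , _) = subst(Result plus i2)(l k ∙ N.suc-injective(sym e))(Plus₂₃.result₂ k)
  where
  l : ∀ k → 2 · k ∔ 1 ≡ k ∔ (suc k ∔ 0)
  l = ringℕ
 results plus i3 m((suc k , e) , _) = subst(Result plus i3)(l k ∙ N.suc-injective(sym e))(Plus₂₃.result₃ k)
  where
  l : ∀ k → 2 · k ∔ 1 ≡ k ∔ (suc k ∔ 0)
  l = ringℕ
 results plus i4 m((suc zero , e) , le) = ⊥-elim(N.<⇒≱(N.≤-reflexive(cong suc e))(N.≤-trans(N.n≤1+n 3) le))
 results plus i4 m((suc(suc k) , e) , _) = subst(Result plus i4)(l k ∙ N.suc-injective(sym e))(Plus₄.result k)
  where
  l : ∀ k → suc(2 · k) ∔ 2 ≡ suc k ∔ (suc(suc k) ∔ 0)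
  l = ringℕ
 results minus i1 m((k , e) , _) = subst(Result minus i1)(N.+-identityʳ(2 · k) ∙ N.suc-injective(sym e))(Minus₁.result k)
 results minus i2 m((zero , refl) , s≤s())
 results minus i2 m((suc k , e) , _) = subst(Result minus i2)(l k ∙ N.suc-injective(sym e))(Minus₂₃.result₂ k)
  where
  l : ∀ k → suc(2 · k) ∔ 1 ≡ 2 · suc k
  l = ringℕ
 results minus i3 m((zero , refl) , s≤s())
 results minus i3 m((suc k , e) , _) = subst(Result minus i3)(l k ∙ N.suc-injective(sym e))(Minus₂₃.result₃ k)
  where
  l : ∀ k → suc(2 · k) ∔ 1 ≡ 2 · suc k
  l = ringℕ
 results minus i4 m((zero , refl) , s≤s())
 results minus i4 m((suc k , e) , _) = subst(Result minus i4)(l k ∙ N.suc-injective(sym e))(Minus₄.result k)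
  where
  l : ∀ k → 2 · k ∔ 2 ≡ 2 · suc k
  l = ringℕ

 4≤q⇒2≤r : 4 ≤ q → 2 ≤ r
 4≤q⇒2≤r le = N.≮⇒≥(λ r<2 → N.<⇒≱(s≤s(N.≤-trans(N.≤-reflexive size≡)(N.^-monoʳ-≤ 2(N.≤-pred r<2))))(N.≤-trans(N.n≤1+n 3) le))

 module _ (ε : Sign)(i : Idx)(m : ℕ)(R : Result ε i m) where
  open Pieces ε i m
  open Parts 𝒟 ε i m
  private
   N≡AB = proj₁ R
   S≡ = proj₂(proj₂ R)
   instance
    nonZero : ℕ.NonZero A
    nonZero = proj₁(proj₂ R)
   l : ∀ A e k → A * (e * k) ≡ e * A * k
   l = ring
   l' : ∀ A e k → A * (- e * k) ≡ - (e * A) * k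
   l' = ring
   l″ : ∀ B e q → B + e * (q * q) ≡ B + e * (q * q - q) + e * q
   l″ = ring

  part-a : (∀ a → value ε i a ≡ e * K a) → PartA
  part-a v = partA N≡AB(λ a na → S≡ a na ∙ cong(pos A *_)(v a) ∙ l(pos A) e(K a))

  module _ (u : ℤ)(v : ∀ a → value ε i a ≡ - e * (u + K₂ a)) where
   S-eq : ∀ a → a ≢ 0# → S a ≡ - (e * pos A) * (u + K₂ a)
   S-eq a na = S≡ a na ∙ cong(pos A *_)(v a) ∙ l'(pos A) e(u + K₂ a)

  part-b : (∀ a → value ε i a ≡ - e * (Q + K₂ a)) → 4 ≤ q → PartB
  part-b v le = (λ h h≥1 → moments-K₂ N≡AB Q(S-eq Q v) h h≥1 , moments-K² N≡AB Q(S-eq Q v)(pos B) refl h h≥1) , λ j _ → weightsBC N≡AB Q(S-eq Q v)(4≤q⇒2≤r le) j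

  -- Here u = q², so the centre for K₂ is B + εq², and that for K² is lower by εq.
  part-c : (∀ a → value ε i a ≡ - e * (Q * Q + K₂ a)) → 4 ≤ q → PartC
  part-c v le = (λ h h≥1 → moments-K₂ N≡AB u(S-eq u v) h h≥1 , moments-K² N≡AB u(S-eq u v)(pos B + e * (u - Q))(l″(pos B) e Q) h h≥1) , λ j _ → weightsBC N≡AB u(S-eq u v)(4≤q⇒2≤r le) j
   where u = Q * Q

 conclude : ∀ ε i m → Result ε i m → Goal ε i m
 conclude plus i1 m R = proj₁ R , (λ _ → part-a plus i1 m R λ _ → refl) , ⊥-elim , ⊥-elim
 conclude minus i1 m R = proj₁ R , (λ _ → part-a minus i1 m R λ _ → refl) , ⊥-elim , ⊥-elim
 conclude plus i2 m R = proj₁ R , ⊥-elim , (λ (_ , _ , le) → part-b plus i2 m R(λ _ → refl) le) , ⊥-elim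
 conclude minus i2 m R = proj₁ R , ⊥-elim , (λ (_ , _ , le) → part-b minus i2 m R(λ _ → refl) le) , ⊥-elim
 conclude plus i3 m R = proj₁ R , (λ _ → part-a plus i3 m R λ _ → refl) , ⊥-elim , ⊥-elim
 conclude minus i3 m R = proj₁ R , (λ _ → part-a minus i3 m R λ _ → refl) , ⊥-elim , ⊥-elim
 conclude plus i4 m R = proj₁ R , ⊥-elim , ⊥-elim , (λ (_ , _ , le) → part-c plus i4 m R(λ _ → refl) le)
 conclude minus i4 m R = proj₁ R , ⊥-elim , ⊥-elim , (λ (_ , _ , le) → part-c minus i4 m R(λ _ → refl) le)

theorem1 : (r : ℕ) → 1 ≤ r → (𝔽 : FiniteField) → FiniteField.size 𝔽 ≡ 2 ** r →
 (κ : FiniteField.Carrier 𝔽) → Irreducible 𝔽 κ →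
 (ε : Sign)(i : Idx)(m : ℕ) → Valid ε i(suc m) →
 let open Setup.Pieces 𝔽 r κ ε i m in
 (N ≡ A · B)
 × (CondA ε i(suc m)(FiniteField.size 𝔽) → PartA)
 × (CondB ε i(suc m)(FiniteField.size 𝔽) → PartB)
 × (CondC ε i(suc m)(FiniteField.size 𝔽) → PartC)
theorem1 r r≥1 𝔽 size≡ κ irreducible ε i m valid = conclude ε i m(results ε i m valid)
 where
 𝒟 : FieldData
 𝒟 = record { r = r ; r≥1 = r≥1 ; 𝔽 = 𝔽 ; size≡ = size≡ ; κ = κ ; irreducible = irreducible }
 open Conclusion 𝒟
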